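{- Let $n\ge 1$, $0\le \ell\le n-1$, and $\mu = (n-\ell, 1^\ell)$. Then $$\langle \tilde{J}_\mu^{(\alpha)}(X),s_\mu \rangle = \sum_{k=0}^n \bigl(\ell \cdot \ell!\, h_k(B(c_1,\ldots,c_n)) + \ell!\, h_k(B(d_1,\ldots,d_n))\bigr) \binom{\alpha + k}{n}$$ $$= \sum_{k=0}^n \bigl(\ell \cdot \ell!\, r_{n-k}(B(c_1,\ldots,c_n)) + \ell!\, r_{n-k}(B(d_1,\ldots,d_n))\bigr) \binom{\alpha}{k}k!,$$ where $c_1 = c_2 = \cdots = c_{n-\ell-1} = n-\ell-2$ and $c_{n-\ell+i} = n-\ell-1+i$ for $0 \le i \le \ell$, and $d_1 = d_2 = \cdots = d_{n-\ell} = n-\ell-1$ and $d_{n-\ell+i} = n-\ell-1+i$ for $1 \le i \le \ell$.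
   Context: Jack polynomials: over $\mathbb{Q}(\alpha)$, with $\alpha$ an indeterminate, let $\langle p_\lambda,p_\nu\rangle_\alpha=\delta_{\lambda\nu}z_\lambda\alpha^{\ell(\lambda)}$, where $z_\lambda=\prod_i i^{m_i}m_i!$ and $m_i$ is the number of parts of $\lambda$ equal to $i$. The integral form Jack symmetric functions $J_\mu^{(\alpha)}(X)$ are the unique family, indexed by partitions $\mu$, of symmetric functions that are pairwise orthogonal for $\langle\cdot,\cdot\rangle_\alpha$, are triangular (only monomial symmetric functions $m_\lambda$ with $\lambda\le\mu$ in dominance order appear in $J_\mu^{(\alpha)}$), and are normalized so that the coefficient of $m_{1^n}$ in $J_\mu^{(\alpha)}$ is $n!$ where $n=|\mu|$. For $\mu$ a partition of $n$, define $\tilde J_\mu^{(\alpha)}(X)=\alpha^nJ_\mu^{(1/\alpha)}(X)$. The bracket $\langle\cdot,\cdot\rangle$ (without subscript) is the Hall scalar product, for which Schur functions are orthonormal (extended linearly over $\mathbb{Q}(\alpha)$). Binomial coefficients $\binom{\alpha+k}{n}$ and $\binom{\alpha}{k}$ are polynomials in $\alpha$. Rook theory: for $0\le c_1\le\cdots\le c_n\le n$ integers, $B(c_1,\ldots,c_n)$ is the Ferrers board in the $n\times n$ grid consisting of the bottom $c_i$ cells of column $i$, for each $i$. For a board $B$ (a subset of the $n\times n$ grid), $r_k(B)$ is the number of ways to place $k$ nonattacking rooks (no two in the same row or column) on $B$, and $h_k(B)$ is the number of ways to place $n$ nonattacking rooks on the $n\times n$ grid with exactly $k$ of them on $B$.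 -}

module Defs where

open import Level using (0ℓ; _⊔_)
open import Algebra.Bundles using (CommutativeRing; CommutativeMonoid)
open import Data.Bool.Base using (Bool; if_then_else_)
open import Data.Fin.Base using (Fin; toℕ)
import Data.Fin.Properties as Finₚ
open import Data.List.Base using (List; []; _∷_; [_]; _∷ʳ_; _++_; map; length; reverse; concat; filter; filterᵇ; foldr; take; replicate; upTo; applyUpTo; allFin; cartesianProduct; cartesianProductWith)
open import Data.List.Properties using (≡-dec; length-reverse; unfold-reverse; filter-none; filter-accept; filter-reject; map-upTo; length-++; filter-++; ++-identityʳ)
open import Data.List.Relation.Unary.All as All using (All; []; _∷_; all?)
import Data.List.Relation.Unary.All.Properties as Allₚ
open import Data.List.Relation.Unary.AllPairs using (allPairs?)
open import Data.List.Relation.Unary.Linked using (Linked; []; [-]; _∷_; linked?)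
import Data.List.Relation.Unary.Sorted.TotalOrder.Properties as Sortedₚ
open import Data.List.Relation.Binary.Pointwise using (Pointwise; Pointwise-≡⇒≡) renaming (decidable to pointwise?)
open import Data.List.Relation.Binary.Permutation.Propositional as Perm using (_↭_; prep; swap; ↭-sym; ↭-trans; ↭⇒↭ₛ)
open import Data.List.Relation.Binary.Permutation.Propositional.Properties using (All-resp-↭; ↭-reverse; filter-↭)
open import Data.List.Sort.Base using (module SortingAlgorithm)
import Data.List.Sort.InsertionSort as InsertionSort
open import Data.Nat.Base as ℕ using (ℕ; zero; suc; _≤_; _<_; _≥_; _∸_; _!; z≤n; s≤s)
open import Data.Nat.ListAction using (sum; product)
open import Data.Nat.ListAction.Properties using (sum-↭)
import Data.Nat.Properties as ℕₚ
open import Data.Product.Base using (_×_; _,_; ∃; proj₁; proj₂)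
open import Data.Rational.Base as ℚ using (ℚ; 0ℚ; 1ℚ)
import Data.Rational.Properties as ℚₚ
open import Data.Sum.Base as Sum using (_⊎_; inj₁; inj₂)
open import Function.Base using (_∘_; id; case_of_)
open import Function.Definitions using (Injective)
import Relation.Binary.Construct.Flip.EqAndOrd as Flip
open import Relation.Binary.PropositionalEquality as ≡ using (_≡_; _≢_)
open import Relation.Nullary using (¬_; Dec; yes; no; does; contradiction)
open import Relation.Nullary.Decidable using (map′; _×-dec_; ¬?)
open import Relation.Unary using (Decidable)

record Partition : Set where
  field
    parts      : List ℕ
    positive   : All (1 ≤_) parts
    decreasing : Linked _≥_ parts

open Partition public

size : Partition → ℕ
size λ′ = sum (parts λ′)

multiplicity : ℕ → List ℕ → ℕ
multiplicity i xs = length (filter (i ℕₚ.≟_) xs)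

-- z λ = ∏ᵢ i^{mᵢ} mᵢ!; the parts of λ are at most |λ|.
z : Partition → ℕ
z λ′ = product (map (λ i → i ℕ.^ m i ℕ.* m i !) (applyUpTo suc (size λ′)))
  where
  m : ℕ → ℕ
  m i = multiplicity i (parts λ′)

_⊴_ : Partition → Partition → Set
λ′ ⊴ μ = size λ′ ≡ size μ × (∀ k → sum (take k (parts λ′)) ≤ sum (take k (parts μ)))

hook : ∀ n ℓ → ℓ < n → Partition
hook n ℓ ℓ<n = record
  { parts      = (n ∸ ℓ) ∷ replicate ℓ 1
  ; positive   = ℕₚ.m<n⇒0<n∸m ℓ<n ∷ Allₚ.replicate⁺ ℓ ℕₚ.≤-refl
  ; decreasing = ∷-decreasing ℓ (ℕₚ.m<n⇒0<n∸m ℓ<n)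
  }
  where
  ∷-decreasing : ∀ {a} k → 1 ≤ a → Linked _≥_ (a ∷ replicate k 1)
  ∷-decreasing zero    1≤a = [-]
  ∷-decreasing (suc k) 1≤a = 1≤a ∷ ∷-decreasing k ℕₚ.≤-refl

open InsertionSort (Flip.decTotalOrder ℕₚ.≤-decTotalOrder) using (sort; insertionSort)

-- The partition obtained from an exponent vector by sorting it decreasingly
-- and discarding its zeros.
type : List ℕ → List ℕ
type a = sort (filter (1 ℕₚ.≤?_) a)

type-↭ : ∀ {a b} → a ↭ b → type a ≡ type b
type-↭ {a} {b} a↭b = Pointwise-≡⇒≡ (Sortedₚ.↗↭↗⇒≋ (Flip.totalOrder ℕₚ.≤-totalOrder)
  (sort-↗ (filter (1 ℕₚ.≤?_) a)) (sort-↗ (filter (1 ℕₚ.≤?_) b))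
  (↭⇒↭ₛ (↭-trans (sort-↭ _) (↭-trans (filter-↭ (1 ℕₚ.≤?_) a↭b) (↭-sym (sort-↭ _))))))
  where open SortingAlgorithm insertionSort using (sort-↭; sort-↗)

type-∷ʳ0 : ∀ a → type (a ∷ʳ 0) ≡ type a
type-∷ʳ0 a = ≡.cong sort (≡.trans (filter-++ (1 ℕₚ.≤?_) a [ 0 ]) (++-identityʳ _))

sum-type : ∀ a → sum (type a) ≡ sum a
sum-type a = ≡.trans (sum-↭ (sort-↭ (filter (1 ℕₚ.≤?_) a))) (sum-filter a)
  where
  open SortingAlgorithm insertionSort using (sort-↭)
  sum-filter : ∀ a → sum (filter (1 ℕₚ.≤?_) a) ≡ sum a
  sum-filter []          = ≡.refl
  sum-filter (zero  ∷ a) = sum-filter a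
  sum-filter (suc m ∷ a) = ≡.cong (suc m ℕ.+_) (sum-filter a)

-- A filling is its list of rows. Entries are numbered from 0 and not from 1, so
-- that entry i corresponds to the variable x₍ᵢ₊₁₎.
IsSemistandard : List (List ℕ) → Set
IsSemistandard T = All (Linked _≤_) T × Linked Above T
  where
  Above : List ℕ → List ℕ → Set
  Above r s = Pointwise _<_ (take (length s) r) s

isSemistandard? : Decidable IsSemistandard
isSemistandard? T = all? (linked? ℕₚ._≤?_) T ×-dec
  linked? (λ r s → pointwise? ℕₚ._<?_ (take (length s) r) s) T

words : ℕ → ℕ → List (List ℕ)
words N zero    = [ [] ]
words N (suc k) = cartesianProductWith _∷_ (upTo N) (words N k)

fillings : ℕ → List ℕ → List (List (List ℕ))
fillings N []      = [ [] ]
fillings N (r ∷ λ′) = cartesianProductWith _∷_ (words N r) (fillings N λ′)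

content : ℕ → List (List ℕ) → List ℕ
content N T = map (λ i → multiplicity i (concat T)) (upTo N)

HasContent : List ℕ → List (List ℕ) → Set
HasContent t T = content (length t) T ≡ t

isSSYT? : ∀ t → Decidable (λ T → IsSemistandard T × HasContent t T)
isSSYT? t T = isSemistandard? T ×-dec ≡-dec ℕₚ._≟_ (content (length t) T) t

kostka : List ℕ → List ℕ → ℕ
kostka λ′ t = length (filter (isSSYT? t) (fillings (length t) λ′))

private
  sum-multiplicity : ∀ f → Injective _≡_ _≡_ f → ∀ N xs →
                     sum (applyUpTo (λ i → multiplicity (f i) xs) N) ≤ length xs
  sum-multiplicity f inj N []       = ℕₚ.≤-reflexive (zeros f N)
    where
    zeros : ∀ f N → sum (applyUpTo (λ i → multiplicity (f i) []) N) ≡ 0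
    zeros f zero    = ≡.refl
    zeros f (suc N) = zeros (f ∘ suc) N
  sum-multiplicity f inj N (x ∷ xs) =
    ℕₚ.≤-trans (step f inj N) (s≤s (sum-multiplicity f inj N xs))
    where
    S : (ℕ → ℕ) → ℕ → List ℕ → ℕ
    S f N xs = sum (applyUpTo (λ i → multiplicity (f i) xs) N)

    miss : ∀ f N → (∀ i → f i ≢ x) → S f N (x ∷ xs) ≡ S f N xs
    miss f zero    f≢x = ≡.refl
    miss f (suc N) f≢x = ≡.cong₂ ℕ._+_
      (≡.cong length (filter-reject (f 0 ℕₚ.≟_) (f≢x 0)))
      (miss (f ∘ suc) N (f≢x ∘ suc))

    step : ∀ f → Injective _≡_ _≡_ f → ∀ N → S f N (x ∷ xs) ≤ suc (S f N xs)
    step f inj zero    = z≤n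
    step f inj (suc N) = case (f 0 ℕₚ.≟ x) of λ where
      (yes f0≡x) → ℕₚ.≤-reflexive (≡.cong₂ ℕ._+_
        (≡.cong length (filter-accept (f 0 ℕₚ.≟_) f0≡x))
        (miss (f ∘ suc) N λ i fi≡x → contradiction (inj (≡.trans fi≡x (≡.sym f0≡x))) λ ()))
      (no f0≢x) → ℕₚ.≤-trans
        (ℕₚ.+-mono-≤ (ℕₚ.≤-reflexive (≡.cong length (filter-reject (f 0 ℕₚ.≟_) f0≢x)))
                     (step (f ∘ suc) (ℕₚ.suc-injective ∘ inj) N))
        (ℕₚ.≤-reflexive (ℕₚ.+-suc (multiplicity (f 0) xs) _))

  words-length : ∀ N k → All (λ w → length w ≡ k) (words N k)
  words-length N zero    = ≡.refl ∷ []
  words-length N (suc k) = Allₚ.cartesianProductWith⁺ (≡.setoid _) (≡.setoid _) _∷_ (upTo N) (words N k)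
    λ _ w∈ → ≡.cong suc (All.lookup (words-length N k) w∈)

  fillings-size : ∀ N λ′ → All (λ T → length (concat T) ≡ sum λ′) (fillings N λ′)
  fillings-size N []       = ≡.refl ∷ []
  fillings-size N (r ∷ λ′) = Allₚ.cartesianProductWith⁺ (≡.setoid _) (≡.setoid _) _∷_ (words N r) (fillings N λ′)
    λ {w} w∈ T∈ → ≡.trans (length-++ w)
      (≡.cong₂ ℕ._+_ (All.lookup (words-length N r) w∈) (All.lookup (fillings-size N λ′) T∈))

kostka-large : ∀ λ′ t → sum λ′ < sum t → kostka λ′ t ≡ 0
kostka-large λ′ t |λ|<|t| = ≡.cong length (filter-none (isSSYT? t)
  (All.map (λ {T} |T|≡|λ| (_ , content≡t) → ℕₚ.<⇒≱ |λ|<|t| (small {T} |T|≡|λ| content≡t))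
    (fillings-size (length t) λ′)))
  where
  small : ∀ {T} → length (concat T) ≡ sum λ′ → HasContent t T → sum t ≤ sum λ′
  small {T} |T|≡|λ| content≡t = ℕₚ.≤-trans
    (ℕₚ.≤-reflexive (≡.cong sum (≡.trans (≡.sym content≡t)
      (map-upTo (λ i → multiplicity i (concat T)) (length t)))))
    (ℕₚ.≤-trans (sum-multiplicity id id (length t) (concat T)) (ℕₚ.≤-reflexive |T|≡|λ|))

-- A symmetric function is a formal power series of bounded degree in x₁, x₂, …,
-- invariant under permutations of the variables; the coefficient of
-- x₁^a₁ ⋯ xₖ^aₖ in f is coeff f (a₁ ∷ … ∷ aₖ ∷ []). In particular, the
-- coefficient of the monomial symmetric function m_λ in f is coeff f (parts λ).
module SymmetricFunctions {c ℓ} (K : CommutativeRing c ℓ) where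

  open CommutativeRing K renaming (refl to ≈-refl; trans to ≈-trans)
  open import Algebra.Properties.Semiring.Exp semiring using (_^_)
  open import Algebra.Properties.Monoid.Mult +-monoid using () renaming (_×_ to _×ᴷ_)
  open import Algebra.Properties.CommutativeMonoid.Sum +-commutativeMonoid
    using (sum⁺-syntax; sum-cong-≋; sum-replicate-zero; ∑-comm)

  fromℕ : ℕ → Carrier
  fromℕ m = m ×ᴷ 1#

  record Λ : Set (c ⊔ ℓ) where
    field
      coeff     : List ℕ → Carrier
      symmetric : ∀ {a b} → a ↭ b → coeff a ≈ coeff b
      padding   : ∀ a → coeff (a ∷ʳ 0) ≈ coeff a
      bounded   : ∃ λ d → ∀ a → d < sum a → coeff a ≈ 0#

  open Λ public

  infix 4 _≈Λ_
  _≈Λ_ : Λ → Λ → Set ℓ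
  f ≈Λ g = ∀ a → coeff f a ≈ coeff g a

  infixl 6 _+Λ_
  _+Λ_ : Λ → Λ → Λ
  f +Λ g = record
    { coeff     = λ a → coeff f a + coeff g a
    ; symmetric = λ a↭b → +-cong (symmetric f a↭b) (symmetric g a↭b)
    ; padding   = λ a → +-cong (padding f a) (padding g a)
    ; bounded   = proj₁ (bounded f) ℕ.⊔ proj₁ (bounded g) , λ a d<a → ≈-trans
        (+-cong (proj₂ (bounded f) a (ℕₚ.m⊔n<o⇒m<o _ _ d<a))
                (proj₂ (bounded g) a (ℕₚ.m⊔n<o⇒n<o _ _ d<a)))
        (+-identityˡ 0#)
    }

  mapΛ : (φ : Carrier → Carrier) → (∀ {x y} → x ≈ y → φ x ≈ φ y) → φ 0# ≈ 0# → Λ → Λ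
  mapΛ φ φ-cong φ-0 f = record
    { coeff     = λ a → φ (coeff f a)
    ; symmetric = λ a↭b → φ-cong (symmetric f a↭b)
    ; padding   = λ a → φ-cong (padding f a)
    ; bounded   = proj₁ (bounded f) , λ a d<a →
        ≈-trans (φ-cong (proj₂ (bounded f) a d<a)) φ-0
    }

  infixr 7 _·Λ_
  _·Λ_ : Carrier → Λ → Λ
  x ·Λ f = mapΛ (x *_) *-congˡ (zeroʳ x) f

  -- The coefficient of x^a in a product is the sum, over all exponent vectors
  -- b ≤ a, of the coefficient of x^b times that of x^(a - b).
  convolve : (List ℕ → Carrier) → (List ℕ → Carrier) → List ℕ → Carrier
  convolve f g []      = f [] * g []
  convolve f g (a ∷ as) =
    ∑[ i ≤ a ] convolve (λ b → f (toℕ i ∷ b)) (λ b → g (a ∸ toℕ i ∷ b)) as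

  private
    Symmetric : (List ℕ → Carrier) → Set ℓ
    Symmetric f = ∀ {a b} → a ↭ b → f a ≈ f b

    convolve-cong : ∀ {f f′ g g′} → (∀ a → f a ≈ f′ a) → (∀ a → g a ≈ g′ a) →
                    ∀ a → convolve f g a ≈ convolve f′ g′ a
    convolve-cong f≈ g≈ []       = *-cong (f≈ []) (g≈ [])
    convolve-cong f≈ g≈ (a ∷ as) =
      sum-cong-≋ {suc a} λ i → convolve-cong (λ b → f≈ (toℕ i ∷ b)) (λ b → g≈ (a ∸ toℕ i ∷ b)) as

    convolve-sym : ∀ f g → Symmetric f → Symmetric g → Symmetric (convolve f g)
    convolve-sym f g fs gs Perm.refl = ≈-refl
    convolve-sym f g fs gs (prep a p) = sum-cong-≋ {suc a} λ i →
      convolve-sym (λ b → f (toℕ i ∷ b)) (λ b → g (a ∸ toℕ i ∷ b)) (fs ∘ prep _) (gs ∘ prep _) p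
    convolve-sym f g fs gs {a ∷ b ∷ as} {_ ∷ _ ∷ bs} (swap a b p) = ≈-trans
      (∑-comm {suc a} {suc b} λ i j →
        convolve (λ c → f (toℕ i ∷ toℕ j ∷ c)) (λ c → g (a ∸ toℕ i ∷ b ∸ toℕ j ∷ c)) as)
      (sum-cong-≋ {suc b} λ j → sum-cong-≋ {suc a} λ i → ≈-trans
        (convolve-cong (λ c → fs (swap _ _ Perm.refl)) (λ c → gs (swap _ _ Perm.refl)) as)
        (convolve-sym (λ c → f (toℕ j ∷ toℕ i ∷ c)) (λ c → g (b ∸ toℕ j ∷ a ∸ toℕ i ∷ c))
          (fs ∘ prep _ ∘ prep _) (gs ∘ prep _ ∘ prep _) p))
    convolve-sym f g fs gs (Perm.trans p q) =
      ≈-trans (convolve-sym f g fs gs p) (convolve-sym f g fs gs q)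

    convolve-padding : ∀ f g → (∀ a → f (a ∷ʳ 0) ≈ f a) → (∀ a → g (a ∷ʳ 0) ≈ g a) →
                       ∀ a → convolve f g (a ∷ʳ 0) ≈ convolve f g a
    convolve-padding f g fp gp []       = ≈-trans (+-identityʳ _) (*-cong (fp []) (gp []))
    convolve-padding f g fp gp (a ∷ as) = sum-cong-≋ {suc a} λ i →
      convolve-padding (λ b → f (toℕ i ∷ b)) (λ b → g (a ∸ toℕ i ∷ b)) (λ b → fp (toℕ i ∷ b)) (λ b → gp (a ∸ toℕ i ∷ b)) as

    convolve-bounded : ∀ f g {d e} m n →
      (∀ a → d < m ℕ.+ sum a → f a ≈ 0#) → (∀ a → e < n ℕ.+ sum a → g a ≈ 0#) →
      ∀ a → d ℕ.+ e < m ℕ.+ n ℕ.+ sum a → convolve f g a ≈ 0#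
    convolve-bounded f g {d} {e} m n fb gb [] d+e<
      with d ℕₚ.<? m ℕ.+ 0
    ... | yes d<m = ≈-trans (*-congʳ (fb [] d<m)) (zeroˡ _)
    ... | no  d≮m = ≈-trans (*-congˡ (gb [] e<n)) (zeroʳ _)
      where
      e<n : e < n ℕ.+ 0
      e<n = ℕₚ.+-cancelˡ-< d e (n ℕ.+ 0) (ℕₚ.<-≤-trans d+e< (ℕₚ.≤-trans
        (ℕₚ.≤-reflexive (ℕₚ.+-assoc m n 0)) (ℕₚ.+-monoˡ-≤ (n ℕ.+ 0)
        (ℕₚ.≤-trans (ℕₚ.≤-reflexive (≡.sym (ℕₚ.+-identityʳ m))) (ℕₚ.≮⇒≥ d≮m)))))
    convolve-bounded f g {d} {e} m n fb gb (a ∷ as) d+e< =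
      ≈-trans (sum-cong-≋ {suc a} λ i →
        convolve-bounded (λ b → f (toℕ i ∷ b)) (λ b → g (a ∸ toℕ i ∷ b)) (m ℕ.+ toℕ i) (n ℕ.+ (a ∸ toℕ i))
          (λ b d< → fb (toℕ i ∷ b) (ℕₚ.<-≤-trans d< (ℕₚ.≤-reflexive (ℕₚ.+-assoc m _ _))))
          (λ b e< → gb (a ∸ toℕ i ∷ b) (ℕₚ.<-≤-trans e< (ℕₚ.≤-reflexive (ℕₚ.+-assoc n _ _))))
          as (ℕₚ.<-≤-trans d+e< (ℕₚ.≤-reflexive (regroup (toℕ i) (ℕₚ.≤-pred (Finₚ.toℕ<n i))))))
      (sum-replicate-zero (suc a))
      where
      open import Data.Nat.Solver using (module +-*-Solver)
      regroup : ∀ i → i ≤ a → m ℕ.+ n ℕ.+ (a ℕ.+ sum as) ≡ m ℕ.+ i ℕ.+ (n ℕ.+ (a ∸ i)) ℕ.+ sum as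
      regroup i i≤a = ≡.trans
        (≡.cong (λ k → m ℕ.+ n ℕ.+ (k ℕ.+ sum as)) (≡.sym (ℕₚ.m+[n∸m]≡n i≤a)))
        (solve 5 (λ m n i j s → m :+ n :+ (i :+ j :+ s) := m :+ i :+ (n :+ j) :+ s) ≡.refl
          m n i (a ∸ i) (sum as))
        where open +-*-Solver

  infixl 7 _*Λ_
  _*Λ_ : Λ → Λ → Λ
  f *Λ g = record
    { coeff     = convolve (coeff f) (coeff g)
    ; symmetric = convolve-sym (coeff f) (coeff g) (symmetric f) (symmetric g)
    ; padding   = convolve-padding (coeff f) (coeff g) (padding f) (padding g)
    ; bounded   = proj₁ (bounded f) ℕ.+ proj₁ (bounded g) ,
        convolve-bounded (coeff f) (coeff g) 0 0 (proj₂ (bounded f)) (proj₂ (bounded g))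
    }

  -- The symmetric function ∑ c(λ) m_λ, where c vanishes above degree d.
  fromMonomials : (c : List ℕ → Carrier) → ∀ d → (∀ t → d < sum t → c t ≈ 0#) → Λ
  fromMonomials c d c-bounded = record
    { coeff     = λ a → c (type a)
    ; symmetric = λ a↭b → reflexive (≡.cong c (type-↭ a↭b))
    ; padding   = λ a → reflexive (≡.cong c (type-∷ʳ0 a))
    ; bounded   = d , λ a d<a →
        c-bounded (type a) (ℕₚ.<-≤-trans d<a (ℕₚ.≤-reflexive (≡.sym (sum-type a))))
    }

  δ : List ℕ → List ℕ → Carrier
  δ t u = if does (≡-dec ℕₚ._≟_ t u) then 1# else 0#

  δ-≢ : ∀ {t u} → t ≢ u → δ t u ≈ 0#
  δ-≢ {t} {u} t≢u with ≡-dec ℕₚ._≟_ t u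
  ... | yes t≡u = contradiction t≡u t≢u
  ... | no  _   = ≈-refl

  monomial : List ℕ → Λ
  monomial t = fromMonomials (δ t) (sum t)
    λ u |t|<|u| → δ-≢ {t} {u} λ t≡u → ℕₚ.<⇒≢ |t|<|u| (≡.cong sum t≡u)

  1Λ : Λ
  1Λ = monomial []

  powerSum : Partition → Λ
  powerSum λ′ = foldr _*Λ_ 1Λ (map (λ r → monomial [ r ]) (parts λ′))

  schur : Partition → Λ
  schur λ′ = fromMonomials (λ t → fromℕ (kostka (parts λ′) t)) (size λ′)
    λ t |λ|<|t| → reflexive (≡.cong fromℕ (kostka-large (parts λ′) t |λ|<|t|))

  record BilinearForm : Set (c ⊔ ℓ) where
    field
      ⟨_,_⟩ : Λ → Λ → Carrier
      ⟨⟩-cong : ∀ f f′ g g′ → f ≈Λ f′ → g ≈Λ g′ → ⟨ f , g ⟩ ≈ ⟨ f′ , g′ ⟩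
      +-linearˡ : ∀ f f′ g → ⟨ f +Λ f′ , g ⟩ ≈ ⟨ f , g ⟩ + ⟨ f′ , g ⟩
      +-linearʳ : ∀ f g g′ → ⟨ f , g +Λ g′ ⟩ ≈ ⟨ f , g ⟩ + ⟨ f , g′ ⟩
      ·-linearˡ : ∀ x f g → ⟨ x ·Λ f , g ⟩ ≈ x * ⟨ f , g ⟩
      ·-linearʳ : ∀ x f g → ⟨ f , x ·Λ g ⟩ ≈ x * ⟨ f , g ⟩

record IsDecidableDomain {c ℓ} (R : CommutativeRing c ℓ) : Set (c ⊔ ℓ) where
  open CommutativeRing R
  field
    1≉0            : ¬ (1# ≈ 0#)
    noZeroDivisors : ∀ x y → x * y ≈ 0# → x ≈ 0# ⊎ y ≈ 0#
    _≈0?           : ∀ x → Dec (x ≈ 0#)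

module Fractions {c ℓ} (R : CommutativeRing c ℓ) (isDomain : IsDecidableDomain R) where

  open CommutativeRing R
  open IsDecidableDomain isDomain
  open import Algebra.Properties.Ring ring using (x∙y⁻¹≈ε⇒x≈y; -‿distribˡ-*; -‿distribʳ-*)
  open import Algebra.Solver.Ring.NaturalCoefficients.Default commutativeSemiring
    using (solve; _:=_; _:+_; _:*_; con)
  open import Relation.Binary.Reasoning.Setoid setoid

  record Fraction : Set (c ⊔ ℓ) where
    constructor _/_[_]
    field
      num   : Carrier
      den   : Carrier
      den≉0 : ¬ (den ≈ 0#)

  open Fraction public

  record _≈ᶠ_ (p q : Fraction) : Set ℓ where
    constructor cross
    field cross⁻¹ : num p * den q ≈ num q * den p

  open _≈ᶠ_ public

  *-≉0 : ∀ {x y} → ¬ (x ≈ 0#) → ¬ (y ≈ 0#) → ¬ (x * y ≈ 0#)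
  *-≉0 {x} {y} x≉0 y≉0 xy≈0 with noZeroDivisors x y xy≈0
  ... | inj₁ x≈0 = x≉0 x≈0
  ... | inj₂ y≈0 = y≉0 y≈0

  *-cancelˡ : ∀ x {y z} → ¬ (x ≈ 0#) → x * y ≈ x * z → y ≈ z
  *-cancelˡ x {y} {z} x≉0 xy≈xz
    with noZeroDivisors x (y + - z) (begin
      x * (y + - z)      ≈⟨ distribˡ x y (- z) ⟩
      x * y + x * - z    ≈⟨ +-cong xy≈xz (sym (-‿distribʳ-* x z)) ⟩
      x * z + - (x * z)  ≈⟨ -‿inverseʳ _ ⟩
      0#                 ∎)
  ... | inj₁ x≈0 = contradiction x≈0 x≉0
  ... | inj₂ y-z≈0 = x∙y⁻¹≈ε⇒x≈y y z y-z≈0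

  fromR : Carrier → Fraction
  fromR x = x / 1# [ 1≉0 ]

  infixl 6 _+ᶠ_
  infixl 7 _*ᶠ_
  infix  8 -ᶠ_ _⁻¹

  0ᶠ 1ᶠ : Fraction
  0ᶠ = fromR 0#
  1ᶠ = fromR 1#

  _+ᶠ_ _*ᶠ_ : Fraction → Fraction → Fraction
  (a / b [ b≉0 ]) +ᶠ (c / d [ d≉0 ]) = (a * d + c * b) / b * d [ *-≉0 b≉0 d≉0 ]
  (a / b [ b≉0 ]) *ᶠ (c / d [ d≉0 ]) = (a * c) / b * d [ *-≉0 b≉0 d≉0 ]

  -ᶠ_ : Fraction → Fraction
  -ᶠ (a / b [ b≉0 ]) = (- a) / b [ b≉0 ]

  -- Total inverse, with the convention 0 ⁻¹ = 0.
  _⁻¹ : Fraction → Fraction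
  (a / b [ b≉0 ]) ⁻¹ with a ≈0?
  ... | yes _   = 0ᶠ
  ... | no  a≉0 = b / a [ a≉0 ]

  ≈ᶠ-refl : ∀ {p} → p ≈ᶠ p
  ≈ᶠ-refl = cross refl

  ≈ᶠ-sym : ∀ {p q} → p ≈ᶠ q → q ≈ᶠ p
  ≈ᶠ-sym (cross e) = cross (sym e)

  ≈ᶠ-trans : ∀ {p q r} → p ≈ᶠ q → q ≈ᶠ r → p ≈ᶠ r
  ≈ᶠ-trans {a / b [ _ ]} {c / d [ d≉0 ]} {e / f [ _ ]} (cross ad≈cb) (cross cf≈ed) =
    cross (*-cancelˡ d d≉0 (begin
      d * (a * f)  ≈⟨ solve 3 (λ a d f → (d :* (a :* f)) := ((a :* d) :* f)) refl a d f ⟩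
      (a * d) * f  ≈⟨ *-congʳ ad≈cb ⟩
      (c * b) * f  ≈⟨ solve 3 (λ c b f → ((c :* b) :* f) := ((c :* f) :* b)) refl c b f ⟩
      (c * f) * b  ≈⟨ *-congʳ cf≈ed ⟩
      (e * d) * b  ≈⟨ solve 3 (λ e d b → ((e :* d) :* b) := (d :* (e :* b))) refl e d b ⟩
      d * (e * b)  ∎))

  +ᶠ-cong : ∀ {p p′ q q′} → p ≈ᶠ p′ → q ≈ᶠ q′ → (p +ᶠ q) ≈ᶠ (p′ +ᶠ q′)
  +ᶠ-cong {a / b [ _ ]} {a′ / b′ [ _ ]} {c / d [ _ ]} {c′ / d′ [ _ ]} (cross e) (cross f) =
    cross (begin
      (a * d + c * b) * (b′ * d′)
        ≈⟨ solve 6 (λ a b c d b′ d′ → ((a :* d :+ c :* b) :* (b′ :* d′)) :=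
             ((a :* b′) :* (d :* d′) :+ (c :* d′) :* (b :* b′))) refl a b c d b′ d′ ⟩
      (a * b′) * (d * d′) + (c * d′) * (b * b′)
        ≈⟨ +-cong (*-congʳ e) (*-congʳ f) ⟩
      (a′ * b) * (d * d′) + (c′ * d) * (b * b′)
        ≈⟨ solve 6 (λ a′ b c′ d b′ d′ → ((a′ :* b) :* (d :* d′) :+ (c′ :* d) :* (b :* b′)) :=
             ((a′ :* d′ :+ c′ :* b′) :* (b :* d))) refl a′ b c′ d b′ d′ ⟩
      (a′ * d′ + c′ * b′) * (b * d) ∎)

  *ᶠ-cong : ∀ {p p′ q q′} → p ≈ᶠ p′ → q ≈ᶠ q′ → (p *ᶠ q) ≈ᶠ (p′ *ᶠ q′)
  *ᶠ-cong {a / b [ _ ]} {a′ / b′ [ _ ]} {c / d [ _ ]} {c′ / d′ [ _ ]} (cross e) (cross f) =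
    cross (begin
      (a * c) * (b′ * d′)
        ≈⟨ solve 4 (λ a c b′ d′ → ((a :* c) :* (b′ :* d′)) := ((a :* b′) :* (c :* d′))) refl a c b′ d′ ⟩
      (a * b′) * (c * d′)
        ≈⟨ *-cong e f ⟩
      (a′ * b) * (c′ * d)
        ≈⟨ solve 4 (λ a′ b c′ d → ((a′ :* b) :* (c′ :* d)) := ((a′ :* c′) :* (b :* d))) refl a′ b c′ d ⟩
      (a′ * c′) * (b * d) ∎)

  -ᶠ-cong : ∀ {p q} → p ≈ᶠ q → (-ᶠ p) ≈ᶠ (-ᶠ q)
  -ᶠ-cong {a / b [ _ ]} {c / d [ _ ]} (cross e) = cross (begin
    - a * d    ≈⟨ -‿distribˡ-* a d ⟨
    - (a * d)  ≈⟨ -‿cong e ⟩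
    - (c * b)  ≈⟨ -‿distribˡ-* c b ⟩
    - c * b    ∎)

  +ᶠ-assoc : ∀ p q r → ((p +ᶠ q) +ᶠ r) ≈ᶠ (p +ᶠ (q +ᶠ r))
  +ᶠ-assoc (a / b [ _ ]) (c / d [ _ ]) (e / f [ _ ]) = cross
    (solve 6 (λ a b c d e f →
      (((a :* d :+ c :* b) :* f :+ e :* (b :* d)) :* (b :* (d :* f))) :=
      ((a :* (d :* f) :+ (c :* f :+ e :* d) :* b) :* ((b :* d) :* f))) refl a b c d e f)

  *ᶠ-assoc : ∀ p q r → ((p *ᶠ q) *ᶠ r) ≈ᶠ (p *ᶠ (q *ᶠ r))
  *ᶠ-assoc (a / b [ _ ]) (c / d [ _ ]) (e / f [ _ ]) =
    cross (*-cong (*-assoc a c e) (sym (*-assoc b d f)))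

  +ᶠ-comm : ∀ p q → (p +ᶠ q) ≈ᶠ (q +ᶠ p)
  +ᶠ-comm (a / b [ _ ]) (c / d [ _ ]) = cross (*-cong (+-comm _ _) (*-comm d b))

  *ᶠ-comm : ∀ p q → (p *ᶠ q) ≈ᶠ (q *ᶠ p)
  *ᶠ-comm (a / b [ _ ]) (c / d [ _ ]) = cross (*-cong (*-comm a c) (*-comm d b))

  +ᶠ-identityˡ : ∀ p → (0ᶠ +ᶠ p) ≈ᶠ p
  +ᶠ-identityˡ (a / b [ _ ]) = cross (begin
    (0# * b + a * 1#) * b  ≈⟨ *-congʳ (+-cong (zeroˡ b) (*-identityʳ a)) ⟩
    (0# + a) * b           ≈⟨ *-cong (+-identityˡ a) (sym (*-identityˡ b)) ⟩
    a * (1# * b)           ∎)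

  *ᶠ-identityˡ : ∀ p → (1ᶠ *ᶠ p) ≈ᶠ p
  *ᶠ-identityˡ (a / b [ _ ]) =
    cross (*-cong (*-identityˡ a) (sym (*-identityˡ b)))

  -ᶠ-inverseˡ : ∀ p → (-ᶠ p +ᶠ p) ≈ᶠ 0ᶠ
  -ᶠ-inverseˡ (a / b [ _ ]) = cross (begin
    (- a * b + a * b) * 1#  ≈⟨ *-identityʳ _ ⟩
    - a * b + a * b         ≈⟨ sym (distribʳ b (- a) a) ⟩
    (- a + a) * b           ≈⟨ *-congʳ (-‿inverseˡ a) ⟩
    0# * b                  ≈⟨ zeroˡ b ⟩
    0#                      ≈⟨ sym (zeroˡ _) ⟩
    0# * (b * b)            ∎)

  distribʳᶠ : ∀ r p q → ((p +ᶠ q) *ᶠ r) ≈ᶠ (p *ᶠ r +ᶠ q *ᶠ r)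
  distribʳᶠ (e / f [ _ ]) (a / b [ _ ]) (c / d [ _ ]) = cross
    (solve 6 (λ a b c d e f →
      (((a :* d :+ c :* b) :* e) :* ((b :* f) :* (d :* f))) :=
      (((a :* e) :* (d :* f) :+ (c :* e) :* (b :* f)) :* ((b :* d) :* f))) refl a b c d e f)

  fractionField : CommutativeRing (c ⊔ ℓ) ℓ
  fractionField = record
    { _≈_ = _≈ᶠ_ ; _+_ = _+ᶠ_ ; _*_ = _*ᶠ_ ; -_ = -ᶠ_ ; 0# = 0ᶠ ; 1# = 1ᶠ
    ; isCommutativeRing = record
      { isRing = record
        { +-isAbelianGroup = record
          { isGroup = record
            { isMonoid = record
              { isSemigroup = record
                { isMagma = record
                  { isEquivalence = record
                    { refl = ≈ᶠ-refl ; sym = ≈ᶠ-sym ; trans = ≈ᶠ-trans }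
                  ; ∙-cong = +ᶠ-cong }
                ; assoc = +ᶠ-assoc }
              ; identity = +ᶠ-identityˡ ,
                  λ p → ≈ᶠ-trans (+ᶠ-comm p 0ᶠ) (+ᶠ-identityˡ p) }
            ; inverse = -ᶠ-inverseˡ ,
                λ p → ≈ᶠ-trans (+ᶠ-comm p (-ᶠ p)) (-ᶠ-inverseˡ p)
            ; ⁻¹-cong = -ᶠ-cong }
          ; comm = +ᶠ-comm }
        ; *-cong = *ᶠ-cong
        ; *-assoc = *ᶠ-assoc
        ; *-identity = *ᶠ-identityˡ ,
            λ p → ≈ᶠ-trans (*ᶠ-comm p 1ᶠ) (*ᶠ-identityˡ p)
        ; distrib = (λ r p q → ≈ᶠ-trans (*ᶠ-comm r (p +ᶠ q))
                      (≈ᶠ-trans (distribʳᶠ r p q)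
                        (+ᶠ-cong (*ᶠ-comm p r) (*ᶠ-comm q r)))) ,
                    distribʳᶠ }
      ; *-comm = *ᶠ-comm } }

  num≈0⇒≈0 : ∀ {p} → num p ≈ 0# → p ≈ᶠ 0ᶠ
  num≈0⇒≈0 {a / b [ _ ]} a≈0 =
    cross (trans (*-identityʳ a) (trans a≈0 (sym (zeroˡ b))))

  ⁻¹-inverseˡ : ∀ p → ¬ (p ≈ᶠ 0ᶠ) → (p ⁻¹ *ᶠ p) ≈ᶠ 1ᶠ
  ⁻¹-inverseˡ (a / b [ b≉0 ]) p≉0 with a ≈0?
  ... | yes a≈0 = contradiction (num≈0⇒≈0 a≈0) p≉0
  ... | no  a≉0 = cross (trans (*-identityʳ _) (trans (*-comm b a) (sym (*-identityˡ _))))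

  fromR-+ : ∀ x y → fromR (x + y) ≈ᶠ (fromR x +ᶠ fromR y)
  fromR-+ x y = cross (solve 2 (λ x y →
    ((x :+ y) :* (con 1 :* con 1)) := ((x :* con 1 :+ y :* con 1) :* con 1)) refl x y)

  fromR-* : ∀ x y → fromR (x * y) ≈ᶠ (fromR x *ᶠ fromR y)
  fromR-* x y = cross (*-congˡ (*-identityˡ 1#))

  fromR-cong : ∀ {x y} → x ≈ y → fromR x ≈ᶠ fromR y
  fromR-cong e = cross (*-congʳ e)

  fromR-≈0 : ∀ {x} → fromR x ≈ᶠ 0ᶠ → x ≈ 0#
  fromR-≈0 {x} (cross e) = trans (sym (*-identityʳ x)) (trans e (*-identityʳ 0#))

-- A polynomial over ℚ is its list of coefficients, lowest degree first;
-- trailing zeros are immaterial.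
Poly : Set
Poly = List ℚ

coeffₚ : Poly → ℕ → ℚ
coeffₚ []      _       = 0ℚ
coeffₚ (a ∷ p) zero    = a
coeffₚ (a ∷ p) (suc i) = coeffₚ p i

infix  4 _≈ₚ_
infixl 6 _+ₚ_
infixl 7 _*ₚ_ _·ₚ_

record _≈ₚ_ (p q : Poly) : Set where
  constructor coeffwise
  field at : ∀ i → coeffₚ p i ≡ coeffₚ q i

open _≈ₚ_ public

_+ₚ_ _*ₚ_ : Poly → Poly → Poly
[]      +ₚ q       = q
p       +ₚ []      = p
(a ∷ p) +ₚ (b ∷ q) = (a ℚ.+ b) ∷ (p +ₚ q)

_·ₚ_ : ℚ → Poly → Poly
a ·ₚ p = map (a ℚ.*_) p

[]      *ₚ q = []
(a ∷ p) *ₚ q = a ·ₚ q +ₚ (0ℚ ∷ p *ₚ q)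

-ₚ_ : Poly → Poly
-ₚ p = map ℚ.-_ p

noZeroDivisorsℚ : ∀ a b → a ℚ.* b ≡ 0ℚ → a ≡ 0ℚ ⊎ b ≡ 0ℚ
noZeroDivisorsℚ a b ab≡0 with a ℚₚ.≟ 0ℚ
... | yes a≡0 = inj₁ a≡0
... | no  a≢0 = inj₂ (begin
  b                          ≡⟨ ℚₚ.*-identityˡ b ⟨
  1ℚ ℚ.* b                   ≡⟨ ≡.cong (ℚ._* b) (ℚₚ.*-inverseˡ a) ⟨
  ((ℚ.1/ a) ℚ.* a) ℚ.* b     ≡⟨ ℚₚ.*-assoc (ℚ.1/ a) a b ⟩
  (ℚ.1/ a) ℚ.* (a ℚ.* b)     ≡⟨ ≡.cong ((ℚ.1/ a) ℚ.*_) ab≡0 ⟩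
  (ℚ.1/ a) ℚ.* 0ℚ            ≡⟨ ℚₚ.*-zeroʳ (ℚ.1/ a) ⟩
  0ℚ                         ∎)
  where
  open ≡.≡-Reasoning
  instance
    a≢0′ : ℚ.NonZero a
    a≢0′ = ℚ.≢-nonZero a≢0

module PolyLaws where

  ≈ₚ-refl : ∀ {p} → p ≈ₚ p
  ≈ₚ-refl = coeffwise λ _ → ≡.refl

  ≈ₚ-sym : ∀ {p q} → p ≈ₚ q → q ≈ₚ p
  ≈ₚ-sym e = coeffwise λ i → ≡.sym (at e i)

  ≈ₚ-trans : ∀ {p q r} → p ≈ₚ q → q ≈ₚ r → p ≈ₚ r
  ≈ₚ-trans e f = coeffwise λ i → ≡.trans (at e i) (at f i)

  coeff-+ : ∀ p q i → coeffₚ (p +ₚ q) i ≡ coeffₚ p i ℚ.+ coeffₚ q i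
  coeff-+ []      q       i       = ≡.sym (ℚₚ.+-identityˡ _)
  coeff-+ (a ∷ p) []      i       = ≡.sym (ℚₚ.+-identityʳ _)
  coeff-+ (a ∷ p) (b ∷ q) zero    = ≡.refl
  coeff-+ (a ∷ p) (b ∷ q) (suc i) = coeff-+ p q i

  coeff-· : ∀ a p i → coeffₚ (a ·ₚ p) i ≡ a ℚ.* coeffₚ p i
  coeff-· a []      i       = ≡.sym (ℚₚ.*-zeroʳ a)
  coeff-· a (b ∷ p) zero    = ≡.refl
  coeff-· a (b ∷ p) (suc i) = coeff-· a p i

  coeff-- : ∀ p i → coeffₚ (-ₚ p) i ≡ ℚ.- coeffₚ p i
  coeff-- []      i       = ≡.refl
  coeff-- (b ∷ p) zero    = ≡.refl
  coeff-- (b ∷ p) (suc i) = coeff-- p i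

  ∷-cong : ∀ {a b p q} → a ≡ b → p ≈ₚ q → a ∷ p ≈ₚ b ∷ q
  ∷-cong a≡b p≈q = coeffwise λ { zero → a≡b ; (suc i) → at p≈q i }

  +ₚ-cong : ∀ {p p′ q q′} → p ≈ₚ p′ → q ≈ₚ q′ → p +ₚ q ≈ₚ p′ +ₚ q′
  +ₚ-cong {p} {p′} {q} {q′} e f = coeffwise λ i →
    ≡.trans (coeff-+ p q i) (≡.trans (≡.cong₂ ℚ._+_ (at e i) (at f i)) (≡.sym (coeff-+ p′ q′ i)))

  +ₚ-assoc : ∀ p q r → (p +ₚ q) +ₚ r ≈ₚ p +ₚ (q +ₚ r)
  +ₚ-assoc p q r = coeffwise λ i → begin
    coeffₚ ((p +ₚ q) +ₚ r) i                        ≡⟨ coeff-+ (p +ₚ q) r i ⟩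
    coeffₚ (p +ₚ q) i ℚ.+ coeffₚ r i                ≡⟨ ≡.cong (ℚ._+ _) (coeff-+ p q i) ⟩
    (coeffₚ p i ℚ.+ coeffₚ q i) ℚ.+ coeffₚ r i      ≡⟨ ℚₚ.+-assoc (coeffₚ p i) _ _ ⟩
    coeffₚ p i ℚ.+ (coeffₚ q i ℚ.+ coeffₚ r i)      ≡⟨ ≡.cong (coeffₚ p i ℚ.+_) (≡.sym (coeff-+ q r i)) ⟩
    coeffₚ p i ℚ.+ coeffₚ (q +ₚ r) i                ≡⟨ ≡.sym (coeff-+ p (q +ₚ r) i) ⟩
    coeffₚ (p +ₚ (q +ₚ r)) i                        ∎
    where open ≡.≡-Reasoning

  +ₚ-comm : ∀ p q → p +ₚ q ≈ₚ q +ₚ p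
  +ₚ-comm p q = coeffwise λ i →
    ≡.trans (coeff-+ p q i) (≡.trans (ℚₚ.+-comm (coeffₚ p i) _) (≡.sym (coeff-+ q p i)))

  +ₚ-identityʳ : ∀ p → p +ₚ [] ≈ₚ p
  +ₚ-identityʳ p = coeffwise λ i → ≡.trans (coeff-+ p [] i) (ℚₚ.+-identityʳ _)

  -ₚ-inverseˡ : ∀ p → (-ₚ p) +ₚ p ≈ₚ []
  -ₚ-inverseˡ p = coeffwise λ i → ≡.trans (coeff-+ (-ₚ p) p i)
    (≡.trans (≡.cong (ℚ._+ coeffₚ p i) (coeff-- p i)) (ℚₚ.+-inverseˡ (coeffₚ p i)))

  -ₚ-cong : ∀ {p q} → p ≈ₚ q → -ₚ p ≈ₚ -ₚ q
  -ₚ-cong {p} {q} e = coeffwise λ i →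
    ≡.trans (coeff-- p i) (≡.trans (≡.cong ℚ.-_ (at e i)) (≡.sym (coeff-- q i)))

  +ₚ-commutativeMonoid : CommutativeMonoid 0ℓ 0ℓ
  +ₚ-commutativeMonoid = record { isCommutativeMonoid = record
    { isMonoid = record
      { isSemigroup = record
        { isMagma = record
          { isEquivalence = record { refl = ≈ₚ-refl ; sym = ≈ₚ-sym ; trans = ≈ₚ-trans }
          ; ∙-cong = +ₚ-cong }
        ; assoc = +ₚ-assoc }
      ; identity = (λ p → ≈ₚ-refl {p}) , +ₚ-identityʳ }
    ; comm = +ₚ-comm } }

  module P+ = CommutativeMonoid +ₚ-commutativeMonoid
  open import Algebra.Properties.CommutativeSemigroup P+.commutativeSemigroup
    using (interchange; x∙yz≈y∙xz)
  open import Relation.Binary.Reasoning.Setoid P+.setoid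

  ·ₚ-cong : ∀ {a b p q} → a ≡ b → p ≈ₚ q → a ·ₚ p ≈ₚ b ·ₚ q
  ·ₚ-cong {a} {b} {p} {q} ≡.refl e = coeffwise λ i →
    ≡.trans (coeff-· a p i) (≡.trans (≡.cong (a ℚ.*_) (at e i)) (≡.sym (coeff-· a q i)))

  ·ₚ-distribˡ : ∀ a p q → a ·ₚ (p +ₚ q) ≈ₚ a ·ₚ p +ₚ a ·ₚ q
  ·ₚ-distribˡ a p q = coeffwise λ i →
    ≡.trans (coeff-· a (p +ₚ q) i) (≡.trans (≡.cong (a ℚ.*_) (coeff-+ p q i))
    (≡.trans (ℚₚ.*-distribˡ-+ a _ _) (≡.trans (≡.sym (≡.cong₂ ℚ._+_ (coeff-· a p i) (coeff-· a q i)))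
    (≡.sym (coeff-+ (a ·ₚ p) (a ·ₚ q) i)))))

  ·ₚ-distribʳ : ∀ a b p → (a ℚ.+ b) ·ₚ p ≈ₚ a ·ₚ p +ₚ b ·ₚ p
  ·ₚ-distribʳ a b p = coeffwise λ i →
    ≡.trans (coeff-· (a ℚ.+ b) p i) (≡.trans (ℚₚ.*-distribʳ-+ (coeffₚ p i) a b)
    (≡.trans (≡.sym (≡.cong₂ ℚ._+_ (coeff-· a p i) (coeff-· b p i)))
    (≡.sym (coeff-+ (a ·ₚ p) (b ·ₚ p) i))))

  ·ₚ-assoc : ∀ a b p → (a ℚ.* b) ·ₚ p ≈ₚ a ·ₚ (b ·ₚ p)
  ·ₚ-assoc a b p = coeffwise λ i →
    ≡.trans (coeff-· (a ℚ.* b) p i) (≡.trans (ℚₚ.*-assoc a b _)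
    (≡.trans (≡.cong (a ℚ.*_) (≡.sym (coeff-· b p i))) (≡.sym (coeff-· a (b ·ₚ p) i))))

  ·ₚ-identity : ∀ p → 1ℚ ·ₚ p ≈ₚ p
  ·ₚ-identity p = coeffwise λ i → ≡.trans (coeff-· 1ℚ p i) (ℚₚ.*-identityˡ _)

  ·ₚ-zeroˡ : ∀ p → 0ℚ ·ₚ p ≈ₚ []
  ·ₚ-zeroˡ p = coeffwise λ i → ≡.trans (coeff-· 0ℚ p i) (ℚₚ.*-zeroˡ (coeffₚ p i))

  0∷[]≈[] : 0ℚ ∷ [] ≈ₚ []
  0∷[]≈[] = coeffwise λ { zero → ≡.refl ; (suc _) → ≡.refl }

  0∷≈[] : ∀ {p} → p ≈ₚ [] → 0ℚ ∷ p ≈ₚ []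
  0∷≈[] e = ≈ₚ-trans (∷-cong ≡.refl e) 0∷[]≈[]

  0∷-+ : ∀ p q → 0ℚ ∷ (p +ₚ q) ≈ₚ (0ℚ ∷ p) +ₚ (0ℚ ∷ q)
  0∷-+ p q = ∷-cong (≡.sym (ℚₚ.+-identityˡ 0ℚ)) ≈ₚ-refl

  *ₚ-zeroʳ : ∀ p → p *ₚ [] ≈ₚ []
  *ₚ-zeroʳ []      = ≈ₚ-refl
  *ₚ-zeroʳ (a ∷ p) = 0∷≈[] (*ₚ-zeroʳ p)

  *ₚ-∷ʳ : ∀ p b q → p *ₚ (b ∷ q) ≈ₚ b ·ₚ p +ₚ (0ℚ ∷ p *ₚ q)
  *ₚ-∷ʳ []      b q = ≈ₚ-sym 0∷[]≈[]
  *ₚ-∷ʳ (a ∷ p) b q = ∷-cong (≡.cong (ℚ._+ 0ℚ) (ℚₚ.*-comm a b)) (begin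
    a ·ₚ q +ₚ p *ₚ (b ∷ q)                  ≈⟨ +ₚ-cong (≈ₚ-refl {a ·ₚ q}) (*ₚ-∷ʳ p b q) ⟩
    a ·ₚ q +ₚ (b ·ₚ p +ₚ (0ℚ ∷ p *ₚ q))     ≈⟨ x∙yz≈y∙xz (a ·ₚ q) (b ·ₚ p) (0ℚ ∷ p *ₚ q) ⟩
    b ·ₚ p +ₚ (a ·ₚ q +ₚ (0ℚ ∷ p *ₚ q))     ∎)

  *ₚ-comm : ∀ p q → p *ₚ q ≈ₚ q *ₚ p
  *ₚ-comm []      q = ≈ₚ-sym (*ₚ-zeroʳ q)
  *ₚ-comm (a ∷ p) q = begin
    a ·ₚ q +ₚ (0ℚ ∷ p *ₚ q)  ≈⟨ +ₚ-cong (≈ₚ-refl {a ·ₚ q}) (∷-cong ≡.refl (*ₚ-comm p q)) ⟩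
    a ·ₚ q +ₚ (0ℚ ∷ q *ₚ p)  ≈⟨ *ₚ-∷ʳ q a p ⟨
    q *ₚ (a ∷ p)             ∎

  *ₚ-congˡ : ∀ p {q q′} → q ≈ₚ q′ → p *ₚ q ≈ₚ p *ₚ q′
  *ₚ-congˡ []      e = ≈ₚ-refl
  *ₚ-congˡ (a ∷ p) e = +ₚ-cong (·ₚ-cong {a} ≡.refl e) (∷-cong ≡.refl (*ₚ-congˡ p e))

  *ₚ-cong : ∀ {p p′ q q′} → p ≈ₚ p′ → q ≈ₚ q′ → p *ₚ q ≈ₚ p′ *ₚ q′
  *ₚ-cong {p} {p′} {q} {q′} e f = begin
    p *ₚ q    ≈⟨ *ₚ-congˡ p f ⟩
    p *ₚ q′   ≈⟨ *ₚ-comm p q′ ⟩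
    q′ *ₚ p   ≈⟨ *ₚ-congˡ q′ e ⟩
    q′ *ₚ p′  ≈⟨ *ₚ-comm q′ p′ ⟩
    p′ *ₚ q′  ∎

  *ₚ-distribˡ : ∀ p q r → p *ₚ (q +ₚ r) ≈ₚ p *ₚ q +ₚ p *ₚ r
  *ₚ-distribˡ []      q r = ≈ₚ-refl
  *ₚ-distribˡ (a ∷ p) q r = begin
    a ·ₚ (q +ₚ r) +ₚ (0ℚ ∷ p *ₚ (q +ₚ r))
      ≈⟨ +ₚ-cong (·ₚ-distribˡ a q r)
           (≈ₚ-trans (∷-cong ≡.refl (*ₚ-distribˡ p q r)) (0∷-+ (p *ₚ q) (p *ₚ r))) ⟩
    (a ·ₚ q +ₚ a ·ₚ r) +ₚ ((0ℚ ∷ p *ₚ q) +ₚ (0ℚ ∷ p *ₚ r))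
      ≈⟨ interchange (a ·ₚ q) (a ·ₚ r) (0ℚ ∷ p *ₚ q) (0ℚ ∷ p *ₚ r) ⟩
    (a ·ₚ q +ₚ (0ℚ ∷ p *ₚ q)) +ₚ (a ·ₚ r +ₚ (0ℚ ∷ p *ₚ r)) ∎

  *ₚ-distribʳ : ∀ r p q → (p +ₚ q) *ₚ r ≈ₚ p *ₚ r +ₚ q *ₚ r
  *ₚ-distribʳ r p q = begin
    (p +ₚ q) *ₚ r      ≈⟨ *ₚ-comm (p +ₚ q) r ⟩
    r *ₚ (p +ₚ q)      ≈⟨ *ₚ-distribˡ r p q ⟩
    r *ₚ p +ₚ r *ₚ q   ≈⟨ +ₚ-cong (*ₚ-comm r p) (*ₚ-comm r q) ⟩
    p *ₚ r +ₚ q *ₚ r   ∎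

  ·ₚ-*ₚ : ∀ a p q → (a ·ₚ p) *ₚ q ≈ₚ a ·ₚ (p *ₚ q)
  ·ₚ-*ₚ a []      q = ≈ₚ-refl
  ·ₚ-*ₚ a (b ∷ p) q = begin
    (a ℚ.* b) ·ₚ q +ₚ (0ℚ ∷ (a ·ₚ p) *ₚ q)
      ≈⟨ +ₚ-cong (·ₚ-assoc a b q) (∷-cong (≡.sym (ℚₚ.*-zeroʳ a)) (·ₚ-*ₚ a p q)) ⟩
    a ·ₚ (b ·ₚ q) +ₚ a ·ₚ (0ℚ ∷ p *ₚ q)
      ≈⟨ ·ₚ-distribˡ a (b ·ₚ q) (0ℚ ∷ p *ₚ q) ⟨
    a ·ₚ (b ·ₚ q +ₚ (0ℚ ∷ p *ₚ q)) ∎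

  0∷-*ₚ : ∀ p q → (0ℚ ∷ p) *ₚ q ≈ₚ 0ℚ ∷ p *ₚ q
  0∷-*ₚ p q = +ₚ-cong (·ₚ-zeroˡ q) (≈ₚ-refl {0ℚ ∷ p *ₚ q})

  *ₚ-assoc : ∀ p q r → (p *ₚ q) *ₚ r ≈ₚ p *ₚ (q *ₚ r)
  *ₚ-assoc []      q r = ≈ₚ-refl
  *ₚ-assoc (a ∷ p) q r = begin
    (a ·ₚ q +ₚ (0ℚ ∷ p *ₚ q)) *ₚ r
      ≈⟨ *ₚ-distribʳ r (a ·ₚ q) (0ℚ ∷ p *ₚ q) ⟩
    (a ·ₚ q) *ₚ r +ₚ (0ℚ ∷ p *ₚ q) *ₚ r
      ≈⟨ +ₚ-cong (·ₚ-*ₚ a q r)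
           (≈ₚ-trans (0∷-*ₚ (p *ₚ q) r) (∷-cong ≡.refl (*ₚ-assoc p q r))) ⟩
    a ·ₚ (q *ₚ r) +ₚ (0ℚ ∷ p *ₚ (q *ₚ r)) ∎

  1ₚ-identityˡ : ∀ p → (1ℚ ∷ []) *ₚ p ≈ₚ p
  1ₚ-identityˡ p = begin
    1ℚ ·ₚ p +ₚ (0ℚ ∷ [])  ≈⟨ +ₚ-cong (·ₚ-identity p) 0∷[]≈[] ⟩
    p +ₚ []               ≈⟨ +ₚ-identityʳ p ⟩
    p                     ∎

private open module P = PolyLaws

ℚ[α] : CommutativeRing 0ℓ 0ℓ
ℚ[α] = record
  { _≈_ = _≈ₚ_ ; _+_ = _+ₚ_ ; _*_ = _*ₚ_ ; -_ = -ₚ_ ; 0# = [] ; 1# = 1ℚ ∷ []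
  ; isCommutativeRing = record
    { isRing = record
      { +-isAbelianGroup = record
        { isGroup = record
          { isMonoid = P+.isMonoid
          ; inverse = -ₚ-inverseˡ ,
              λ p → ≈ₚ-trans (+ₚ-comm p (-ₚ p)) (-ₚ-inverseˡ p)
          ; ⁻¹-cong = -ₚ-cong }
        ; comm = +ₚ-comm }
      ; *-cong = *ₚ-cong
      ; *-assoc = *ₚ-assoc
      ; *-identity = 1ₚ-identityˡ ,
          λ p → ≈ₚ-trans (*ₚ-comm p (1ℚ ∷ [])) (1ₚ-identityˡ p)
      ; distrib = *ₚ-distribˡ , *ₚ-distribʳ }
    ; *-comm = *ₚ-comm } }

1≉0ₚ : ¬ (1ℚ ∷ [] ≈ₚ [])
1≉0ₚ e = contradiction (at e 0) λ ()

_≈0ₚ? : ∀ p → Dec (p ≈ₚ [])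
[]      ≈0ₚ? = yes ≈ₚ-refl
(a ∷ p) ≈0ₚ? = map′ (λ { (≡.refl , e) → 0∷≈[] e })
                    (λ e → at e 0 , coeffwise λ i → at e (suc i))
                    ((a ℚₚ.≟ 0ℚ) ×-dec (p ≈0ₚ?))

noZeroDivisorsₚ : ∀ p q → p *ₚ q ≈ₚ [] → p ≈ₚ [] ⊎ q ≈ₚ []
noZeroDivisorsₚ []      q pq≈0 = inj₁ ≈ₚ-refl
noZeroDivisorsₚ (a ∷ p) q pq≈0 with a ℚₚ.≟ 0ℚ
... | yes ≡.refl = Sum.map₁ 0∷≈[] (noZeroDivisorsₚ p q
        (coeffwise λ i → at (≈ₚ-trans (≈ₚ-sym (0∷-*ₚ p q)) pq≈0) (suc i)))
... | no  a≢0 = inj₂ (cancel q pq≈0)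
  where
  cancel : ∀ q → (a ∷ p) *ₚ q ≈ₚ [] → q ≈ₚ []
  cancel []      _ = ≈ₚ-refl
  cancel (b ∷ q) e with noZeroDivisorsℚ a b (≡.trans (≡.sym (ℚₚ.+-identityʳ _)) (at e 0))
  ... | inj₁ a≡0    = contradiction a≡0 a≢0
  ... | inj₂ ≡.refl = 0∷≈[] (cancel q (coeffwise λ i →
          at (≈ₚ-trans (≈ₚ-sym shift) e) (suc i)))
    where
    shift : (a ∷ p) *ₚ (0ℚ ∷ q) ≈ₚ 0ℚ ∷ (a ∷ p) *ₚ q
    shift = ≈ₚ-trans (*ₚ-∷ʳ (a ∷ p) 0ℚ q) (+ₚ-cong (·ₚ-zeroˡ (a ∷ p)) ≈ₚ-refl)

ℚ[α]-isDecidableDomain : IsDecidableDomain ℚ[α]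
ℚ[α]-isDecidableDomain = record
  { 1≉0 = 1≉0ₚ ; noZeroDivisors = noZeroDivisorsₚ ; _≈0? = _≈0ₚ? }

open Fractions ℚ[α] ℚ[α]-isDecidableDomain public
  renaming (fractionField to ℚ⟨α⟩)

open CommutativeRing ℚ⟨α⟩ public
  using (Carrier; _≈_; _+_; _*_; _-_; 0#; 1#)
open CommutativeRing ℚ⟨α⟩
  hiding (Carrier; _≈_; _+_; _*_; _-_; 0#; 1#; zero)
open import Algebra.Properties.Semiring.Exp semiring public using (_^_)

fromℚ : ℚ → Carrier
fromℚ a = fromR (a ∷ [])

α : Carrier
α = fromR (0ℚ ∷ 1ℚ ∷ [])

evalₚ : Poly → Carrier → Carrier
evalₚ []      x = 0#
evalₚ (a ∷ p) x = fromℚ a + x * evalₚ p x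

module EvalLaws where

  open import Relation.Binary.Reasoning.Setoid setoid
  open import Algebra.Properties.CommutativeSemigroup +-commutativeSemigroup using (interchange)
  open import Algebra.Properties.CommutativeSemigroup *-commutativeSemigroup
    using (x∙yz≈y∙xz; xy∙z≈xz∙y)

  fromℚ-* : ∀ a b → fromℚ (a ℚ.* b) ≈ fromℚ a * fromℚ b
  fromℚ-* a b = trans (fromR-cong (P.∷-cong (≡.sym (ℚₚ.+-identityʳ _)) P.≈ₚ-refl))
                      (fromR-* (a ∷ []) (b ∷ []))

  fromℚ-0 : fromℚ 0ℚ ≈ 0#
  fromℚ-0 = fromR-cong P.0∷[]≈[]

  eval-+ : ∀ p q x → evalₚ (p +ₚ q) x ≈ evalₚ p x + evalₚ q x
  eval-+ []      q       x = sym (+-identityˡ _)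
  eval-+ (a ∷ p) []      x = sym (+-identityʳ _)
  eval-+ (a ∷ p) (b ∷ q) x = begin
    fromℚ (a ℚ.+ b) + x * evalₚ (p +ₚ q) x
      ≈⟨ +-cong (fromR-+ (a ∷ []) (b ∷ []))
           (trans (*-congˡ {x} (eval-+ p q x)) (distribˡ x (evalₚ p x) (evalₚ q x))) ⟩
    (fromℚ a + fromℚ b) + (x * evalₚ p x + x * evalₚ q x)
      ≈⟨ interchange (fromℚ a) (fromℚ b) (x * evalₚ p x) (x * evalₚ q x) ⟩
    (fromℚ a + x * evalₚ p x) + (fromℚ b + x * evalₚ q x) ∎

  eval-· : ∀ a p x → evalₚ (a ·ₚ p) x ≈ fromℚ a * evalₚ p x
  eval-· a []      x = sym (zeroʳ (fromℚ a))
  eval-· a (b ∷ p) x = begin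
    fromℚ (a ℚ.* b) + x * evalₚ (a ·ₚ p) x
      ≈⟨ +-cong (fromℚ-* a b) (trans (*-congˡ {x} (eval-· a p x))
           (x∙yz≈y∙xz x (fromℚ a) (evalₚ p x))) ⟩
    fromℚ a * fromℚ b + fromℚ a * (x * evalₚ p x)
      ≈⟨ distribˡ (fromℚ a) (fromℚ b) (x * evalₚ p x) ⟨
    fromℚ a * (fromℚ b + x * evalₚ p x) ∎

  eval-0∷ : ∀ p x → evalₚ (0ℚ ∷ p) x ≈ x * evalₚ p x
  eval-0∷ p x = trans (+-congʳ {x * evalₚ p x} fromℚ-0) (+-identityˡ _)

  eval-* : ∀ p q x → evalₚ (p *ₚ q) x ≈ evalₚ p x * evalₚ q x
  eval-* []      q x = sym (zeroˡ (evalₚ q x))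
  eval-* (a ∷ p) q x = begin
    evalₚ (a ·ₚ q +ₚ (0ℚ ∷ p *ₚ q)) x
      ≈⟨ eval-+ (a ·ₚ q) (0ℚ ∷ p *ₚ q) x ⟩
    evalₚ (a ·ₚ q) x + evalₚ (0ℚ ∷ p *ₚ q) x
      ≈⟨ +-cong (eval-· a q x) (trans (eval-0∷ (p *ₚ q) x) (trans (*-congˡ {x} (eval-* p q x))
           (sym (*-assoc x (evalₚ p x) (evalₚ q x))))) ⟩
    fromℚ a * evalₚ q x + (x * evalₚ p x) * evalₚ q x
      ≈⟨ distribʳ (evalₚ q x) (fromℚ a) (x * evalₚ p x) ⟨
    (fromℚ a + x * evalₚ p x) * evalₚ q x ∎

  eval-≈0 : ∀ p x → p ≈ₚ [] → evalₚ p x ≈ 0#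
  eval-≈0 []      x e = refl
  eval-≈0 (a ∷ p) x e with at e 0
  ... | ≡.refl = trans (eval-0∷ p x)
    (trans (*-congˡ {x} (eval-≈0 p x (coeffwise λ i → at e (suc i)))) (zeroʳ x))

  eval-cong : ∀ {p q} x → p ≈ₚ q → evalₚ p x ≈ evalₚ q x
  eval-cong {[]}    {q}     x e = sym (eval-≈0 q x (P.≈ₚ-sym e))
  eval-cong {a ∷ p} {[]}    x e = eval-≈0 (a ∷ p) x e
  eval-cong {a ∷ p} {b ∷ q} x e with at e 0
  ... | ≡.refl = +-congˡ {fromℚ a} (*-congˡ {x} (eval-cong {p} {q} x (coeffwise λ i → at e (suc i))))

  α*fromR : ∀ p → α * fromR p ≈ fromR (0ℚ ∷ p)
  α*fromR p = trans (sym (fromR-* (0ℚ ∷ 1ℚ ∷ []) p)) (fromR-cong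
    (P.≈ₚ-trans (P.0∷-*ₚ (1ℚ ∷ []) p) (P.∷-cong ≡.refl (P.1ₚ-identityˡ p))))

  α≉0 : ¬ (α ≈ 0#)
  α≉0 e = contradiction (at (fromR-≈0 e) 1) λ ()

  fromR-∷ : ∀ a p → fromR (a ∷ p) ≈ fromℚ a + α * fromR p
  fromR-∷ a p = begin
    fromR (a ∷ p)                 ≈⟨ fromR-cong (P.∷-cong (≡.sym (ℚₚ.+-identityʳ a)) P.≈ₚ-refl) ⟩
    fromR ((a ∷ []) +ₚ (0ℚ ∷ p))  ≈⟨ fromR-+ (a ∷ []) (0ℚ ∷ p) ⟩
    fromℚ a + fromR (0ℚ ∷ p)      ≈⟨ +-congˡ {fromℚ a} (α*fromR p) ⟨
    fromℚ a + α * fromR p         ∎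

  fromR-∷ʳ : ∀ p a → fromR (p ∷ʳ a) ≈ fromR p + fromℚ a * α ^ length p
  fromR-∷ʳ []      a = sym (trans (+-identityˡ _) (*-identityʳ (fromℚ a)))
  fromR-∷ʳ (b ∷ p) a = begin
    fromR (b ∷ (p ∷ʳ a))
      ≈⟨ fromR-∷ b (p ∷ʳ a) ⟩
    fromℚ b + α * fromR (p ∷ʳ a)
      ≈⟨ +-congˡ {fromℚ b} (*-congˡ {α} (fromR-∷ʳ p a)) ⟩
    fromℚ b + α * (fromR p + fromℚ a * α ^ length p)
      ≈⟨ +-congˡ {fromℚ b} (distribˡ α (fromR p) (fromℚ a * α ^ length p)) ⟩
    fromℚ b + (α * fromR p + α * (fromℚ a * α ^ length p))
      ≈⟨ +-assoc (fromℚ b) (α * fromR p) (α * (fromℚ a * α ^ length p)) ⟨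
    (fromℚ b + α * fromR p) + α * (fromℚ a * α ^ length p)
      ≈⟨ +-cong (sym (fromR-∷ b p)) (x∙yz≈y∙xz α (fromℚ a) (α ^ length p)) ⟩
    fromR (b ∷ p) + fromℚ a * (α * α ^ length p) ∎

  eval-reverse : ∀ p → evalₚ p (α ⁻¹) * α ^ length p ≈ α * fromR (reverse p)
  eval-reverse []      = trans (zeroˡ 1#) (sym (zeroʳ α))
  eval-reverse (a ∷ p) = begin
    (A + α ⁻¹ * E) * (α * αⁿ)
      ≈⟨ distribʳ (α * αⁿ) A (α ⁻¹ * E) ⟩
    A * (α * αⁿ) + (α ⁻¹ * E) * (α * αⁿ)
      ≈⟨ +-cong (x∙yz≈y∙xz A α αⁿ) (begin
           (α ⁻¹ * E) * (α * αⁿ)  ≈⟨ *-congˡ {α ⁻¹ * E} (*-comm α αⁿ) ⟩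
           (α ⁻¹ * E) * (αⁿ * α)  ≈⟨ *-assoc (α ⁻¹) E (αⁿ * α) ⟩
           α ⁻¹ * (E * (αⁿ * α))  ≈⟨ *-congˡ {α ⁻¹} (sym (*-assoc E αⁿ α)) ⟩
           α ⁻¹ * (E * αⁿ * α)    ≈⟨ x∙yz≈y∙xz (α ⁻¹) (E * αⁿ) α ⟩
           E * αⁿ * (α ⁻¹ * α)    ≈⟨ *-cong (eval-reverse p) (⁻¹-inverseˡ α α≉0) ⟩
           α * fromR (reverse p) * 1#  ≈⟨ *-identityʳ _ ⟩
           α * fromR (reverse p)  ∎) ⟩
    α * (A * αⁿ) + α * fromR (reverse p)
      ≈⟨ distribˡ α (A * αⁿ) (fromR (reverse p)) ⟨
    α * (A * αⁿ + fromR (reverse p))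
      ≈⟨ *-congˡ {α} (+-comm (A * αⁿ) (fromR (reverse p))) ⟩
    α * (fromR (reverse p) + A * αⁿ)
      ≡⟨ ≡.cong (λ m → α * (fromR (reverse p) + A * α ^ m)) (≡.sym (length-reverse p)) ⟩
    α * (fromR (reverse p) + A * α ^ length (reverse p))
      ≈⟨ *-congˡ {α} (fromR-∷ʳ (reverse p) a) ⟨
    α * fromR (reverse p ∷ʳ a)
      ≡⟨ ≡.cong (λ q → α * fromR q) (≡.sym (unfold-reverse a p)) ⟩
    α * fromR (reverse (a ∷ p)) ∎
    where
    A  = fromℚ a
    E  = evalₚ p (α ⁻¹)
    αⁿ = α ^ length p

  ≈[]⇒All : ∀ p → p ≈ₚ [] → All (_≡ 0ℚ) p
  ≈[]⇒All []      e = []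
  ≈[]⇒All (a ∷ p) e = at e 0 ∷ ≈[]⇒All p (coeffwise λ i → at e (suc i))

  All⇒≈[] : ∀ {p} → All (_≡ 0ℚ) p → p ≈ₚ []
  All⇒≈[] []           = P.≈ₚ-refl
  All⇒≈[] (≡.refl ∷ e) = P.0∷≈[] (All⇒≈[] e)

  eval-≉0 : ∀ {p} → ¬ (p ≈ₚ []) → ¬ (evalₚ p (α ⁻¹) ≈ 0#)
  eval-≉0 {p} p≉0 E≈0 = p≉0 (All⇒≈[] (All-resp-↭ (↭-reverse p) (≈[]⇒All (reverse p) (coeffwise λ i →
    at (fromR-≈0 {0ℚ ∷ reverse p} (begin
      fromR (0ℚ ∷ reverse p)            ≈⟨ α*fromR (reverse p) ⟨
      α * fromR (reverse p)             ≈⟨ eval-reverse p ⟨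
      evalₚ p (α ⁻¹) * α ^ length p     ≈⟨ *-congʳ {α ^ length p} E≈0 ⟩
      0# * α ^ length p                 ≈⟨ zeroˡ (α ^ length p) ⟩
      0#                                ∎)) (suc i)))))

-- r [1/α] is r(1/α), the image of r under the substitution α ↦ 1/α.
_[1/α] : Carrier → Carrier
r [1/α] = evalₚ (num r) (α ⁻¹) * evalₚ (den r) (α ⁻¹) ⁻¹

0[1/α] : 0# [1/α] ≈ 0#
0[1/α] = zeroˡ (evalₚ (1ℚ ∷ []) (α ⁻¹) ⁻¹)

[1/α]-cong : ∀ {r s} → r ≈ s → r [1/α] ≈ s [1/α]
[1/α]-cong {a / b [ b≉0 ]} {c / d [ d≉0 ]} (cross ad≈cb) = begin
  A * B ⁻¹                    ≈⟨ *-identityʳ _ ⟨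
  A * B ⁻¹ * 1#               ≈⟨ *-congˡ {A * B ⁻¹} (⁻¹-inverseˡ D (eval-≉0 d≉0)) ⟨
  A * B ⁻¹ * (D ⁻¹ * D)       ≈⟨ *-congˡ {A * B ⁻¹} (*-comm (D ⁻¹) D) ⟩
  A * B ⁻¹ * (D * D ⁻¹)       ≈⟨ interchange A (B ⁻¹) D (D ⁻¹) ⟩
  A * D * (B ⁻¹ * D ⁻¹)       ≈⟨ *-congʳ {B ⁻¹ * D ⁻¹} AD≈CB ⟩
  C * B * (B ⁻¹ * D ⁻¹)       ≈⟨ *-congˡ {C * B} (*-comm (B ⁻¹) (D ⁻¹)) ⟩
  C * B * (D ⁻¹ * B ⁻¹)       ≈⟨ interchange C B (D ⁻¹) (B ⁻¹) ⟩
  C * D ⁻¹ * (B * B ⁻¹)       ≈⟨ *-congˡ {C * D ⁻¹} (*-comm B (B ⁻¹)) ⟩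
  C * D ⁻¹ * (B ⁻¹ * B)       ≈⟨ *-congˡ {C * D ⁻¹} (⁻¹-inverseˡ B (eval-≉0 b≉0)) ⟩
  C * D ⁻¹ * 1#               ≈⟨ *-identityʳ _ ⟩
  C * D ⁻¹                    ∎
  where
  open EvalLaws
  open import Relation.Binary.Reasoning.Setoid setoid
  open import Algebra.Properties.CommutativeSemigroup *-commutativeSemigroup using (interchange)
  A = evalₚ a (α ⁻¹)
  B = evalₚ b (α ⁻¹)
  C = evalₚ c (α ⁻¹)
  D = evalₚ d (α ⁻¹)
  AD≈CB : A * D ≈ C * B
  AD≈CB = trans (sym (eval-* a d (α ⁻¹)))
    (trans (eval-cong (α ⁻¹) ad≈cb) (eval-* c b (α ⁻¹)))

open SymmetricFunctions ℚ⟨α⟩ public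

-- Schur functions and power sums are bases of Λ over ℚ(α), so that each of the next
-- two conditions determines the form.
IsHallProduct : BilinearForm → Set
IsHallProduct form = ∀ λ′ μ → ⟨ schur λ′ , schur μ ⟩ ≈ δ (parts λ′) (parts μ)
  where open BilinearForm form

IsJackProduct : BilinearForm → Set
IsJackProduct form = ∀ λ′ ν →
  ⟨ powerSum λ′ , powerSum ν ⟩ ≈ δ (parts λ′) (parts ν) * (fromℕ (z λ′) * α ^ length (parts λ′))
  where open BilinearForm form

record IsJackFamily (jackProduct : BilinearForm) (J : Partition → Λ) : Set where
  open BilinearForm jackProduct
  field
    orthogonal : ∀ μ ν → parts μ ≢ parts ν → ⟨ J μ , J ν ⟩ ≈ 0#
    triangular : ∀ μ ν → ¬ (ν ⊴ μ) → coeff (J μ) (parts ν) ≈ 0#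
    normalized : ∀ μ → coeff (J μ) (replicate (size μ) 1) ≈ fromℕ (size μ !)

-- α^|μ| J_μ^{(1/α)}, where J stands for the family J^{(α)}.
tilde : (Partition → Λ) → Partition → Λ
tilde J μ = α ^ size μ ·Λ mapΛ _[1/α] [1/α]-cong 0[1/α] (J μ)

fallingFactorial : Carrier → ℕ → Carrier
fallingFactorial x zero    = 1#
fallingFactorial x (suc k) = fallingFactorial x k * (x - fromℕ k)

binomial : Carrier → ℕ → Carrier
binomial x k = fallingFactorial x k * fromℕ (k !) ⁻¹

-- A cell is a pair (column , row), both numbered from 0, row 0 being the bottom.
Cell : ℕ → Set
Cell n = Fin n × Fin n

Board : ℕ → Set
Board n = Cell n → Bool

cells : ∀ n → List (Cell n)
cells n = cartesianProduct (allFin n) (allFin n)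

-- The column heights c are indexed from 1.
ferrers : ∀ n → (ℕ → ℕ) → Board n
ferrers n c (i , j) = does (toℕ j ℕₚ.<? c (suc (toℕ i)))

NonAttacking : ∀ {n} → Cell n → Cell n → Set
NonAttacking (i , j) (i′ , j′) = i ≢ i′ × j ≢ j′

nonAttacking? : ∀ {n} (x y : Cell n) → Dec (NonAttacking x y)
nonAttacking? (i , j) (i′ , j′) = ¬? (i Finₚ.≟ i′) ×-dec ¬? (j Finₚ.≟ j′)

sublists : ∀ {A : Set} → ℕ → List A → List (List A)
sublists zero    _        = [ [] ]
sublists (suc k) []       = []
sublists (suc k) (x ∷ xs) = map (x ∷_) (sublists k xs) ++ sublists (suc k) xs

-- As cells are listed without repetition, a set of k cells is a sublist of length k.
placements : ∀ {n} → ℕ → List (Cell n) → List (List (Cell n))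
placements k = filter (allPairs? nonAttacking?) ∘ sublists k

rookNumber : ∀ {n} → ℕ → Board n → ℕ
rookNumber {n} k B = length (placements k (filterᵇ B (cells n)))

hitNumber : ∀ {n} → ℕ → Board n → ℕ
hitNumber {n} k B =
  length (filter (λ P → length (filterᵇ B P) ℕₚ.≟ k) (placements n (cells n)))

-- When ℓ = n - 1, no column i ≥ 1 falls in the first case of hookHeightsC, so the
-- truncation of n - ℓ - 2 is harmless.
hookHeightsC hookHeightsD : ℕ → ℕ → ℕ → ℕ
hookHeightsC n ℓ i =
  if does (i ℕₚ.≤? n ∸ ℓ ∸ 1) then n ∸ ℓ ∸ 2 else n ∸ ℓ ∸ 1 ℕ.+ (i ∸ (n ∸ ℓ))
hookHeightsD n ℓ i =
  if does (i ℕₚ.≤? n ∸ ℓ) then n ∸ ℓ ∸ 1 else n ∸ ℓ ∸ 1 ℕ.+ (i ∸ (n ∸ ℓ))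

open import Algebra.Properties.Monoid.Sum +-monoid public using (sum⁺-syntax)

{-# OPTIONS --safe #-}
module Submission where

-- Let μ = (r, 1^ℓ), let e_a be the elementary symmetric functions and let g_b be given by
-- Σ g_b y^b = Π (1 - xᵢ y)^{-1/α}. Comparing logarithmic derivatives in y gives
-- Σ_{a+b=n} (-1)^a (α b + a) e_a g_b = 0. Hence the part H of this sum with a ≤ ℓ is, up to
-- sign, the part with a > ℓ. The second form only involves monomials m_ν with ν ⊴ μ. The
-- first one is orthogonal to every function supported strictly below μ, because the product
-- by g_b is adjoint to extracting the coefficient of y^b after adding a variable y, and
-- b ≥ r. By definiteness of the form, H is proportional to J_μ. Comparing the coefficients
-- of m_μ and m_{1^n} gives the coefficient of m_μ in J_μ,
--   ℓ! (α (r - 1) + ℓ + 1) Π_{a<r-1} (1 + α a),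
-- which by triangularity is also the coefficient of s_μ.
-- On the rook side, Σ_k r_{n-k} x(x-1)⋯(x-k+1) factors as Π (x + cᵢ - i + 1) for Ferrers
-- boards, and the hit numbers are reduced to rook numbers by counting the pairs formed by a
-- full placement and j of its rooks on the board, together with Vandermonde's identity.

open import Level using (Level; _⊔_)
open import Algebra.Bundles using (CommutativeRing; RawRing)
open import Data.Bool.Base using (Bool; true; false; if_then_else_)
open import Data.Fin.Base using (Fin; toℕ; zero; suc)
import Data.Fin.Properties as Finₚ
open import Data.List.Base using (List; []; _∷_; [_]; _++_; _∷ʳ_; map; foldr; length; filter; filterᵇ; take; replicate; concat; upTo; applyUpTo; downFrom; reverse; tabulate; allFin; deduplicate; cartesianProduct; cartesianProductWith)
open import Data.List.Properties using (≡-dec; ∷-injective; ∷-injectiveˡ; ∷-injectiveʳ; length-reverse; map-injective; length-++; length-map; length-replicate; length-tabulate; length-downFrom; length-filter; map-++; map-∘; map-cong; map-upTo; map-replicate; map-tabulate; reverse-map; reverse-upTo; take-all; applyUpTo-∷ʳ; filter-++; filter-all; filter-none; filter-accept; filter-reject; filter-notAll; filter-complete)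
open import Data.List.Membership.Propositional using (_∈_; find)
open import Data.List.Membership.Propositional.Properties using (∈-allFin; ∈-filter⁺; ∈-upTo⁺; ∈-upTo⁻; ∈-cartesianProductWith⁺; ∈-∃++)
open import Data.List.Membership.Setoid.Properties using (∈-deduplicate⁺)
open import Data.List.Relation.Unary.All as All using (All; []; _∷_; all?)
import Data.List.Relation.Unary.All.Properties as Allₚ
open import Data.List.Relation.Unary.AllPairs using (AllPairs; []; _∷_; allPairs?)
open import Data.List.Relation.Unary.Any as Any using (Any; here; there)
import Data.List.Relation.Unary.Any.Properties as Anyₚ
open import Data.List.Relation.Unary.Linked using (Linked; []; [-]; _∷_)
import Data.List.Relation.Unary.Sorted.TotalOrder.Properties as Sortedₚ
open import Data.List.Relation.Unary.Unique.Propositional using (Unique)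
import Data.List.Relation.Unary.Unique.Propositional.Properties as Uniqueₚ
open import Data.List.Relation.Unary.Unique.DecSetoid.Properties using (deduplicate-!)
open import Data.List.Relation.Binary.Pointwise using (Pointwise; []; _∷_; Pointwise-≡⇒≡)
open import Data.List.Relation.Binary.Permutation.Propositional as Perm using (_↭_; prep; swap; ↭-refl; ↭-sym; ↭-trans; ↭-reflexive; ↭-isEquivalence; ↭⇒↭ₛ)
open import Data.List.Relation.Binary.Permutation.Propositional.Properties using (All-resp-↭; ∈-resp-↭; ↭-length; ↭-map-inv; ↭-reverse; filter-↭; map⁺; shift; shifts; drop-∷; ++⁺ˡ; ++-comm)
open import Data.List.Sort.Base using (module SortingAlgorithm)
import Data.List.Sort.InsertionSort as InsertionSort
open import Data.Maybe.Base using (Maybe; just; nothing)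
open import Data.Nat.Base as ℕ using (ℕ; zero; suc; _∸_; _≤_; _<_; _≥_; z≤n; s≤s; _!)
open import Data.Nat.ListAction using (sum; product)
open import Data.Nat.ListAction.Properties using (sum-++; product-++)
import Data.Nat.Properties as ℕₚ
open import Data.Nat.Solver using (module +-*-Solver)
open import Data.Product.Base using (_×_; _,_; ∃; proj₁; proj₂)
open import Data.Sum.Base using (_⊎_; inj₁; inj₂)
open import Data.Unit.Base using (⊤; tt)
open import Function.Base using (_∘_; case_of_; id)
open import Relation.Binary.Bundles using (DecSetoid)
import Relation.Binary.Construct.Flip.EqAndOrd as Flip
import Relation.Binary.Definitions as B
open import Relation.Binary.Definitions using (tri<; tri≈; tri>)
open import Relation.Binary.PropositionalEquality as ≡ using (_≡_; _≢_)
open import Relation.Nullary using (¬_; Dec; yes; no; does; contradiction; T?; ¬?)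
open import Relation.Nullary.Decidable using (decidable-stable; dec-true; dec-false; map′)
open import Relation.Unary using (Decidable)
open import Defs using (Partition; parts; positive; decreasing; size; multiplicity; z; _⊴_; hook; type; type-↭; sum-type; IsSemistandard; HasContent; content; isSSYT?; words; fillings; kostka; sublists; placements; Cell; Board; cells; ferrers; NonAttacking; nonAttacking?; rookNumber; hitNumber; hookHeightsC; hookHeightsD; module SymmetricFunctions; IsDecidableDomain; module Fractions)

open InsertionSort (Flip.decTotalOrder ℕₚ.≤-decTotalOrder) using (sort; insertionSort)
open SortingAlgorithm insertionSort using (sort-↭; sort-↗)

-- Each form is given only by its values on power sums or on Schur functions, so a pairing can be
-- computed only after its arguments are placed in a span of these; this is what the triangular
-- eliminations provide. A Jack family is normalized at m_{1^n}, which says nothing directly about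
-- the coefficient of m_μ. That this coefficient is nonzero is derived for all partitions from
-- definiteness (`leading`), which in turn requires an order on the field of rational functions. The
-- comparison uses D = C H - h J_μ, where C and h are the coefficients of m_μ in J_μ and in H. It is
-- supported strictly below μ, and both H and J_μ are orthogonal to such functions, so D is
-- orthogonal to itself and vanishes. The substitution of 1/α for α is made at the end, in an
-- explicit polynomial. After multiplication by α^n, the factor α (r - 1) + ℓ + 1 has become ℓ α +
-- (α + r - 1); its two summands account for the two boards and for their weights ℓ ℓ! and ℓ!.

module Combinatorics where

  open import Data.Nat.Base using (_+_; _*_; _^_)
  open import Relation.Binary.PropositionalEquality using (refl; sym; trans; cong; cong₂; subst; ≢-sym)

  -- Placements of pairwise compatible pieces

  filter-comm : ∀ {A : Set} {P Q : A → Set} (P? : Decidable P) (Q? : Decidable Q) xs →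
                filter P? (filter Q? xs) ≡ filter Q? (filter P? xs)
  filter-comm P? Q? [] = refl
  filter-comm P? Q? (x ∷ xs) with does (P? x) in p | does (Q? x) in q
  ... | true  | true  rewrite p | q = cong (x ∷_) (filter-comm P? Q? xs)
  ... | true  | false rewrite q = filter-comm P? Q? xs
  ... | false | true  rewrite p = filter-comm P? Q? xs
  ... | false | false = filter-comm P? Q? xs

  -- Pascal's recursion is the form met in the double counting when one more piece of a placement is
  -- a hit: that piece is either among the `j` chosen ones or not.
  choose : ℕ → ℕ → ℕ
  choose _       zero    = 1
  choose zero    (suc j) = 0
  choose (suc n) (suc j) = choose n j + choose n (suc j)

  choose-> : ∀ n j → n < j → choose n j ≡ 0
  choose-> zero    (suc j) _         = refl
  choose-> (suc n) (suc j) (s≤s n<j) = cong₂ _+_ (choose-> n j n<j) (choose-> n (suc j) (ℕₚ.m<n⇒m<1+n n<j))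

  -- The double counting that links hits to rooks works for any symmetric irreflexive compatibility
  -- relation; rows and columns enter only afterwards.
  module Placements {A : Set} {R : A → A → Set} (R? : B.Decidable R)
                    (R-sym : ∀ {x y} → R x y → R y x) (R-irrefl : ∀ {x} → ¬ R x x) where

    placementsIn : ℕ → List A → List (List A)
    placementsIn k xs = filter (allPairs? R?) (sublists k xs)

    filter-all-sublists : ∀ x k ys →
      filter (all? (R? x)) (sublists k ys) ≡ sublists k (filter (R? x) ys)
    filter-all-sublists x zero    ys       = refl
    filter-all-sublists x (suc k) []       = refl
    filter-all-sublists x (suc k) (y ∷ ys)
      rewrite filter-++ (all? (R? x)) (map (y ∷_) (sublists k ys)) (sublists (suc k) ys)
            | filter-all-sublists x (suc k) ys
      with R? x y in e
    ... | yes xRy = cong (_++ sublists (suc k) (filter (R? x) ys))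
                      (trans (accept (sublists k ys)) (cong (map (y ∷_)) (filter-all-sublists x k ys)))
      where
      accept : ∀ ss → filter (all? (R? x)) (map (y ∷_) ss) ≡ map (y ∷_) (filter (all? (R? x)) ss)
      accept [] = refl
      accept (s ∷ ss) rewrite e with does (all? (R? x) s)
      ... | true  = cong ((y ∷ s) ∷_) (accept ss)
      ... | false = accept ss
    ... | no ¬xRy = cong (_++ sublists (suc k) (filter (R? x) ys)) (reject (sublists k ys))
      where
      reject : ∀ ss → filter (all? (R? x)) (map (y ∷_) ss) ≡ []
      reject [] = refl
      reject (s ∷ ss) rewrite e = reject ss

    -- Deletion and contraction: a placement either uses `x`, and its other pieces are compatible
    -- with `x`, or lies in `xs`.
    placementsIn-∷ : ∀ k x xs → placementsIn (suc k) (x ∷ xs) ≡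
      map (x ∷_) (placementsIn k (filter (R? x) xs)) ++ placementsIn (suc k) xs
    placementsIn-∷ k x xs = trans
      (filter-++ (allPairs? R?) (map (x ∷_) (sublists k xs)) (sublists (suc k) xs))
      (cong (_++ placementsIn (suc k) xs) (trans (factor (sublists k xs))
        (cong (map (x ∷_) ∘ filter (allPairs? R?)) (filter-all-sublists x k xs))))
      where
      factor : ∀ ss → filter (allPairs? R?) (map (x ∷_) ss) ≡
                      map (x ∷_) (filter (allPairs? R?) (filter (all? (R? x)) ss))
      factor [] = refl
      factor (s ∷ ss) with does (all? (R? x) s)
      ... | false = factor ss
      ... | true with does (allPairs? R? s)
      ...   | true  = cong ((x ∷ s) ∷_) (factor ss)
      ...   | false = factor ss

    -- The recursion of `placementsIn-∷` on cardinalities, so that later arguments do not handle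
    -- lists of placements.
    count : ℕ → List A → ℕ
    count zero    _        = 1
    count (suc k) []       = 0
    count (suc k) (x ∷ xs) = count k (filter (R? x) xs) + count (suc k) xs

    length-placementsIn : ∀ k xs → length (placementsIn k xs) ≡ count k xs
    length-placementsIn zero    xs       = refl
    length-placementsIn (suc k) []       = refl
    length-placementsIn (suc k) (x ∷ xs) = begin
      length (placementsIn (suc k) (x ∷ xs))
        ≡⟨ cong length (placementsIn-∷ k x xs) ⟩
      length (map (x ∷_) (placementsIn k (filter (R? x) xs)) ++ placementsIn (suc k) xs)
        ≡⟨ length-++ (map (x ∷_) (placementsIn k (filter (R? x) xs))) ⟩
      length (map (x ∷_) (placementsIn k (filter (R? x) xs))) + length (placementsIn (suc k) xs)
        ≡⟨ cong₂ _+_ (trans (length-map (x ∷_) (placementsIn k (filter (R? x) xs)))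
             (length-placementsIn k (filter (R? x) xs))) (length-placementsIn (suc k) xs) ⟩
      count k (filter (R? x) xs) + count (suc k) xs ∎
      where open ≡.≡-Reasoning

    filter-self : ∀ x xs → filter (R? x) (x ∷ xs) ≡ filter (R? x) xs
    filter-self x xs with R? x x
    ... | yes xRx = contradiction xRx R-irrefl
    ... | no  _   = refl

    count-swap : ∀ k x y xs → count (suc k) (x ∷ y ∷ xs) ≡ count (suc k) (y ∷ x ∷ xs)
    count-swap k x y xs with R? x y | R? y x
    ... | yes xRy | no ¬yRx = contradiction (R-sym xRy) ¬yRx
    ... | no ¬xRy | yes yRx = contradiction (R-sym yRx) ¬xRy
    ... | no _    | no _    = x∙yz≈y∙xz (count k (filter (R? x) xs)) (count k (filter (R? y) xs)) (count (suc k) xs)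
      where open import Algebra.Properties.CommutativeSemigroup ℕₚ.+-commutativeSemigroup using (x∙yz≈y∙xz)
    ... | yes _   | yes _   = both k
      where
      open +-*-Solver
      both : ∀ k → count k (y ∷ filter (R? x) xs) + (count k (filter (R? y) xs) + count (suc k) xs) ≡
                   count k (x ∷ filter (R? y) xs) + (count k (filter (R? x) xs) + count (suc k) xs)
      both zero    = refl
      both (suc k) rewrite filter-comm (R? y) (R? x) xs =
        solve 4 (λ a b c d → (a :+ b) :+ (c :+ d) := (a :+ c) :+ (b :+ d)) refl
          (count k (filter (R? x) (filter (R? y) xs))) (count (suc k) (filter (R? x) xs))
          (count (suc k) (filter (R? y) xs)) (count (suc (suc k)) xs)

    -- This independence of the order of the cells is what allows the columns of a board to be
    -- listed from right to left in `rookSum-staircase`.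
    count-↭ : ∀ k {xs ys} → xs ↭ ys → count k xs ≡ count k ys
    count-∷ : ∀ k x {xs ys} → xs ↭ ys → count k (x ∷ xs) ≡ count k (x ∷ ys)
    count-∷ zero    x p = refl
    count-∷ (suc k) x p = cong₂ _+_ (count-↭ k (filter-↭ (R? x) p)) (count-↭ (suc k) p)
    count-↭ zero    p          = refl
    count-↭ (suc k) Perm.refl  = refl
    count-↭ (suc k) (prep x p) = count-∷ (suc k) x p
    count-↭ (suc k) (swap {xs} {ys} x y p) = trans (count-swap k x y xs)
      (cong₂ _+_ (count-↭ k (filter-↭ (R? y) (prep x p))) (count-∷ (suc k) x p))
    count-↭ (suc k) (Perm.trans p q) = trans (count-↭ (suc k) p) (count-↭ (suc k) q)

    avoid : List A → List A → List A
    avoid []      xs = xs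
    avoid (q ∷ Q) xs = avoid Q (filter (R? q) xs)

    -- The number of placements of m pieces on xs compatible with a placement of j
    -- pieces on ys, summed over the latter.
    extensions : ℕ → ℕ → List A → List A → ℕ
    extensions m j ys xs = sum (map (λ Q → count m (avoid Q xs)) (placementsIn j ys))

    extensions-∷ : ∀ m j y ys xs → extensions m (suc j) (y ∷ ys) xs ≡
      extensions m j (filter (R? y) ys) (filter (R? y) xs) + extensions m (suc j) ys xs
    extensions-∷ m j y ys xs rewrite placementsIn-∷ j y ys
      | map-++ (λ Q → count m (avoid Q xs)) (map (y ∷_) (placementsIn j (filter (R? y) ys))) (placementsIn (suc j) ys)
      | sum-++ (map (λ Q → count m (avoid Q xs)) (map (y ∷_) (placementsIn j (filter (R? y) ys))))
               (map (λ Q → count m (avoid Q xs)) (placementsIn (suc j) ys)) =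
      cong (λ l → sum l + extensions m (suc j) ys xs) (sym (map-∘ (placementsIn j (filter (R? y) ys))))

    -- Either `x` is not among the `suc m` extending pieces, or it is, and then both the `j` pieces
    -- on `ys` and the other extending pieces are compatible with `x`.
    extensions-pivot : ∀ m j ys x xs → extensions (suc m) j ys (x ∷ xs) ≡
      extensions (suc m) j ys xs + extensions m j (filter (R? x) ys) (filter (R? x) xs)
    extensions-pivot m zero ys x xs =
      solve 2 (λ a b → (a :+ b) :+ con 0 := (b :+ con 0) :+ (a :+ con 0)) refl
        (count m (filter (R? x) xs)) (count (suc m) xs)
      where open +-*-Solver
    extensions-pivot m (suc j) []       x xs = refl
    extensions-pivot m (suc j) (y ∷ ys) x xs =
      step (extensions-pivot m j (filter (R? y) ys) x (filter (R? y) xs)) (extensions-pivot m (suc j) ys x xs)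
      where
      open +-*-Solver
      step : extensions (suc m) j (filter (R? y) ys) (x ∷ filter (R? y) xs) ≡
               extensions (suc m) j (filter (R? y) ys) (filter (R? y) xs) +
               extensions m j (filter (R? x) (filter (R? y) ys)) (filter (R? x) (filter (R? y) xs)) →
             extensions (suc m) (suc j) ys (x ∷ xs) ≡
               extensions (suc m) (suc j) ys xs + extensions m (suc j) (filter (R? x) ys) (filter (R? x) xs) →
             extensions (suc m) (suc j) (y ∷ ys) (x ∷ xs) ≡
               extensions (suc m) (suc j) (y ∷ ys) xs +
               extensions m (suc j) (filter (R? x) (y ∷ ys)) (filter (R? x) xs)
      step ih₁ ih₂ rewrite extensions-∷ (suc m) j y ys (x ∷ xs) | extensions-∷ (suc m) j y ys xs | ih₂
        with R? x y | R? y x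
      ... | yes xRy | no ¬yRx = contradiction (R-sym xRy) ¬yRx
      ... | no ¬xRy | yes yRx = contradiction (R-sym yRx) ¬xRy
      ... | no _ | no _ = sym (ℕₚ.+-assoc (extensions (suc m) j (filter (R? y) ys) (filter (R? y) xs)) _ _)
      ... | yes _ | yes _
        rewrite extensions-∷ m j y (filter (R? x) ys) (filter (R? x) xs) | ih₁
              | filter-comm (R? x) (R? y) ys | filter-comm (R? x) (R? y) xs =
        solve 4 (λ a b c d → (a :+ b) :+ (c :+ d) := (a :+ c) :+ (b :+ d)) refl
          (extensions (suc m) j (filter (R? y) ys) (filter (R? y) xs)) _ _ _

    placementsIn-length : ∀ n xs → All (λ P → length P ≡ n) (placementsIn n xs)
    placementsIn-length zero    xs       = refl ∷ []
    placementsIn-length (suc n) []       = []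
    placementsIn-length (suc n) (x ∷ xs) = ≡.subst (All (λ P → length P ≡ suc n)) (sym (placementsIn-∷ n x xs))
      (Allₚ.++⁺ (Allₚ.map⁺ (All.map (cong suc) (placementsIn-length n (filter (R? x) xs))))
        (placementsIn-length (suc n) xs))

    module _ (β : A → Bool) where

      hits : List A → ℕ
      hits P = length (filterᵇ β P)

      binomialHits : ℕ → ℕ → List A → ℕ
      binomialHits n j xs = sum (map (λ P → choose (hits P) j) (placementsIn n xs))

      private
        sum-map-+ : ∀ {X : Set} (f g : X → ℕ) xs →
                    sum (map (λ x → f x + g x) xs) ≡ sum (map f xs) + sum (map g xs)
        sum-map-+ f g []       = refl
        sum-map-+ f g (x ∷ xs) = trans (cong (f x + g x +_) (sum-map-+ f g xs))
          (solve 4 (λ a b c d → (a :+ b) :+ (c :+ d) := (a :+ c) :+ (b :+ d)) refl (f x) (g x) _ _)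
          where open +-*-Solver

        split : ∀ n j x xs → binomialHits (suc n) j (x ∷ xs) ≡
          sum (map (λ P → choose (hits (x ∷ P)) j) (placementsIn n (filter (R? x) xs))) + binomialHits (suc n) j xs
        split n j x xs rewrite placementsIn-∷ n x xs
          | map-++ (λ P → choose (hits P) j) (map (x ∷_) (placementsIn n (filter (R? x) xs))) (placementsIn (suc n) xs)
          | sum-++ (map (λ P → choose (hits P) j) (map (x ∷_) (placementsIn n (filter (R? x) xs))))
                   (map (λ P → choose (hits P) j) (placementsIn (suc n) xs)) =
          cong (λ l → sum l + binomialHits (suc n) j xs) (sym (map-∘ (placementsIn n (filter (R? x) xs))))

      sum-zero : ∀ {X : Set} (f : X → ℕ) {xs} → All (λ x → f x ≡ 0) xs → sum (map f xs) ≡ 0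
      sum-zero f []       = refl
      sum-zero f (e ∷ es) = cong₂ _+_ e (sum-zero f es)

      binomialHits-large : ∀ {n j} xs → n < j → binomialHits n j xs ≡ 0
      binomialHits-large {n} {j} xs n<j = sum-zero _ (All.map (λ {P} |P|≡n →
        choose-> _ _ (ℕₚ.≤-<-trans (ℕₚ.≤-trans (length-filter (λ x → T? (β x)) P) (ℕₚ.≤-reflexive |P|≡n)) n<j))
        (placementsIn-length n xs))

      -- Both sides count the pairs formed by a placement of m + j pieces on xs and a
      -- choice of j of its pieces lying in β.
      binomialHits≡extensions : ∀ m j xs →
        binomialHits (m + j) j xs ≡ extensions m j (filterᵇ β xs) xs
      binomialHits≡extensions m zero xs = begin
        sum (map (λ P → choose (hits P) 0) (placementsIn (m + 0) xs))
                                           ≡⟨ cong (λ n → binomialHits n 0 xs) (ℕₚ.+-identityʳ m) ⟩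
        sum (map (λ P → choose (hits P) 0) (placementsIn m xs))
                                           ≡⟨ ones (placementsIn m xs) ⟩
        length (placementsIn m xs)         ≡⟨ length-placementsIn m xs ⟩
        count m xs                         ≡⟨ ℕₚ.+-identityʳ _ ⟨
        count m xs + 0                     ∎
        where
        open ≡.≡-Reasoning
        ones : ∀ (l : List (List A)) → sum (map (λ P → choose (hits P) 0) l) ≡ length l
        ones []      = refl
        ones (P ∷ l) = cong suc (ones l)
      binomialHits≡extensions m (suc j) [] =
        cong (λ n → binomialHits n (suc j) []) (ℕₚ.+-suc m j)
      binomialHits≡extensions zero (suc j) (x ∷ xs) =
        step (binomialHits≡extensions zero j ys) (binomialHits≡extensions zero (suc j) xs)
        where
        open ≡.≡-Reasoning
        ys = filter (R? x) xs
        E = extensions zero (suc j) (filterᵇ β xs) xs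
        step : binomialHits j j ys ≡ extensions zero j (filterᵇ β ys) ys → binomialHits (suc j) (suc j) xs ≡ E →
               binomialHits (suc j) (suc j) (x ∷ xs) ≡ extensions zero (suc j) (filterᵇ β (x ∷ xs)) (x ∷ xs)
        step ih₁ ih₂ rewrite split j (suc j) x xs | ih₂ with β x
        -- For `m = 0` all pieces of a placement have to be chosen in β, so a placement containing
        -- the cell `x` outside β contributes nothing.
        ... | false = cong (_+ E) (binomialHits-large {j} {suc j} ys ℕₚ.≤-refl)
        ... | true rewrite extensions-∷ zero j x (filterᵇ β xs) (x ∷ xs)
                        | filter-comm (R? x) (λ y → T? (β y)) xs = cong (_+ E) (begin
          sum (map (λ P → choose (hits P) j + choose (hits P) (suc j)) (placementsIn j ys))
            ≡⟨ sum-map-+ _ _ (placementsIn j ys) ⟩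
          binomialHits j j ys + binomialHits j (suc j) ys
            ≡⟨ cong₂ _+_ ih₁ (binomialHits-large {j} {suc j} ys ℕₚ.≤-refl) ⟩
          extensions zero j (filterᵇ β ys) ys + 0
            ≡⟨ ℕₚ.+-identityʳ _ ⟩
          extensions zero j (filterᵇ β ys) ys ∎)
      binomialHits≡extensions (suc m) (suc j) (x ∷ xs) = step
        (binomialHits≡extensions (suc m) j ys) (binomialHits≡extensions m (suc j) ys)
        (binomialHits≡extensions (suc m) (suc j) xs)
        where
        open ≡.≡-Reasoning
        ys = filter (R? x) xs
        E = extensions (suc m) (suc j) (filterᵇ β xs) xs
        step : binomialHits (suc m + j) j ys ≡ extensions (suc m) j (filterᵇ β ys) ys →
               binomialHits (m + suc j) (suc j) ys ≡ extensions m (suc j) (filterᵇ β ys) ys →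
               binomialHits (suc m + suc j) (suc j) xs ≡ E →
               binomialHits (suc m + suc j) (suc j) (x ∷ xs) ≡
               extensions (suc m) (suc j) (filterᵇ β (x ∷ xs)) (x ∷ xs)
        step ih₁ ih₂ ih₃ rewrite split (m + suc j) (suc j) x xs | ih₃ with β x
        ... | false rewrite extensions-pivot m (suc j) (filterᵇ β xs) x xs
                          | filter-comm (R? x) (λ y → T? (β y)) xs =
          trans (cong (_+ E) ih₂) (ℕₚ.+-comm (extensions m (suc j) (filterᵇ β ys) ys) E)
        -- The three terms correspond to `x` placed and chosen, `x` not placed (`E`), and `x` placed
        -- but not chosen.
        ... | true  rewrite extensions-∷ (suc m) j x (filterᵇ β xs) (x ∷ xs)
                          | filter-self x xs
                          | extensions-pivot m (suc j) (filterᵇ β xs) x xs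
                          | filter-comm (R? x) (λ y → T? (β y)) xs = begin
          sum (map (λ P → choose (hits P) j + choose (hits P) (suc j)) (placementsIn (m + suc j) ys)) + E
            ≡⟨ cong (_+ E) (sum-map-+ _ _ (placementsIn (m + suc j) ys)) ⟩
          binomialHits (m + suc j) j ys + binomialHits (m + suc j) (suc j) ys + E
            ≡⟨ cong (λ n → binomialHits n j ys + binomialHits (m + suc j) (suc j) ys + E) (ℕₚ.+-suc m j) ⟩
          binomialHits (suc m + j) j ys + binomialHits (m + suc j) (suc j) ys + E
            ≡⟨ cong₂ (λ a b → a + b + E) ih₁ ih₂ ⟩
          extensions (suc m) j (filterᵇ β ys) ys + extensions m (suc j) (filterᵇ β ys) ys + E
            ≡⟨ solve 3 (λ a b c → a :+ b :+ c := a :+ (c :+ b)) refl (extensions (suc m) j (filterᵇ β ys) ys) _ E ⟩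
          extensions (suc m) j (filterᵇ β ys) ys + (E + extensions m (suc j) (filterᵇ β ys) ys) ∎
          where open +-*-Solver using (solve; _:=_; _:+_)

    -- The elements of `col` attack each other, so a placement uses at most one of them.
    count-column : ∀ k col rest → AllPairs (λ x y → ¬ R x y) col →
      count (suc k) (col ++ rest) ≡ sum (map (λ x → count k (filter (R? x) rest)) col) + count (suc k) rest
    count-column k []        rest []             = refl
    count-column k (x ∷ col) rest (attack ∷ ap) = begin
      count k (filter (R? x) (col ++ rest)) + count (suc k) (col ++ rest)
        ≡⟨ cong₂ _+_ (cong (count k) (trans (filter-++ (R? x) col rest)
             (cong (_++ filter (R? x) rest) (filter-none (R? x) attack)))) (count-column k col rest ap) ⟩
      count k (filter (R? x) rest) + (sum (map (λ x → count k (filter (R? x) rest)) col) + count (suc k) rest)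
        ≡⟨ ℕₚ.+-assoc (count k (filter (R? x) rest)) _ _ ⟨
      count k (filter (R? x) rest) + sum (map (λ x → count k (filter (R? x) rest)) col) + count (suc k) rest ∎
      where open ≡.≡-Reasoning

  -- Rooks on the square board

  NonAttacking-sym : ∀ {n} {x y : Cell n} → NonAttacking x y → NonAttacking y x
  NonAttacking-sym (i≢ , j≢) = ≢-sym i≢ , ≢-sym j≢

  NonAttacking-irrefl : ∀ {n} {x : Cell n} → ¬ NonAttacking x x
  NonAttacking-irrefl (i≢i , _) = i≢i refl

  module Rooks {n : ℕ} = Placements (nonAttacking? {n}) NonAttacking-sym NonAttacking-irrefl
  open Rooks

  sum-const : ∀ {A : Set} {f : A → ℕ} {c xs} → All (λ x → f x ≡ c) xs → sum (map f xs) ≡ length xs * c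
  sum-const []       = refl
  sum-const (e ∷ es) = cong₂ _+_ e (sum-const es)

  unless : ∀ {P : Set} → Dec P → ℕ → ℕ
  unless (yes _) x = 0
  unless (no _)  x = x

  unless-yes : ∀ {P : Set} (d : Dec P) {x} → P → unless d x ≡ 0
  unless-yes (yes _) p = refl
  unless-yes (no ¬p) p = contradiction p ¬p

  unless-no : ∀ {P : Set} (d : Dec P) {x} → ¬ P → unless d x ≡ x
  unless-no (yes p) ¬p = contradiction p ¬p
  unless-no (no _)  ¬p = refl

  module _ {n : ℕ} where

    remove : Fin n → List (Fin n) → List (Fin n)
    remove a = filter (λ i → ¬? (a Finₚ.≟ i))

    length-remove : ∀ {a xs} → Unique xs → a ∈ xs → suc (length (remove a xs)) ≡ length xs
    length-remove {a} {x ∷ xs} (x∉ ∷ u) a∈ with a Finₚ.≟ x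
    length-remove {a} {x ∷ xs} (x∉ ∷ u) a∈ | yes refl =
      cong (suc ∘ length) (filter-all (λ i → ¬? (a Finₚ.≟ i)) x∉)
    length-remove {a} {x ∷ xs} (x∉ ∷ u) (here a≡x) | no a≢x = contradiction a≡x a≢x
    length-remove {a} {x ∷ xs} (x∉ ∷ u) (there a∈) | no a≢x = cong suc (length-remove u a∈)

    column-attacks : ∀ a rs → AllPairs (λ x y → ¬ NonAttacking x y) (map {B = Cell n} (a ,_) rs)
    column-attacks a []       = []
    column-attacks a (r ∷ rs) = Allₚ.map⁺ (All.universal (λ _ na → proj₁ na refl) rs) ∷ column-attacks a rs

    -- Pigeonhole principle: each rook uses up one of the columns in `A`.
    count-few-columns : ∀ k A ys → All (λ y → proj₁ y ∈ A) ys → length A < k → count {n} k ys ≡ 0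
    count-few-columns (suc k) A []       _         _         = refl
    count-few-columns (suc k) A (y ∷ ys) (y∈ ∷ ys∈) |A|<k = cong₂ _+_
      (count-few-columns k (remove (proj₁ y) A) (filter (nonAttacking? y) ys)
        (All.zipWith (λ (z∈ , na) → ∈-filter⁺ (λ i → ¬? (proj₁ y Finₚ.≟ i)) z∈ (proj₁ na))
          (Allₚ.filter⁺ (nonAttacking? y) ys∈ , Allₚ.all-filter (nonAttacking? y) ys))
        (ℕₚ.<-≤-trans (filter-notAll (λ i → ¬? (proj₁ y Finₚ.≟ i)) A (Any.map (λ e ¬e → ¬e e) y∈)) (ℕₚ.≤-pred |A|<k)))
      (count-few-columns (suc k) A ys ys∈ |A|<k)

    filter-grid : ∀ a b A B → filter (nonAttacking? {n} (a , b)) (cartesianProduct A B) ≡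
                              cartesianProduct (remove a A) (remove b B)
    filter-grid a b []      B = refl
    filter-grid a b (i ∷ A) B = trans
      (filter-++ (nonAttacking? (a , b)) (map (i ,_) B) (cartesianProduct A B))
      (case a Finₚ.≟ i of λ where
        (yes a≡i) → cong₂ _++_ (filter-none (nonAttacking? (a , b))
            (Allₚ.map⁺ (All.universal (λ _ na → proj₁ na a≡i) B)))
          (trans (filter-grid a b A B) (cong (λ A → cartesianProduct A (remove b B))
            (sym (filter-reject (λ i → ¬? (a Finₚ.≟ i)) λ a≢i → a≢i a≡i))))
        (no a≢i) → trans (cong₂ _++_ (accept a≢i B) (filter-grid a b A B))
          (cong (λ A → cartesianProduct A (remove b B)) (sym (filter-accept (λ i → ¬? (a Finₚ.≟ i)) a≢i))))
      where
      accept : a ≢ i → ∀ B → filter (nonAttacking? (a , b)) (map (i ,_) B) ≡ map (i ,_) (remove b B)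
      accept a≢i []      = refl
      accept a≢i (j ∷ B) = case b Finₚ.≟ j of λ where
        (yes b≡j) → trans (filter-reject (nonAttacking? (a , b)) (λ na → proj₂ na b≡j))
          (trans (accept a≢i B) (cong (map (i ,_)) (sym (filter-reject (λ i → ¬? (b Finₚ.≟ i)) λ b≢j → b≢j b≡j))))
        (no b≢j) → trans (filter-accept (nonAttacking? (a , b)) (a≢i , b≢j))
          (trans (cong ((i , j) ∷_) (accept a≢i B))
            (cong (map (i ,_)) (sym (filter-accept (λ i → ¬? (b Finₚ.≟ i)) b≢j))))

    -- Expansion along the first column: each choice of a row leaves a square grid of side `m`, and
    -- leaving the column empty is excluded by `count-few-columns`.
    count-grid : ∀ m A B → Unique A → Unique B → length A ≡ m → length B ≡ m →
                 count {n} m (cartesianProduct A B) ≡ m !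
    count-grid zero    A       B _         _  _   _   = refl
    count-grid (suc m) (a ∷ A) B (a∉ ∷ uA) uB |A| |B| = begin
      count (suc m) (map (a ,_) B ++ cartesianProduct A B)
        ≡⟨ count-column m (map (a ,_) B) (cartesianProduct A B) (column-attacks a B) ⟩
      sum (map (λ x → count m (filter (nonAttacking? x) (cartesianProduct A B))) (map (a ,_) B)) +
        count (suc m) (cartesianProduct A B)
        ≡⟨ cong₂ _+_ (trans (sum-const (Allₚ.map⁺ (All.tabulate λ {b} b∈ → begin
             count m (filter (nonAttacking? (a , b)) (cartesianProduct A B))
               ≡⟨ cong (count m) (filter-grid a b A B) ⟩
             count m (cartesianProduct (remove a A) (remove b B))
               ≡⟨ cong (λ A → count m (cartesianProduct A (remove b B))) (filter-all (λ i → ¬? (a Finₚ.≟ i)) a∉) ⟩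
             count m (cartesianProduct A (remove b B))
               ≡⟨ count-grid m A (remove b B) uA (Uniqueₚ.filter⁺ (λ i → ¬? (b Finₚ.≟ i)) uB) (ℕₚ.suc-injective |A|)
                    (ℕₚ.suc-injective (trans (length-remove uB b∈) |B|)) ⟩
             m ! ∎))) (cong (_* m !) (trans (length-map (a ,_) B) |B|)))
           (count-few-columns (suc m) A (cartesianProduct A B) (columns A B)
             (s≤s (ℕₚ.≤-reflexive (ℕₚ.suc-injective |A|)))) ⟩
      suc m * m ! + 0
        ≡⟨ ℕₚ.+-identityʳ _ ⟩
      suc m ! ∎
      where
      open ≡.≡-Reasoning
      columns : ∀ A B → All (λ y → proj₁ y ∈ A) (cartesianProduct A B)
      columns []      B = []
      columns (a ∷ A) B = Allₚ.++⁺ (Allₚ.map⁺ (All.universal (λ _ → here refl) B)) (All.map there (columns A B))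

    -- Each rook of `Q` deletes one row and one column, so a square grid of side `m` remains.
    count-avoid-grid : ∀ m Q A B → AllPairs NonAttacking Q → Unique A → Unique B →
      All (λ q → proj₁ q ∈ A) Q → All (λ q → proj₂ q ∈ B) Q →
      length A ≡ m + length Q → length B ≡ m + length Q →
      count {n} m (avoid Q (cartesianProduct A B)) ≡ m !
    count-avoid-grid m [] A B _ uA uB _ _ |A| |B| =
      count-grid m A B uA uB (trans |A| (ℕₚ.+-identityʳ m)) (trans |B| (ℕₚ.+-identityʳ m))
    count-avoid-grid m ((a , b) ∷ Q) A B (na ∷ nas) uA uB (a∈ ∷ A∈) (b∈ ∷ B∈) |A| |B| = trans
      (cong (count m ∘ avoid Q) (filter-grid a b A B))
      (count-avoid-grid m Q (remove a A) (remove b B) nas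
        (Uniqueₚ.filter⁺ (λ i → ¬? (a Finₚ.≟ i)) uA) (Uniqueₚ.filter⁺ (λ i → ¬? (b Finₚ.≟ i)) uB)
        (All.zipWith (λ (q∈ , na) → ∈-filter⁺ (λ i → ¬? (a Finₚ.≟ i)) q∈ (proj₁ na)) (A∈ , na))
        (All.zipWith (λ (q∈ , na) → ∈-filter⁺ (λ i → ¬? (b Finₚ.≟ i)) q∈ (proj₂ na)) (B∈ , na))
        (ℕₚ.suc-injective (trans (length-remove uA a∈) (trans |A| (ℕₚ.+-suc m (length Q)))))
        (ℕₚ.suc-injective (trans (length-remove uB b∈) (trans |B| (ℕₚ.+-suc m (length Q))))))

    rookNumber-count : ∀ k (β : Board n) → rookNumber k β ≡ count k (filterᵇ β (cells n))
    rookNumber-count k β = length-placementsIn k (filterᵇ β (cells n))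

    -- The classical relation between hit numbers and rook numbers: `j` nonattacking rooks on the
    -- board extend to a full placement in `(n - j)!` ways, whatever their position.
    binomialHits-rookNumber : ∀ (β : Board n) m j → m + j ≡ n →
      binomialHits β n j (cells n) ≡ rookNumber j β * m !
    binomialHits-rookNumber β m j m+j≡n = begin
      binomialHits β n j (cells n)                ≡⟨ cong (λ k → binomialHits β k j (cells n)) m+j≡n ⟨
      binomialHits β (m + j) j (cells n)          ≡⟨ binomialHits≡extensions β m j (cells n) ⟩
      extensions m j (filterᵇ β (cells n)) (cells n)
        ≡⟨ sum-const (All.zipWith (λ {Q} (nas , |Q|) →
             count-avoid-grid m Q (allFin n) (allFin n) nas (Uniqueₚ.allFin⁺ n) (Uniqueₚ.allFin⁺ n)
               (All.universal (λ q → ∈-allFin (proj₁ q)) Q) (All.universal (λ q → ∈-allFin (proj₂ q)) Q)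
               (total |Q|) (total |Q|))
             (Allₚ.all-filter (allPairs? nonAttacking?) (sublists j (filterᵇ β (cells n))) ,
              placementsIn-length j (filterᵇ β (cells n)))) ⟩
      rookNumber j β * m ! ∎
      where
      open ≡.≡-Reasoning
      total : ∀ {k} → k ≡ j → length (allFin n) ≡ m + k
      total refl = trans (length-tabulate _) (sym m+j≡n)

    -- A placement of k rooks off column a, in rows belonging to rs, leaves length rs - k
    -- of these rows free; the equation avoids the subtraction.
    sum-free-rows : ∀ a rs → Unique rs → ∀ k ys → All (λ y → a ≢ proj₁ y × proj₂ y ∈ rs) ys →
      sum (map (λ r → count k (filter (nonAttacking? {n} (a , r)) ys)) rs) + k * count k ys ≡
      length rs * count k ys
    sum-free-rows a rs u zero    ys       _ =
      trans (ℕₚ.+-identityʳ _) (sum-const (All.universal (λ _ → refl) rs))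
    sum-free-rows a rs u (suc k) []       _ =
      trans (cong₂ _+_ (sum-const (All.universal (λ _ → refl) rs)) (ℕₚ.*-zeroʳ k)) (ℕₚ.+-identityʳ _)
    sum-free-rows a rs u (suc k) (y ∷ ys) ((a≢ , y∈) ∷ ys∈) = begin
      sum (map (λ r → count (suc k) (filter (nonAttacking? (a , r)) (y ∷ ys))) rs) + suc k * (X + Y)
        ≡⟨ cong (_+ suc k * (X + Y)) (splits rs) ⟩
      Σ′ + ΣY + suc k * (X + Y)
        ≡⟨ regroup Σ′ ΣY k X Y ⟩
      (Σ′ + X + k * X) + (ΣY + suc k * Y)
        ≡⟨ cong₂ _+_ (cong (_+ k * X) (sym (omit rs u y∈)))
             (sum-free-rows a rs u (suc k) ys ys∈) ⟩
      ΣX + k * X + length rs * Y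
        ≡⟨ cong (_+ length rs * Y) (sum-free-rows a rs u k (filter (nonAttacking? y) ys)
             (Allₚ.filter⁺ (nonAttacking? y) ys∈)) ⟩
      length rs * X + length rs * Y
        ≡⟨ ℕₚ.*-distribˡ-+ (length rs) X Y ⟨
      length rs * (X + Y) ∎
      where
      open ≡.≡-Reasoning
      regroup : ∀ s y k x z → s + y + suc k * (x + z) ≡ (s + x + k * x) + (y + suc k * z)
      regroup = solve 5 (λ s y k x z → s :+ y :+ (x :+ z :+ k :* (x :+ z)) := (s :+ x :+ k :* x) :+ (y :+ (z :+ k :* z))) refl
        where open +-*-Solver using (solve; _:=_; _:+_; _:*_)
      open import Algebra.Properties.CommutativeSemigroup ℕₚ.+-commutativeSemigroup using (interchange)
      X Y ΣX Σ′ ΣY : ℕ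
      X = count k (filter (nonAttacking? y) ys)
      Y = count (suc k) ys
      φ : Fin n → ℕ
      φ r = count k (filter (nonAttacking? (a , r)) (filter (nonAttacking? y) ys))
      -- A rook in the row of `y` attacks `y`, so this row yields no placement that contains `y`.
      φ′ : Fin n → ℕ
      φ′ r = unless (r Finₚ.≟ proj₂ y) (φ r)
      ΣX = sum (map φ rs)
      Σ′ = sum (map φ′ rs)
      ΣY = sum (map (λ r → count (suc k) (filter (nonAttacking? (a , r)) ys)) rs)

      splits : ∀ rs → sum (map (λ r → count (suc k) (filter (nonAttacking? (a , r)) (y ∷ ys))) rs) ≡
        sum (map φ′ rs) + sum (map (λ r → count (suc k) (filter (nonAttacking? (a , r)) ys)) rs)
      splits []       = refl
      splits (r ∷ rs) = trans (cong₂ _+_ (one r) (splits rs))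
        (interchange (φ′ r) _ _ _)
        where
        one : ∀ r → count (suc k) (filter (nonAttacking? (a , r)) (y ∷ ys)) ≡
                    φ′ r + count (suc k) (filter (nonAttacking? (a , r)) ys)
        one r = case r Finₚ.≟ proj₂ y of λ where
          (yes e) → trans (cong (count (suc k)) (filter-reject (nonAttacking? (a , r)) (λ na → proj₂ na e)))
            (cong (_+ count (suc k) (filter (nonAttacking? (a , r)) ys)) (sym (unless-yes (r Finₚ.≟ proj₂ y) e)))
          (no ¬e) → trans (cong (count (suc k)) (filter-accept (nonAttacking? (a , r)) (a≢ , ¬e)))
            (cong (_+ count (suc k) (filter (nonAttacking? (a , r)) ys)) (trans
              (cong (count k) (filter-comm (nonAttacking? y) (nonAttacking? (a , r)) ys))
              (sym (unless-no (r Finₚ.≟ proj₂ y) ¬e))))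

      -- The cells compatible with `y` already avoid its row, so a rook at `(a , proj₂ y)` removes
      -- none of them. The row omitted from `Σ′` would therefore contribute `X`.
      φy : φ (proj₂ y) ≡ X
      φy = cong (count k) (filter-all (nonAttacking? (a , proj₂ y)) (All.zipWith (λ ((a≢ , _) , na) → a≢ , proj₂ na)
        (Allₚ.filter⁺ (nonAttacking? y) ys∈ , Allₚ.all-filter (nonAttacking? y) ys)))

      same : ∀ rs → All (λ r → proj₂ y ≢ r) rs → sum (map φ rs) ≡ sum (map φ′ rs)
      same []       _           = refl
      same (r ∷ rs) (≢r ∷ ≢rs) =
        cong₂ _+_ (sym (unless-no (r Finₚ.≟ proj₂ y) (≢-sym ≢r))) (same rs ≢rs)

      omit : ∀ rs → Unique rs → proj₂ y ∈ rs → sum (map φ rs) ≡ sum (map φ′ rs) + X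
      omit (r ∷ rs) (r∉ ∷ u) (here refl) = trans (cong₂ _+_ φy (same rs r∉)) (trans (ℕₚ.+-comm X _)
        (cong (λ x → x + sum (map φ′ rs) + X) (sym (unless-yes (r Finₚ.≟ r) {φ r} refl))))
      omit (r ∷ rs) (r∉ ∷ u) (there y∈) = trans
        (cong₂ _+_ (sym (unless-no (r Finₚ.≟ proj₂ y) (All.lookup r∉ y∈))) (omit rs u y∈))
        (sym (ℕₚ.+-assoc (φ′ r) _ X))

  -- The numbers z of partitions

  toPartition : List ℕ → Partition
  toPartition a = record
    { parts      = type a
    ; positive   = All-resp-↭ (↭-sym (sort-↭ _)) (Allₚ.all-filter (1 ℕₚ.≤?_) a)
    ; decreasing = sort-↗ (filter (1 ℕₚ.≤?_) a)
    }

  type-parts : ∀ ν → type (parts ν) ≡ parts ν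
  type-parts ν = trans (cong sort (filter-all (1 ℕₚ.≤?_) (positive ν)))
    (Pointwise-≡⇒≡ (Sortedₚ.↗↭↗⇒≋ (Flip.totalOrder ℕₚ.≤-totalOrder)
      (sort-↗ (parts ν)) (decreasing ν) (↭⇒↭ₛ (sort-↭ (parts ν)))))

  type-↭-filter : ∀ a → type a ↭ filter (1 ℕₚ.≤?_) a
  type-↭-filter a = sort-↭ _

  type-map-suc : ∀ ks → type (map suc ks) ↭ map suc ks
  type-map-suc ks = ↭-trans (sort-↭ _) (↭-reflexive (filter-all (1 ℕₚ.≤?_) (Allₚ.map⁺ (All.universal (λ _ → s≤s z≤n) ks))))

  type-suc : ∀ ks → ∃ λ ls → type (map suc ks) ≡ map suc ls × ks ↭ ls
  type-suc ks = ↭-map-inv suc (↭-sym (type-map-suc ks))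

  pred-parts : ∀ ν → ∃ λ ks → parts ν ≡ map suc ks
  pred-parts ν = go (parts ν) (positive ν)
    where
    go : ∀ xs → All (1 ≤_) xs → ∃ λ ks → xs ≡ map suc ks
    go []           []       = [] , refl
    go (suc x ∷ xs) (_ ∷ ps) with go xs ps
    ... | ks , e = x ∷ ks , cong (suc x ∷_) e

  map-suc-↭⁻ : ∀ {ks ls} → map suc ks ↭ map suc ls → ks ↭ ls
  map-suc-↭⁻ {ks} {ls} p with ↭-map-inv suc p
  ... | ls′ , e , q = ↭-trans q (↭-reflexive (sym (map-injective ℕₚ.suc-injective e)))

  infix 4 _↭?_
  -- Two lists are compared after sorting; the entries are raised by one first because `type`
  -- discards zeros.
  _↭?_ : ∀ (ks ls : List ℕ) → Dec (ks ↭ ls)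
  ks ↭? ls = case ≡-dec ℕₚ._≟_ (type (map suc ks)) (type (map suc ls)) of λ where
    (yes e) → yes (map-suc-↭⁻ (↭-trans (↭-sym (type-map-suc ks)) (↭-trans (↭-reflexive e) (type-map-suc ls))))
    (no ¬e) → no (¬e ∘ type-↭ ∘ map⁺ suc)

  multiplicity-here : ∀ i xs → multiplicity i (i ∷ xs) ≡ suc (multiplicity i xs)
  multiplicity-here i xs = cong length (filter-accept (i ℕₚ.≟_) {i} {xs} refl)

  multiplicity-there : ∀ {i x} xs → i ≢ x → multiplicity i (x ∷ xs) ≡ multiplicity i xs
  multiplicity-there {i} {x} xs i≢x = cong length (filter-reject (i ℕₚ.≟_) {x} {xs} i≢x)

  multiplicity-↭ : ∀ i {xs ys} → xs ↭ ys → multiplicity i xs ≡ multiplicity i ys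
  multiplicity-↭ i p = ↭-length (filter-↭ (i ℕₚ.≟_) p)

  multiplicity-none : ∀ {i xs} → All (i ≢_) xs → multiplicity i xs ≡ 0
  multiplicity-none {i} none = cong length (filter-none (i ℕₚ.≟_) none)

  factor : ℕ → List ℕ → ℕ
  factor i xs = i ^ multiplicity i xs * multiplicity i xs !

  -- The bound of the product is made a separate argument: in `z` it is the size, which changes when
  -- a part is added.
  zUpTo : ℕ → List ℕ → ℕ
  zUpTo N xs = product (map (λ i → factor i xs) (applyUpTo suc N))

  zUpTo-suc : ∀ N xs → zUpTo (suc N) xs ≡ zUpTo N xs * factor (suc N) xs
  zUpTo-suc N xs = begin
    product (map F (applyUpTo suc (suc N)))        ≡⟨ cong (product ∘ map F) (applyUpTo-∷ʳ suc N) ⟨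
    product (map F (applyUpTo suc N ∷ʳ suc N))     ≡⟨ cong product (map-++ F (applyUpTo suc N) [ suc N ]) ⟩
    product (map F (applyUpTo suc N) ++ [ F (suc N) ])  ≡⟨ product-++ (map F (applyUpTo suc N)) [ F (suc N) ] ⟩
    zUpTo N xs * (F (suc N) * 1)                   ≡⟨ cong (zUpTo N xs *_) (ℕₚ.*-identityʳ _) ⟩
    zUpTo N xs * F (suc N)                         ∎
    where
    open ≡.≡-Reasoning
    F : ℕ → ℕ
    F i = factor i xs

  zUpTo-skip : ∀ N {x} xs → N < x → zUpTo N (x ∷ xs) ≡ zUpTo N xs
  zUpTo-skip zero    xs _   = refl
  zUpTo-skip (suc N) {x} xs N<x = trans (zUpTo-suc N (x ∷ xs)) (trans
    (cong₂ _*_ (zUpTo-skip N xs (ℕₚ.<-trans ℕₚ.≤-refl N<x))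
      (cong (λ m → suc N ^ m * m !) (multiplicity-there xs (ℕₚ.<⇒≢ N<x)))) (sym (zUpTo-suc N xs)))

  zUpTo-∷ : ∀ N {x} xs → 1 ≤ x → x ≤ N → zUpTo N (x ∷ xs) ≡ x * suc (multiplicity x xs) * zUpTo N xs
  zUpTo-∷ zero    {suc x} xs _ ()
  zUpTo-∷ (suc N) {x} xs 1≤x x≤N = case x ℕₚ.≟ suc N of λ where
      (yes refl) → trans (zUpTo-suc N (x ∷ xs)) (trans
        (cong₂ _*_ (zUpTo-skip N xs ℕₚ.≤-refl) (cong (λ m → suc N ^ m * m !) (multiplicity-here x xs)))
        (trans (arith (zUpTo N xs) (suc N) (multiplicity x xs) (suc N ^ multiplicity x xs) (multiplicity x xs !))
          (cong (suc N * suc (multiplicity x xs) *_) (sym (zUpTo-suc N xs)))))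
      (no x≢N) → trans (zUpTo-suc N (x ∷ xs)) (trans
        (cong₂ _*_ (zUpTo-∷ N xs 1≤x (ℕₚ.≤-pred (ℕₚ.≤∧≢⇒< x≤N x≢N)))
          (cong (λ m → suc N ^ m * m !) (multiplicity-there xs (x≢N ∘ sym))))
        (trans (ℕₚ.*-assoc (x * suc (multiplicity x xs)) (zUpTo N xs) _)
          (cong (x * suc (multiplicity x xs) *_) (sym (zUpTo-suc N xs)))))
    where
    arith : ∀ z n m p f → z * (n * p * (suc m * f)) ≡ n * suc m * (z * (p * f))
    arith = solve 5 (λ z n m p f → z :* (n :* p :* ((con 1 :+ m) :* f)) := n :* (con 1 :+ m) :* (z :* (p :* f))) refl
      where open +-*-Solver

  zUpTo-large : ∀ d {N} xs → All (_≤ N) xs → zUpTo (d + N) xs ≡ zUpTo N xs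
  zUpTo-large zero    xs small = refl
  zUpTo-large (suc d) {N} xs small = trans (zUpTo-suc (d + N) xs) (trans
    (cong₂ _*_ (zUpTo-large d xs small) (cong (λ m → suc (d + N) ^ m * m !) (multiplicity-none
      (All.map (λ x≤N e → ℕₚ.<⇒≱ (s≤s (ℕₚ.m≤n+m N d)) (ℕₚ.≤-trans (ℕₚ.≤-reflexive e) x≤N)) small))))
    (ℕₚ.*-identityʳ _))

  zUpTo-↭ : ∀ N {xs ys} → xs ↭ ys → zUpTo N xs ≡ zUpTo N ys
  zUpTo-↭ N p = cong product (map-cong (λ i → cong (λ m → i ^ m * m !) (multiplicity-↭ i p)) (applyUpTo suc N))

  ≤-sum : ∀ xs → All (_≤ sum xs) xs
  ≤-sum []       = []
  ≤-sum (x ∷ xs) = ℕₚ.m≤m+n x (sum xs) ∷ All.map (λ y≤ → ℕₚ.≤-trans y≤ (ℕₚ.m≤n+m (sum xs) x)) (≤-sum xs)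

  weight : List ℕ → ℕ
  weight ks = zUpTo (sum (map suc ks)) (map suc ks)

  z-toPartition : ∀ ks → z (toPartition (map suc ks)) ≡ weight ks
  z-toPartition ks = trans (cong (λ N → zUpTo N (type (map suc ks))) (sum-type (map suc ks)))
    (zUpTo-↭ (sum (map suc ks)) (type-map-suc ks))

  multiplicity-map-suc : ∀ k ks → multiplicity (suc k) (map suc ks) ≡ multiplicity k ks
  multiplicity-map-suc k []       = refl
  multiplicity-map-suc k (l ∷ ks) = case k ℕₚ.≟ l of λ where
    (yes refl) → trans (multiplicity-here (suc k) (map suc ks))
      (trans (cong suc (multiplicity-map-suc k ks)) (sym (multiplicity-here k ks)))
    (no k≢l) → trans (multiplicity-there (map suc ks) (k≢l ∘ ℕₚ.suc-injective))
      (trans (multiplicity-map-suc k ks) (sym (multiplicity-there ks k≢l)))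

  -- This ratio is the scalar produced by `derivative-∷` up to α, and makes the derivative adjoint
  -- to the product by a power sum.
  weight-∷ : ∀ k ks → weight (k ∷ ks) ≡ suc k * suc (multiplicity k ks) * weight ks
  weight-∷ k ks = trans (zUpTo-∷ (suc k + sum (map suc ks)) (map suc ks) (s≤s z≤n) (ℕₚ.m≤m+n (suc k) _))
    (cong₂ (λ m w → suc k * suc m * w) (multiplicity-map-suc k ks)
      (zUpTo-large (suc k) (map suc ks) (≤-sum (map suc ks))))

  -- Dominance

  boundedLists : ℕ → ℕ → List (List ℕ)
  boundedLists b zero    = [ [] ]
  boundedLists b (suc m) = [] ∷ cartesianProductWith _∷_ (upTo (suc b)) (boundedLists b m)

  boundedLists-complete : ∀ b m t → length t ≤ m → All (_≤ b) t → t ∈ boundedLists b m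
  boundedLists-complete b zero    []      _         _          = here refl
  boundedLists-complete b (suc m) []      _         _          = here refl
  boundedLists-complete b (suc m) (x ∷ t) (s≤s len) (x≤b ∷ t≤) =
    there (∈-cartesianProductWith⁺ _∷_ (∈-upTo⁺ (s≤s x≤b)) (boundedLists-complete b m t len t≤))

  length≤sum : ∀ {t} → All (1 ≤_) t → length t ≤ sum t
  length≤sum []             = z≤n
  length≤sum (1≤x ∷ 1≤t) = ℕₚ.+-mono-≤ 1≤x (length≤sum 1≤t)

  -- A partition may occur several times, and other sizes occur too. Elimination asks only for a
  -- finite list that contains every partition of size `n`.
  allPartitions : ℕ → List Partition
  allPartitions n = map toPartition (boundedLists n n)

  allPartitions-complete : ∀ {n} ν → size ν ≡ n → Any (λ κ → parts κ ≡ parts ν) (allPartitions n)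
  allPartitions-complete ν refl = Anyₚ.map⁺ (Any.map (λ e → trans (cong type (sym e)) (type-parts ν))
    (boundedLists-complete (size ν) (size ν) (parts ν) (length≤sum (positive ν)) (≤-sum (parts ν))))

  ⊴-trans : ∀ ν κ μ → ν ⊴ κ → κ ⊴ μ → ν ⊴ μ
  ⊴-trans ν κ μ (e , le) (e′ , le′) = trans e e′ , λ k → ℕₚ.≤-trans (le k) (le′ k)

  take-sums-injective : ∀ {xs ys} → All (1 ≤_) xs → All (1 ≤_) ys →
    (∀ k → k ≤ length xs ℕ.⊔ length ys → sum (take k xs) ≡ sum (take k ys)) → xs ≡ ys
  take-sums-injective []          []          e = refl
  take-sums-injective []          (p ∷ _)     e = contradiction (subst (1 ≤_) (trans (sym (ℕₚ.+-identityʳ _)) (sym (e 1 (s≤s z≤n)))) p) λ ()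
  take-sums-injective (p ∷ _)     []          e = contradiction (subst (1 ≤_) (trans (sym (ℕₚ.+-identityʳ _)) (e 1 (s≤s z≤n))) p) λ ()
  take-sums-injective {x ∷ xs} {y ∷ ys} (_ ∷ ps) (_ ∷ qs) e = cong₂ _∷_ x≡y
    (take-sums-injective ps qs λ k k≤ → ℕₚ.+-cancelˡ-≡ x _ _
      (trans (e (suc k) (s≤s k≤)) (cong (_+ sum (take k ys)) (sym x≡y))))
    where
    x≡y : x ≡ y
    x≡y = trans (sym (ℕₚ.+-identityʳ x)) (trans (e 1 (s≤s z≤n)) (ℕₚ.+-identityʳ y))

  ⊴-antisym : ∀ ν κ → ν ⊴ κ → κ ⊴ ν → parts ν ≡ parts κ
  ⊴-antisym ν κ (_ , le) (_ , le′) =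
    take-sums-injective (positive ν) (positive κ) λ k _ → ℕₚ.≤-antisym (le k) (le′ k)

  takeSums : ℕ → List ℕ → ℕ
  takeSums zero    t = 0
  takeSums (suc k) t = sum (take (suc k) t) + takeSums k t

  -- A linear refinement of the dominance order, which serves as measure for inductions along it.
  rank : Partition → ℕ
  rank ν = takeSums (size ν) (parts ν)

  takeSums-mono : ∀ m {s t} → (∀ k → sum (take k s) ≤ sum (take k t)) → takeSums m s ≤ takeSums m t
  takeSums-mono zero    le = z≤n
  takeSums-mono (suc m) le = ℕₚ.+-mono-≤ (le (suc m)) (takeSums-mono m le)

  takeSums-equal : ∀ m {s t} → (∀ k → sum (take k s) ≤ sum (take k t)) → takeSums m s ≡ takeSums m t →
                   ∀ k → k ≤ m → sum (take k s) ≡ sum (take k t)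
  takeSums-equal m       le e zero    _ = refl
  takeSums-equal (suc m) {s} {t} le e (suc k) (s≤s k≤m) = case suc k ℕₚ.≟ suc m of λ where
      (yes refl) → top
      (no k≢m)   → takeSums-equal m le rest (suc k) (ℕₚ.≤∧≢⇒< k≤m (k≢m ∘ cong suc))
    where
    top : sum (take (suc m) s) ≡ sum (take (suc m) t)
    top = ℕₚ.≤-antisym (le (suc m)) (ℕₚ.+-cancelʳ-≤ (takeSums m t) _ _ (ℕₚ.≤-trans
      (ℕₚ.≤-reflexive (sym e)) (ℕₚ.+-monoʳ-≤ (sum (take (suc m) s)) (takeSums-mono m le))))
    rest : takeSums m s ≡ takeSums m t
    rest = ℕₚ.+-cancelˡ-≡ (sum (take (suc m) s)) _ _ (trans e (cong (_+ takeSums m t) (sym top)))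

  -- Partial sums are compared term by term, so equal ranks force all of them up to the size to
  -- agree. A partition has no more parts than its size, hence these sums determine it.
  rank-strict : ∀ ν κ → ν ⊴ κ → parts ν ≢ parts κ → rank ν < rank κ
  rank-strict ν κ (e , le) ≢ = ℕₚ.≤∧≢⇒<
    (subst (λ m → takeSums (size ν) (parts ν) ≤ takeSums m (parts κ)) e (takeSums-mono (size ν) le))
    λ eq → ≢ (take-sums-injective (positive ν) (positive κ) λ k k≤ →
      takeSums-equal (size ν) le (trans eq (cong (λ m → takeSums m (parts κ)) (sym e))) k
        (ℕₚ.≤-trans k≤ (ℕₚ.⊔-lub (length≤sum (positive ν)) (subst (length (parts κ) ≤_) (sym e) (length≤sum (positive κ))))))

  head-max : ∀ {x t} → Linked _≥_ (x ∷ t) → All (_≤ x) t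
  head-max [-]       = []
  head-max (x≥y ∷ l) = x≥y ∷ All.map (λ z≤y → ℕₚ.≤-trans z≤y x≥y) (head-max l)

  ones-unique : ∀ {t} → All (1 ≤_) t → All (_≤ 1) t → t ≡ replicate (sum t) 1
  ones-unique []           []           = refl
  ones-unique (1≤x ∷ ps) (x≤1 ∷ qs) with refl ← ℕₚ.≤-antisym x≤1 1≤x = cong (1 ∷_) (ones-unique ps qs)

  sum-take-ones : ∀ k s → sum (take k (replicate s 1)) ≡ k ℕ.⊓ s
  sum-take-ones zero    s       = refl
  sum-take-ones (suc k) zero    = refl
  sum-take-ones (suc k) (suc s) = cong suc (sum-take-ones k s)

  sum-ones : ∀ s → sum (replicate s 1) ≡ s
  sum-ones zero    = refl
  sum-ones (suc s) = cong suc (sum-ones s)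

  module _ (μ : Partition) (p s : ℕ) (μ-parts : parts μ ≡ suc p ∷ replicate s 1) where

    hook-size : size μ ≡ suc p + s
    hook-size = trans (cong sum μ-parts) (cong (suc p +_) (sum-ones s))

    -- Each part after the k-th one is at least 1, so the first k parts leave at least `suc s ∸ k`
    -- of the total to the others. The hook attains this bound.
    ⊴-hook : ∀ ν → size ν ≡ suc p + s → s < length (parts ν) → ν ⊴ μ
    ⊴-hook ν size≡ s<len = trans size≡ (sym hook-size) , λ k →
      ℕₚ.≤-trans (bound k (parts ν) (positive ν) size≡ s<len) (ℕₚ.≤-reflexive (cong (sum ∘ take k) (sym μ-parts)))
      where
      bound : ∀ k t → All (1 ≤_) t → sum t ≡ suc p + s → s < length t →
              sum (take k t) ≤ sum (take k (suc p ∷ replicate s 1))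
      bound zero    t ps e lt = z≤n
      bound (suc k) t ps e lt = ℕₚ.≤-trans (tail-bound (suc k) t ps)
        (ℕₚ.≤-trans (ℕₚ.∸-mono (ℕₚ.≤-reflexive e) (ℕₚ.∸-monoˡ-≤ (suc k) lt)) (ℕₚ.≤-reflexive (trans value
          (cong (suc p +_) (sym (sum-take-ones k s))))))
        where
        tail-bound : ∀ k t → All (1 ≤_) t → sum (take k t) ≤ sum t ∸ (length t ∸ k)
        tail-bound zero    t       ps        = z≤n
        tail-bound (suc k) []      ps        = z≤n
        tail-bound (suc k) (x ∷ t) (_ ∷ ps) = ℕₚ.≤-trans (ℕₚ.+-monoʳ-≤ x (tail-bound k t ps))
          (ℕₚ.≤-reflexive (sym (ℕₚ.+-∸-assoc x (ℕₚ.≤-trans (ℕₚ.m∸n≤m (length t) k) (length≤sum ps)))))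
        value : suc p + s ∸ (suc s ∸ suc k) ≡ suc p + k ℕ.⊓ s
        value = trans (ℕₚ.+-∸-assoc (suc p) (ℕₚ.m∸n≤m s k)) (cong (suc p +_) (trans (complement s k) (ℕₚ.⊓-comm s k)))
          where
          complement : ∀ s k → s ∸ (s ∸ k) ≡ s ℕ.⊓ k
          complement s k = case ℕₚ.≤-total k s of λ where
            (inj₁ k≤s) → trans (ℕₚ.m∸[m∸n]≡n k≤s) (sym (ℕₚ.m≥n⇒m⊓n≡n k≤s))
            (inj₂ s≤k) → trans (cong (s ∸_) (ℕₚ.m≤n⇒m∸n≡0 s≤k)) (sym (ℕₚ.m≤n⇒m⊓n≡m s≤k))

    -- Dominance at the first partial sum makes the largest part equal to `suc p`. The next partial
    -- sum then bounds the second part by 1, and the rest follows by monotonicity.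
    hook-maximal : ∀ ν {b} → ν ⊴ μ → b ∈ parts ν → suc p ≤ b → parts ν ≡ parts μ
    hook-maximal ν {b} (size≡ , le) b∈ p<b = trans (go (parts ν) (positive ν) (decreasing ν)
        (trans size≡ hook-size) (λ k → ℕₚ.≤-trans (le k) (ℕₚ.≤-reflexive (cong (sum ∘ take k) μ-parts))) b∈)
        (sym μ-parts)
      where
      go : ∀ t → All (1 ≤_) t → Linked _≥_ t → sum t ≡ suc p + s →
           (∀ k → sum (take k t) ≤ sum (take k (suc p ∷ replicate s 1))) → b ∈ t → t ≡ suc p ∷ replicate s 1
      go (x ∷ t) (_ ∷ ps) link e le b∈ = cong₂ _∷_ x≡ (trans (ones-unique ps (small t link λ k → ℕₚ.+-cancelˡ-≤ x _ _
          (ℕₚ.≤-trans (le (suc k)) (ℕₚ.+-mono-≤ (ℕₚ.≤-reflexive (sym x≡)) (ℕₚ.≤-trans (ℕₚ.≤-reflexive (sum-take-ones k s)) (ℕₚ.m⊓n≤m k s))))))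
          (cong (λ m → replicate m 1) (ℕₚ.+-cancelˡ-≡ x _ _ (trans e (cong (_+ s) (sym x≡))))))
        where
        b≤x : b ≤ x
        b≤x = case b∈ of λ where
          (here b≡x)  → ℕₚ.≤-reflexive b≡x
          (there b∈t) → All.lookup (head-max link) b∈t
        x≡ : x ≡ suc p
        x≡ = ℕₚ.≤-antisym (ℕₚ.+-cancelʳ-≤ 0 _ _ (le 1)) (ℕₚ.≤-trans p<b b≤x)
        small : ∀ t → Linked _≥_ (x ∷ t) → (∀ k → sum (take k t) ≤ k) → All (_≤ 1) t
        small []      _          _  = []
        small (y ∷ t) (_ ∷ link) le = y≤1 ∷ All.map (λ z≤y → ℕₚ.≤-trans z≤y y≤1) (head-max link)
          where
          y≤1 : y ≤ 1
          y≤1 = ℕₚ.≤-trans (ℕₚ.m≤m+n y 0) (le 1)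

  -- Semistandard tableaux

  length-filter-unique : ∀ {A : Set} {P : A → Set} (P? : Decidable P) {x xs} → Unique xs → x ∈ xs → P x →
    (∀ {y} → y ∈ xs → P y → y ≡ x) → length (filter P? xs) ≡ 1
  length-filter-unique P? {x} {_ ∷ xs} (x∉ ∷ u) (here refl) px only = trans
    (cong length (filter-accept P? px)) (cong (suc ∘ length) (filter-none P?
      (All.tabulate λ y∈ py → All.lookup x∉ y∈ (sym (only (there y∈) py)))))
  length-filter-unique P? {x} {y ∷ xs} (y∉ ∷ u) (there x∈) px only = trans
    (cong length (filter-reject P? λ py → All.lookup y∉ x∈ (only (here refl) py)))
    (length-filter-unique P? u x∈ px (only ∘ there))

  smaller : ℕ → List ℕ → ℕ
  smaller k xs = length (filter (ℕₚ._<? k) xs)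

  smaller-++ : ∀ k xs ys → smaller k (xs ++ ys) ≡ smaller k xs + smaller k ys
  smaller-++ k xs ys = trans (cong length (filter-++ (ℕₚ._<? k) xs ys)) (length-++ (filter (ℕₚ._<? k) xs))

  smaller-suc : ∀ k xs → smaller (suc k) xs ≡ smaller k xs + multiplicity k xs
  smaller-suc k []       = refl
  smaller-suc k (x ∷ xs) = case ℕₚ.<-cmp x k of λ where
      (tri< x<k x≢k _) → trans (cong length (filter-accept (ℕₚ._<? suc k) (ℕₚ.m<n⇒m<1+n x<k)))
        (trans (cong suc (smaller-suc k xs)) (sym (cong₂ _+_ (cong length (filter-accept (ℕₚ._<? k) {x} {xs} x<k))
          (multiplicity-there xs (x≢k ∘ sym)))))
      (tri≈ x≮k refl _) → trans (cong length (filter-accept (ℕₚ._<? suc k) {x} {xs} ℕₚ.≤-refl))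
        (trans (cong suc (smaller-suc k xs)) (trans (sym (ℕₚ.+-suc (smaller k xs) (multiplicity k xs)))
          (sym (cong₂ _+_ (cong length (filter-reject (ℕₚ._<? k) {x} {xs} x≮k)) (multiplicity-here k xs)))))
      (tri> x≮k x≢k k<x) → trans (cong length (filter-reject (ℕₚ._<? suc k) (λ x≤k → x≢k (ℕₚ.≤-antisym (ℕₚ.≤-pred x≤k) (ℕₚ.<⇒≤ k<x)))))
        (trans (smaller-suc k xs) (sym (cong₂ _+_ (cong length (filter-reject (ℕₚ._<? k) {x} {xs} x≮k))
          (multiplicity-there xs (x≢k ∘ sym)))))

  smaller-none : ∀ {k xs} → All (k ≤_) xs → smaller k xs ≡ 0
  smaller-none {k} k≤ = cong length (filter-none (ℕₚ._<? k) (All.map ℕₚ.≤⇒≯ k≤))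

  smaller-all : ∀ {k xs} → All (_< k) xs → smaller k xs ≡ length xs
  smaller-all {k} <k = cong length (filter-all (ℕₚ._<? k) <k)

  sum-multiplicities : ∀ k xs → sum (applyUpTo (λ i → multiplicity i xs) k) ≡ smaller k xs
  sum-multiplicities zero    xs = sym (smaller-none {xs = xs} (All.universal (λ _ → z≤n) xs))
  sum-multiplicities (suc k) xs = begin
    sum (applyUpTo f (suc k))              ≡⟨ cong sum (applyUpTo-∷ʳ f k) ⟨
    sum (applyUpTo f k ++ [ f k ])         ≡⟨ sum-++ (applyUpTo f k) [ f k ] ⟩
    sum (applyUpTo f k) + (f k + 0)        ≡⟨ cong₂ _+_ (sum-multiplicities k xs) (ℕₚ.+-identityʳ (f k)) ⟩
    smaller k xs + f k                     ≡⟨ smaller-suc k xs ⟨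
    smaller (suc k) xs                     ∎
    where
    open ≡.≡-Reasoning
    f : ℕ → ℕ
    f i = multiplicity i xs

  take-applyUpTo : ∀ {A : Set} (f : ℕ → A) {k N} → k ≤ N → take k (applyUpTo f N) ≡ applyUpTo f k
  take-applyUpTo f z≤n       = refl
  take-applyUpTo f (s≤s k≤N) = cong (f 0 ∷_) (take-applyUpTo (f ∘ suc) k≤N)

  applyUpTo-cong : ∀ {A : Set} {f g : ℕ → A} n → (∀ i → f i ≡ g i) → applyUpTo f n ≡ applyUpTo g n
  applyUpTo-cong zero    e = refl
  applyUpTo-cong (suc n) e = cong₂ _∷_ (e 0) (applyUpTo-cong n (e ∘ suc))

  -- The consequence of strict increase along columns through which all bounds on tableaux pass: the
  -- entries of row i, counted from 0, are at least i.
  RowsFrom : ℕ → List (List ℕ) → Set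
  RowsFrom i []      = ⊤
  RowsFrom i (r ∷ T) = All (i ≤_) r × RowsFrom (suc i) T

  Above : List ℕ → List ℕ → Set
  Above r s = Pointwise _<_ (take (length s) r) s

  rowsFrom : ∀ i r T → All (i ≤_) r → Linked Above (r ∷ T) → RowsFrom i (r ∷ T)
  rowsFrom i r []      i≤r _         = i≤r , tt
  rowsFrom i r (s ∷ T) i≤r (a ∷ l) = i≤r , rowsFrom (suc i) s T (next (Allₚ.take⁺ (length s) i≤r) a) l
    where
    next : ∀ {xs ys} → All (i ≤_) xs → Pointwise _<_ xs ys → All (suc i ≤_) ys
    next []        []        = []
    next (i≤x ∷ p) (x<y ∷ q) = ℕₚ.≤-<-trans i≤x x<y ∷ next p q

  semistandard-rows : ∀ T → Linked Above T → RowsFrom 0 T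
  semistandard-rows []      _ = tt
  semistandard-rows (r ∷ T) l = rowsFrom 0 r T (All.universal (λ _ → z≤n) r) l

  rows-bounded : ∀ {i k} T → RowsFrom i T → k ≤ i → All (k ≤_) (concat T)
  rows-bounded []      _         _   = []
  rows-bounded (r ∷ T) (i≤r , R) k≤i =
    Allₚ.++⁺ (All.map (ℕₚ.≤-trans k≤i) i≤r) (rows-bounded T R (ℕₚ.m≤n⇒m≤1+n k≤i))

  HasShape : List ℕ → List (List ℕ) → Set
  HasShape = Pointwise (λ l r → length r ≡ l)

  -- Entries below `i + m` can only lie in the first `m` rows.
  smaller-take : ∀ i m {λ′ T} → HasShape λ′ T → RowsFrom i T → smaller (i + m) (concat T) ≤ sum (take m λ′)
  smaller-take i zero    {T = T} sh R = ℕₚ.≤-reflexive (smaller-none (rows-bounded T R (ℕₚ.≤-reflexive (ℕₚ.+-identityʳ i))))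
  smaller-take i (suc m) []           R = z≤n
  smaller-take i (suc m) {l ∷ λ′} {r ∷ T} (refl ∷ sh) (_ , R) = ℕₚ.≤-trans
    (ℕₚ.≤-reflexive (smaller-++ (i + suc m) r (concat T)))
    (ℕₚ.+-mono-≤ (length-filter (ℕₚ._<? (i + suc m)) r)
      (ℕₚ.≤-trans (ℕₚ.≤-reflexive (cong (λ k → smaller k (concat T)) (ℕₚ.+-suc i m))) (smaller-take (suc i) m sh R)))

  superstandard : ℕ → List ℕ → List (List ℕ)
  superstandard i []       = []
  superstandard i (l ∷ λ′) = replicate l i ∷ superstandard (suc i) λ′

  smaller-complete : ∀ {i} r → All (i ≤_) r → smaller (suc i) r ≡ length r → r ≡ replicate (length r) i
  smaller-complete {i} r i≤r e = go r (subst (All (_< suc i)) (filter-complete (ℕₚ._<? suc i) e) (Allₚ.all-filter (ℕₚ._<? suc i) r)) i≤r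
    where
    go : ∀ r → All (_< suc i) r → All (i ≤_) r → r ≡ replicate (length r) i
    go []      []          []          = refl
    go (x ∷ r) (s≤s x≤i ∷ p) (i≤x ∷ q) = cong₂ _∷_ (ℕₚ.≤-antisym x≤i i≤x) (go r p q)

  -- Equality in `smaller-take` for every `m` fills each row completely with its smallest admissible
  -- entry.
  superstandard-unique : ∀ i {λ′ T} → HasShape λ′ T → RowsFrom i T →
    (∀ m → m ≤ length λ′ → smaller (i + m) (concat T) ≡ sum (take m λ′)) → T ≡ superstandard i λ′
  superstandard-unique i [] R e = refl
  superstandard-unique i {l ∷ λ′} {r ∷ T} (refl ∷ sh) (i≤r , R) e = cong₂ _∷_ r≡ (superstandard-unique (suc i) sh R rest)
    where
    r≡ : r ≡ replicate l i
    r≡ = smaller-complete r i≤r (begin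
      smaller (suc i) r                              ≡⟨ ℕₚ.+-identityʳ _ ⟨
      smaller (suc i) r + 0                          ≡⟨ cong (smaller (suc i) r +_) (smaller-none (rows-bounded T R ℕₚ.≤-refl)) ⟨
      smaller (suc i) r + smaller (suc i) (concat T) ≡⟨ smaller-++ (suc i) r (concat T) ⟨
      smaller (suc i) (r ++ concat T)                ≡⟨ cong (λ k → smaller k (r ++ concat T)) (ℕₚ.+-comm i 1) ⟨
      smaller (i + 1) (r ++ concat T)                ≡⟨ e 1 (s≤s z≤n) ⟩
      l + 0                                          ≡⟨ ℕₚ.+-identityʳ l ⟩
      l                                              ∎)
      where open ≡.≡-Reasoning
    below : ∀ m → All (_< i + suc m) r
    below m = subst (All (_< i + suc m)) (sym r≡) (Allₚ.replicate⁺ l (ℕₚ.m<m+n i (s≤s z≤n)))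
    rest : ∀ m → m ≤ length λ′ → smaller (suc i + m) (concat T) ≡ sum (take m λ′)
    rest m m≤ = ℕₚ.+-cancelˡ-≡ l _ _ (begin
      l + smaller (suc i + m) (concat T)             ≡⟨ cong (λ k → l + smaller k (concat T)) (ℕₚ.+-suc i m) ⟨
      l + smaller (i + suc m) (concat T)             ≡⟨ cong (_+ smaller (i + suc m) (concat T)) (smaller-all (below m)) ⟨
      smaller (i + suc m) r + smaller (i + suc m) (concat T)  ≡⟨ smaller-++ (i + suc m) r (concat T) ⟨
      smaller (i + suc m) (r ++ concat T)            ≡⟨ e (suc m) (s≤s m≤) ⟩
      l + sum (take m λ′)                            ∎)
      where open ≡.≡-Reasoning

  words-members : ∀ N k → All (λ w → length w ≡ k × All (_< N) w) (words N k)
  words-members N zero    = (refl , []) ∷ []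
  words-members N (suc k) = Allₚ.cartesianProductWith⁺ (≡.setoid _) (≡.setoid _) _∷_ (upTo N) (words N k)
    λ x∈ w∈ → let (e , w<) = All.lookup (words-members N k) w∈ in cong suc e , ∈-upTo⁻ x∈ ∷ w<

  fillings-members : ∀ N λ′ → All (λ T → HasShape λ′ T × All (_< N) (concat T)) (fillings N λ′)
  fillings-members N []       = ([] , []) ∷ []
  fillings-members N (l ∷ λ′) = Allₚ.cartesianProductWith⁺ (≡.setoid _) (≡.setoid _) _∷_ (words N l) (fillings N λ′)
    λ w∈ T∈ → let (e , w<) = All.lookup (words-members N l) w∈ ; (sh , T<) = All.lookup (fillings-members N λ′) T∈ in
      e ∷ sh , Allₚ.++⁺ w< T<

  words-unique : ∀ N k → Unique (words N k)
  words-unique N zero    = [] ∷ []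
  words-unique N (suc k) = Uniqueₚ.cartesianProductWith⁺ _∷_ ∷-injective (Uniqueₚ.upTo⁺ N) (words-unique N k)

  fillings-unique : ∀ N λ′ → Unique (fillings N λ′)
  fillings-unique N []       = [] ∷ []
  fillings-unique N (l ∷ λ′) = Uniqueₚ.cartesianProductWith⁺ _∷_ ∷-injective (words-unique N l) (fillings-unique N λ′)

  replicate∈words : ∀ {N} l {i} → i < N → replicate l i ∈ words N l
  replicate∈words zero    i<N = here refl
  replicate∈words (suc l) i<N = ∈-cartesianProductWith⁺ _∷_ (∈-upTo⁺ i<N) (replicate∈words l i<N)

  superstandard∈fillings : ∀ {N} i λ′ → i + length λ′ ≤ N → superstandard i λ′ ∈ fillings N λ′
  superstandard∈fillings i []       _  = here refl
  superstandard∈fillings i (l ∷ λ′) le = ∈-cartesianProductWith⁺ _∷_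
    (replicate∈words l (ℕₚ.<-≤-trans (ℕₚ.m<m+n i (s≤s z≤n)) le))
    (superstandard∈fillings (suc i) λ′ (ℕₚ.≤-trans (ℕₚ.≤-reflexive (sym (ℕₚ.+-suc i (length λ′)))) le))

  superstandard-rows : ∀ i λ′ → RowsFrom i (superstandard i λ′)
  superstandard-rows i []       = tt
  superstandard-rows i (l ∷ λ′) = Allₚ.replicate⁺ l ℕₚ.≤-refl , superstandard-rows (suc i) λ′

  superstandard-semistandard : ∀ i λ′ → Linked _≥_ λ′ → IsSemistandard (superstandard i λ′)
  superstandard-semistandard i λ′ link = rows i λ′ , columns i λ′ link
    where
    constant : ∀ l i → Linked _≤_ (replicate l i)
    constant zero          i = []
    constant (suc zero)    i = [-]
    constant (suc (suc l)) i = ℕₚ.≤-refl ∷ constant (suc l) i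
    rows : ∀ i λ′ → All (Linked _≤_) (superstandard i λ′)
    rows i []       = []
    rows i (l ∷ λ′) = constant l i ∷ rows (suc i) λ′
    above : ∀ {l l′} i → l′ ≤ l → Above (replicate l i) (replicate l′ (suc i))
    above i z≤n       = []
    above i (s≤s l≤) = ℕₚ.≤-refl ∷ above i l≤
    columns : ∀ i λ′ → Linked _≥_ λ′ → Linked Above (superstandard i λ′)
    columns i []            _        = []
    columns i (l ∷ [])      _        = [-]
    columns i (l ∷ l′ ∷ λ′) (l≥ ∷ k) = above i l≥ ∷ columns (suc i) (l′ ∷ λ′) k

  superstandard-content : ∀ λ′ → HasContent λ′ (superstandard 0 λ′)
  superstandard-content λ′ = trans (map-upTo (λ i → multiplicity i (concat (superstandard 0 λ′))) (length λ′)) (go 0 λ′)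
    where
    multiplicity-++ : ∀ k xs ys → multiplicity k (xs ++ ys) ≡ multiplicity k xs + multiplicity k ys
    multiplicity-++ k xs ys = trans (cong length (filter-++ (k ℕₚ.≟_) xs ys)) (length-++ (filter (k ℕₚ.≟_) xs))
    multiplicity-replicate : ∀ i l → multiplicity i (replicate l i) ≡ l
    multiplicity-replicate i l = trans (cong length (filter-all (i ℕₚ.≟_) (Allₚ.replicate⁺ l refl))) (length-replicate l)
    go : ∀ j λ′ → applyUpTo (λ i → multiplicity (j + i) (concat (superstandard j λ′))) (length λ′) ≡ λ′
    go j []       = refl
    go j (l ∷ λ′) = cong₂ _∷_ first (trans (applyUpTo-cong (length λ′) later) (go (suc j) λ′))
      where
      X : List ℕ
      X = concat (superstandard (suc j) λ′)
      first : multiplicity (j + 0) (replicate l j ++ X) ≡ l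
      first = begin
        multiplicity (j + 0) (replicate l j ++ X)  ≡⟨ cong (λ k → multiplicity k (replicate l j ++ X)) (ℕₚ.+-identityʳ j) ⟩
        multiplicity j (replicate l j ++ X)        ≡⟨ multiplicity-++ j (replicate l j) X ⟩
        multiplicity j (replicate l j) + multiplicity j X
          ≡⟨ cong₂ _+_ (multiplicity-replicate j l) (multiplicity-none (All.map ℕₚ.<⇒≢
               (rows-bounded (superstandard (suc j) λ′) (superstandard-rows (suc j) λ′) ℕₚ.≤-refl))) ⟩
        l + 0                                      ≡⟨ ℕₚ.+-identityʳ l ⟩
        l                                          ∎
        where open ≡.≡-Reasoning
      later : ∀ i → multiplicity (j + suc i) (replicate l j ++ X) ≡ multiplicity (suc j + i) X
      later i = trans (multiplicity-++ (j + suc i) (replicate l j) X) (trans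
        (cong (_+ multiplicity (j + suc i) X) (multiplicity-none (Allₚ.replicate⁺ l (ℕₚ.<⇒≢ (ℕₚ.m<m+n j (s≤s z≤n)) ∘ sym))))
        (cong (λ k → multiplicity k X) (ℕₚ.+-suc j i)))

  -- Partial sums of the content count small entries; this is the form in which they can be compared
  -- with row lengths.
  content-sums : ∀ {t T} → HasContent t T → ∀ k → k ≤ length t → sum (take k t) ≡ smaller k (concat T)
  content-sums {t} {T} e k k≤ = begin
    sum (take k t)                                       ≡⟨ cong (sum ∘ take k) e ⟨
    sum (take k (content (length t) T))                  ≡⟨ cong (sum ∘ take k) (map-upTo f (length t)) ⟩
    sum (take k (applyUpTo f (length t)))                ≡⟨ cong sum (take-applyUpTo f k≤) ⟩
    sum (applyUpTo f k)                                  ≡⟨ sum-multiplicities k (concat T) ⟩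
    smaller k (concat T)                                 ∎
    where
    open ≡.≡-Reasoning
    f : ℕ → ℕ
    f i = multiplicity i (concat T)

  -- In a tableau of content ν, the entries below k are as many as the k-th partial sum of ν and fit
  -- into the first k rows of λ′, so a tableau forces dominance.
  kostka-triangular : ∀ λ′ ν → ¬ (ν ⊴ λ′) → kostka (parts λ′) (parts ν) ≡ 0
  kostka-triangular λ′ ν ¬⊴ = cong length (filter-none (isSSYT? (parts ν))
      (All.map (λ {T} (sh , T<) (semi , cont) → ¬⊴ (dominated {T} sh T< semi cont)) (fillings-members N (parts λ′))))
    where
    N : ℕ
    N = length (parts ν)
    dominated : ∀ {T} → HasShape (parts λ′) T → All (_< N) (concat T) → IsSemistandard T → HasContent (parts ν) T → ν ⊴ λ′
    dominated {T} sh T< (_ , cols) cont = size≡ , λ k → case ℕₚ.≤-total k N of λ where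
        (inj₁ k≤N) → initial k k≤N
        (inj₂ N≤k) → ℕₚ.≤-trans (ℕₚ.≤-reflexive (cong sum (take-all k (parts ν) N≤k)))
          (ℕₚ.≤-trans (ℕₚ.≤-reflexive (sym (cong sum (take-all N (parts ν) ℕₚ.≤-refl))))
            (ℕₚ.≤-trans (initial N ℕₚ.≤-refl) (take-mono (parts λ′) N≤k)))
      where
      initial : ∀ k → k ≤ N → sum (take k (parts ν)) ≤ sum (take k (parts λ′))
      initial k k≤N = ℕₚ.≤-trans (ℕₚ.≤-reflexive (content-sums {parts ν} {T} cont k k≤N)) (smaller-take 0 k sh (semistandard-rows T cols))
      take-mono : ∀ t {k l} → k ≤ l → sum (take k t) ≤ sum (take l t)
      take-mono t       z≤n       = z≤n
      take-mono []      (s≤s _)   = z≤n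
      take-mono (x ∷ t) (s≤s k≤l) = ℕₚ.+-monoʳ-≤ x (take-mono t k≤l)
      shape-sum : ∀ {λ′ T} → HasShape λ′ T → length (concat T) ≡ sum λ′
      shape-sum []                    = refl
      shape-sum {T = r ∷ T} (e ∷ sh) = trans (length-++ r) (cong₂ _+_ e (shape-sum sh))
      size≡ : size ν ≡ size λ′
      size≡ = trans (cong sum (sym (take-all N (parts ν) ℕₚ.≤-refl)))
        (trans (content-sums {parts ν} {T} cont N ℕₚ.≤-refl) (trans (smaller-all T<) (shape-sum sh)))

  -- When content and shape agree, the bound of `smaller-take` is attained for every `m`, and only
  -- the superstandard tableau remains.
  kostka-diagonal : ∀ λ′ → kostka (parts λ′) (parts λ′) ≡ 1
  kostka-diagonal λ′ = length-filter-unique (isSSYT? (parts λ′)) (fillings-unique N (parts λ′))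
    (superstandard∈fillings 0 (parts λ′) ℕₚ.≤-refl)
    (superstandard-semistandard 0 (parts λ′) (decreasing λ′) , superstandard-content (parts λ′))
    (λ {T} T∈ ((_ , cols) , cont) → superstandard-unique 0 (proj₁ (All.lookup (fillings-members N (parts λ′)) T∈))
      (semistandard-rows T cols) λ m m≤ → sym (content-sums {parts λ′} {T} cont m m≤))
    where
    N : ℕ
    N = length (parts λ′)

open Combinatorics
open Rooks

module OverRing {c ℓ} (K : CommutativeRing c ℓ) where

  open CommutativeRing K hiding (zero)
  open import Algebra.Properties.AbelianGroup +-abelianGroup using (⁻¹-∙-comm; ⁻¹-involutive)
  open import Algebra.Properties.CommutativeMonoid.Sum +-commutativeMonoid using (sum-cong-≋)
  open import Algebra.Properties.CommutativeSemigroup +-commutativeSemigroup using (interchange)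
  open import Algebra.Properties.Ring ring using (-‿distribˡ-*; -‿distribʳ-*; -0#≈0#)
  open import Algebra.Properties.Semiring.Exp semiring using (_^_)
  open import Relation.Binary.Reasoning.Setoid setoid
  open SymmetricFunctions K

  -- Polynomial identities and sums over diagonals

  -- Equality in the ring need not be decidable, so the coefficients of normal forms are integers
  -- that are mapped into the ring.
  module IntegerSolver where

    open import Algebra.Solver.Ring.AlmostCommutativeRing
    open import Algebra.Properties.Semiring.Mult.TCOptimised semiring
      using (×-homo-+; ×1-homo-*) renaming (_×_ to _×′_)

    reduce : ℕ → ℕ → ℕ × ℕ
    reduce zero    b       = zero , b
    reduce (suc a) zero    = suc a , zero
    reduce (suc a) (suc b) = reduce a b

    -- The pair (a , b) stands for the integer a - b; reduced pairs make equality of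
    -- normal forms of polynomials syntactic.
    differences : RawRing _ _
    differences = record
      { Carrier = ℕ × ℕ
      ; _≈_     = _≡_
      ; _+_     = λ (a , b) (c , d) → reduce (a ℕ.+ c) (b ℕ.+ d)
      ; _*_     = λ (a , b) (c , d) → reduce (a ℕ.* c ℕ.+ b ℕ.* d) (a ℕ.* d ℕ.+ b ℕ.* c)
      ; -_      = λ (a , b) → b , a
      ; 0#      = 0 , 0
      ; 1#      = 1 , 0
      }

    -- The clause without subtraction makes the constants `one` and `nil` evaluate definitionally to
    -- `1#` and `0#`.
    ⟦_⟧ : ℕ × ℕ → Carrier
    ⟦ a , zero  ⟧ = a ×′ 1#
    ⟦ a , suc b ⟧ = a ×′ 1# - suc b ×′ 1#

    ⟦⟧-difference : ∀ a b → ⟦ a , b ⟧ ≈ a ×′ 1# - b ×′ 1#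
    ⟦⟧-difference a zero    = sym (trans (+-congˡ -0#≈0#) (+-identityʳ _))
    ⟦⟧-difference a (suc b) = refl

    ⟦reduce⟧ : ∀ a b → ⟦ reduce a b ⟧ ≈ a ×′ 1# - b ×′ 1#
    ⟦reduce⟧ zero    b       = ⟦⟧-difference zero b
    ⟦reduce⟧ (suc a) zero    = ⟦⟧-difference (suc a) zero
    ⟦reduce⟧ (suc a) (suc b) = begin
      ⟦ reduce a b ⟧                              ≈⟨ ⟦reduce⟧ a b ⟩
      a ×′ 1# - b ×′ 1#                           ≈⟨ +-identityˡ _ ⟨
      0# + (a ×′ 1# - b ×′ 1#)                    ≈⟨ +-congʳ (-‿inverseʳ 1#) ⟨
      (1# - 1#) + (a ×′ 1# - b ×′ 1#)             ≈⟨ interchange _ _ _ _ ⟩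
      (1# + a ×′ 1#) + (- 1# - b ×′ 1#)           ≈⟨ +-cong (×-homo-+ 1# 1 a) (trans (-‿cong (×-homo-+ 1# 1 b)) (sym (⁻¹-∙-comm _ _))) ⟨
      suc a ×′ 1# - suc b ×′ 1#                   ∎

    homomorphism : differences -Raw-AlmostCommutative⟶ fromCommutativeRing K
    homomorphism = record
      { ⟦_⟧    = ⟦_⟧
      ; +-homo = λ (a , b) (c , d) → begin
          ⟦ reduce (a ℕ.+ c) (b ℕ.+ d) ⟧                 ≈⟨ ⟦reduce⟧ (a ℕ.+ c) (b ℕ.+ d) ⟩
          (a ℕ.+ c) ×′ 1# - (b ℕ.+ d) ×′ 1#
            ≈⟨ +-cong (×-homo-+ 1# a c) (trans (-‿cong (×-homo-+ 1# b d)) (sym (⁻¹-∙-comm _ _))) ⟩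
          (a ×′ 1# + c ×′ 1#) + (- (b ×′ 1#) - d ×′ 1#)  ≈⟨ interchange _ _ _ _ ⟩
          (a ×′ 1# - b ×′ 1#) + (c ×′ 1# - d ×′ 1#)
            ≈⟨ +-cong (⟦⟧-difference a b) (⟦⟧-difference c d) ⟨
          ⟦ a , b ⟧ + ⟦ c , d ⟧                          ∎
      ; *-homo = λ (a , b) (c , d) → begin
          ⟦ reduce (a ℕ.* c ℕ.+ b ℕ.* d) (a ℕ.* d ℕ.+ b ℕ.* c) ⟧
            ≈⟨ ⟦reduce⟧ (a ℕ.* c ℕ.+ b ℕ.* d) (a ℕ.* d ℕ.+ b ℕ.* c) ⟩
          (a ℕ.* c ℕ.+ b ℕ.* d) ×′ 1# - (a ℕ.* d ℕ.+ b ℕ.* c) ×′ 1#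
            ≈⟨ +-cong (sum-of-products a c b d) (trans (-‿cong (sum-of-products a d b c)) (sym (⁻¹-∙-comm _ _))) ⟩
          (a ×′ 1# * c ×′ 1# + b ×′ 1# * d ×′ 1#) + (- (a ×′ 1# * d ×′ 1#) - b ×′ 1# * c ×′ 1#)
            ≈⟨ +-congˡ (+-comm _ _) ⟩
          (a ×′ 1# * c ×′ 1# + b ×′ 1# * d ×′ 1#) + (- (b ×′ 1# * c ×′ 1#) - a ×′ 1# * d ×′ 1#)
            ≈⟨ interchange _ _ _ _ ⟩
          (a ×′ 1# * c ×′ 1# - b ×′ 1# * c ×′ 1#) + (b ×′ 1# * d ×′ 1# - a ×′ 1# * d ×′ 1#)
            ≈⟨ +-cong (trans (+-congˡ (-‿distribˡ-* _ _)) (sym (distribʳ _ _ _))) (begin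
                 b ×′ 1# * d ×′ 1# - a ×′ 1# * d ×′ 1#         ≈⟨ +-comm _ _ ⟩
                 - (a ×′ 1# * d ×′ 1#) + b ×′ 1# * d ×′ 1#     ≈⟨ +-cong (-‿distribˡ-* _ _) (sym (*-congʳ (⁻¹-involutive _))) ⟩
                 - (a ×′ 1#) * d ×′ 1# + - - (b ×′ 1#) * d ×′ 1# ≈⟨ distribʳ _ _ _ ⟨
                 (- (a ×′ 1#) - - (b ×′ 1#)) * d ×′ 1#         ≈⟨ *-congʳ (⁻¹-∙-comm _ _) ⟩
                 - (a ×′ 1# - b ×′ 1#) * d ×′ 1#               ≈⟨ -‿distribˡ-* _ _ ⟨
                 - ((a ×′ 1# - b ×′ 1#) * d ×′ 1#)             ≈⟨ -‿distribʳ-* _ _ ⟩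
                 (a ×′ 1# - b ×′ 1#) * - (d ×′ 1#)             ∎) ⟩
          (a ×′ 1# - b ×′ 1#) * c ×′ 1# + (a ×′ 1# - b ×′ 1#) * - (d ×′ 1#)
            ≈⟨ distribˡ _ _ _ ⟨
          (a ×′ 1# - b ×′ 1#) * (c ×′ 1# - d ×′ 1#)
            ≈⟨ *-cong (⟦⟧-difference a b) (⟦⟧-difference c d) ⟨
          ⟦ a , b ⟧ * ⟦ c , d ⟧ ∎
      ; -‿homo = λ (a , b) → begin
          ⟦ b , a ⟧                  ≈⟨ ⟦⟧-difference b a ⟩
          b ×′ 1# - a ×′ 1#          ≈⟨ +-comm _ _ ⟩
          - (a ×′ 1#) + b ×′ 1#      ≈⟨ +-congˡ (⁻¹-involutive _) ⟨
          - (a ×′ 1#) - - (b ×′ 1#)  ≈⟨ ⁻¹-∙-comm _ _ ⟩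
          - (a ×′ 1# - b ×′ 1#)      ≈⟨ -‿cong (⟦⟧-difference a b) ⟨
          - ⟦ a , b ⟧                ∎
      ; 0-homo = refl
      ; 1-homo = refl
      }
      where
      sum-of-products : ∀ a c b d →
        (a ℕ.* c ℕ.+ b ℕ.* d) ×′ 1# ≈ a ×′ 1# * c ×′ 1# + b ×′ 1# * d ×′ 1#
      sum-of-products a c b d = trans (×-homo-+ 1# (a ℕ.* c) (b ℕ.* d))
        (+-cong (×1-homo-* a c) (×1-homo-* b d))

    equal? : ∀ p q → Maybe (⟦ p ⟧ ≈ ⟦ q ⟧)
    equal? (a , b) (c , d) with a ℕₚ.≟ c | b ℕₚ.≟ d
    ... | yes ≡.refl | yes ≡.refl = just refl
    ... | _ | _ = nothing

    open import Algebra.Solver.Ring differences (fromCommutativeRing K) homomorphism equal? public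
      using (solve; _:=_; _:+_; _:*_; _:-_; :-_; con; Polynomial)

    one : ∀ {n} → Polynomial n
    one = con (1 , 0)

    nil : ∀ {n} → Polynomial n
    nil = con (0 , 0)

  open IntegerSolver using (solve; _:=_; _:+_; _:*_; _:-_; :-_; one; nil)
  open import Algebra.Properties.Semiring.Mult semiring using (×-homo-+; ×1-homo-*)
  open import Algebra.Properties.Monoid.Sum +-monoid using (sum⁺-syntax)

  -- The sum over `a + b = n` with both indices visible, which keeps truncated subtraction out of
  -- the calculations; `∑-diagonal` relates it to the sums of the theorem.
  diagonal : (ℕ → ℕ → Carrier) → ℕ → Carrier
  diagonal F zero    = F 0 0
  diagonal F (suc n) = F 0 (suc n) + diagonal (F ∘ suc) n

  diagonal-cong : ∀ {F G} n → (∀ a b → a ℕ.+ b ≡ n → F a b ≈ G a b) → diagonal F n ≈ diagonal G n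
  diagonal-cong zero    e = e 0 0 ≡.refl
  diagonal-cong (suc n) e = +-cong (e 0 (suc n) ≡.refl)
    (diagonal-cong n λ a b a+b≡n → e (suc a) b (≡.cong suc a+b≡n))

  diagonal-+ : ∀ F G n → diagonal (λ a b → F a b + G a b) n ≈ diagonal F n + diagonal G n
  diagonal-+ F G zero    = refl
  diagonal-+ F G (suc n) = trans (+-congˡ (diagonal-+ (F ∘ suc) (G ∘ suc) n)) (interchange _ _ _ _)

  diagonal-* : ∀ x F n → diagonal (λ a b → x * F a b) n ≈ x * diagonal F n
  diagonal-* x F zero    = refl
  diagonal-* x F (suc n) = trans (+-congˡ (diagonal-* x (F ∘ suc) n)) (sym (distribˡ x _ _))

  diagonal-0 : ∀ n → diagonal (λ _ _ → 0#) n ≈ 0#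
  diagonal-0 zero    = refl
  diagonal-0 (suc n) = trans (+-identityˡ _) (diagonal-0 n)

  diagonal-last : ∀ F n → diagonal F (suc n) ≈ diagonal (λ a b → F a (suc b)) n + F (suc n) 0
  diagonal-last F zero    = refl
  diagonal-last F (suc n) = trans (+-congˡ (diagonal-last (F ∘ suc) n)) (sym (+-assoc _ _ _))

  diagonal-flip : ∀ F n → diagonal F n ≈ diagonal (λ a b → F b a) n
  diagonal-flip F zero    = refl
  diagonal-flip F (suc n) = begin
    F 0 (suc n) + diagonal (F ∘ suc) n                     ≈⟨ +-comm _ _ ⟩
    diagonal (F ∘ suc) n + F 0 (suc n)                     ≈⟨ +-congʳ (diagonal-flip (F ∘ suc) n) ⟩
    diagonal (λ a b → F (suc b) a) n + F 0 (suc n)         ≈⟨ diagonal-last (λ a b → F b a) n ⟨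
    diagonal (λ a b → F b a) (suc n)                       ∎

  -- Both sides run over the triples of sum `n`; only the grouping differs.
  diagonal-assoc : ∀ (T : ℕ → ℕ → ℕ → Carrier) n →
    diagonal (λ a m → diagonal (T a) m) n ≈ diagonal (λ m c → diagonal (λ a b → T a b c) m) n
  diagonal-assoc T zero    = refl
  diagonal-assoc T (suc n) = begin
    diagonal (T 0) (suc n) + diagonal (λ a m → diagonal (T (suc a)) m) n
      ≈⟨ +-congˡ (diagonal-assoc (T ∘ suc) n) ⟩
    (T 0 0 (suc n) + diagonal (T 0 ∘ suc) n) + diagonal (λ m c → diagonal (λ a b → T (suc a) b c) m) n
      ≈⟨ +-assoc _ _ _ ⟩
    T 0 0 (suc n) + (diagonal (T 0 ∘ suc) n + diagonal (λ m c → diagonal (λ a b → T (suc a) b c) m) n)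
      ≈⟨ +-congˡ (diagonal-+ (T 0 ∘ suc) _ n) ⟨
    T 0 0 (suc n) + diagonal (λ m c → T 0 (suc m) c + diagonal (λ a b → T (suc a) b c) m) n ∎

  ∑-diagonal : ∀ F n → ∑[ k ≤ n ] F (toℕ k) (n ∸ toℕ k) ≈ diagonal F n
  ∑-diagonal F zero    = +-identityʳ _
  ∑-diagonal F (suc n) = +-congˡ (∑-diagonal (F ∘ suc) n)

  ∑ᴸ : ∀ {a} {A : Set a} → (A → Carrier) → List A → Carrier
  ∑ᴸ f = foldr (λ x s → f x + s) 0#

  -- Factorial rook polynomials of Ferrers boards

  fromℕ-+ : ∀ m n → fromℕ (m ℕ.+ n) ≈ fromℕ m + fromℕ n
  fromℕ-+ = ×-homo-+ 1#

  fromℕ-* : ∀ m n → fromℕ (m ℕ.* n) ≈ fromℕ m * fromℕ n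
  fromℕ-* = ×1-homo-*

  fromℕ-cong : ∀ {m n} → m ≡ n → fromℕ m ≈ fromℕ n
  fromℕ-cong ≡.refl = refl

  ∑ᴸ-cong : ∀ {a} {A : Set a} {f g : A → Carrier} xs → (∀ x → f x ≈ g x) → ∑ᴸ f xs ≈ ∑ᴸ g xs
  ∑ᴸ-cong []       e = refl
  ∑ᴸ-cong (x ∷ xs) e = +-cong (e x) (∑ᴸ-cong xs e)

  ∑ᴸ-diagonal : ∀ {a} {A : Set a} (F : A → ℕ → ℕ → Carrier) xs n →
    ∑ᴸ (λ x → diagonal (F x) n) xs ≈ diagonal (λ a b → ∑ᴸ (λ x → F x a b) xs) n
  ∑ᴸ-diagonal F []       n = sym (diagonal-0 n)
  ∑ᴸ-diagonal F (x ∷ xs) n = trans (+-congˡ (∑ᴸ-diagonal F xs n)) (sym (diagonal-+ (F x) _ n))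

  ∑ᴸ-fromℕ : ∀ {a} {A : Set a} (f : A → ℕ) y xs → ∑ᴸ (λ x → fromℕ (f x) * y) xs ≈ fromℕ (sum (map f xs)) * y
  ∑ᴸ-fromℕ f y []       = sym (zeroˡ y)
  ∑ᴸ-fromℕ f y (x ∷ xs) = trans (+-congˡ (∑ᴸ-fromℕ f y xs))
    (trans (sym (distribʳ y _ _)) (*-congʳ (sym (fromℕ-+ (f x) _))))

  indicator : ∀ {p} {P : Set p} → Dec P → Carrier
  indicator d = if does d then 1# else 0#

  ∑-indicator : ∀ (φ : ℕ → Carrier) {h} n → h ≤ n →
    diagonal (λ k _ → indicator (h ℕₚ.≟ k) * φ k) n ≈ φ h
  ∑-indicator φ {zero}  zero    _         = *-identityˡ _
  ∑-indicator φ {zero}  (suc n) _         = trans (+-cong (*-identityˡ _) (trans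
    (diagonal-cong n λ k _ _ → zeroˡ (φ (suc k))) (diagonal-0 n))) (+-identityʳ _)
  ∑-indicator φ {suc h} (suc n) (s≤s h≤n) =
    trans (+-cong (zeroˡ _) (∑-indicator (φ ∘ suc) n h≤n)) (+-identityˡ _)

  -- Its use is to turn a sum over hit numbers into a sum over full placements, to which
  -- Vandermonde's identity applies term by term.
  ∑-fibres : ∀ {A : Set} (h : A → ℕ) (φ : ℕ → Carrier) n {xs} → All (λ x → h x ≤ n) xs →
    diagonal (λ k _ → fromℕ (length (filter (λ x → h x ℕₚ.≟ k) xs)) * φ k) n ≈ ∑ᴸ (φ ∘ h) xs
  ∑-fibres h φ n []                = trans (diagonal-cong n λ k _ _ → zeroˡ (φ k)) (diagonal-0 n)
  ∑-fibres h φ n {x ∷ xs} (h≤ ∷ hs) = begin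
    diagonal (λ k _ → fromℕ (length (filter (λ x → h x ℕₚ.≟ k) (x ∷ xs))) * φ k) n
      ≈⟨ diagonal-cong n (λ k _ _ → trans (*-congʳ (step k)) (distribʳ (φ k) _ _)) ⟩
    diagonal (λ k _ → indicator (h x ℕₚ.≟ k) * φ k + fromℕ (length (filter (λ x → h x ℕₚ.≟ k) xs)) * φ k) n
      ≈⟨ diagonal-+ _ _ n ⟩
    diagonal (λ k _ → indicator (h x ℕₚ.≟ k) * φ k) n +
    diagonal (λ k _ → fromℕ (length (filter (λ x → h x ℕₚ.≟ k) xs)) * φ k) n
      ≈⟨ +-cong (∑-indicator φ n h≤) (∑-fibres h φ n hs) ⟩
    φ (h x) + ∑ᴸ (φ ∘ h) xs ∎
    where
    step : ∀ k → fromℕ (length (filter (λ x → h x ℕₚ.≟ k) (x ∷ xs))) ≈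
           indicator (h x ℕₚ.≟ k) + fromℕ (length (filter (λ x → h x ℕₚ.≟ k) xs))
    step k with does (h x ℕₚ.≟ k)
    ... | true  = refl
    ... | false = sym (+-identityˡ _)

  filterᵇ-column : ∀ {n} (β : Board n) a rs →
    filterᵇ β (map (a ,_) rs) ≡ map (a ,_) (filterᵇ (λ j → β (a , j)) rs)
  filterᵇ-column β a []       = ≡.refl
  filterᵇ-column β a (r ∷ rs) with β (a , r)
  ... | true  = ≡.cong ((a , r) ∷_) (filterᵇ-column β a rs)
  ... | false = filterᵇ-column β a rs

  cartesianProduct-↭ : ∀ {A B : Set} {xs xs′ : List A} (ys : List B) → xs ↭ xs′ →
                       cartesianProduct xs ys ↭ cartesianProduct xs′ ys
  cartesianProduct-↭ ys Perm.refl        = Perm.refl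
  cartesianProduct-↭ ys (prep x p)       = ++⁺ˡ (map (x ,_) ys) (cartesianProduct-↭ ys p)
  cartesianProduct-↭ ys (swap x y p)     = ↭-trans (shifts (map (x ,_) ys) (map (y ,_) ys))
    (++⁺ˡ (map (y ,_) ys) (++⁺ˡ (map (x ,_) ys) (cartesianProduct-↭ ys p)))
  cartesianProduct-↭ ys (Perm.trans p q) = ↭-trans (cartesianProduct-↭ ys p) (cartesianProduct-↭ ys q)

  length-initial : ∀ {A : Set} {n} m (f : Fin n → A) (p : A → Bool) →
    (∀ i → p (f i) ≡ does (toℕ i ℕₚ.<? m)) → m ≤ n → length (filterᵇ p (tabulate f)) ≡ m
  length-initial {n = zero}  zero    f p e _         = ≡.refl
  length-initial {n = suc n} zero    f p e _         rewrite e zero =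
    length-initial zero (f ∘ suc) p (e ∘ suc) z≤n
  length-initial {n = suc n} (suc m) f p e (s≤s m≤n) rewrite e zero =
    ≡.cong suc (length-initial m (f ∘ suc) p (e ∘ suc) m≤n)

  rising : Carrier → ℕ → Carrier
  rising x zero    = 1#
  rising x (suc m) = (x + fromℕ m) * rising x m

  -- The function `ff` is specified by its recursion because `fallingFactorial` exists only over the
  -- rational functions, while the ring is arbitrary here.
  module FallingFactorials
    (ff : Carrier → ℕ → Carrier) (ff-zero : ∀ x → ff x 0 ≈ 1#)
    (ff-suc : ∀ x k → ff x (suc k) ≈ ff x k * (x - fromℕ k)) where

    ff-cong : ∀ {x y} k → x ≈ y → ff x k ≈ ff y k
    ff-cong zero    e = trans (ff-zero _) (sym (ff-zero _))
    ff-cong (suc k) e = trans (ff-suc _ k) (trans (*-cong (ff-cong k e) (+-congʳ e)) (sym (ff-suc _ k)))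

    ff-shift : ∀ x k → ff (x + 1#) (suc k) ≈ (x + 1#) * ff x k
    ff-shift x zero = begin
      ff (x + 1#) 1                ≈⟨ ff-suc (x + 1#) 0 ⟩
      ff (x + 1#) 0 * (x + 1# - 0#)  ≈⟨ *-congʳ (ff-zero _) ⟩
      1# * (x + 1# - 0#)           ≈⟨ solve 1 (λ x → one :* (x :+ one :- nil) := (x :+ one) :* one) refl x ⟩
      (x + 1#) * 1#                ≈⟨ *-congˡ (ff-zero x) ⟨
      (x + 1#) * ff x 0            ∎
    ff-shift x (suc k) = begin
      ff (x + 1#) (suc (suc k))                          ≈⟨ ff-suc (x + 1#) (suc k) ⟩
      ff (x + 1#) (suc k) * (x + 1# - (1# + fromℕ k))    ≈⟨ *-congʳ (ff-shift x k) ⟩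
      (x + 1#) * ff x k * (x + 1# - (1# + fromℕ k))
        ≈⟨ solve 3 (λ x f k → (x :+ one) :* f :* (x :+ one :- (one :+ k)) := (x :+ one) :* (f :* (x :- k))) refl x (ff x k) (fromℕ k) ⟩
      (x + 1#) * (ff x k * (x - fromℕ k))                ≈⟨ *-congˡ (ff-suc x k) ⟨
      (x + 1#) * ff x (suc k)                            ∎

    ff-rising : ∀ x m → ff (x + fromℕ m) (suc m) ≈ rising x (suc m)
    ff-rising x zero = begin
      ff (x + 0#) 1               ≈⟨ ff-suc (x + 0#) 0 ⟩
      ff (x + 0#) 0 * (x + 0# - 0#)  ≈⟨ *-congʳ (ff-zero _) ⟩
      1# * (x + 0# - 0#)          ≈⟨ solve 1 (λ x → one :* (x :+ nil :- nil) := (x :+ nil) :* one) refl x ⟩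
      (x + 0#) * 1#               ∎
    ff-rising x (suc m) = begin
      ff (x + (1# + fromℕ m)) (suc (suc m))         ≈⟨ ff-cong (suc (suc m)) (reassociate x (fromℕ m)) ⟩
      ff (x + fromℕ m + 1#) (suc (suc m))           ≈⟨ ff-shift (x + fromℕ m) (suc m) ⟩
      (x + fromℕ m + 1#) * ff (x + fromℕ m) (suc m) ≈⟨ *-cong (sym (reassociate x (fromℕ m))) (ff-rising x m) ⟩
      (x + (1# + fromℕ m)) * rising x (suc m)       ∎
      where
      reassociate : ∀ x m → x + (1# + m) ≈ x + m + 1#
      reassociate = solve 2 (λ x m → x :+ (one :+ m) := x :+ m :+ one) refl

    module _ {n : ℕ} (height : ℕ → ℕ) (height≤ : ∀ (a : Fin n) → height (suc (toℕ a)) ≤ n) (x : Carrier) where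

      private
        β : Board n
        β = ferrers n height

      rows : Fin n → List (Fin n)
      rows a = filterᵇ (λ j → β (a , j)) (allFin n)

      columnCells : List (Fin n) → List (Cell n)
      columnCells L = filterᵇ β (cartesianProduct L (allFin n))

      -- Columns are listed from the tallest on, so that every row met by the later columns is also
      -- a row of the first one.
      Tower : List (Fin n) → Set
      Tower = AllPairs (λ a b → a ≢ b × height (suc (toℕ b)) ≤ height (suc (toℕ a)))

      heightProduct : List (Fin n) → Carrier
      heightProduct []      = 1#
      heightProduct (a ∷ L) = heightProduct L * (x + fromℕ (height (suc (toℕ a))) - fromℕ (length L))

      columnCells-∷ : ∀ a L → columnCells (a ∷ L) ≡ map (a ,_) (rows a) ++ columnCells L
      columnCells-∷ a L = ≡.trans
        (filter-++ (λ y → T? (β y)) (map (a ,_) (allFin n)) (cartesianProduct L (allFin n)))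
        (≡.cong (_++ columnCells L) (filterᵇ-column β a (allFin n)))

      columnCells-∈ : ∀ L → All (λ y → proj₁ y ∈ L × toℕ (proj₂ y) < height (suc (toℕ (proj₁ y)))) (columnCells L)
      columnCells-∈ L = All.zipWith (λ {y} (y∈ , βy) → y∈ , ℕₚ.<ᵇ⇒< (toℕ (proj₂ y)) _ βy)
        (Allₚ.filter⁺ (λ y → T? (β y)) (columns L) , Allₚ.all-filter (λ y → T? (β y)) (cartesianProduct L (allFin n)))
        where
        columns : ∀ L → All (λ y → proj₁ y ∈ L) (cartesianProduct L (allFin n))
        columns []      = []
        columns (a ∷ L) = Allₚ.++⁺ (Allₚ.map⁺ (All.universal (λ _ → here ≡.refl) (allFin n))) (All.map there (columns L))

      -- Of the rows of the tallest column, `k` are occupied by rooks placed in the other columns,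
      -- so the last rook has `height - k` positions. The subtraction is moved to the other side.
      count-columns : ∀ k a L → Tower (a ∷ L) →
        count (suc k) (columnCells (a ∷ L)) ℕ.+ k ℕ.* count k (columnCells L) ≡
        count (suc k) (columnCells L) ℕ.+ height (suc (toℕ a)) ℕ.* count k (columnCells L)
      count-columns k a L (above ∷ _) = ≡R.begin
        count (suc k) (columnCells (a ∷ L)) ℕ.+ k ℕ.* count k (columnCells L)
          ≡R.≡⟨ ≡.cong (λ l → count (suc k) l ℕ.+ k ℕ.* count k (columnCells L)) (columnCells-∷ a L) ⟩
        count (suc k) (map (a ,_) (rows a) ++ columnCells L) ℕ.+ k ℕ.* count k (columnCells L)
          ≡R.≡⟨ ≡.cong (ℕ._+ k ℕ.* count k (columnCells L)) (≡.trans
                 (count-column k (map (a ,_) (rows a)) (columnCells L) (column-attacks a (rows a)))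
                 (≡.cong (λ l → sum l ℕ.+ count (suc k) (columnCells L)) (≡.sym (map-∘ (rows a))))) ⟩
        S ℕ.+ count (suc k) (columnCells L) ℕ.+ k ℕ.* count k (columnCells L)
          ≡R.≡⟨ regroup S (count (suc k) (columnCells L)) (k ℕ.* count k (columnCells L)) ⟩
        count (suc k) (columnCells L) ℕ.+ (S ℕ.+ k ℕ.* count k (columnCells L))
          ≡R.≡⟨ ≡.cong (count (suc k) (columnCells L) ℕ.+_) (≡.trans
                 (sum-free-rows a (rows a) (Uniqueₚ.filter⁺ (λ j → T? (β (a , j))) (Uniqueₚ.allFin⁺ n)) k (columnCells L)
                   (All.map (λ {y} (y∈ , y<) → proj₁ (All.lookup above y∈) ,
                      ∈-filter⁺ (λ j → T? (β (a , j))) (∈-allFin (proj₂ y))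
                        (ℕₚ.<⇒<ᵇ (ℕₚ.<-≤-trans y< (proj₂ (All.lookup above y∈)))))
                      (columnCells-∈ L)))
                 (≡.cong (ℕ._* count k (columnCells L))
                   (length-initial (height (suc (toℕ a))) id (λ j → β (a , j)) (λ _ → ≡.refl) (height≤ a)))) ⟩
        count (suc k) (columnCells L) ℕ.+ height (suc (toℕ a)) ℕ.* count k (columnCells L) ≡R.∎
        where
        module ≡R = ≡.≡-Reasoning
        S : ℕ
        S = sum (map (λ r → count k (filter (nonAttacking? (a , r)) (columnCells L))) (rows a))
        regroup : ∀ s m k → s ℕ.+ m ℕ.+ k ≡ m ℕ.+ (s ℕ.+ k)
        regroup s m k = ≡.trans (≡.cong (ℕ._+ k) (ℕₚ.+-comm s m)) (ℕₚ.+-assoc m s k)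

      -- The theorem of Goldman, Joichi and White, by adding the columns in order of increasing
      -- height.
      factorization : ∀ L → Tower L →
        diagonal (λ k i → fromℕ (count k (columnCells L)) * ff x i) (length L) ≈ heightProduct L
      factorization []      _ = trans (*-cong (+-identityʳ 1#) (ff-zero x)) (*-identityˡ 1#)
      factorization (a ∷ L) t@(_ ∷ tL) = begin
        fromℕ 1 * ff x (suc m) + diagonal (λ k i → fromℕ (N′ (suc k)) * ff x i) m
          ≈⟨ +-congˡ (diagonal-cong m λ k i _ → peel k (ff x i)) ⟩
        fromℕ 1 * ff x (suc m) + diagonal (λ k i → fromℕ (N (suc k)) * ff x i + (H - fromℕ k) * (fromℕ (N k) * ff x i)) m
          ≈⟨ +-congˡ (diagonal-+ _ _ m) ⟩
        fromℕ 1 * ff x (suc m) + (diagonal (λ k i → fromℕ (N (suc k)) * ff x i) m +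
          diagonal (λ k i → (H - fromℕ k) * (fromℕ (N k) * ff x i)) m)
          ≈⟨ +-assoc _ _ _ ⟨
        diagonal (λ k i → fromℕ (N k) * ff x i) (suc m) + diagonal (λ k i → (H - fromℕ k) * (fromℕ (N k) * ff x i)) m
          ≈⟨ +-congʳ (diagonal-last (λ k i → fromℕ (N k) * ff x i) m) ⟩
        (diagonal (λ k i → fromℕ (N k) * ff x (suc i)) m + fromℕ (N (suc m)) * ff x 0) +
          diagonal (λ k i → (H - fromℕ k) * (fromℕ (N k) * ff x i)) m
          ≈⟨ +-congʳ (trans (+-congˡ (trans (*-congʳ (fromℕ-cong few)) (zeroˡ _))) (+-identityʳ _)) ⟩
        diagonal (λ k i → fromℕ (N k) * ff x (suc i)) m + diagonal (λ k i → (H - fromℕ k) * (fromℕ (N k) * ff x i)) m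
          ≈⟨ diagonal-+ _ _ m ⟨
        diagonal (λ k i → fromℕ (N k) * ff x (suc i) + (H - fromℕ k) * (fromℕ (N k) * ff x i)) m
          ≈⟨ diagonal-cong m combine ⟩
        diagonal (λ k i → (x + H - fromℕ m) * (fromℕ (N k) * ff x i)) m
          ≈⟨ diagonal-* _ _ m ⟩
        (x + H - fromℕ m) * diagonal (λ k i → fromℕ (N k) * ff x i) m
          ≈⟨ trans (*-comm _ _) (*-congʳ (factorization L tL)) ⟩
        heightProduct L * (x + H - fromℕ m) ∎
        where
        m : ℕ
        m = length L
        N N′ : ℕ → ℕ
        N k = count k (columnCells L)
        N′ k = count k (columnCells (a ∷ L))
        H : Carrier
        H = fromℕ (height (suc (toℕ a)))
        -- The boundary term of the change of index: `suc m` rooks do not fit into `m` columns.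
        few : N (suc m) ≡ 0
        few = count-few-columns (suc m) L (columnCells L) (All.map proj₁ (columnCells-∈ L)) ℕₚ.≤-refl
        peel : ∀ k y → fromℕ (N′ (suc k)) * y ≈ fromℕ (N (suc k)) * y + (H - fromℕ k) * (fromℕ (N k) * y)
        peel k y = begin
          fromℕ (N′ (suc k)) * y
            ≈⟨ solve 4 (λ n k m y → n :* y := (n :+ k :* m) :* y :- k :* m :* y) refl _ (fromℕ k) (fromℕ (N k)) y ⟩
          (fromℕ (N′ (suc k)) + fromℕ k * fromℕ (N k)) * y - fromℕ k * fromℕ (N k) * y
            ≈⟨ +-congʳ (*-congʳ recurrence) ⟩
          (fromℕ (N (suc k)) + H * fromℕ (N k)) * y - fromℕ k * fromℕ (N k) * y
            ≈⟨ solve 5 (λ n h k m y → (n :+ h :* m) :* y :- k :* m :* y := n :* y :+ (h :- k) :* (m :* y)) refl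
                 (fromℕ (N (suc k))) H (fromℕ k) (fromℕ (N k)) y ⟩
          fromℕ (N (suc k)) * y + (H - fromℕ k) * (fromℕ (N k) * y) ∎
          where
          recurrence : fromℕ (N′ (suc k)) + fromℕ k * fromℕ (N k) ≈ fromℕ (N (suc k)) + H * fromℕ (N k)
          recurrence = begin
            fromℕ (N′ (suc k)) + fromℕ k * fromℕ (N k)   ≈⟨ +-congˡ (fromℕ-* k (N k)) ⟨
            fromℕ (N′ (suc k)) + fromℕ (k ℕ.* N k)       ≈⟨ fromℕ-+ (N′ (suc k)) _ ⟨
            fromℕ (N′ (suc k) ℕ.+ k ℕ.* N k)             ≈⟨ fromℕ-cong (count-columns k a L t) ⟩
            fromℕ (N (suc k) ℕ.+ height (suc (toℕ a)) ℕ.* N k)  ≈⟨ fromℕ-+ (N (suc k)) _ ⟩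
            fromℕ (N (suc k)) + fromℕ (height (suc (toℕ a)) ℕ.* N k)  ≈⟨ +-congˡ (fromℕ-* (height (suc (toℕ a))) (N k)) ⟩
            fromℕ (N (suc k)) + H * fromℕ (N k)          ∎
        -- The factor is `(x - i) + (H - k)`, which on the diagonal `k + i = m` no longer depends on
        -- `k`; hence it can be taken out of the sum.
        combine : ∀ k i → k ℕ.+ i ≡ m → fromℕ (N k) * ff x (suc i) + (H - fromℕ k) * (fromℕ (N k) * ff x i) ≈
                  (x + H - fromℕ m) * (fromℕ (N k) * ff x i)
        combine k i k+i≡m = begin
          fromℕ (N k) * ff x (suc i) + (H - fromℕ k) * (fromℕ (N k) * ff x i)
            ≈⟨ +-congʳ (*-congˡ (ff-suc x i)) ⟩
          fromℕ (N k) * (ff x i * (x - fromℕ i)) + (H - fromℕ k) * (fromℕ (N k) * ff x i)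
            ≈⟨ solve 6 (λ n f x i h k → n :* (f :* (x :- i)) :+ (h :- k) :* (n :* f) := (x :+ h :- (k :+ i)) :* (n :* f)) refl
                 (fromℕ (N k)) (ff x i) x (fromℕ i) H (fromℕ k) ⟩
          (x + H - (fromℕ k + fromℕ i)) * (fromℕ (N k) * ff x i)
            ≈⟨ *-congʳ (+-congˡ (-‿cong (trans (sym (fromℕ-+ k i)) (fromℕ-cong k+i≡m)))) ⟩
          (x + H - fromℕ m) * (fromℕ (N k) * ff x i) ∎

      staircaseProduct : ℕ → Carrier
      staircaseProduct zero    = 1#
      staircaseProduct (suc i) = staircaseProduct i * (x + fromℕ (height (suc i)) - fromℕ i)

      -- From column q on, the i-th column from the left (i counted from 0) has height i,
      -- so that it contributes x + i - i.
      staircase-stairs : ∀ q {h} → (∀ i → suc i ≤ q → height (suc i) ≡ h) →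
        (∀ t → height (suc (q ℕ.+ t)) ≡ q ℕ.+ t) →
        ∀ t → staircaseProduct (q ℕ.+ t) ≈ ff (x + fromℕ h) q * x ^ t
      staircase-stairs q {h} low high zero rewrite ℕₚ.+-identityʳ q = trans (flat q ℕₚ.≤-refl) (sym (*-identityʳ _))
        where
        flat : ∀ i → i ≤ q → staircaseProduct i ≈ ff (x + fromℕ h) i
        flat zero    _   = sym (ff-zero _)
        flat (suc i) i<q = trans (*-cong (flat i (ℕₚ.<⇒≤ i<q)) (+-congʳ (+-congˡ (fromℕ-cong (low i i<q)))))
          (sym (ff-suc _ i))
      staircase-stairs q {h} low high (suc t) rewrite ℕₚ.+-suc q t = begin
        staircaseProduct (q ℕ.+ t) * (x + fromℕ (height (suc (q ℕ.+ t))) - fromℕ (q ℕ.+ t))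
          ≈⟨ *-cong (staircase-stairs q low high t) (+-congʳ (+-congˡ (fromℕ-cong (high t)))) ⟩
        ff (x + fromℕ h) q * x ^ t * (x + fromℕ (q ℕ.+ t) - fromℕ (q ℕ.+ t))
          ≈⟨ solve 4 (λ f y x k → f :* y :* (x :+ k :- k) := f :* (x :* y)) refl (ff (x + fromℕ h) q) (x ^ t) x (fromℕ (q ℕ.+ t)) ⟩
        ff (x + fromℕ h) q * (x * x ^ t) ∎

      heightProduct-downFrom : ∀ i L → map toℕ L ≡ downFrom i → heightProduct L ≈ staircaseProduct i
      heightProduct-downFrom zero    []      _ = refl
      heightProduct-downFrom (suc i) (a ∷ L) e = *-cong
        (heightProduct-downFrom i L (∷-injectiveʳ e))
        (+-cong (+-congˡ (fromℕ-cong (≡.cong (height ∘ suc) (∷-injectiveˡ e))))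
          (-‿cong (fromℕ-cong (≡.trans (≡.sym (length-map toℕ L))
            (≡.trans (≡.cong length (∷-injectiveʳ e)) (length-downFrom i))))))

      toℕ-reverse-allFin : map toℕ (reverse (allFin n)) ≡ downFrom n
      toℕ-reverse-allFin = ≡.trans (reverse-map toℕ (allFin n))
        (≡.trans (≡.cong reverse (≡.trans (map-tabulate id toℕ) (tabulate-toℕ n))) (reverse-upTo n))
        where
        tabulate-toℕ : ∀ n → tabulate {n = n} toℕ ≡ upTo n
        tabulate-toℕ n = go n id
          where
          go : ∀ n (f : ℕ → ℕ) → tabulate {n = n} (f ∘ toℕ) ≡ applyUpTo f n
          go zero    f = ≡.refl
          go (suc n) f = ≡.cong (f 0 ∷_) (go n (f ∘ suc))

      -- The columns are reversed to satisfy `Tower`. The factor of a column subtracts the number of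
      -- columns to its left.
      rookSum-staircase : (∀ {i j} → i ≤ j → height i ≤ height j) →
        diagonal (λ k i → fromℕ (rookNumber k β) * ff x i) n ≈ staircaseProduct n
      rookSum-staircase monotone = begin
        diagonal (λ k i → fromℕ (rookNumber k β) * ff x i) n
          ≈⟨ diagonal-cong n (λ k i _ → *-congʳ (fromℕ-cong (≡.trans (rookNumber-count k β)
               (count-↭ k (filter-↭ (λ y → T? (β y)) (cartesianProduct-↭ (allFin n) (↭-sym (↭-reverse (allFin n))))))))) ⟩
        diagonal (λ k i → fromℕ (count k (columnCells (reverse (allFin n)))) * ff x i) n
          ≡⟨ ≡.cong (diagonal _) (≡.sym (≡.trans (length-reverse (allFin n)) (length-tabulate {n = n} id))) ⟩
        diagonal (λ k i → fromℕ (count k (columnCells (reverse (allFin n)))) * ff x i) (length (reverse (allFin n)))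
          ≈⟨ factorization (reverse (allFin n)) (tower n (reverse (allFin n)) toℕ-reverse-allFin) ⟩
        heightProduct (reverse (allFin n))
          ≈⟨ heightProduct-downFrom n (reverse (allFin n)) toℕ-reverse-allFin ⟩
        staircaseProduct n ∎
        where
        below : ∀ i L → map toℕ L ≡ downFrom i → All (λ b → toℕ b < i) L
        below zero    []      _ = []
        below (suc i) (b ∷ L) e = s≤s (ℕₚ.≤-reflexive (∷-injectiveˡ e)) ∷
          All.map ℕₚ.m<n⇒m<1+n (below i L (∷-injectiveʳ e))
        tower : ∀ i L → map toℕ L ≡ downFrom i → Tower L
        tower zero    []      _ = []
        tower (suc i) (a ∷ L) e = All.map (λ b<i → (λ { ≡.refl → ℕₚ.<-irrefl (∷-injectiveˡ e) b<i }) ,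
            monotone (s≤s (ℕₚ.≤-trans (ℕₚ.<⇒≤ b<i) (ℕₚ.≤-reflexive (≡.sym (∷-injectiveˡ e))))))
          (below i L (∷-injectiveʳ e)) ∷ tower i L (∷-injectiveʳ e)

    -- Hit numbers and Vandermonde's identity

    module Binomials (inv! : ℕ → Carrier) (inv!-inverse : ∀ k → inv! k * fromℕ (k !) ≈ 1#) where

      choiceOf : Carrier → ℕ → Carrier
      choiceOf x k = ff x k * inv! k

      inv!-suc : ∀ k → inv! (suc k) * fromℕ (suc k) ≈ inv! k
      inv!-suc k = begin
        inv! (suc k) * fromℕ (suc k)                              ≈⟨ *-identityʳ _ ⟨
        inv! (suc k) * fromℕ (suc k) * 1#                         ≈⟨ *-congˡ (inv!-inverse k) ⟨
        inv! (suc k) * fromℕ (suc k) * (inv! k * fromℕ (k !))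
          ≈⟨ solve 4 (λ a b c d → a :* b :* (c :* d) := c :* (a :* (b :* d))) refl _ _ _ _ ⟩
        inv! k * (inv! (suc k) * (fromℕ (suc k) * fromℕ (k !)))   ≈⟨ *-congˡ (*-congˡ (fromℕ-* (suc k) (k !))) ⟨
        inv! k * (inv! (suc k) * fromℕ (suc k !))                 ≈⟨ *-congˡ (inv!-inverse (suc k)) ⟩
        inv! k * 1#                                               ≈⟨ *-identityʳ _ ⟩
        inv! k                                                    ∎

      pascal : ∀ x k → choiceOf (x + 1#) (suc k) ≈ choiceOf x (suc k) + choiceOf x k
      pascal x k = begin
        ff (x + 1#) (suc k) * inv! (suc k)                ≈⟨ *-congʳ (ff-shift x k) ⟩
        (x + 1#) * ff x k * inv! (suc k)
          ≈⟨ solve 4 (λ x f v k → (x :+ one) :* f :* v := f :* (x :- k) :* v :+ f :* (v :* (one :+ k))) refl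
               x (ff x k) (inv! (suc k)) (fromℕ k) ⟩
        ff x k * (x - fromℕ k) * inv! (suc k) + ff x k * (inv! (suc k) * fromℕ (suc k))
          ≈⟨ +-cong (*-congʳ (sym (ff-suc x k))) (*-congˡ (inv!-suc k)) ⟩
        ff x (suc k) * inv! (suc k) + ff x k * inv! k     ∎

      -- Induction on `k`: `pascal` in the upper argument matches the recursion of `choose`.
      vandermonde : ∀ x k n → choiceOf (x + fromℕ k) n ≈ diagonal (λ j i → fromℕ (choose k j) * choiceOf x i) n
      vandermonde x k       zero    = trans (*-congʳ (trans (ff-zero _) (sym (ff-zero _))))
        (trans (sym (*-identityˡ _)) (*-congʳ (sym (+-identityʳ 1#))))
      vandermonde x zero    (suc n) = sym (begin
        fromℕ 1 * choiceOf x (suc n) + diagonal (λ j i → 0# * choiceOf x i) n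
          ≈⟨ +-cong (*-congʳ (+-identityʳ 1#)) (trans (diagonal-cong n λ j i _ → zeroˡ _) (diagonal-0 n)) ⟩
        1# * choiceOf x (suc n) + 0#
          ≈⟨ trans (+-identityʳ _) (*-identityˡ _) ⟩
        choiceOf x (suc n)
          ≈⟨ *-congʳ (ff-cong (suc n) (sym (+-identityʳ x))) ⟩
        choiceOf (x + 0#) (suc n) ∎)
      vandermonde x (suc k) (suc n) = begin
        choiceOf (x + (1# + fromℕ k)) (suc n)
          ≈⟨ *-congʳ (ff-cong (suc n) (solve 2 (λ x k → x :+ (one :+ k) := x :+ k :+ one) refl x (fromℕ k))) ⟩
        choiceOf (x + fromℕ k + 1#) (suc n)
          ≈⟨ pascal (x + fromℕ k) n ⟩
        choiceOf (x + fromℕ k) (suc n) + choiceOf (x + fromℕ k) n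
          ≈⟨ +-cong (vandermonde x k (suc n)) (vandermonde x k n) ⟩
        (fromℕ 1 * choiceOf x (suc n) + diagonal (λ j i → fromℕ (choose k (suc j)) * choiceOf x i) n) +
          diagonal (λ j i → fromℕ (choose k j) * choiceOf x i) n
          ≈⟨ trans (+-assoc _ _ _) (+-congˡ (trans (+-comm _ _) (sym (diagonal-+ _ _ n)))) ⟩
        fromℕ 1 * choiceOf x (suc n) +
          diagonal (λ j i → fromℕ (choose k j) * choiceOf x i + fromℕ (choose k (suc j)) * choiceOf x i) n
          ≈⟨ +-congˡ (diagonal-cong n λ j i _ → trans (sym (distribʳ _ _ _)) (*-congʳ (sym (fromℕ-+ (choose k j) _)))) ⟩
        fromℕ 1 * choiceOf x (suc n) + diagonal (λ j i → fromℕ (choose (suc k) (suc j)) * choiceOf x i) n ∎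

      -- Each full placement contributes a binomial coefficient in `x` plus its number of hits.
      -- Vandermonde's identity expands it, and the sums of `choose (hits P) j` are rook numbers
      -- times factorials.
      hits≈rooks : ∀ {n} (β : Board n) x →
        diagonal (λ k _ → fromℕ (hitNumber k β) * choiceOf (x + fromℕ k) n) n ≈
        diagonal (λ j i → fromℕ (rookNumber j β) * (choiceOf x i * fromℕ (i !))) n
      hits≈rooks {n} β x = begin
        diagonal (λ k _ → fromℕ (hitNumber k β) * choiceOf (x + fromℕ k) n) n
          ≈⟨ ∑-fibres (hits β) (λ k → choiceOf (x + fromℕ k) n) n
               (All.map (λ {P} |P| → ℕₚ.≤-trans (length-filter (λ y → T? (β y)) P) (ℕₚ.≤-reflexive |P|))
                 (placementsIn-length n (cells n))) ⟩
        ∑ᴸ (λ P → choiceOf (x + fromℕ (hits β P)) n) (placements n (cells n))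
          ≈⟨ ∑ᴸ-cong (placements n (cells n)) (λ P → vandermonde x (hits β P) n) ⟩
        ∑ᴸ (λ P → diagonal (λ j i → fromℕ (choose (hits β P) j) * choiceOf x i) n) (placements n (cells n))
          ≈⟨ ∑ᴸ-diagonal _ (placements n (cells n)) n ⟩
        diagonal (λ j i → ∑ᴸ (λ P → fromℕ (choose (hits β P) j) * choiceOf x i) (placements n (cells n))) n
          ≈⟨ diagonal-cong n (λ j i j+i≡n → begin
               ∑ᴸ (λ P → fromℕ (choose (hits β P) j) * choiceOf x i) (placements n (cells n))
                 ≈⟨ ∑ᴸ-fromℕ (λ P → choose (hits β P) j) (choiceOf x i) (placements n (cells n)) ⟩
               fromℕ (binomialHits β n j (cells n)) * choiceOf x i
                 ≈⟨ *-congʳ (fromℕ-cong (binomialHits-rookNumber β i j (≡.trans (ℕₚ.+-comm i j) j+i≡n))) ⟩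
               fromℕ (rookNumber j β ℕ.* i !) * choiceOf x i
                 ≈⟨ *-congʳ (fromℕ-* (rookNumber j β) (i !)) ⟩
               fromℕ (rookNumber j β) * fromℕ (i !) * choiceOf x i
                 ≈⟨ trans (*-assoc _ _ _) (*-congˡ (*-comm _ _)) ⟩
               fromℕ (rookNumber j β) * (choiceOf x i * fromℕ (i !)) ∎) ⟩
        diagonal (λ j i → fromℕ (rookNumber j β) * (choiceOf x i * fromℕ (i !))) n ∎

      choiceOf-! : ∀ x i → choiceOf x i * fromℕ (i !) ≈ ff x i
      choiceOf-! x i = trans (*-assoc _ _ _) (trans (*-congˡ (inv!-inverse i)) (*-identityʳ _))

      private
        combination : ∀ u v (f g : ℕ → ℕ) (y : ℕ → Carrier) n →
          ∑[ k ≤ n ] (fromℕ (u ℕ.* f (toℕ k) ℕ.+ v ℕ.* g (toℕ k)) * y (toℕ k)) ≈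
          fromℕ u * ∑[ k ≤ n ] (fromℕ (f (toℕ k)) * y (toℕ k)) + fromℕ v * ∑[ k ≤ n ] (fromℕ (g (toℕ k)) * y (toℕ k))
        combination u v f g y n = begin
          ∑[ k ≤ n ] (fromℕ (u ℕ.* f (toℕ k) ℕ.+ v ℕ.* g (toℕ k)) * y (toℕ k))
            ≈⟨ ∑-diagonal (λ k _ → fromℕ (u ℕ.* f k ℕ.+ v ℕ.* g k) * y k) n ⟩
          diagonal (λ k _ → fromℕ (u ℕ.* f k ℕ.+ v ℕ.* g k) * y k) n
            ≈⟨ diagonal-cong n (λ k _ _ → trans (*-congʳ (trans (fromℕ-+ (u ℕ.* f k) (v ℕ.* g k))
                 (+-cong (fromℕ-* u (f k)) (fromℕ-* v (g k)))))
                 (solve 5 (λ u f v g y → (u :* f :+ v :* g) :* y := u :* (f :* y) :+ v :* (g :* y)) refl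
                   (fromℕ u) (fromℕ (f k)) (fromℕ v) (fromℕ (g k)) (y k))) ⟩
          diagonal (λ k _ → fromℕ u * (fromℕ (f k) * y k) + fromℕ v * (fromℕ (g k) * y k)) n
            ≈⟨ trans (diagonal-+ _ _ n) (+-cong (diagonal-* _ _ n) (diagonal-* _ _ n)) ⟩
          fromℕ u * diagonal (λ k _ → fromℕ (f k) * y k) n + fromℕ v * diagonal (λ k _ → fromℕ (g k) * y k) n
            ≈⟨ +-cong (*-congˡ (∑-diagonal (λ k _ → fromℕ (f k) * y k) n)) (*-congˡ (∑-diagonal (λ k _ → fromℕ (g k) * y k) n)) ⟨
          fromℕ u * ∑[ k ≤ n ] (fromℕ (f (toℕ k)) * y (toℕ k)) + fromℕ v * ∑[ k ≤ n ] (fromℕ (g (toℕ k)) * y (toℕ k)) ∎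

        hits∑ : ∀ {n} (β : Board n) x → ∑[ k ≤ n ] (fromℕ (hitNumber (toℕ k) β) * choiceOf (x + fromℕ (toℕ k)) n) ≈
          diagonal (λ j i → fromℕ (rookNumber j β) * ff x i) n
        hits∑ {n} β x = trans (∑-diagonal (λ k _ → fromℕ (hitNumber k β) * choiceOf (x + fromℕ k) n) n)
          (trans (hits≈rooks β x) (diagonal-cong n λ j i _ → *-congˡ (choiceOf-! x i)))

        rooks∑ : ∀ {n} (β : Board n) x → ∑[ k ≤ n ] (fromℕ (rookNumber (n ∸ toℕ k) β) * (choiceOf x (toℕ k) * fromℕ (toℕ k !))) ≈
          diagonal (λ j i → fromℕ (rookNumber j β) * ff x i) n
        rooks∑ {n} β x = trans (∑-diagonal (λ k j → fromℕ (rookNumber j β) * (choiceOf x k * fromℕ (k !))) n)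
          (trans (diagonal-flip _ n) (diagonal-cong n λ j i _ → *-congˡ (choiceOf-! x i)))

      hitSum≈ : ∀ {n} u v (β γ : Board n) x →
        ∑[ k ≤ n ] (fromℕ (u ℕ.* hitNumber (toℕ k) β ℕ.+ v ℕ.* hitNumber (toℕ k) γ) * choiceOf (x + fromℕ (toℕ k)) n) ≈
        fromℕ u * diagonal (λ j i → fromℕ (rookNumber j β) * ff x i) n +
        fromℕ v * diagonal (λ j i → fromℕ (rookNumber j γ) * ff x i) n
      hitSum≈ {n} u v β γ x = trans
        (combination u v (λ k → hitNumber k β) (λ k → hitNumber k γ) (λ k → choiceOf (x + fromℕ k) n) n)
        (+-cong (*-congˡ (hits∑ β x)) (*-congˡ (hits∑ γ x)))

      rookSum≈ : ∀ {n} u v (β γ : Board n) x →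
        ∑[ k ≤ n ] (fromℕ (u ℕ.* rookNumber (n ∸ toℕ k) β ℕ.+ v ℕ.* rookNumber (n ∸ toℕ k) γ) *
                    (choiceOf x (toℕ k) * fromℕ (toℕ k !))) ≈
        fromℕ u * diagonal (λ j i → fromℕ (rookNumber j β) * ff x i) n +
        fromℕ v * diagonal (λ j i → fromℕ (rookNumber j γ) * ff x i) n
      rookSum≈ {n} u v β γ x = trans
        (combination u v (λ k → rookNumber (n ∸ k) β) (λ k → rookNumber (n ∸ k) γ) (λ k → choiceOf x k * fromℕ (k !)) n)
        (+-cong (*-congˡ (rooks∑ β x)) (*-congˡ (rooks∑ γ x)))

    -- The two boards of a hook

    module HookBoards (p ℓ′ : ℕ) (x : Carrier) where

      private
        n : ℕ
        n = suc p ℕ.+ ℓ′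
        n∸ℓ : n ∸ ℓ′ ≡ suc p
        n∸ℓ = ℕₚ.m+n∸n≡m (suc p) ℓ′

      heightC heightD : ℕ → ℕ
      heightC = hookHeightsC n ℓ′
      heightD = hookHeightsD n ℓ′

      private
        does-yes : ∀ {i m} → i ≤ m → does (i ℕₚ.≤? m) ≡ true
        does-yes {i} {m} = dec-true (i ℕₚ.≤? m)

        does-no : ∀ {i m} → ¬ i ≤ m → does (i ℕₚ.≤? m) ≡ false
        does-no {i} {m} = dec-false (i ℕₚ.≤? m)

      heightC-low : ∀ {i} → i ≤ p → heightC i ≡ p ∸ 1
      heightC-low i≤p rewrite n∸ℓ | does-yes i≤p = ≡.refl

      heightC-high : ∀ {i} → ¬ i ≤ p → heightC i ≡ p ℕ.+ (i ∸ suc p)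
      heightC-high i≰p rewrite n∸ℓ | does-no i≰p = ≡.refl

      heightD-low : ∀ {i} → i ≤ suc p → heightD i ≡ p
      heightD-low i≤p rewrite n∸ℓ | does-yes i≤p = ≡.refl

      heightD-high : ∀ {i} → ¬ i ≤ suc p → heightD i ≡ p ℕ.+ (i ∸ suc p)
      heightD-high i≰p rewrite n∸ℓ | does-no i≰p = ≡.refl

      private
        high≤ : ∀ {i} → i ≤ n → p ℕ.+ (i ∸ suc p) ≤ n
        high≤ {i} i≤n = ℕₚ.≤-trans (ℕₚ.+-monoʳ-≤ p (ℕₚ.≤-trans (ℕₚ.∸-monoˡ-≤ (suc p) i≤n)
          (ℕₚ.≤-reflexive (ℕₚ.m+n∸m≡n (suc p) ℓ′)))) (ℕₚ.n≤1+n _)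

      heightC≤ : ∀ (a : Fin n) → heightC (suc (toℕ a)) ≤ n
      heightC≤ a = case suc (toℕ a) ℕₚ.≤? p of λ where
        (yes q) → ℕₚ.≤-trans (ℕₚ.≤-reflexive (heightC-low q))
          (ℕₚ.≤-trans (ℕₚ.m∸n≤m p 1) (ℕₚ.m≤n⇒m≤1+n (ℕₚ.m≤m+n p ℓ′)))
        (no q)  → ℕₚ.≤-trans (ℕₚ.≤-reflexive (heightC-high q)) (high≤ (Finₚ.toℕ<n a))

      heightD≤ : ∀ (a : Fin n) → heightD (suc (toℕ a)) ≤ n
      heightD≤ a = case suc (toℕ a) ℕₚ.≤? suc p of λ where
        (yes q) → ℕₚ.≤-trans (ℕₚ.≤-reflexive (heightD-low q)) (ℕₚ.m≤n⇒m≤1+n (ℕₚ.m≤m+n p ℓ′))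
        (no q)  → ℕₚ.≤-trans (ℕₚ.≤-reflexive (heightD-high q)) (high≤ (Finₚ.toℕ<n a))

      heightC-mono : ∀ {i j} → i ≤ j → heightC i ≤ heightC j
      heightC-mono {i} {j} i≤j = case (i ℕₚ.≤? p) of λ where
        (yes q) → case (j ℕₚ.≤? p) of λ where
          (yes q′) → ℕₚ.≤-reflexive (≡.trans (heightC-low q) (≡.sym (heightC-low q′)))
          (no q′)  → ℕₚ.≤-trans (ℕₚ.≤-reflexive (heightC-low q)) (ℕₚ.≤-trans
            (ℕₚ.≤-trans (ℕₚ.m∸n≤m p 1) (ℕₚ.m≤m+n p _)) (ℕₚ.≤-reflexive (≡.sym (heightC-high q′))))
        (no q) → ℕₚ.≤-trans (ℕₚ.≤-reflexive (heightC-high q)) (ℕₚ.≤-trans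
          (ℕₚ.+-monoʳ-≤ p (ℕₚ.∸-monoˡ-≤ (suc p) i≤j))
          (ℕₚ.≤-reflexive (≡.sym (heightC-high (λ j≤p → q (ℕₚ.≤-trans i≤j j≤p))))))

      heightD-mono : ∀ {i j} → i ≤ j → heightD i ≤ heightD j
      heightD-mono {i} {j} i≤j = case (i ℕₚ.≤? suc p) of λ where
        (yes q) → case (j ℕₚ.≤? suc p) of λ where
          (yes q′) → ℕₚ.≤-reflexive (≡.trans (heightD-low q) (≡.sym (heightD-low q′)))
          (no q′)  → ℕₚ.≤-trans (ℕₚ.≤-reflexive (heightD-low q)) (ℕₚ.≤-trans
            (ℕₚ.m≤m+n p _) (ℕₚ.≤-reflexive (≡.sym (heightD-high q′))))
        (no q) → ℕₚ.≤-trans (ℕₚ.≤-reflexive (heightD-high q)) (ℕₚ.≤-trans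
          (ℕₚ.+-monoʳ-≤ p (ℕₚ.∸-monoˡ-≤ (suc p) i≤j))
          (ℕₚ.≤-reflexive (≡.sym (heightD-high (λ j≤p → q (ℕₚ.≤-trans i≤j j≤p))))))

      private
        index : ∀ q t → suc (q ℕ.+ t) ∸ suc q ≡ t
        index q t = ℕₚ.m+n∸m≡n q t

        -- For `p = 0` the falling factorial is empty, so the truncation in `p ∸ 1` does no harm.
        ff-p∸1 : ∀ p → ff (x + fromℕ (p ∸ 1)) p ≈ rising x p
        ff-p∸1 zero    = ff-zero _
        ff-p∸1 (suc p) = ff-rising x p

      -- The first `p` columns are flat of height `p ∸ 1`; from the next column on the heights climb
      -- by one, and each of these `suc ℓ′` columns contributes a factor `x`.
      rooksC : diagonal (λ k i → fromℕ (rookNumber k (ferrers n heightC)) * ff x i) n ≈ rising x p * x ^ suc ℓ′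
      rooksC = begin
        diagonal (λ k i → fromℕ (rookNumber k (ferrers n heightC)) * ff x i) n
          ≈⟨ rookSum-staircase heightC heightC≤ x heightC-mono ⟩
        staircaseProduct heightC heightC≤ x n
          ≡⟨ ≡.cong (staircaseProduct heightC heightC≤ x) (ℕₚ.+-suc p ℓ′) ⟨
        staircaseProduct heightC heightC≤ x (p ℕ.+ suc ℓ′)
          ≈⟨ staircase-stairs heightC heightC≤ x p (λ i i<p → heightC-low i<p)
               (λ t → ≡.trans (heightC-high (λ le → ℕₚ.m+1+n≰m p (ℕₚ.≤-trans (ℕₚ.≤-reflexive (ℕₚ.+-suc p t)) le)))
                 (≡.cong (p ℕ.+_) (index p t))) (suc ℓ′) ⟩
        ff (x + fromℕ (p ∸ 1)) p * x ^ suc ℓ′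
          ≈⟨ *-congʳ (ff-p∸1 p) ⟩
        rising x p * x ^ suc ℓ′ ∎

      -- The flat part now has `suc p` columns of height `p`, which exchanges one factor `x` for
      -- `x + p`.
      rooksD : diagonal (λ k i → fromℕ (rookNumber k (ferrers n heightD)) * ff x i) n ≈ rising x (suc p) * x ^ ℓ′
      rooksD = begin
        diagonal (λ k i → fromℕ (rookNumber k (ferrers n heightD)) * ff x i) n
          ≈⟨ rookSum-staircase heightD heightD≤ x heightD-mono ⟩
        staircaseProduct heightD heightD≤ x (suc p ℕ.+ ℓ′)
          ≈⟨ staircase-stairs heightD heightD≤ x (suc p) (λ i i<p → heightD-low i<p)
               (λ t → ≡.trans (heightD-high (λ le → ℕₚ.m+1+n≰m (suc p) (ℕₚ.≤-trans (ℕₚ.≤-reflexive (ℕₚ.+-suc (suc p) t)) le)))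
                 (≡.trans (≡.cong (p ℕ.+_) (≡.trans (≡.cong (_∸ p) (≡.sym (ℕₚ.+-suc p t))) (ℕₚ.m+n∸m≡n p (suc t))))
                   (ℕₚ.+-suc p t))) ℓ′ ⟩
        ff (x + fromℕ p) (suc p) * x ^ ℓ′
          ≈⟨ *-congʳ (ff-rising x p) ⟩
        rising x (suc p) * x ^ ℓ′ ∎

  -- Products by power sums and elementary symmetric functions

  Coefficients : Set c
  Coefficients = List ℕ → Carrier

  -- With one more variable y adjoined to the alphabet, this is the coefficient of y^b; by symmetry
  -- y may be taken as the first variable.
  slice : ℕ → Λ → Λ
  slice b f = record
    { coeff     = λ a → coeff f (b ∷ a)
    ; symmetric = λ p → symmetric f (prep b p)
    ; padding   = λ a → padding f (b ∷ a)
    ; bounded   = proj₁ (bounded f) , λ a d<a → proj₂ (bounded f) (b ∷ a) (ℕₚ.<-≤-trans d<a (ℕₚ.m≤n+m (sum a) b))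
    }

  coeff-0∷ : ∀ f a → coeff f (0 ∷ a) ≈ coeff f a
  coeff-0∷ f a = trans (symmetric f (++-comm [ 0 ] a)) (padding f a)

  coeff-filter : ∀ f a → coeff f a ≈ coeff f (filter (1 ℕₚ.≤?_) a)
  coeff-filter f []          = refl
  coeff-filter f (zero  ∷ a) = trans (coeff-0∷ f a) (coeff-filter f a)
  coeff-filter f (suc m ∷ a) = coeff-filter (slice (suc m) f) a

  -- Hence a symmetric function is determined by its coefficients at partitions.
  coeff-type : ∀ f a → coeff f a ≈ coeff f (type a)
  coeff-type f a = trans (coeff-filter f a) (symmetric f (↭-sym (sort-↭ _)))

  -- The product by y^k on the coefficients of a series in one variable y.
  shiftᶠ : ℕ → (ℕ → Carrier) → ℕ → Carrier
  shiftᶠ zero    φ a       = φ a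
  shiftᶠ (suc k) φ zero    = 0#
  shiftᶠ (suc k) φ (suc a) = shiftᶠ k φ a

  shift-cong : ∀ k {φ ψ} a → (∀ x → φ x ≈ ψ x) → shiftᶠ k φ a ≈ shiftᶠ k ψ a
  shift-cong zero    a       e = e a
  shift-cong (suc k) zero    e = refl
  shift-cong (suc k) (suc a) e = shift-cong k a e

  shift-+ : ∀ k φ ψ a → shiftᶠ k (λ x → φ x + ψ x) a ≈ shiftᶠ k φ a + shiftᶠ k ψ a
  shift-+ zero    φ ψ a       = refl
  shift-+ (suc k) φ ψ zero    = sym (+-identityˡ 0#)
  shift-+ (suc k) φ ψ (suc a) = shift-+ k φ ψ a

  shift-* : ∀ k x φ a → shiftᶠ k (λ y → x * φ y) a ≈ x * shiftᶠ k φ a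
  shift-* zero    x φ a       = refl
  shift-* (suc k) x φ zero    = sym (zeroʳ x)
  shift-* (suc k) x φ (suc a) = shift-* k x φ a

  shift-0 : ∀ k a → shiftᶠ k (λ _ → 0#) a ≈ 0#
  shift-0 zero    a       = refl
  shift-0 (suc k) zero    = refl
  shift-0 (suc k) (suc a) = shift-0 k a

  shift-shift : ∀ k l φ a → shiftᶠ k (shiftᶠ l φ) a ≈ shiftᶠ (k ℕ.+ l) φ a
  shift-shift zero    l φ a       = refl
  shift-shift (suc k) l φ zero    = refl
  shift-shift (suc k) l φ (suc a) = shift-shift k l φ a

  shift-comm : ∀ k l φ a → shiftᶠ k (shiftᶠ l φ) a ≈ shiftᶠ l (shiftᶠ k φ) a
  shift-comm k l φ a = trans (shift-shift k l φ a)
    (trans (reflexive (≡.cong (λ m → shiftᶠ m φ a) (ℕₚ.+-comm k l))) (sym (shift-shift l k φ a)))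

  -- The coefficients of the product by the power sum p_k.
  powerShift : ℕ → Coefficients → Coefficients
  powerShift k f []       = 0#
  powerShift k f (a ∷ as) = shiftᶠ k (λ x → f (x ∷ as)) a + powerShift k (λ b → f (a ∷ b)) as

  powerShift-cong : ∀ k {f g} t → (∀ a → f a ≈ g a) → powerShift k f t ≈ powerShift k g t
  powerShift-cong k []       e = refl
  powerShift-cong k (a ∷ as) e = +-cong (shift-cong k a (λ x → e (x ∷ as))) (powerShift-cong k as (λ b → e (a ∷ b)))

  powerShift-+ : ∀ k f g t → powerShift k (λ a → f a + g a) t ≈ powerShift k f t + powerShift k g t
  powerShift-+ k f g []       = sym (+-identityˡ 0#)
  powerShift-+ k f g (a ∷ as) = trans
    (+-cong (shift-+ k (λ x → f (x ∷ as)) (λ x → g (x ∷ as)) a) (powerShift-+ k (λ b → f (a ∷ b)) (λ b → g (a ∷ b)) as))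
    (interchange _ _ _ _)

  powerShift-* : ∀ k x f t → powerShift k (λ a → x * f a) t ≈ x * powerShift k f t
  powerShift-* k x f []       = sym (zeroʳ x)
  powerShift-* k x f (a ∷ as) = trans
    (+-cong (shift-* k x (λ y → f (y ∷ as)) a) (powerShift-* k x (λ b → f (a ∷ b)) as)) (sym (distribˡ x _ _))

  powerShift-0 : ∀ k t → powerShift k (λ _ → 0#) t ≈ 0#
  powerShift-0 k []       = refl
  powerShift-0 k (a ∷ as) = trans (+-cong (shift-0 k a) (powerShift-0 k as)) (+-identityˡ 0#)

  powerShift-shift : ∀ k l (f : ℕ → Coefficients) a t →
    powerShift l (λ b → shiftᶠ k (λ x → f x b) a) t ≈ shiftᶠ k (λ x → powerShift l (f x) t) a
  powerShift-shift zero    l f a       t = refl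
  powerShift-shift (suc k) l f zero    t = powerShift-0 l t
  powerShift-shift (suc k) l f (suc a) t = powerShift-shift k l f a t

  powerShift-comm : ∀ k l f t → powerShift k (powerShift l f) t ≈ powerShift l (powerShift k f) t
  powerShift-comm k l f []       = refl
  powerShift-comm k l f (a ∷ as) = begin
    shiftᶠ k (λ x → shiftᶠ l (λ y → f (y ∷ as)) x + powerShift l (λ b → f (x ∷ b)) as) a +
    powerShift k (λ b → shiftᶠ l (λ x → f (x ∷ b)) a + powerShift l (λ b → f (a ∷ b)) b) as
      ≈⟨ expand k l ⟩
    (shiftᶠ k (shiftᶠ l (λ y → f (y ∷ as))) a + powerShift k (powerShift l (λ b → f (a ∷ b))) as) + (M k l + M l k)
      ≈⟨ +-cong (+-cong (shift-comm k l _ a) (powerShift-comm k l _ as)) (+-comm (M k l) (M l k)) ⟩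
    (shiftᶠ l (shiftᶠ k (λ y → f (y ∷ as))) a + powerShift l (powerShift k (λ b → f (a ∷ b))) as) + (M l k + M k l)
      ≈⟨ expand l k ⟨
    shiftᶠ l (λ x → shiftᶠ k (λ y → f (y ∷ as)) x + powerShift k (λ b → f (x ∷ b)) as) a +
    powerShift l (λ b → shiftᶠ k (λ x → f (x ∷ b)) a + powerShift k (λ b → f (a ∷ b)) b) as ∎
    where
    -- The mixed terms, in which one power falls on the first variable and the other on a later one.
    M : ℕ → ℕ → Carrier
    M k l = shiftᶠ k (λ x → powerShift l (λ b → f (x ∷ b)) as) a
    expand : ∀ k l →
      shiftᶠ k (λ x → shiftᶠ l (λ y → f (y ∷ as)) x + powerShift l (λ b → f (x ∷ b)) as) a +
      powerShift k (λ b → shiftᶠ l (λ x → f (x ∷ b)) a + powerShift l (λ b → f (a ∷ b)) b) as ≈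
      (shiftᶠ k (shiftᶠ l (λ y → f (y ∷ as))) a + powerShift k (powerShift l (λ b → f (a ∷ b))) as) + (M k l + M l k)
    expand k l = trans
      (+-cong (shift-+ k _ _ a) (trans (powerShift-+ k _ _ as) (+-congʳ (powerShift-shift l k (λ x b → f (x ∷ b)) a as))))
      (solve 4 (λ a b c d → (a :+ b) :+ (c :+ d) := (a :+ d) :+ (b :+ c)) refl _ _ _ _)

  length-sort : ∀ l → length (sort l) ≡ length l
  length-sort l = ↭-length (sort-↭ l)

  δ-length : ∀ u v → length u ≢ length v → δ u v ≈ 0#
  δ-length u v ≢ = δ-≢ {u} {v} λ e → ≢ (≡.cong length e)

  coeff-1Λ-suc : ∀ x xs → coeff 1Λ (suc x ∷ xs) ≈ 0#
  coeff-1Λ-suc x xs = δ-length [] (type (suc x ∷ xs)) λ e →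
    contradiction (≡.trans e (length-sort (suc x ∷ filter (1 ℕₚ.≤?_) xs))) λ ()

  δ-singleton : ∀ k i → δ [ k ] [ i ] ≈ indicator (k ℕₚ.≟ i)
  δ-singleton k i = lemma (≡-dec ℕₚ._≟_ [ k ] [ i ]) (k ℕₚ.≟ i)
    where
    lemma : ∀ (d : Dec ([ k ] ≡ [ i ])) (d′ : Dec (k ≡ i)) → indicator d ≈ indicator d′
    lemma (yes _)      (yes _)      = refl
    lemma (yes ≡.refl) (no k≢k)     = contradiction ≡.refl k≢k
    lemma (no k≢k)     (yes ≡.refl) = contradiction ≡.refl k≢k
    lemma (no _)       (no _)       = refl

  coeff-monomial-suc : ∀ k i b → coeff (monomial [ k ]) (suc i ∷ b) ≈ indicator (k ℕₚ.≟ suc i) * coeff 1Λ b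
  coeff-monomial-suc k i b = lemma (filter (1 ℕₚ.≤?_) b)
    where
    lemma : ∀ l → δ [ k ] (sort (suc i ∷ l)) ≈ indicator (k ℕₚ.≟ suc i) * δ [] (sort l)
    lemma []      = trans (δ-singleton k (suc i)) (sym (*-identityʳ _))
    lemma (y ∷ l) = trans
      (δ-length [ k ] (sort (suc i ∷ y ∷ l)) λ e → contradiction (≡.trans e (length-sort (suc i ∷ y ∷ l))) λ ())
      (sym (trans (*-congˡ (δ-length [] (sort (y ∷ l)) λ e → contradiction (≡.trans e (length-sort (y ∷ l))) λ ()))
        (zeroʳ _)))

  convolve-diagonal : ∀ f g a as →
    convolve f g (a ∷ as) ≈ diagonal (λ i j → convolve (λ b → f (i ∷ b)) (λ b → g (j ∷ b)) as) a
  convolve-diagonal f g a as = ∑-diagonal (λ i j → convolve (λ b → f (i ∷ b)) (λ b → g (j ∷ b)) as) a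

  convolve-congˡ : ∀ {f f′} g t → (∀ a → f a ≈ f′ a) → convolve f g t ≈ convolve f′ g t
  convolve-congˡ g []       e = *-congʳ (e [])
  convolve-congˡ g (a ∷ as) e = sum-cong-≋ {suc a} λ i →
    convolve-congˡ (λ b → g (a ∸ toℕ i ∷ b)) as (λ b → e (toℕ i ∷ b))

  convolve-*ˡ : ∀ x f g t → convolve (λ a → x * f a) g t ≈ x * convolve f g t
  convolve-*ˡ x f g []       = *-assoc _ _ _
  convolve-*ˡ x f g (a ∷ as) = begin
    convolve (λ a → x * f a) g (a ∷ as)
      ≈⟨ convolve-diagonal (λ a → x * f a) g a as ⟩
    diagonal (λ i j → convolve (λ b → x * f (i ∷ b)) (λ b → g (j ∷ b)) as) a
      ≈⟨ diagonal-cong a (λ i j _ → convolve-*ˡ x _ _ as) ⟩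
    diagonal (λ i j → x * convolve (λ b → f (i ∷ b)) (λ b → g (j ∷ b)) as) a
      ≈⟨ diagonal-* x _ a ⟩
    x * diagonal (λ i j → convolve (λ b → f (i ∷ b)) (λ b → g (j ∷ b)) as) a
      ≈⟨ *-congˡ (convolve-diagonal f g a as) ⟨
    x * convolve f g (a ∷ as) ∎

  convolve-0ˡ : ∀ g t → convolve (λ _ → 0#) g t ≈ 0#
  convolve-0ˡ g t = trans (convolve-congˡ g t (λ _ → sym (zeroˡ 0#))) (trans (convolve-*ˡ 0# _ g t) (zeroˡ _))

  convolve-1Λ : ∀ g t → convolve (coeff 1Λ) g t ≈ g t
  convolve-1Λ g []       = *-identityˡ _
  convolve-1Λ g (a ∷ as) = trans (convolve-diagonal (coeff 1Λ) g a as) (first a (λ i j → trans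
      (convolve-congˡ _ as (coeff-1Λ-suc i)) (convolve-0ˡ _ as)) (λ j → convolve-1Λ (λ b → g (j ∷ b)) as))
    where
    first : ∀ {F : ℕ → ℕ → Carrier} {φ : ℕ → Carrier} a → (∀ i j → F (suc i) j ≈ 0#) → (∀ j → F 0 j ≈ φ j) → diagonal F a ≈ φ a
    first zero    e₀ e = e 0
    first (suc a) e₀ e = trans (+-cong (e (suc a)) (trans (diagonal-cong a λ i j _ → e₀ i j) (diagonal-0 a))) (+-identityʳ _)

  diagonal-indicator : ∀ k (φ : ℕ → Carrier) a → diagonal (λ i j → indicator (k ℕₚ.≟ i) * φ j) a ≈ shiftᶠ k φ a
  diagonal-indicator zero    φ zero    = *-identityˡ _
  diagonal-indicator zero    φ (suc a) = trans (+-cong (*-identityˡ _)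
    (trans (diagonal-cong a λ i j _ → zeroˡ _) (diagonal-0 a))) (+-identityʳ _)
  diagonal-indicator (suc k) φ zero    = zeroˡ _
  diagonal-indicator (suc k) φ (suc a) =
    trans (+-cong (zeroˡ _) (diagonal-indicator k φ a)) (+-identityˡ _)

  -- The power is taken either in a later variable, when the first factor has exponent 0 in the
  -- first variable, or in the first variable, which leaves `1Λ` for the others.
  convolve-monomial : ∀ k g t → convolve (coeff (monomial [ suc k ])) g t ≈ powerShift (suc k) g t
  convolve-monomial k g []       = zeroˡ _
  convolve-monomial k g (a ∷ as) = trans (convolve-diagonal (coeff (monomial [ suc k ])) g a as) (split a)
    where
    F : ℕ → ℕ → Carrier
    F i j = convolve (λ b → coeff (monomial [ suc k ]) (i ∷ b)) (λ b → g (j ∷ b)) as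
    F-suc : ∀ i j → F (suc i) j ≈ indicator (k ℕₚ.≟ i) * g (j ∷ as)
    F-suc i j = trans (convolve-congˡ _ as (coeff-monomial-suc (suc k) i))
      (trans (convolve-*ˡ _ (coeff 1Λ) _ as) (*-congˡ (convolve-1Λ _ as)))
    split : ∀ a → diagonal F a ≈ shiftᶠ (suc k) (λ x → g (x ∷ as)) a + powerShift (suc k) (λ b → g (a ∷ b)) as
    split zero    = trans (convolve-monomial k (λ b → g (0 ∷ b)) as) (sym (+-identityˡ _))
    split (suc a) = trans (+-cong (convolve-monomial k (λ b → g (suc a ∷ b)) as)
      (trans (diagonal-cong a λ i j _ → F-suc i j) (diagonal-indicator k (λ x → g (x ∷ as)) a))) (+-comm _ _)

  -- The product by p_{k+1}.
  p· : ℕ → Λ → Λ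
  p· k f = monomial [ suc k ] *Λ f

  coeff-p· : ∀ k f t → coeff (p· k f) t ≈ powerShift (suc k) (coeff f) t
  coeff-p· k f t = convolve-monomial k (coeff f) t

  0Λ : Λ
  0Λ = 0# ·Λ 1Λ

  coeff-0Λ : ∀ t → coeff 0Λ t ≈ 0#
  coeff-0Λ t = zeroˡ _

  ≈Λ-sym : ∀ f g → f ≈Λ g → g ≈Λ f
  ≈Λ-sym f g e t = sym (e t)

  p·-cong : ∀ k f g → f ≈Λ g → p· k f ≈Λ p· k g
  p·-cong k f g e t = trans (coeff-p· k f t) (trans (powerShift-cong (suc k) t e) (sym (coeff-p· k g t)))

  p·-+ : ∀ k f g → p· k (f +Λ g) ≈Λ p· k f +Λ p· k g
  p·-+ k f g t = trans (coeff-p· k (f +Λ g) t) (trans (powerShift-+ (suc k) (coeff f) (coeff g) t)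
    (sym (+-cong (coeff-p· k f t) (coeff-p· k g t))))

  p·-· : ∀ k x f → p· k (x ·Λ f) ≈Λ x ·Λ p· k f
  p·-· k x f t = trans (coeff-p· k (x ·Λ f) t) (trans (powerShift-* (suc k) x (coeff f) t) (sym (*-congˡ (coeff-p· k f t))))

  p·-comm : ∀ k l f → p· k (p· l f) ≈Λ p· l (p· k f)
  p·-comm k l f t = begin
    coeff (p· k (p· l f)) t                             ≈⟨ coeff-p· k (p· l f) t ⟩
    powerShift (suc k) (coeff (p· l f)) t               ≈⟨ powerShift-cong (suc k) t (coeff-p· l f) ⟩
    powerShift (suc k) (powerShift (suc l) (coeff f)) t ≈⟨ powerShift-comm (suc k) (suc l) (coeff f) t ⟩
    powerShift (suc l) (powerShift (suc k) (coeff f)) t ≈⟨ powerShift-cong (suc l) t (coeff-p· k f) ⟨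
    powerShift (suc l) (coeff (p· k f)) t               ≈⟨ coeff-p· l (p· k f) t ⟨
    coeff (p· l (p· k f)) t                             ∎

  -- p_{k₁+1} p_{k₂+1} ⋯; shifting the indices by one makes every list admissible.
  pProduct : List ℕ → Λ
  pProduct []       = 1Λ
  pProduct (k ∷ ks) = p· k (pProduct ks)

  pProduct-↭ : ∀ {ks ls} → ks ↭ ls → pProduct ks ≈Λ pProduct ls
  pProduct-↭ Perm.refl = λ t → refl
  pProduct-↭ {k ∷ ks} {_ ∷ ls} (prep k p) = p·-cong k (pProduct ks) (pProduct ls) (pProduct-↭ p)
  pProduct-↭ {_ ∷ _ ∷ ks} {_ ∷ _ ∷ ls} (swap k l p) t = trans (p·-comm k l (pProduct ks) t)
    (p·-cong l (p· k (pProduct ks)) (p· k (pProduct ls)) (p·-cong k (pProduct ks) (pProduct ls) (pProduct-↭ p)) t)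
  pProduct-↭ (Perm.trans p q) t = trans (pProduct-↭ p t) (pProduct-↭ q t)

  powerSum-parts : ∀ λ′ ks → parts λ′ ≡ map suc ks → powerSum λ′ ≈Λ pProduct ks
  powerSum-parts λ′ ks e t rewrite e = reflexive (≡.cong (λ f → coeff f t) (fold ks))
    where
    fold : ∀ ks → foldr _*Λ_ 1Λ (map (λ r → monomial [ r ]) (map suc ks)) ≡ pProduct ks
    fold []       = ≡.refl
    fold (k ∷ ks) = ≡.cong (p· k) (fold ks)

  -- The coefficients of the product by (-1)^a e_a.
  elementaryShift : ℕ → Coefficients → Coefficients
  elementaryShift zero    f t        = f t
  elementaryShift (suc a) f []       = 0#
  elementaryShift (suc a) f (x ∷ xs) =
    elementaryShift (suc a) (λ b → f (x ∷ b)) xs - elementaryShift a (λ b → shiftᶠ 1 (λ y → f (y ∷ b)) x) xs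

  elementaryShift-cong : ∀ a {f g} t → (∀ b → f b ≈ g b) → elementaryShift a f t ≈ elementaryShift a g t
  elementaryShift-cong zero    t        e = e t
  elementaryShift-cong (suc a) []       e = refl
  elementaryShift-cong (suc a) (x ∷ xs) e = +-cong (elementaryShift-cong (suc a) xs (λ b → e (x ∷ b)))
    (-‿cong (elementaryShift-cong a xs (λ b → shift-cong 1 x (λ y → e (y ∷ b)))))

  elementaryShift-+ : ∀ a f g t → elementaryShift a (λ b → f b + g b) t ≈ elementaryShift a f t + elementaryShift a g t
  elementaryShift-+ zero    f g t        = refl
  elementaryShift-+ (suc a) f g []       = sym (+-identityˡ 0#)
  elementaryShift-+ (suc a) f g (x ∷ xs) = trans
    (+-cong (elementaryShift-+ (suc a) (λ b → f (x ∷ b)) (λ b → g (x ∷ b)) xs)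
      (-‿cong (trans (elementaryShift-cong a xs (λ b → shift-+ 1 (λ y → f (y ∷ b)) (λ y → g (y ∷ b)) x)) (elementaryShift-+ a _ _ xs))))
    (solve 4 (λ a b c d → (a :+ b) :- (c :+ d) := (a :- c) :+ (b :- d)) refl _ _ _ _)

  elementaryShift-* : ∀ a x f t → elementaryShift a (λ b → x * f b) t ≈ x * elementaryShift a f t
  elementaryShift-* zero    x f t        = refl
  elementaryShift-* (suc a) x f []       = sym (zeroʳ x)
  elementaryShift-* (suc a) x f (y ∷ ys) = trans
    (+-cong (elementaryShift-* (suc a) x (λ b → f (y ∷ b)) ys)
      (-‿cong (trans (elementaryShift-cong a ys (λ b → shift-* 1 x (λ z → f (z ∷ b)) y)) (elementaryShift-* a x _ ys))))
    (solve 3 (λ x a b → x :* a :- x :* b := x :* (a :- b)) refl _ _ _)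

  elementaryShift-shift : ∀ k a (f : ℕ → Coefficients) x t →
    elementaryShift a (λ b → shiftᶠ k (λ y → f y b) x) t ≈ shiftᶠ k (λ y → elementaryShift a (f y) t) x
  elementaryShift-shift zero    a f x       t = refl
  elementaryShift-shift (suc k) a f zero    t = trans (elementaryShift-cong a t (λ _ → sym (zeroˡ 0#)))
    (trans (elementaryShift-* a 0# (λ _ → 0#) t) (zeroˡ _))
  elementaryShift-shift (suc k) a f (suc x) t = elementaryShift-shift k a f x t

  diagonal-powerShift : ∀ k (F : ℕ → ℕ → Coefficients) n t →
    diagonal (λ i j → powerShift k (F i j) t) n ≈ powerShift k (λ b → diagonal (λ i j → F i j b) n) t
  diagonal-powerShift k F zero    t = refl
  diagonal-powerShift k F (suc n) t =
    trans (+-congˡ (diagonal-powerShift k (F ∘ suc) n t)) (sym (powerShift-+ k (F 0 (suc n)) _ t))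

  -- Newton's identities between power sums and signed elementary functions, by induction on the
  -- number of variables. `first` collects the powers of the first variable and `second` those of
  -- the others.
  newton-elementary : ∀ a f t → fromℕ (suc a) * elementaryShift (suc a) f t +
    diagonal (λ k j → powerShift (suc k) (elementaryShift j f) t) a ≈ 0#
  newton-elementary a f []       = trans (+-cong (zeroʳ _) (diagonal-0 a)) (+-identityˡ 0#)
  newton-elementary a f (x ∷ xs) = begin
    fromℕ (suc a) * (V - W) + diagonal (λ k j → shiftᶠ (suc k) (u j) x + powerShift (suc k) (λ b → elementaryShift j f (x ∷ b)) xs) a
      ≈⟨ +-congˡ (trans (diagonal-+ _ _ a) (+-cong (first a) (second a))) ⟩
    fromℕ (suc a) * (V - W) + (W + (R₁ - R₂ a))
      ≈⟨ regroup a ⟩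
    0# ∎
    where
    fx f⁻ : Coefficients
    fx b = f (x ∷ b)
    f⁻ b = shiftᶠ 1 (λ y → f (y ∷ b)) x
    V W R₁ : Carrier
    V = elementaryShift (suc a) fx xs
    W = elementaryShift a f⁻ xs
    R₁ = diagonal (λ k j → powerShift (suc k) (elementaryShift j fx) xs) a
    R₂ : ℕ → Carrier
    R₂ zero    = 0#
    R₂ (suc a) = diagonal (λ k j → powerShift (suc k) (elementaryShift j f⁻) xs) a
    u : ℕ → ℕ → Carrier
    u j y = elementaryShift j f (y ∷ xs)
    q : ℕ → ℕ → Carrier
    q k j = shiftᶠ k (λ y → elementaryShift j (λ b → f (y ∷ b)) xs) x

    -- Splitting off the first variable from each signed elementary function makes the sum
    -- telescope.
    first : ∀ a → diagonal (λ k j → shiftᶠ (suc k) (u j) x) a ≈ elementaryShift a f⁻ xs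
    first zero    = sym (elementaryShift-shift 1 zero (λ y b → f (y ∷ b)) x xs)
    first (suc a) = begin
      diagonal (λ k j → shiftᶠ (suc k) (u j) x) (suc a)
        ≈⟨ diagonal-last (λ k j → shiftᶠ (suc k) (u j) x) a ⟩
      diagonal (λ k j → shiftᶠ (suc k) (u (suc j)) x) a + shiftᶠ (suc (suc a)) (u 0) x
        ≈⟨ +-congʳ (diagonal-cong a λ k j _ → unfold k j) ⟩
      diagonal (λ k j → q (suc k) (suc j) + - 1# * q (suc (suc k)) j) a + q (suc (suc a)) 0
        ≈⟨ +-congʳ (trans (diagonal-+ _ _ a) (+-congˡ (diagonal-* (- 1#) _ a))) ⟩
      (diagonal (λ k j → q (suc k) (suc j)) a + - 1# * D) + q (suc (suc a)) 0
        ≈⟨ solve 3 (λ a d b → (a :+ :- one :* d) :+ b := a :+ b :+ :- d) refl _ D _ ⟩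
      diagonal (λ k j → q (suc k) (suc j)) a + q (suc (suc a)) 0 + - D
        ≈⟨ +-congʳ (diagonal-last (λ k j → q (suc k) j) a) ⟨
      q 1 (suc a) + D + - D
        ≈⟨ solve 2 (λ a d → a :+ d :+ :- d := a) refl (q 1 (suc a)) D ⟩
      q 1 (suc a)
        ≈⟨ elementaryShift-shift 1 (suc a) (λ y b → f (y ∷ b)) x xs ⟨
      elementaryShift (suc a) f⁻ xs ∎
      where
      D : Carrier
      D = diagonal (λ k j → q (suc (suc k)) j) a
      unfold : ∀ k j → shiftᶠ (suc k) (u (suc j)) x ≈ q (suc k) (suc j) + - 1# * q (suc (suc k)) j
      unfold k j = begin
        shiftᶠ (suc k) (λ y → elementaryShift (suc j) (λ b → f (y ∷ b)) xs -
                             elementaryShift j (λ b → shiftᶠ 1 (λ z → f (z ∷ b)) y) xs) x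
          ≈⟨ shift-cong (suc k) x (λ y → +-congˡ (trans (-‿cong (elementaryShift-shift 1 j (λ z b → f (z ∷ b)) y xs))
               (solve 1 (λ a → :- a := :- one :* a) refl _))) ⟩
        shiftᶠ (suc k) (λ y → elementaryShift (suc j) (λ b → f (y ∷ b)) xs +
                             - 1# * shiftᶠ 1 (λ z → elementaryShift j (λ b → f (z ∷ b)) xs) y) x
          ≈⟨ trans (shift-+ (suc k) _ _ x) (+-congˡ (shift-* (suc k) (- 1#) _ x)) ⟩
        q (suc k) (suc j) + - 1# * shiftᶠ (suc k) (shiftᶠ 1 (λ z → elementaryShift j (λ b → f (z ∷ b)) xs)) x
          ≈⟨ +-congˡ (*-congˡ (trans (shift-shift (suc k) 1 _ x)
               (reflexive (≡.cong (λ m → q m j) (ℕₚ.+-comm (suc k) 1))))) ⟩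
        q (suc k) (suc j) + - 1# * q (suc (suc k)) j ∎

    -- The same splitting gives Newton sums in the remaining variables, of degree one lower for
    -- `f⁻`; for `a = 0` this second sum is absent, whence the value of `R₂ zero`.
    second : ∀ a → diagonal (λ k j → powerShift (suc k) (λ b → elementaryShift j f (x ∷ b)) xs) a ≈
             diagonal (λ k j → powerShift (suc k) (elementaryShift j fx) xs) a - R₂ a
    second zero    = trans (sym (+-identityʳ _)) (+-congˡ (sym -0#≈0#))
    second (suc a) = begin
      diagonal (λ k j → powerShift (suc k) (λ b → elementaryShift j f (x ∷ b)) xs) (suc a)
        ≈⟨ diagonal-last (λ k j → powerShift (suc k) (λ b → elementaryShift j f (x ∷ b)) xs) a ⟩
      diagonal (λ k j → powerShift (suc k) (λ b → elementaryShift (suc j) fx b - elementaryShift j f⁻ b) xs) a +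
        powerShift (suc (suc a)) fx xs
        ≈⟨ +-congʳ (diagonal-cong a λ k j _ → trans
             (powerShift-cong (suc k) xs (λ b → +-congˡ (solve 1 (λ a → :- a := :- one :* a) refl _)))
             (trans (powerShift-+ (suc k) _ _ xs) (+-congˡ (powerShift-* (suc k) (- 1#) _ xs)))) ⟩
      diagonal (λ k j → powerShift (suc k) (elementaryShift (suc j) fx) xs + - 1# * powerShift (suc k) (elementaryShift j f⁻) xs) a +
        powerShift (suc (suc a)) fx xs
        ≈⟨ +-congʳ (trans (diagonal-+ _ _ a) (+-congˡ (diagonal-* (- 1#) _ a))) ⟩
      (diagonal (λ k j → powerShift (suc k) (elementaryShift (suc j) fx) xs) a + - 1# * R₂ (suc a)) + powerShift (suc (suc a)) fx xs
        ≈⟨ solve 3 (λ a d b → (a :+ :- one :* d) :+ b := a :+ b :- d) refl _ (R₂ (suc a)) _ ⟩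
      diagonal (λ k j → powerShift (suc k) (elementaryShift (suc j) fx) xs) a + powerShift (suc (suc a)) fx xs - R₂ (suc a)
        ≈⟨ +-congʳ (diagonal-last (λ k j → powerShift (suc k) (elementaryShift j fx) xs) a) ⟨
      diagonal (λ k j → powerShift (suc k) (elementaryShift j fx) xs) (suc a) - R₂ (suc a) ∎

    R₂-value : ∀ a → fromℕ a * elementaryShift a f⁻ xs + R₂ a ≈ 0#
    R₂-value zero    = trans (+-identityʳ _) (zeroˡ _)
    R₂-value (suc a) = newton-elementary a f⁻ xs

    regroup : ∀ a → fromℕ (suc a) * (elementaryShift (suc a) fx xs - elementaryShift a f⁻ xs) +
      (elementaryShift a f⁻ xs + (diagonal (λ k j → powerShift (suc k) (elementaryShift j fx) xs) a - R₂ a)) ≈ 0#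
    regroup a = begin
      (1# + m) * (v - w) + (w + (r₁ - r₂))
        ≈⟨ solve 5 (λ m v w r s → (one :+ m) :* (v :- w) :+ (w :+ (r :- s)) := ((one :+ m) :* v :+ r) :- (m :* w :+ s)) refl m v w r₁ r₂ ⟩
      ((1# + m) * v + r₁) - (m * w + r₂)
        ≈⟨ +-cong (newton-elementary a fx xs) (-‿cong (R₂-value a)) ⟩
      0# - 0#
        ≈⟨ -‿inverseʳ 0# ⟩
      0# ∎
      where
      m v w r₁ r₂ : Carrier
      m = fromℕ a
      v = elementaryShift (suc a) fx xs
      w = elementaryShift a f⁻ xs
      r₁ = diagonal (λ k j → powerShift (suc k) (elementaryShift j fx) xs) a
      r₂ = R₂ a

  -- Adjoints

  -- Membership in a span is what transfers an identity of the forms from power sums or Schur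
  -- functions to other symmetric functions; `resp` is there because these are compared by
  -- coefficients.
  data Span {i} {I : Set i} (F : I → Λ) : Λ → Set (i ⊔ c ⊔ ℓ) where
    base  : ∀ i → Span F (F i)
    null  : Span F 0Λ
    plus  : ∀ {f g} → Span F f → Span F g → Span F (f +Λ g)
    scale : ∀ x {f} → Span F f → Span F (x ·Λ f)
    resp  : ∀ {f g} → f ≈Λ g → Span F f → Span F g

  module Form (form : BilinearForm) where

    open BilinearForm form public

    ⟨⟩-congˡ : ∀ {f f′} g → f ≈Λ f′ → ⟨ f , g ⟩ ≈ ⟨ f′ , g ⟩
    ⟨⟩-congˡ g e = ⟨⟩-cong _ _ g g e λ t → refl

    ⟨⟩-congʳ : ∀ f {g g′} → g ≈Λ g′ → ⟨ f , g ⟩ ≈ ⟨ f , g′ ⟩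
    ⟨⟩-congʳ f e = ⟨⟩-cong f f _ _ (λ t → refl) e

    ⟨0,⟩ : ∀ g → ⟨ 0Λ , g ⟩ ≈ 0#
    ⟨0,⟩ g = trans (·-linearˡ 0# 1Λ g) (zeroˡ _)

    ⟨,0⟩ : ∀ f → ⟨ f , 0Λ ⟩ ≈ 0#
    ⟨,0⟩ f = trans (·-linearʳ 0# f 1Λ) (zeroˡ _)

    Span-⊥ˡ : ∀ {i} {I : Set i} {F : I → Λ} {f} g → (∀ i → ⟨ F i , g ⟩ ≈ 0#) → Span F f → ⟨ f , g ⟩ ≈ 0#
    Span-⊥ˡ g e (base i)    = e i
    Span-⊥ˡ g e null        = ⟨0,⟩ g
    Span-⊥ˡ g e (plus s s′) = trans (+-linearˡ _ _ g) (trans (+-cong (Span-⊥ˡ g e s) (Span-⊥ˡ g e s′)) (+-identityˡ 0#))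
    Span-⊥ˡ g e (scale x s) = trans (·-linearˡ x _ g) (trans (*-congˡ (Span-⊥ˡ g e s)) (zeroʳ x))
    Span-⊥ˡ g e (resp {f} {f′} q s) = trans (⟨⟩-congˡ g (≈Λ-sym f f′ q)) (Span-⊥ˡ g e s)

    Span-⊥ʳ : ∀ {i} {I : Set i} {F : I → Λ} f {g} → (∀ i → ⟨ f , F i ⟩ ≈ 0#) → Span F g → ⟨ f , g ⟩ ≈ 0#
    Span-⊥ʳ f e (base i)    = e i
    Span-⊥ʳ f e null        = ⟨,0⟩ f
    Span-⊥ʳ f e (plus s s′) = trans (+-linearʳ f _ _) (trans (+-cong (Span-⊥ʳ f e s) (Span-⊥ʳ f e s′)) (+-identityˡ 0#))
    Span-⊥ʳ f e (scale x s) = trans (·-linearʳ x f _) (trans (*-congˡ (Span-⊥ʳ f e s)) (zeroʳ x))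
    Span-⊥ʳ f e (resp {g} {g′} q s) = trans (⟨⟩-congʳ f (≈Λ-sym g g′ q)) (Span-⊥ʳ f e s)

  diagonalΛ : (ℕ → ℕ → Λ) → ℕ → Λ
  diagonalΛ F zero    = F 0 0
  diagonalΛ F (suc n) = F 0 (suc n) +Λ diagonalΛ (F ∘ suc) n

  coeff-diagonalΛ : ∀ F n t → coeff (diagonalΛ F n) t ≈ diagonal (λ i j → coeff (F i j) t) n
  coeff-diagonalΛ F zero    t = refl
  coeff-diagonalΛ F (suc n) t = +-congˡ (coeff-diagonalΛ (F ∘ suc) n t)

  private
    powerSums : (ℕ → ℕ) → List Λ → Λ
    powerSums κ []       = 0Λ
    powerSums κ (g ∷ gs) = p· (κ 0) g +Λ powerSums (κ ∘ suc) gs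

  -- newton w b f is the b-th term of the sequence with g₀ = f and
  -- g_{b+1} = w b ∙ Σ_{i+j=b} p_{i+1} g_j, and previous w b f lists the earlier terms.
  newton : (ℕ → Carrier) → ℕ → Λ → Λ
  previous : (ℕ → Carrier) → ℕ → Λ → List Λ
  newton w zero    f = f
  newton w (suc b) f = w b ·Λ powerSums (λ i → i) (newton w b f ∷ previous w b f)
  previous w zero    f = []
  previous w (suc b) f = newton w b f ∷ previous w b f

  private
    powerSums-newton : ∀ w f κ b t → coeff (powerSums κ (newton w b f ∷ previous w b f)) t ≈
      diagonal (λ i j → coeff (p· (κ i) (newton w j f)) t) b
    powerSums-newton w f κ zero    t = trans (+-congˡ (coeff-0Λ t)) (+-identityʳ _)
    powerSums-newton w f κ (suc b) t = +-congˡ (powerSums-newton w f (κ ∘ suc) b t)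

  coeff-newton-suc : ∀ w b f t →
    coeff (newton w (suc b) f) t ≈ w b * diagonal (λ i j → coeff (p· i (newton w j f)) t) b
  coeff-newton-suc w b f t = *-congˡ (powerSums-newton w f (λ i → i) b t)

  newton-suc : ∀ w b f → newton w (suc b) f ≈Λ w b ·Λ diagonalΛ (λ i j → p· i (newton w j f)) b
  newton-suc w b f t = trans (coeff-newton-suc w b f t)
    (*-congˡ (sym (coeff-diagonalΛ (λ i j → p· i (newton w j f)) b t)))

  strong : ∀ {p} (P : ℕ → Set p) → P 0 → (∀ b → (∀ j → j ≤ b → P j) → P (suc b)) → ∀ b → P b
  strong P P0 step b = below b b ℕₚ.≤-refl
    where
    below : ∀ n j → j ≤ n → P j
    below n       zero    _         = P0
    below (suc n) (suc j) (s≤s j≤n) = step j (λ i i≤j → below n i (ℕₚ.≤-trans i≤j j≤n))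

  ≤-diagonal : ∀ {i j n} → i ℕ.+ j ≡ n → j ≤ n
  ≤-diagonal {i} {j} ≡.refl = ℕₚ.m≤n+m j i

  -- Linear operators that commute with products by power sums commute with everything built from
  -- these by `newton`. This is how the products by e and by g are seen to commute.
  record Operator : Set (c ⊔ ℓ) where
    field
      op      : Λ → Λ
      op-cong : ∀ f g → f ≈Λ g → op f ≈Λ op g
      op-+    : ∀ f g → op (f +Λ g) ≈Λ op f +Λ op g
      op-·    : ∀ x f → op (x ·Λ f) ≈Λ x ·Λ op f
      op-p·   : ∀ k f → op (p· k f) ≈Λ p· k (op f)

    op-diagonalΛ : ∀ F n → op (diagonalΛ F n) ≈Λ diagonalΛ (λ i j → op (F i j)) n
    op-diagonalΛ F zero    t = refl
    op-diagonalΛ F (suc n) t = trans (op-+ _ _ t) (+-congˡ (op-diagonalΛ (F ∘ suc) n t))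

    op-newton : ∀ w b f → op (newton w b f) ≈Λ newton w b (op f)
    op-newton w b f = strong (λ b → op (newton w b f) ≈Λ newton w b (op f)) (λ t → refl) step b
      where
      step : ∀ b → (∀ j → j ≤ b → op (newton w j f) ≈Λ newton w j (op f)) → op (newton w (suc b) f) ≈Λ newton w (suc b) (op f)
      step b ih t = begin
        coeff (op (newton w (suc b) f)) t
          ≈⟨ op-cong _ _ (newton-suc w b f) t ⟩
        coeff (op (w b ·Λ diagonalΛ (λ i j → p· i (newton w j f)) b)) t
          ≈⟨ op-· (w b) _ t ⟩
        w b * coeff (op (diagonalΛ (λ i j → p· i (newton w j f)) b)) t
          ≈⟨ *-congˡ (trans (op-diagonalΛ _ b t) (coeff-diagonalΛ _ b t)) ⟩
        w b * diagonal (λ i j → coeff (op (p· i (newton w j f))) t) b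
          ≈⟨ *-congˡ (diagonal-cong b λ i j e → trans (op-p· i (newton w j f) t)
               (p·-cong i (op (newton w j f)) (newton w j (op f)) (ih j (≤-diagonal {i} e)) t)) ⟩
        w b * diagonal (λ i j → coeff (p· i (newton w j (op f))) t) b
          ≈⟨ coeff-newton-suc w b (op f) t ⟨
        coeff (newton w (suc b) (op f)) t ∎

  p·-operator : ℕ → Operator
  p·-operator k = record
    { op = p· k ; op-cong = p·-cong k ; op-+ = p·-+ k ; op-· = p·-· k ; op-p· = p·-comm k }

  PowerSpan : Λ → Set (c ⊔ ℓ)
  PowerSpan = Span pProduct

  PowerSpan-p· : ∀ k {f} → PowerSpan f → PowerSpan (p· k f)
  PowerSpan-p· k (base ks)  = base (k ∷ ks)
  PowerSpan-p· k null       = resp (λ t → sym (trans (p·-· k 0# 1Λ t) (trans (zeroˡ _) (sym (coeff-0Λ t))))) null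
  PowerSpan-p· k (plus {f} {g} s s′) = resp (≈Λ-sym (p· k (f +Λ g)) (p· k f +Λ p· k g) (p·-+ k f g)) (plus (PowerSpan-p· k s) (PowerSpan-p· k s′))
  PowerSpan-p· k (scale x {f} s) = resp (≈Λ-sym (p· k (x ·Λ f)) (x ·Λ p· k f) (p·-· k x f)) (scale x (PowerSpan-p· k s))
  PowerSpan-p· k (resp {f} {g} e s) = resp (p·-cong k f g e) (PowerSpan-p· k s)

  PowerSpan-newton : ∀ w b {f} → PowerSpan f → PowerSpan (newton w b f)
  PowerSpan-newton w b {f} s = strong (λ b → PowerSpan (newton w b f)) s step b
    where
    powerSums-span : ∀ κ b → (∀ j → j ≤ b → PowerSpan (newton w j f)) →
                     PowerSpan (powerSums κ (newton w b f ∷ previous w b f))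
    powerSums-span κ zero    ih = plus (PowerSpan-p· (κ 0) (ih 0 z≤n)) null
    powerSums-span κ (suc b) ih = plus (PowerSpan-p· (κ 0) (ih (suc b) ℕₚ.≤-refl))
      (powerSums-span (κ ∘ suc) b (λ j j≤b → ih j (ℕₚ.m≤n⇒m≤1+n j≤b)))
    step : ∀ b → (∀ j → j ≤ b → PowerSpan (newton w j f)) → PowerSpan (newton w (suc b) f)
    step b ih = scale (w b) (powerSums-span (λ i → i) b ih)

  indicator-yes : ∀ {P : Set} (d : Dec P) → P → indicator d ≈ 1#
  indicator-yes (yes _) p = refl
  indicator-yes (no ¬p) p = contradiction p ¬p

  indicator-no : ∀ {P : Set} (d : Dec P) → ¬ P → indicator d ≈ 0#
  indicator-no (yes p) ¬p = contradiction p ¬p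
  indicator-no (no _)  ¬p = refl

  module Adjoints (α : Carrier) where

    ι : ℕ → Carrier
    ι k = α * fromℕ (suc k)

    -- The adjoint of the product by p_{k+1}, namely α (k + 1) ∂/∂p_{k+1}, on products of power sums.
    derivative : ℕ → List ℕ → Λ
    derivative k []       = 0Λ
    derivative k (l ∷ ls) = (indicator (l ℕₚ.≟ k) * ι l) ·Λ pProduct ls +Λ p· l (derivative k ls)

    derivative-span : ∀ k ls → PowerSpan (derivative k ls)
    derivative-span k []       = null
    derivative-span k (l ∷ ls) = plus (scale _ (base ls)) (PowerSpan-p· l (derivative-span k ls))

    derivative-↭ : ∀ k {ls ms} → ls ↭ ms → derivative k ls ≈Λ derivative k ms
    derivative-↭ k Perm.refl t = refl
    derivative-↭ k {l ∷ ls} {_ ∷ ms} (prep l p) t = +-cong (*-congˡ (pProduct-↭ p t))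
      (p·-cong l (derivative k ls) (derivative k ms) (derivative-↭ k p) t)
    derivative-↭ k {l ∷ m ∷ ls} {_ ∷ _ ∷ ms} (swap l m p) t = begin
      a l * coeff (p· m (pProduct ls)) t + coeff (p· l (a m ·Λ pProduct ls +Λ p· m (derivative k ls))) t
        ≈⟨ +-congˡ (trans (p·-+ l (a m ·Λ pProduct ls) (p· m (derivative k ls)) t) (+-cong (p·-· l (a m) (pProduct ls) t) (p·-comm l m (derivative k ls) t))) ⟩
      a l * coeff (p· m (pProduct ls)) t + (a m * coeff (p· l (pProduct ls)) t + coeff (p· m (p· l (derivative k ls))) t)
        ≈⟨ solve 3 (λ a b c → a :+ (b :+ c) := b :+ (a :+ c)) refl _ _ _ ⟩
      a m * coeff (p· l (pProduct ls)) t + (a l * coeff (p· m (pProduct ls)) t + coeff (p· m (p· l (derivative k ls))) t)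
        ≈⟨ +-cong (*-congˡ (p·-cong l (pProduct ls) (pProduct ms) (pProduct-↭ p) t)) (trans (sym (trans (p·-+ m (a l ·Λ pProduct ls) (p· l (derivative k ls)) t) (+-congʳ (p·-· m (a l) (pProduct ls) t))))
             (p·-cong m (a l ·Λ pProduct ls +Λ p· l (derivative k ls)) (a l ·Λ pProduct ms +Λ p· l (derivative k ms))
               (λ t → +-cong (*-congˡ (pProduct-↭ p t)) (p·-cong l (derivative k ls) (derivative k ms) (derivative-↭ k p) t)) t)) ⟩
      a m * coeff (p· l (pProduct ms)) t + coeff (p· m (a l ·Λ pProduct ms +Λ p· l (derivative k ms))) t ∎
      where
      a : ℕ → Carrier
      a l = indicator (l ℕₚ.≟ k) * ι l
    derivative-↭ k (Perm.trans p q) t = trans (derivative-↭ k p t) (derivative-↭ k q t)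

    -- Up to `ι k` this is the Euler operator of the variable p_{k+1}, which multiplies a monomial
    -- by its degree in that variable.
    p·-derivative : ∀ k ls → p· k (derivative k ls) ≈Λ (ι k * fromℕ (multiplicity k ls)) ·Λ pProduct ls
    p·-derivative k []       t = trans (p·-· k 0# 1Λ t) (trans (zeroˡ _) (sym (trans (*-congʳ (zeroʳ _)) (zeroˡ _))))
    p·-derivative k (l ∷ ls) t = trans
      (p·-+ k ((indicator (l ℕₚ.≟ k) * ι l) ·Λ pProduct ls) (p· l (derivative k ls)) t)
      (trans (+-cong (p·-· k _ (pProduct ls) t)
        (trans (p·-comm k l (derivative k ls) t) (trans
          (p·-cong l (p· k (derivative k ls)) ((ι k * m) ·Λ pProduct ls) (p·-derivative k ls) t) (p·-· l _ (pProduct ls) t))))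
        (cases (l ℕₚ.≟ k)))
      where
      m : Carrier
      m = fromℕ (multiplicity k ls)
      cases : Dec (l ≡ k) → indicator (l ℕₚ.≟ k) * ι l * coeff (p· k (pProduct ls)) t + ι k * m * coeff (p· l (pProduct ls)) t ≈
              ι k * fromℕ (multiplicity k (l ∷ ls)) * coeff (p· l (pProduct ls)) t
      cases (yes ≡.refl) = trans (+-congʳ (*-congʳ (*-congʳ (indicator-yes (l ℕₚ.≟ k) ≡.refl)))) (trans
        (solve 3 (λ i m p → one :* i :* p :+ i :* m :* p := i :* (one :+ m) :* p) refl (ι k) m (coeff (p· k (pProduct ls)) t))
        (*-congʳ (*-congˡ (fromℕ-cong (≡.sym (multiplicity-here k ls))))))
      cases (no l≢k) = trans (+-congʳ (trans (*-congʳ (trans (*-congʳ (indicator-no (l ℕₚ.≟ k) l≢k)) (zeroˡ _))) (zeroˡ _)))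
        (trans (+-identityˡ _) (*-congʳ (*-congˡ (fromℕ-cong (≡.sym (multiplicity-there {k} {l} ls (l≢k ∘ ≡.sym)))))))

    derivative-∷ : ∀ k ls → derivative k (k ∷ ls) ≈Λ (ι k * fromℕ (suc (multiplicity k ls))) ·Λ pProduct ls
    derivative-∷ k ls t = trans (+-cong (*-congʳ (*-congʳ (indicator-yes (k ℕₚ.≟ k) ≡.refl))) (p·-derivative k ls t))
      (solve 3 (λ i m p → one :* i :* p :+ i :* m :* p := i :* (one :+ m) :* p) refl (ι k) _ (coeff (pProduct ls) t))

    derivative-∉ : ∀ k ls → ¬ k ∈ ls → derivative k ls ≈Λ 0Λ
    derivative-∉ k []       k∉ t = refl
    derivative-∉ k (l ∷ ls) k∉ t = trans (+-cong
        (trans (*-congʳ (trans (*-congʳ (indicator-no (l ℕₚ.≟ k) λ l≡k → k∉ (here (≡.sym l≡k)))) (zeroˡ _))) (zeroˡ _))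
        (trans (p·-cong l (derivative k ls) 0Λ (derivative-∉ k ls (k∉ ∘ there)) t) (trans (p·-· l 0# 1Λ t) (zeroˡ _))))
      (trans (+-identityˡ 0#) (sym (coeff-0Λ t)))

    -- Both sides are the coefficient of y^{b+1} in y d/dy of p_{l₁}[X + y] p_{l₂}[X + y] ⋯ , times α.
    derivative-slices : ∀ ls b t → diagonal (λ i j → coeff (derivative i ls) (j ∷ t)) b ≈ ι b * coeff (pProduct ls) (suc b ∷ t)
    derivative-slices [] b t = trans (diagonal-cong b λ i j _ → coeff-0Λ (j ∷ t))
      (trans (diagonal-0 b) (sym (trans (*-congˡ (coeff-1Λ-suc b t)) (zeroʳ _))))
    derivative-slices (l ∷ ls) b t = begin
      diagonal (λ i j → indicator (l ℕₚ.≟ i) * ι l * π j + coeff (p· l (derivative i ls)) (j ∷ t)) b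
        ≈⟨ diagonal-cong b (λ i j _ → +-cong (trans (*-congʳ (*-comm _ _)) (*-assoc _ _ _)) (coeff-p· l (derivative i ls) (j ∷ t))) ⟩
      diagonal (λ i j → ι l * (indicator (l ℕₚ.≟ i) * π j) + (shiftᶠ (suc l) (ψ i) j + powerShift (suc l) (λ a → coeff (derivative i ls) (j ∷ a)) t)) b
        ≈⟨ trans (diagonal-+ _ _ b) (+-cong (trans (diagonal-* _ _ b) (*-congˡ (diagonal-indicator l π b))) (diagonal-+ _ _ b)) ⟩
      ι l * shiftᶠ l π b + (diagonal (λ i j → shiftᶠ (suc l) (ψ i) j) b +
        diagonal (λ i j → powerShift (suc l) (λ a → coeff (derivative i ls) (j ∷ a)) t) b)
        ≈⟨ +-congˡ (+-cong (trans (diagonal-shift (suc l) ψ b) (shift-cong (suc l) b (λ b → derivative-slices ls b t)))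
             (trans (diagonal-powerShift (suc l) (λ i j a → coeff (derivative i ls) (j ∷ a)) b t)
               (trans (powerShift-cong (suc l) t (λ a → derivative-slices ls b a)) (powerShift-* (suc l) (ι b) _ t)))) ⟩
      ι l * shiftᶠ l π b + (shiftᶠ (suc l) (λ b → ι b * π (suc b)) b + ι b * powerShift (suc l) (λ a → coeff (pProduct ls) (suc b ∷ a)) t)
        ≈⟨ trans (sym (+-assoc _ _ _)) (+-congʳ (euler l b)) ⟩
      ι b * shiftᶠ l π b + ι b * powerShift (suc l) (λ a → coeff (pProduct ls) (suc b ∷ a)) t
        ≈⟨ distribˡ (ι b) _ _ ⟨
      ι b * (shiftᶠ l π b + powerShift (suc l) (λ a → coeff (pProduct ls) (suc b ∷ a)) t)
        ≈⟨ *-congˡ (coeff-p· l (pProduct ls) (suc b ∷ t)) ⟨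
      ι b * coeff (p· l (pProduct ls)) (suc b ∷ t) ∎
      where
      π : ℕ → Carrier
      π x = coeff (pProduct ls) (x ∷ t)
      ψ : ℕ → ℕ → Carrier
      ψ i x = coeff (derivative i ls) (x ∷ t)
      diagonal-shift : ∀ m (ψ : ℕ → ℕ → Carrier) b → diagonal (λ i j → shiftᶠ m (ψ i) j) b ≈ shiftᶠ m (diagonal ψ) b
      diagonal-shift zero    ψ b       = refl
      diagonal-shift (suc m) ψ zero    = refl
      diagonal-shift (suc m) ψ (suc b) = trans (diagonal-last (λ i j → shiftᶠ (suc m) (ψ i) j) b) (trans (+-identityʳ _) (diagonal-shift m ψ b))
      -- Leibniz' rule for y^(l+1) π(y): where the coefficient of π has index b - l, the weights l +
      -- 1 and b - l add up to b + 1.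
      euler : ∀ l b → ι l * shiftᶠ l π b + shiftᶠ (suc l) (λ b → ι b * π (suc b)) b ≈ ι b * shiftᶠ l π b
      euler zero    zero    = +-identityʳ _
      euler zero    (suc b) = solve 3 (λ a k p → a :* (one :+ nil) :* p :+ a :* k :* p := a :* (one :+ k) :* p) refl α (fromℕ (suc b)) (π (suc b))
      euler (suc l) zero    = trans (+-identityʳ _) (trans (zeroʳ _) (sym (zeroʳ _)))
      euler (suc l) (suc b) = begin
        ι (suc l) * shiftᶠ l π b + shiftᶠ (suc l) (λ b → ι b * π (suc b)) b
          ≈⟨ solve 4 (λ a k p s → a :* (one :+ k) :* p :+ s := a :* p :+ (a :* k :* p :+ s)) refl α (fromℕ (suc l)) (shiftᶠ l π b) _ ⟩
        α * shiftᶠ l π b + (ι l * shiftᶠ l π b + shiftᶠ (suc l) (λ b → ι b * π (suc b)) b)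
          ≈⟨ +-congˡ (euler l b) ⟩
        α * shiftᶠ l π b + ι b * shiftᶠ l π b
          ≈⟨ solve 3 (λ a k p → a :* p :+ a :* k :* p := a :* (one :+ k) :* p) refl α (fromℕ (suc b)) (shiftᶠ l π b) ⟩
        ι (suc b) * shiftᶠ l π b ∎

    module PowerForm (form : BilinearForm)
      (values : ∀ λ′ ν → BilinearForm.⟨_,_⟩ form (powerSum λ′) (powerSum ν) ≈
                         δ (parts λ′) (parts ν) * (fromℕ (z λ′) * α ^ length (parts λ′))) where

      open Form form

      norm : List ℕ → Carrier
      norm ks = fromℕ (weight ks) * α ^ length ks

      private
        pProduct-powerSum : ∀ ks → pProduct ks ≈Λ powerSum (toPartition (map suc ks))
        pProduct-powerSum ks t with type-suc ks
        ... | ls , e , p = trans (pProduct-↭ p t) (sym (powerSum-parts (toPartition (map suc ks)) ls e t))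

        δ-yes : ∀ {t u} → t ≡ u → δ t u ≈ 1#
        δ-yes {t} {u} = indicator-yes (≡-dec ℕₚ._≟_ t u)

        pairing : ∀ ks ls → ⟨ pProduct ks , pProduct ls ⟩ ≈ δ (type (map suc ks)) (type (map suc ls)) * norm ks
        pairing ks ls = begin
          ⟨ pProduct ks , pProduct ls ⟩
            ≈⟨ ⟨⟩-cong _ _ _ _ (pProduct-powerSum ks) (pProduct-powerSum ls) ⟩
          ⟨ powerSum (toPartition (map suc ks)) , powerSum (toPartition (map suc ls)) ⟩
            ≈⟨ values (toPartition (map suc ks)) (toPartition (map suc ls)) ⟩
          δ (type (map suc ks)) (type (map suc ls)) *
            (fromℕ (z (toPartition (map suc ks))) * α ^ length (type (map suc ks)))
            ≈⟨ *-congˡ (*-cong (fromℕ-cong (z-toPartition ks)) (reflexive (≡.cong (α ^_)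
                 (≡.trans (↭-length (type-map-suc ks)) (length-map suc ks))))) ⟩
          δ (type (map suc ks)) (type (map suc ls)) * norm ks ∎

      pairing-↭ : ∀ {ks ls} → ks ↭ ls → ⟨ pProduct ks , pProduct ls ⟩ ≈ norm ks
      pairing-↭ {ks} {ls} p = trans (pairing ks ls) (trans (*-congʳ (δ-yes (type-↭ (map⁺ suc p)))) (*-identityˡ _))

      pairing-≁ : ∀ {ks ls} → ¬ (ks ↭ ls) → ⟨ pProduct ks , pProduct ls ⟩ ≈ 0#
      pairing-≁ {ks} {ls} ≁ = trans (pairing ks ls) (trans (*-congʳ (δ-≢ {type (map suc ks)} {type (map suc ls)} λ e →
        ≁ (map-suc-↭⁻ (↭-trans (↭-sym (type-map-suc ks)) (↭-trans (↭-reflexive e) (type-map-suc ls)))))) (zeroˡ _))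

      norm-∷ : ∀ k ks → norm (k ∷ ks) ≈ ι k * fromℕ (suc (multiplicity k ks)) * norm ks
      norm-∷ k ks = begin
        fromℕ (weight (k ∷ ks)) * (α * α ^ length ks)
          ≈⟨ *-congʳ (trans (fromℕ-cong (weight-∷ k ks)) (trans (fromℕ-* (suc k ℕ.* suc (multiplicity k ks)) (weight ks))
               (*-congʳ (fromℕ-* (suc k) (suc (multiplicity k ks)))))) ⟩
        fromℕ (suc k) * fromℕ (suc (multiplicity k ks)) * fromℕ (weight ks) * (α * α ^ length ks)
          ≈⟨ solve 5 (λ k m w a p → k :* m :* w :* (a :* p) := a :* k :* m :* (w :* p)) refl
               (fromℕ (suc k)) (fromℕ (suc (multiplicity k ks))) (fromℕ (weight ks)) α (α ^ length ks) ⟩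
        ι k * fromℕ (suc (multiplicity k ks)) * norm ks ∎

      -- If `k` does not occur in `ls` both sides vanish. Otherwise one occurrence is removed, and
      -- what remains is the ratio of norms given by `norm-∷`.
      p·-adjoint-base : ∀ k ks ls → ⟨ p· k (pProduct ks) , pProduct ls ⟩ ≈ ⟨ pProduct ks , derivative k ls ⟩
      p·-adjoint-base k ks ls = case Any.any? (k ℕₚ.≟_) ls of λ where
          (no k∉) → trans (pairing-≁ {k ∷ ks} {ls} (λ p → k∉ (∈-resp-↭ p (here ≡.refl))))
            (sym (trans (⟨⟩-congʳ _ (derivative-∉ k ls k∉)) (⟨,0⟩ _)))
          (yes k∈) → case ∈-∃++ k∈ of λ where
            (us , vs , ≡.refl) → found (us ++ vs) (shift k us vs)
        where
        found : ∀ ms → ls ↭ k ∷ ms → ⟨ p· k (pProduct ks) , pProduct ls ⟩ ≈ ⟨ pProduct ks , derivative k ls ⟩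
        found ms p = begin
          ⟨ pProduct (k ∷ ks) , pProduct ls ⟩        ≈⟨ compare (ks ↭? ms) ⟩
          (ι k * fromℕ (suc (multiplicity k ms))) * ⟨ pProduct ks , pProduct ms ⟩  ≈⟨ ·-linearʳ _ _ _ ⟨
          ⟨ pProduct ks , (ι k * fromℕ (suc (multiplicity k ms))) ·Λ pProduct ms ⟩
            ≈⟨ ⟨⟩-congʳ _ (λ t → trans (derivative-↭ k p t) (derivative-∷ k ms t)) ⟨
          ⟨ pProduct ks , derivative k ls ⟩          ∎
          where
          compare : Dec (ks ↭ ms) → ⟨ pProduct (k ∷ ks) , pProduct ls ⟩ ≈
                    (ι k * fromℕ (suc (multiplicity k ms))) * ⟨ pProduct ks , pProduct ms ⟩
          compare (yes q) = trans (pairing-↭ (↭-trans (prep k q) (↭-sym p))) (trans (norm-∷ k ks)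
            (*-cong (*-congˡ (fromℕ-cong (≡.cong suc (multiplicity-↭ k q)))) (sym (pairing-↭ q))))
          compare (no ≁) = trans (pairing-≁ (λ q → ≁ (drop-∷ (↭-trans q p))))
            (sym (trans (*-congˡ (pairing-≁ ≁)) (zeroʳ _)))

      p·-adjoint : ∀ k {f} ls → PowerSpan f → ⟨ p· k f , pProduct ls ⟩ ≈ ⟨ f , derivative k ls ⟩
      p·-adjoint k ls (base ks) = p·-adjoint-base k ks ls
      p·-adjoint k ls null = trans (⟨⟩-congˡ {p· k 0Λ} {0# ·Λ p· k 1Λ} _ (p·-· k 0# 1Λ)) (trans (·-linearˡ 0# (p· k 1Λ) _) (trans (zeroˡ _) (sym (⟨0,⟩ _))))
      p·-adjoint k ls (plus {f} {g} s s′) = trans (⟨⟩-congˡ _ (p·-+ k f g)) (trans (+-linearˡ _ _ _)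
        (trans (+-cong (p·-adjoint k ls s) (p·-adjoint k ls s′)) (sym (+-linearˡ _ _ _))))
      p·-adjoint k ls (scale x {f} s) = trans (⟨⟩-congˡ _ (p·-· k x f)) (trans (·-linearˡ _ _ _)
        (trans (*-congˡ (p·-adjoint k ls s)) (sym (·-linearˡ _ _ _))))
      p·-adjoint k ls (resp {f} {g} e s) = trans (⟨⟩-congˡ _ (p·-cong k g f (≈Λ-sym f g e)))
        (trans (p·-adjoint k ls s) (⟨⟩-congˡ _ e))

      ⟨⟩-diagonalˡ : ∀ F g n → ⟨ diagonalΛ F n , g ⟩ ≈ diagonal (λ i j → ⟨ F i j , g ⟩) n
      ⟨⟩-diagonalˡ F g zero    = refl
      ⟨⟩-diagonalˡ F g (suc n) = trans (+-linearˡ _ _ _) (+-congˡ (⟨⟩-diagonalˡ (F ∘ suc) g n))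

      ⟨⟩-diagonalʳ : ∀ f G n → ⟨ f , diagonalΛ G n ⟩ ≈ diagonal (λ i j → ⟨ f , G i j ⟩) n
      ⟨⟩-diagonalʳ f G zero    = refl
      ⟨⟩-diagonalʳ f G (suc n) = trans (+-linearʳ _ _ _) (+-congˡ (⟨⟩-diagonalʳ f (G ∘ suc) n))

      module _ (w : ℕ → Carrier) (w-inverse : ∀ b → w b * ι b ≈ 1#) {f} (f-span : PowerSpan f) where

        -- The product by g_b is adjoint to taking the coefficient of y^b after adding a variable y.
        newton-adjoint : ∀ b {h} → PowerSpan h → ⟨ newton w b f , h ⟩ ≈ ⟨ f , slice b h ⟩
        newton-adjoint b = strong (λ b → ∀ {h} → PowerSpan h → ⟨ newton w b f , h ⟩ ≈ ⟨ f , slice b h ⟩)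
            (λ {h} _ → ⟨⟩-congʳ f (λ t → sym (coeff-0∷ h t)))
            (λ b ih → extend (suc b) (step b ih)) b
          where
          extend : ∀ b → (∀ ls → ⟨ newton w b f , pProduct ls ⟩ ≈ ⟨ f , slice b (pProduct ls) ⟩) →
                   ∀ {h} → PowerSpan h → ⟨ newton w b f , h ⟩ ≈ ⟨ f , slice b h ⟩
          extend b e (base ls)    = e ls
          extend b e null         = trans (⟨,0⟩ _) (sym (trans (⟨⟩-congʳ f {slice b 0Λ} {0Λ} (λ t → trans (coeff-0Λ (b ∷ t)) (sym (coeff-0Λ t)))) (⟨,0⟩ f)))
          extend b e (plus {g} {h} s s′) = trans (+-linearʳ _ _ _) (trans (+-cong (extend b e s) (extend b e s′))
            (trans (sym (+-linearʳ f (slice b g) (slice b h))) (⟨⟩-congʳ f λ t → refl)))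
          extend b e (scale x {h} s) = trans (·-linearʳ x _ _) (trans (*-congˡ (extend b e s))
            (trans (sym (·-linearʳ x f (slice b h))) (⟨⟩-congʳ f λ t → refl)))
          extend b e (resp {g} {h} q s) = trans (⟨⟩-congʳ (newton w b f) (≈Λ-sym g h q)) (trans (extend b e s)
            (⟨⟩-congʳ f {slice b g} {slice b h} (λ t → q (b ∷ t))))
          step : ∀ b → (∀ j → j ≤ b → ∀ {h} → PowerSpan h → ⟨ newton w j f , h ⟩ ≈ ⟨ f , slice j h ⟩) →
                 ∀ ls → ⟨ newton w (suc b) f , pProduct ls ⟩ ≈ ⟨ f , slice (suc b) (pProduct ls) ⟩
          step b ih ls = begin
            ⟨ newton w (suc b) f , pProduct ls ⟩
              ≈⟨ trans (⟨⟩-congˡ _ (newton-suc w b f)) (·-linearˡ _ _ _) ⟩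
            w b * ⟨ diagonalΛ (λ i j → p· i (newton w j f)) b , pProduct ls ⟩
              ≈⟨ *-congˡ (⟨⟩-diagonalˡ _ _ b) ⟩
            w b * diagonal (λ i j → ⟨ p· i (newton w j f) , pProduct ls ⟩) b
              ≈⟨ *-congˡ (diagonal-cong b λ i j e → trans (p·-adjoint i ls (PowerSpan-newton w j f-span))
                   (ih j (≤-diagonal {i} e) (derivative-span i ls))) ⟩
            w b * diagonal (λ i j → ⟨ f , slice j (derivative i ls) ⟩) b
              ≈⟨ *-congˡ (⟨⟩-diagonalʳ f (λ i j → slice j (derivative i ls)) b) ⟨
            w b * ⟨ f , diagonalΛ (λ i j → slice j (derivative i ls)) b ⟩
              -- By `derivative-slices` the sum is `ι b` times the next slice, and `w b` is the
              -- inverse of `ι b`.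
              ≈⟨ *-congˡ (trans (⟨⟩-congʳ f {g′ = ι b ·Λ slice (suc b) (pProduct ls)} (λ t → trans (coeff-diagonalΛ _ b t) (derivative-slices ls b t)))
                   (·-linearʳ (ι b) f (slice (suc b) (pProduct ls)))) ⟩
            w b * (ι b * ⟨ f , slice (suc b) (pProduct ls) ⟩)
              ≈⟨ trans (sym (*-assoc _ _ _)) (trans (*-congʳ (w-inverse b)) (*-identityˡ _)) ⟩
            ⟨ f , slice (suc b) (pProduct ls) ⟩ ∎

  -- Products of e and g

  elementaryShift-vanishes : ∀ a f t → length t < a → elementaryShift a f t ≈ 0#
  elementaryShift-vanishes (suc a) f []       _         = refl
  elementaryShift-vanishes (suc a) f (x ∷ xs) (s≤s lt) = trans
    (+-cong (elementaryShift-vanishes (suc a) _ xs (ℕₚ.m<n⇒m<1+n lt)) (-‿cong (elementaryShift-vanishes a _ xs lt)))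
    (-‿inverseʳ 0#)

  -- In exactly as many variables as its degree, an elementary function is the product of all the
  -- variables.
  elementaryShift-top : ∀ f t → elementaryShift (length t) f (map suc t) ≈ (- 1#) ^ length t * f t
  elementaryShift-top f []       = sym (*-identityˡ _)
  elementaryShift-top f (x ∷ xs) = begin
    elementaryShift (suc (length xs)) (λ b → f (suc x ∷ b)) (map suc xs) - elementaryShift (length xs) (λ b → f (x ∷ b)) (map suc xs)
      ≈⟨ +-cong (elementaryShift-vanishes (suc (length xs)) _ (map suc xs) (s≤s (ℕₚ.≤-reflexive (length-map suc xs))))
           (-‿cong (elementaryShift-top (λ b → f (x ∷ b)) xs)) ⟩
    0# - (- 1#) ^ length xs * f (x ∷ xs)
      ≈⟨ solve 2 (λ p y → nil :- p :* y := (:- one) :* p :* y) refl _ _ ⟩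
    - 1# * (- 1#) ^ length xs * f (x ∷ xs) ∎

  ones : ℕ → List ℕ
  ones n = replicate n 1

  powerShift-ones : ∀ f n → powerShift 1 (coeff f) (ones (suc n)) ≈ fromℕ (suc n) * coeff f (ones n)
  powerShift-ones f zero    = begin
    coeff f (0 ∷ []) + 0#        ≈⟨ +-identityʳ _ ⟩
    coeff f (0 ∷ [])             ≈⟨ coeff-0∷ f [] ⟩
    coeff f []                   ≈⟨ solve 1 (λ y → y := (one :+ nil) :* y) refl _ ⟩
    fromℕ 1 * coeff f []         ∎
  powerShift-ones f (suc n) = begin
    coeff f (0 ∷ ones (suc n)) + powerShift 1 (coeff (slice 1 f)) (ones (suc n))
      ≈⟨ +-cong (coeff-0∷ f (ones (suc n))) (powerShift-ones (slice 1 f) n) ⟩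
    coeff f (ones (suc n)) + fromℕ (suc n) * coeff f (ones (suc n))
      ≈⟨ solve 2 (λ y k → y :+ k :* y := (one :+ k) :* y) refl _ _ ⟩
    fromℕ (suc (suc n)) * coeff f (ones (suc n)) ∎

  powerShift-ones-0 : ∀ k f n → powerShift (suc (suc k)) f (ones n) ≈ 0#
  powerShift-ones-0 k f zero    = refl
  powerShift-ones-0 k f (suc n) = trans (+-identityˡ _) (powerShift-ones-0 k (λ b → f (1 ∷ b)) n)

  -- All exponents are at most 1, so the only power sum that contributes is p_1.
  newton-ones : ∀ w b f n →
    coeff (newton w (suc b) f) (ones (suc n)) ≈ w b * (fromℕ (suc n) * coeff (newton w b f) (ones n))
  newton-ones w b f n = trans (coeff-newton-suc w b f (ones (suc n))) (*-congˡ (only b))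
    where
    first : ∀ b → coeff (p· 0 (newton w b f)) (ones (suc n)) ≈ fromℕ (suc n) * coeff (newton w b f) (ones n)
    first b = trans (coeff-p· 0 (newton w b f) (ones (suc n))) (powerShift-ones (newton w b f) n)
    only : ∀ b → diagonal (λ i j → coeff (p· i (newton w j f)) (ones (suc n))) b ≈ fromℕ (suc n) * coeff (newton w b f) (ones n)
    only zero    = first 0
    only (suc b) = trans (+-cong (first (suc b)) (trans (diagonal-cong b λ i j _ →
      trans (coeff-p· (suc i) (newton w j f) (ones (suc n))) (powerShift-ones-0 i (coeff (newton w j f)) (suc n))) (diagonal-0 b))) (+-identityʳ _)

  partial : (ℕ → ℕ → Carrier) → ℕ → ℕ → Carrier
  partial φ zero    n = φ 0 n
  partial φ (suc s) n = partial φ s n + φ (suc s) (n ∸ suc s)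

  partial-diagonal : ∀ φ n → partial φ n n ≈ diagonal φ n
  partial-diagonal φ zero    = refl
  partial-diagonal φ (suc n) = begin
    partial φ n (suc n) + φ (suc n) (n ∸ n)
      ≈⟨ +-cong (shifted n ℕₚ.≤-refl) (reflexive (≡.cong (φ (suc n)) (ℕₚ.n∸n≡0 n))) ⟩
    partial (λ a b → φ a (suc b)) n n + φ (suc n) 0
      ≈⟨ +-congʳ (partial-diagonal (λ a b → φ a (suc b)) n) ⟩
    diagonal (λ a b → φ a (suc b)) n + φ (suc n) 0
      ≈⟨ diagonal-last φ n ⟨
    diagonal φ (suc n) ∎
    where
    shifted : ∀ s → s ≤ n → partial φ s (suc n) ≈ partial (λ a b → φ a (suc b)) s n
    shifted zero    _   = refl
    shifted (suc s) s<n = +-cong (shifted s (ℕₚ.<⇒≤ s<n))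
      (reflexive (≡.cong (φ (suc s)) (ℕₚ.+-∸-assoc 1 s<n)))

  partial-tail : ∀ φ s n → (∀ a → s < a → φ a (n ∸ a) ≈ 0#) → ∀ d → partial φ (d ℕ.+ s) n ≈ partial φ s n
  partial-tail φ s n e zero    = refl
  partial-tail φ s n e (suc d) = trans (+-cong (partial-tail φ s n e d) (e (suc (d ℕ.+ s)) (s≤s (ℕₚ.m≤n+m s d)))) (+-identityʳ _)

  armProduct : Carrier → ℕ → Carrier
  armProduct x zero    = 1#
  armProduct x (suc b) = armProduct x b * (1# + x * fromℕ b)

  -- The product of `x * arm + leg + 1` over the cells of the hook with first row `suc p` and `s`
  -- further rows: the leg gives `s !`, the corner the middle factor, the rest of the row
  -- `armProduct`.
  hookValue : Carrier → ℕ → ℕ → Carrier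
  hookValue x p s = fromℕ (s !) * (x * fromℕ p + fromℕ (suc s)) * armProduct x p

  module _ (x y : Carrier) (xy≈1 : x * y ≈ 1#) where

    armProduct-rising : ∀ p → x ^ p * armProduct y p ≈ rising x p
    armProduct-rising zero    = *-identityˡ 1#
    armProduct-rising (suc p) = begin
      x * x ^ p * (armProduct y p * (1# + y * fromℕ p))
        ≈⟨ solve 5 (λ x q a y p → x :* q :* (a :* (one :+ y :* p)) := (x :+ x :* y :* p) :* (q :* a)) refl
             x (x ^ p) (armProduct y p) y (fromℕ p) ⟩
      (x + x * y * fromℕ p) * (x ^ p * armProduct y p)
        ≈⟨ *-cong (+-congˡ (trans (*-congʳ xy≈1) (*-identityˡ _))) (armProduct-rising p) ⟩
      (x + fromℕ p) * rising x p ∎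

    -- One factor `x` multiplies the corner factor into `p + x + s * x`. The summand `s * x` gives
    -- the board C, the summand `x + p` extends the rising factorial and gives the board D.
    hookValue-rising : ∀ p s → x ^ (suc p ℕ.+ s) * hookValue y p s ≈
      fromℕ (s ℕ.* s !) * (rising x p * x ^ suc s) + fromℕ (s !) * (rising x (suc p) * x ^ s)
    hookValue-rising p s = begin
      x * x ^ (p ℕ.+ s) * (fromℕ (s !) * (y * fromℕ p + (1# + fromℕ s)) * armProduct y p)
        ≈⟨ *-congʳ (*-congˡ (^-homo-* x p s)) ⟩
      x * (x ^ p * x ^ s) * (fromℕ (s !) * (y * fromℕ p + (1# + fromℕ s)) * armProduct y p)
        ≈⟨ solve 8 (λ x q r f y p s a → x :* (q :* r) :* (f :* (y :* p :+ (one :+ s)) :* a) :=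
             f :* ((x :* y :* p :+ (x :+ s :* x)) :* (r :* (q :* a)))) refl
             x (x ^ p) (x ^ s) (fromℕ (s !)) y (fromℕ p) (fromℕ s) (armProduct y p) ⟩
      fromℕ (s !) * ((x * y * fromℕ p + (x + fromℕ s * x)) * (x ^ s * (x ^ p * armProduct y p)))
        ≈⟨ *-congˡ (*-cong (+-congʳ (trans (*-congʳ xy≈1) (*-identityˡ _))) (*-congˡ (armProduct-rising p))) ⟩
      fromℕ (s !) * ((fromℕ p + (x + fromℕ s * x)) * (x ^ s * rising x p))
        ≈⟨ solve 6 (λ f p x s r a → f :* ((p :+ (x :+ s :* x)) :* (r :* a)) :=
             s :* f :* (a :* (x :* r)) :+ f :* ((x :+ p) :* a :* r)) refl
             (fromℕ (s !)) (fromℕ p) x (fromℕ s) (x ^ s) (rising x p) ⟩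
      fromℕ s * fromℕ (s !) * (rising x p * (x * x ^ s)) + fromℕ (s !) * ((x + fromℕ p) * rising x p * x ^ s)
        ≈⟨ +-congʳ (*-congʳ (fromℕ-* s (s !))) ⟨
      fromℕ (s ℕ.* s !) * (rising x p * x ^ suc s) + fromℕ (s !) * (rising x (suc p) * x ^ s) ∎
      where open import Algebra.Properties.Semiring.Exp semiring using (^-homo-*)

  -- The hook Jack function up to a scalar

  module Hooks (α α⁻¹ : Carrier) (α-inverse : α⁻¹ * α ≈ 1#)
               (inv : ℕ → Carrier) (inv-inverse : ∀ b → inv b * fromℕ (suc b) ≈ 1#) where

    open Adjoints α

    -- The constants come from the logarithmic derivatives of the generating series: with `suc`
    -- removed from the indices, a e_a and α b g_b are sums of power sums times earlier terms, up to
    -- the signs absorbed in E.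
    wᴱ wᴳ : ℕ → Carrier
    wᴱ b = - inv b
    wᴳ b = α⁻¹ * inv b

    wᴱ-inverse : ∀ b → fromℕ (suc b) * wᴱ b ≈ - 1#
    wᴱ-inverse b = trans (solve 2 (λ k i → k :* :- i := :- (i :* k)) refl _ _) (-‿cong (inv-inverse b))

    wᴳ-inverse : ∀ b → wᴳ b * ι b ≈ 1#
    wᴳ-inverse b = trans (solve 4 (λ β i a k → β :* i :* (a :* k) := (β :* a) :* (i :* k)) refl _ _ _ _)
      (trans (*-cong α-inverse (inv-inverse b)) (*-identityˡ 1#))

    -- The product by (-1)^a e_a, and the product by g_b, where Σ g_b y^b = Π (1 - xᵢ y)^{-1/α}.
    E G : ℕ → Λ → Λ
    E = newton wᴱ
    G = newton wᴳ

    -- Two views of the same product: the recursion shows that it commutes with power sums, the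
    -- explicit coefficients show linearity and vanishing in few variables.
    coeff-E : ∀ a f t → coeff (E a f) t ≈ elementaryShift a (coeff f) t
    coeff-E a f = strong (λ a → ∀ t → coeff (E a f) t ≈ elementaryShift a (coeff f) t) (λ t → refl) step a
      where
      step : ∀ a → (∀ j → j ≤ a → ∀ t → coeff (E j f) t ≈ elementaryShift j (coeff f) t) →
             ∀ t → coeff (E (suc a) f) t ≈ elementaryShift (suc a) (coeff f) t
      step a ih t = begin
        coeff (E (suc a) f) t
          ≈⟨ coeff-newton-suc wᴱ a f t ⟩
        wᴱ a * diagonal (λ i j → coeff (p· i (E j f)) t) a
          ≈⟨ *-congˡ (diagonal-cong a λ i j e → trans (coeff-p· i (E j f) t) (powerShift-cong (suc i) t (ih j (≤-diagonal {i} e)))) ⟩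
        wᴱ a * D
          ≈⟨ solve 3 (λ i d x → :- i :* d := i :* x :- i :* (x :+ d)) refl (inv a) D (fromℕ (suc a) * X) ⟩
        inv a * (fromℕ (suc a) * X) - inv a * (fromℕ (suc a) * X + D)
          ≈⟨ +-cong (trans (sym (*-assoc _ _ _)) (trans (*-congʳ (inv-inverse a)) (*-identityˡ X)))
               (-‿cong (trans (*-congˡ (newton-elementary a (coeff f) t)) (zeroʳ _))) ⟩
        X - 0#
          ≈⟨ solve 1 (λ x → x :- nil := x) refl X ⟩
        X ∎
        where
        D X : Carrier
        D = diagonal (λ i j → powerShift (suc i) (elementaryShift j (coeff f)) t) a
        X = elementaryShift (suc a) (coeff f) t

    E-operator : ℕ → Operator
    E-operator a = record
      { op      = E a
      ; op-cong = λ f g e t → trans (coeff-E a f t) (trans (elementaryShift-cong a t e) (sym (coeff-E a g t)))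
      ; op-+    = λ f g t → trans (coeff-E a (f +Λ g) t) (trans (elementaryShift-+ a (coeff f) (coeff g) t)
          (sym (+-cong (coeff-E a f t) (coeff-E a g t))))
      ; op-·    = λ x f t → trans (coeff-E a (x ·Λ f) t) (trans (elementaryShift-* a x (coeff f) t) (sym (*-congˡ (coeff-E a f t))))
      ; op-p·   = λ k f t → sym (Operator.op-newton (p·-operator k) wᴱ a f t)
      }

    E-G-comm : ∀ a b f → E a (G b f) ≈Λ G b (E a f)
    E-G-comm a b f = Operator.op-newton (E-operator a) wᴳ b f

    EG : ℕ → ℕ → Λ
    EG a b = E a (G b 1Λ)

    ι-EG-suc : ∀ a b t → ι b * coeff (EG a (suc b)) t ≈ diagonal (λ k j → coeff (p· k (EG a j)) t) b
    ι-EG-suc a b t = begin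
      ι b * coeff (E a (G (suc b) 1Λ)) t
        ≈⟨ *-congˡ (op-cong _ _ (newton-suc wᴳ b 1Λ) t) ⟩
      ι b * coeff (E a (wᴳ b ·Λ diagonalΛ (λ i j → p· i (G j 1Λ)) b)) t
        ≈⟨ *-congˡ (op-· (wᴳ b) _ t) ⟩
      ι b * (wᴳ b * coeff (E a (diagonalΛ (λ i j → p· i (G j 1Λ)) b)) t)
        ≈⟨ trans (sym (*-assoc _ _ _)) (trans (*-congʳ (trans (*-comm _ _) (wᴳ-inverse b))) (*-identityˡ _)) ⟩
      coeff (E a (diagonalΛ (λ i j → p· i (G j 1Λ)) b)) t
        ≈⟨ trans (op-diagonalΛ _ b t) (coeff-diagonalΛ _ b t) ⟩
      diagonal (λ i j → coeff (E a (p· i (G j 1Λ))) t) b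
        ≈⟨ diagonal-cong b (λ i j _ → op-p· i (G j 1Λ) t) ⟩
      diagonal (λ i j → coeff (p· i (EG a j)) t) b ∎
      where open Operator (E-operator a)

    EG-suc : ∀ a b t → fromℕ (suc a) * coeff (EG (suc a) b) t ≈ - diagonal (λ k i → coeff (p· k (EG i b)) t) a
    EG-suc a b t = begin
      fromℕ (suc a) * coeff (EG (suc a) b) t
        ≈⟨ *-congˡ (coeff-newton-suc wᴱ a (G b 1Λ) t) ⟩
      fromℕ (suc a) * (wᴱ a * diagonal (λ k i → coeff (p· k (EG i b)) t) a)
        ≈⟨ trans (sym (*-assoc _ _ _)) (*-congʳ (wᴱ-inverse a)) ⟩
      - 1# * diagonal (λ k i → coeff (p· k (EG i b)) t) a
        ≈⟨ solve 1 (λ d → :- one :* d := :- d) refl _ ⟩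
      - diagonal (λ k i → coeff (p· k (EG i b)) t) a ∎

    hookTerm : ℕ → ℕ → Λ
    hookTerm a b = (α * fromℕ b + fromℕ a) ·Λ EG a b

    -- From α E(-y) G′(y) + E(-y)′ G(y) = 0.
    hookTerms-vanish : ∀ n t → diagonal (λ a b → coeff (hookTerm a b) t) n ≈ 0#
    hookTerms-vanish zero    t = trans (*-congʳ (trans (+-identityʳ _) (zeroʳ α))) (zeroˡ _)
    hookTerms-vanish (suc m) t = begin
      diagonal (λ a b → (α * fromℕ b + fromℕ a) * w a b) (suc m)
        ≈⟨ trans (diagonal-cong (suc m) (λ a b _ → distribʳ (w a b) (α * fromℕ b) (fromℕ a)))
             (diagonal-+ (λ a b → α * fromℕ b * w a b) (λ a b → fromℕ a * w a b) (suc m)) ⟩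
      diagonal (λ a b → α * fromℕ b * w a b) (suc m) + diagonal (λ a b → fromℕ a * w a b) (suc m)
        ≈⟨ +-cong (trans (diagonal-last (λ a b → α * fromℕ b * w a b) m) (trans (+-congˡ (trans (*-congʳ (zeroʳ α)) (zeroˡ _))) (+-identityʳ _)))
             (trans (+-congʳ (zeroˡ _)) (+-identityˡ _)) ⟩
      diagonal (λ a b → ι b * w a (suc b)) m + diagonal (λ a b → fromℕ (suc a) * w (suc a) b) m
        ≈⟨ +-cong (diagonal-cong m λ a b _ → ι-EG-suc a b t)
             (diagonal-cong m λ a b _ → trans (EG-suc a b t) (solve 1 (λ d → :- d := :- one :* d) refl _)) ⟩
      diagonal (λ a b → diagonal (λ k j → T k a j) b) m + diagonal (λ a b → - 1# * diagonal (λ k i → T k i b) a) m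
        -- Both sums have become the sum of `T k i j` over `k + i + j = m`, with opposite signs.
        ≈⟨ +-cong (trans (diagonal-assoc (λ a k j → T k a j) m)
             (diagonal-cong m λ a b _ → diagonal-flip (λ i k → T k i b) a)) (diagonal-* (- 1#) _ m) ⟩
      diagonal (λ a b → diagonal (λ k i → T k i b) a) m + - 1# * diagonal (λ a b → diagonal (λ k i → T k i b) a) m
        ≈⟨ solve 1 (λ x → x :+ :- one :* x := nil) refl _ ⟩
      0# ∎
      where
      w : ℕ → ℕ → Carrier
      w a b = coeff (EG a b) t
      T : ℕ → ℕ → ℕ → Carrier
      T k i j = coeff (p· k (EG i j)) t

    -- Up to a scalar, hookJack s n is the Jack function of the hook (n - s , 1^s).
    hookJack : ℕ → ℕ → Λ
    hookJack zero    n = hookTerm 0 n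
    hookJack (suc s) n = hookJack s n +Λ hookTerm (suc s) (n ∸ suc s)

    coeff-hookJack : ∀ s n t → coeff (hookJack s n) t ≈ partial (λ a b → coeff (hookTerm a b) t) s n
    coeff-hookJack zero    n t = refl
    coeff-hookJack (suc s) n t = +-congʳ (coeff-hookJack s n t)

    hookTerm-vanishes : ∀ a b t → length t < a → coeff (hookTerm a b) t ≈ 0#
    hookTerm-vanishes a b t lt = trans (*-congˡ (trans (coeff-E a (G b 1Λ) t) (elementaryShift-vanishes a _ t lt))) (zeroʳ _)

    -- In at most `s` variables the terms with `a > s` vanish, so the partial sum equals the whole
    -- sum, which is zero.
    hookJack-whole : ∀ s n t → s ≤ n → length t ≤ s → coeff (hookJack s n) t ≈ 0#
    hookJack-whole s n t s≤n |t|≤s = begin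
      coeff (hookJack s n) t             ≈⟨ coeff-hookJack s n t ⟩
      partial φ s n                      ≈⟨ partial-tail φ s n (λ a s<a → hookTerm-vanishes a (n ∸ a) t (ℕₚ.≤-<-trans |t|≤s s<a)) (n ∸ s) ⟨
      partial φ (n ∸ s ℕ.+ s) n          ≡⟨ ≡.cong (λ m → partial φ m n) (ℕₚ.m∸n+n≡m s≤n) ⟩
      partial φ n n                      ≈⟨ partial-diagonal φ n ⟩
      diagonal φ n                       ≈⟨ hookTerms-vanish n t ⟩
      0#                                 ∎
      where
      φ : ℕ → ℕ → Carrier
      φ a b = coeff (hookTerm a b) t

    -- The coefficient of y^b in (1 - y)^(-1/α).
    γ : ℕ → Carrier
    γ b = coeff (G b 1Λ) [ b ]

    ι-γ : ∀ b → ι b * γ (suc b) ≈ diagonal (λ k j → γ j) b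
    ι-γ b = begin
      ι b * γ (suc b)
        ≈⟨ *-congˡ (coeff-newton-suc wᴳ b 1Λ [ suc b ]) ⟩
      ι b * (wᴳ b * diagonal (λ k j → coeff (p· k (G j 1Λ)) [ suc b ]) b)
        ≈⟨ trans (sym (*-assoc _ _ _)) (trans (*-congʳ (trans (*-comm _ _) (wᴳ-inverse b))) (*-identityˡ _)) ⟩
      diagonal (λ k j → coeff (p· k (G j 1Λ)) [ suc b ]) b
        ≈⟨ diagonal-cong b (λ k j e → trans (coeff-p· k (G j 1Λ) [ suc b ]) (trans (+-identityʳ _)
             (trans (reflexive (≡.cong (shiftᶠ k (λ x → coeff (G j 1Λ) [ x ])) (≡.sym e))) (shift-exact k j _)))) ⟩
      diagonal (λ k j → γ j) b ∎
      where
      shift-exact : ∀ k j (φ : ℕ → Carrier) → shiftᶠ k φ (k ℕ.+ j) ≈ φ j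
      shift-exact zero    j φ = refl
      shift-exact (suc k) j φ = shift-exact k j φ

    -- Consecutive instances of `ι-γ` differ by a single summand.
    γ-suc : ∀ b → ι b * γ (suc b) ≈ (1# + α * fromℕ b) * γ b
    γ-suc zero    = trans (ι-γ 0) (solve 2 (λ a g → g := (one :+ a :* nil) :* g) refl α (γ 0))
    γ-suc (suc b) = begin
      ι (suc b) * γ (suc (suc b))              ≈⟨ ι-γ (suc b) ⟩
      γ (suc b) + diagonal (λ k j → γ j) b     ≈⟨ +-congˡ (ι-γ b) ⟨
      γ (suc b) + ι b * γ (suc b)              ≈⟨ solve 2 (λ i g → g :+ i :* g := (one :+ i) :* g) refl (ι b) (γ (suc b)) ⟩
      (1# + α * fromℕ (suc b)) * γ (suc b)     ∎

    γ-value : ∀ b → α ^ b * fromℕ (b !) * γ b ≈ armProduct α b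
    γ-value zero    = solve 0 (one :* (one :+ nil) :* one := one) refl
    γ-value (suc b) = begin
      α * α ^ b * fromℕ (suc b ℕ.* b !) * γ (suc b)
        ≈⟨ *-congʳ (*-congˡ (fromℕ-* (suc b) (b !))) ⟩
      α * α ^ b * (fromℕ (suc b) * fromℕ (b !)) * γ (suc b)
        ≈⟨ solve 5 (λ a p k f g → a :* p :* (k :* f) :* g := p :* f :* (a :* k :* g)) refl α (α ^ b) (fromℕ (suc b)) (fromℕ (b !)) (γ (suc b)) ⟩
      α ^ b * fromℕ (b !) * (ι b * γ (suc b))
        ≈⟨ *-congˡ (γ-suc b) ⟩
      α ^ b * fromℕ (b !) * ((1# + α * fromℕ b) * γ b)
        ≈⟨ solve 3 (λ x y g → x :* (y :* g) := x :* g :* y) refl _ _ _ ⟩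
      α ^ b * fromℕ (b !) * γ b * (1# + α * fromℕ b)
        ≈⟨ *-congʳ (γ-value b) ⟩
      armProduct α b * (1# + α * fromℕ b) ∎

    hookParts : ℕ → ℕ → List ℕ
    hookParts p s = suc p ∷ ones s

    coeff-EG-hook : ∀ p s → coeff (EG (suc s) p) (hookParts p s) ≈ (- 1#) ^ suc s * γ p
    coeff-EG-hook p s = begin
      coeff (EG (suc s) p) (hookParts p s)
        ≈⟨ coeff-E (suc s) (G p 1Λ) (hookParts p s) ⟩
      elementaryShift (suc s) (coeff (G p 1Λ)) (suc p ∷ replicate s 1)
        ≡⟨ ≡.cong₂ (λ k t → elementaryShift (suc k) (coeff (G p 1Λ)) (suc p ∷ t))
             (≡.sym (length-replicate s)) (≡.sym (map-replicate suc s 0)) ⟩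
      elementaryShift (suc (length (replicate s 0))) (coeff (G p 1Λ)) (map suc (p ∷ replicate s 0))
        ≈⟨ elementaryShift-top (coeff (G p 1Λ)) (p ∷ replicate s 0) ⟩
      (- 1#) ^ suc (length (replicate s 0)) * coeff (G p 1Λ) (p ∷ replicate s 0)
        ≈⟨ *-cong (reflexive (≡.cong (λ k → (- 1#) ^ suc k) (length-replicate s))) (zeros s) ⟩
      (- 1#) ^ suc s * γ p ∎
      where
      zeros : ∀ s → coeff (G p 1Λ) (p ∷ replicate s 0) ≈ γ p
      zeros zero    = refl
      zeros (suc s) = trans (coeff-0∷ (slice p (G p 1Λ)) (replicate s 0)) (zeros s)

    -- The monomial has `suc s` variables, so adding the one term `a = suc s` already gives zero.
    -- The coefficient is thus minus that of this term, in which e takes each variable once.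
    coeff-hookJack-hook : ∀ p s →
      coeff (hookJack s (suc p ℕ.+ s)) (hookParts p s) ≈ (- 1#) ^ s * ((α * fromℕ p + fromℕ (suc s)) * γ p)
    coeff-hookJack-hook p s = begin
      X
        ≈⟨ solve 2 (λ x y → x := (x :+ y) :- y) refl X Y ⟩
      (X + Y) - Y
        ≈⟨ +-cong next (-‿cong value) ⟩
      0# - (α * fromℕ p + fromℕ (suc s)) * ((- 1#) ^ suc s * γ p)
        ≈⟨ solve 3 (λ c m g → nil :- c :* (:- one :* m :* g) := m :* (c :* g)) refl (α * fromℕ p + fromℕ (suc s)) ((- 1#) ^ s) (γ p) ⟩
      (- 1#) ^ s * ((α * fromℕ p + fromℕ (suc s)) * γ p) ∎
      where
      X Y : Carrier
      X = coeff (hookJack s (suc p ℕ.+ s)) (hookParts p s)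
      Y = coeff (hookTerm (suc s) (p ℕ.+ s ∸ s)) (hookParts p s)
      next : X + Y ≈ 0#
      next = hookJack-whole (suc s) (suc p ℕ.+ s) (hookParts p s) (s≤s (ℕₚ.m≤n+m s p))
        (s≤s (ℕₚ.≤-reflexive (length-replicate s)))
      value : Y ≈ (α * fromℕ p + fromℕ (suc s)) * ((- 1#) ^ suc s * γ p)
      value = trans (reflexive (≡.cong (λ b → coeff (hookTerm (suc s) b) (hookParts p s)) (ℕₚ.m+n∸n≡m p s)))
        (*-congˡ (coeff-EG-hook p s))

    ω : ℕ → ℕ → Carrier
    ω a b = coeff (EG a b) (ones (a ℕ.+ b))

    ω-sucˡ : ∀ a b → fromℕ (suc a) * ω (suc a) b ≈ - (fromℕ (suc (a ℕ.+ b)) * ω a b)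
    ω-sucˡ a b = begin
      fromℕ (suc a) * ω (suc a) b
        ≈⟨ *-congˡ (newton-ones wᴱ a (G b 1Λ) (a ℕ.+ b)) ⟩
      fromℕ (suc a) * (wᴱ a * (fromℕ (suc (a ℕ.+ b)) * ω a b))
        ≈⟨ trans (sym (*-assoc _ _ _)) (*-congʳ (wᴱ-inverse a)) ⟩
      - 1# * (fromℕ (suc (a ℕ.+ b)) * ω a b)
        ≈⟨ solve 1 (λ d → :- one :* d := :- d) refl _ ⟩
      - (fromℕ (suc (a ℕ.+ b)) * ω a b) ∎

    ω-sucʳ : ∀ a b → ι b * ω a (suc b) ≈ fromℕ (suc (a ℕ.+ b)) * ω a b
    ω-sucʳ a b = begin
      ι b * ω a (suc b)
        ≈⟨ *-congˡ (trans (reflexive (≡.cong (λ k → coeff (EG a (suc b)) (ones k)) (ℕₚ.+-suc a b)))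
             (E-G-comm a (suc b) 1Λ (ones (suc (a ℕ.+ b))))) ⟩
      ι b * coeff (G (suc b) (E a 1Λ)) (ones (suc (a ℕ.+ b)))
        ≈⟨ *-congˡ (newton-ones wᴳ b (E a 1Λ) (a ℕ.+ b)) ⟩
      ι b * (wᴳ b * (fromℕ (suc (a ℕ.+ b)) * coeff (G b (E a 1Λ)) (ones (a ℕ.+ b))))
        ≈⟨ trans (sym (*-assoc _ _ _)) (trans (*-congʳ (trans (*-comm _ _) (wᴳ-inverse b))) (*-identityˡ _)) ⟩
      fromℕ (suc (a ℕ.+ b)) * coeff (G b (E a 1Λ)) (ones (a ℕ.+ b))
        ≈⟨ *-congˡ (E-G-comm a b 1Λ (ones (a ℕ.+ b))) ⟨
      fromℕ (suc (a ℕ.+ b)) * ω a b ∎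

    -- The `a + b` variables are distributed between e_a and g_b, and the squarefree coefficient of
    -- g_b is α^(-b); the binomial coefficient is cleared of denominators.
    ω-value : ∀ a b → α ^ b * (fromℕ (a !) * fromℕ (b !)) * ω a b ≈ (- 1#) ^ a * fromℕ ((a ℕ.+ b) !)
    ω-value zero    zero    = solve 0 (one :* ((one :+ nil) :* (one :+ nil)) :* one := one :* (one :+ nil)) refl
    ω-value zero    (suc b) = begin
      α * α ^ b * (fromℕ 1 * fromℕ (suc b ℕ.* b !)) * ω 0 (suc b)
        ≈⟨ *-congʳ (*-congˡ (*-congˡ (fromℕ-* (suc b) (b !)))) ⟩
      α * α ^ b * (fromℕ 1 * (fromℕ (suc b) * fromℕ (b !))) * ω 0 (suc b)
        ≈⟨ solve 6 (λ a p o k f w → a :* p :* (o :* (k :* f)) :* w := p :* (o :* f) :* (a :* k :* w)) refl α (α ^ b) (fromℕ 1) (fromℕ (suc b)) (fromℕ (b !)) (ω 0 (suc b)) ⟩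
      α ^ b * (fromℕ 1 * fromℕ (b !)) * (ι b * ω 0 (suc b))
        ≈⟨ *-congˡ (ω-sucʳ 0 b) ⟩
      α ^ b * (fromℕ 1 * fromℕ (b !)) * (fromℕ (suc b) * ω 0 b)
        ≈⟨ solve 3 (λ x y w → x :* (y :* w) := y :* (x :* w)) refl _ _ _ ⟩
      fromℕ (suc b) * (α ^ b * (fromℕ 1 * fromℕ (b !)) * ω 0 b)
        ≈⟨ *-congˡ (ω-value 0 b) ⟩
      fromℕ (suc b) * (1# * fromℕ (b !))
        ≈⟨ trans (solve 2 (λ x y → x :* (one :* y) := one :* (x :* y)) refl _ _) (*-congˡ (sym (fromℕ-* (suc b) (b !)))) ⟩
      1# * fromℕ (suc b !) ∎
    ω-value (suc a) b = begin
      α ^ b * (fromℕ (suc a ℕ.* a !) * fromℕ (b !)) * ω (suc a) b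
        ≈⟨ *-congʳ (*-congˡ (*-congʳ (fromℕ-* (suc a) (a !)))) ⟩
      α ^ b * (fromℕ (suc a) * fromℕ (a !) * fromℕ (b !)) * ω (suc a) b
        ≈⟨ solve 5 (λ p k f g w → p :* (k :* f :* g) :* w := p :* (f :* g) :* (k :* w)) refl (α ^ b) (fromℕ (suc a)) (fromℕ (a !)) (fromℕ (b !)) (ω (suc a) b) ⟩
      α ^ b * (fromℕ (a !) * fromℕ (b !)) * (fromℕ (suc a) * ω (suc a) b)
        ≈⟨ *-congˡ (ω-sucˡ a b) ⟩
      α ^ b * (fromℕ (a !) * fromℕ (b !)) * - (fromℕ (suc (a ℕ.+ b)) * ω a b)
        ≈⟨ solve 3 (λ x y w → x :* :- (y :* w) := :- y :* (x :* w)) refl _ _ _ ⟩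
      - fromℕ (suc (a ℕ.+ b)) * (α ^ b * (fromℕ (a !) * fromℕ (b !)) * ω a b)
        ≈⟨ *-congˡ (ω-value a b) ⟩
      - fromℕ (suc (a ℕ.+ b)) * ((- 1#) ^ a * fromℕ ((a ℕ.+ b) !))
        ≈⟨ solve 3 (λ k m f → :- k :* (m :* f) := :- one :* m :* (k :* f)) refl (fromℕ (suc (a ℕ.+ b))) ((- 1#) ^ a) (fromℕ ((a ℕ.+ b) !)) ⟩
      - 1# * (- 1#) ^ a * (fromℕ (suc (a ℕ.+ b)) * fromℕ ((a ℕ.+ b) !))
        ≈⟨ *-congˡ (fromℕ-* (suc (a ℕ.+ b)) ((a ℕ.+ b) !)) ⟨
      - 1# * (- 1#) ^ a * fromℕ (suc (a ℕ.+ b) !) ∎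

    -- By `ω-sucˡ` and `ω-sucʳ` each term is a difference of consecutive multiples of ω, so the
    -- partial sum telescopes. The induction keeps n fixed and therefore lengthens the arm by one.
    coeff-hookJack-ones : ∀ p s → coeff (hookJack s (suc p ℕ.+ s)) (ones (suc p ℕ.+ s)) ≈ fromℕ (suc p ℕ.+ s) * ω s p
    coeff-hookJack-ones p zero rewrite ℕₚ.+-identityʳ p = begin
      (α * fromℕ (suc p) + fromℕ 0) * ω 0 (suc p)
        ≈⟨ *-congʳ (+-identityʳ _) ⟩
      ι p * ω 0 (suc p)
        ≈⟨ ω-sucʳ 0 p ⟩
      fromℕ (suc p) * ω 0 p ∎
    coeff-hookJack-ones p (suc s) = begin
      coeff (hookJack s (suc p ℕ.+ suc s)) (ones N) + coeff (hookTerm (suc s) (p ℕ.+ suc s ∸ s)) (ones N)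
        ≡⟨ ≡.cong₂ (λ m b → coeff (hookJack s m) (ones m) + coeff (hookTerm (suc s) b) (ones N)) n≡
             (≡.trans (≡.cong (_∸ s) (ℕₚ.+-suc p s)) (ℕₚ.m+n∸n≡m (suc p) s)) ⟩
      coeff (hookJack s (suc (suc p) ℕ.+ s)) (ones (suc (suc p) ℕ.+ s)) + coeff (hookTerm (suc s) (suc p)) (ones N)
        ≈⟨ +-cong (coeff-hookJack-ones (suc p) s) (distribʳ _ _ _) ⟩
      fromℕ (suc (suc p) ℕ.+ s) * ω s (suc p) + (α * fromℕ (suc p) * coeff (EG (suc s) (suc p)) (ones N) + fromℕ (suc s) * coeff (EG (suc s) (suc p)) (ones N))
        ≈⟨ +-congˡ (+-cong (*-congˡ (reflexive (≡.cong (coeff (EG (suc s) (suc p)) ∘ ones) N≡)))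
             (*-congˡ (reflexive (≡.cong (coeff (EG (suc s) (suc p)) ∘ ones) N≡)))) ⟩
      fromℕ (suc (suc p) ℕ.+ s) * ω s (suc p) + (ι p * ω (suc s) (suc p) + fromℕ (suc s) * ω (suc s) (suc p))
        ≈⟨ +-congˡ (+-cong (ω-sucʳ (suc s) p) (ω-sucˡ s (suc p))) ⟩
      fromℕ (suc (suc p) ℕ.+ s) * ω s (suc p) + (fromℕ (suc (suc s ℕ.+ p)) * ω (suc s) p - fromℕ (suc (s ℕ.+ suc p)) * ω s (suc p))
        ≈⟨ +-cong (*-congʳ (fromℕ-cong (≡.cong suc (ℕₚ.+-comm (suc p) s)))) refl ⟩
      fromℕ (suc (s ℕ.+ suc p)) * ω s (suc p) + (fromℕ (suc (suc s ℕ.+ p)) * ω (suc s) p - fromℕ (suc (s ℕ.+ suc p)) * ω s (suc p))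
        ≈⟨ solve 2 (λ x y → x :+ (y :- x) := y) refl _ _ ⟩
      fromℕ (suc (suc s ℕ.+ p)) * ω (suc s) p
        ≈⟨ *-congʳ (fromℕ-cong (≡.cong suc (ℕₚ.+-comm (suc s) p))) ⟩
      fromℕ (suc p ℕ.+ suc s) * ω (suc s) p ∎
      where
      N : ℕ
      N = suc p ℕ.+ suc s
      n≡ : suc p ℕ.+ suc s ≡ suc (suc p) ℕ.+ s
      n≡ = ℕₚ.+-suc (suc p) s
      N≡ : N ≡ suc s ℕ.+ suc p
      N≡ = ℕₚ.+-comm (suc p) (suc s)

  -- Positivity and elimination

  -- The parts of an ordered field used here: positive elements closed under sums and products,
  -- squares of nonzero elements positive, and a decidable zero for elimination.
  record OrderedField : Set (Level.suc ℓ ⊔ c) where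
    field
      Pos      : Carrier → Set ℓ
      Pos-resp : ∀ {x y} → x ≈ y → Pos x → Pos y
      Pos-+    : ∀ {x y} → Pos x → Pos y → Pos (x + y)
      Pos-*    : ∀ {x y} → Pos x → Pos y → Pos (x * y)
      Pos-1    : Pos 1#
      Pos⇒≉0   : ∀ {x} → Pos x → ¬ x ≈ 0#
      square   : ∀ {x} → ¬ x ≈ 0# → Pos (x * x)
      _≈0?     : ∀ x → Dec (x ≈ 0#)
      recip    : Carrier → Carrier
      recip-inverse : ∀ {x} → ¬ x ≈ 0# → recip x * x ≈ 1#

    Pos-fromℕ : ∀ n → Pos (fromℕ (suc n))
    Pos-fromℕ zero    = Pos-resp (sym (+-identityʳ 1#)) Pos-1
    Pos-fromℕ (suc n) = Pos-+ Pos-1 (Pos-fromℕ n)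

    Pos-! : ∀ n → Pos (fromℕ (n !))
    Pos-! zero    = Pos-fromℕ 0
    Pos-! (suc n) = Pos-resp (sym (fromℕ-* (suc n) (n !))) (Pos-* (Pos-fromℕ n) (Pos-! n))

    Pos-^ : ∀ {x} n → Pos x → Pos (x ^ n)
    Pos-^ zero    px = Pos-1
    Pos-^ (suc n) px = Pos-* px (Pos-^ n px)

    NonNeg : Carrier → Set ℓ
    NonNeg x = x ≈ 0# ⊎ Pos x

    NonNeg-resp : ∀ {x y} → x ≈ y → NonNeg x → NonNeg y
    NonNeg-resp e (inj₁ x≈0) = inj₁ (trans (sym e) x≈0)
    NonNeg-resp e (inj₂ px)  = inj₂ (Pos-resp e px)

    Pos-+NonNeg : ∀ {x y} → Pos x → NonNeg y → Pos (x + y)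
    Pos-+NonNeg px (inj₁ y≈0) = Pos-resp (sym (trans (+-congˡ y≈0) (+-identityʳ _))) px
    Pos-+NonNeg px (inj₂ py)  = Pos-+ px py

    NonNeg-+ : ∀ {x y} → NonNeg x → NonNeg y → NonNeg (x + y)
    NonNeg-+ (inj₁ x≈0) ny = NonNeg-resp (sym (trans (+-congʳ x≈0) (+-identityˡ _))) ny
    NonNeg-+ (inj₂ px)  ny = inj₂ (Pos-+NonNeg px ny)

    cancelˡ : ∀ {x y z} → ¬ x ≈ 0# → x * y ≈ x * z → y ≈ z
    cancelˡ {x} {y} {z} x≉0 e = begin
      y                    ≈⟨ *-identityˡ y ⟨
      1# * y               ≈⟨ *-congʳ (recip-inverse x≉0) ⟨
      recip x * x * y      ≈⟨ *-assoc _ _ _ ⟩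
      recip x * (x * y)    ≈⟨ *-congˡ e ⟩
      recip x * (x * z)    ≈⟨ *-assoc _ _ _ ⟨
      recip x * x * z      ≈⟨ *-congʳ (recip-inverse x≉0) ⟩
      1# * z               ≈⟨ *-identityˡ z ⟩
      z                    ∎

  vanishes : ∀ f → (∀ ν → coeff f (parts ν) ≈ 0#) → f ≈Λ 0Λ
  vanishes f e t = trans (coeff-type f t) (trans (e (toPartition t)) (sym (coeff-0Λ t)))

  -- One entry of the first list is lowered by `k`. Its new value is kept as an index because the
  -- number of nonzero exponents drops only if this value is 0.
  data Lowered (k : ℕ) : ℕ → List ℕ → List ℕ → Set where
    here  : ∀ {a as} → Lowered k a (k ℕ.+ a ∷ as) (a ∷ as)
    there : ∀ {a b as bs} → Lowered k a as bs → Lowered k a (b ∷ as) (b ∷ bs)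

  powerShift-vanishes : ∀ k f t → (∀ {a t′} → Lowered k a t t′ → f t′ ≈ 0#) → powerShift k f t ≈ 0#
  powerShift-vanishes k f []       e = refl
  powerShift-vanishes k f (x ∷ xs) e = trans (+-cong
      (shift-vanishes k x (λ y → f (y ∷ xs)) (λ { a ≡.refl → e here }))
      (powerShift-vanishes k (λ b → f (x ∷ b)) xs (λ l → e (there l))))
    (+-identityˡ 0#)
    where
    shift-vanishes : ∀ k x (φ : ℕ → Carrier) → (∀ a → x ≡ k ℕ.+ a → φ a ≈ 0#) → shiftᶠ k φ x ≈ 0#
    shift-vanishes zero    x       φ e = e x ≡.refl
    shift-vanishes (suc k) zero    φ e = refl
    shift-vanishes (suc k) (suc x) φ e = shift-vanishes k x φ (λ a x≡ → e a (≡.cong suc x≡))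

  Lowered-sum : ∀ {k a t t′} → Lowered k a t t′ → sum t ≡ k ℕ.+ sum t′
  Lowered-sum {k} {a} (here {as = as}) = ℕₚ.+-assoc k a (sum as)
  Lowered-sum {k} (there {b = b} {as} {bs} l) = ≡.trans (≡.cong (b ℕ.+_) (Lowered-sum l)) (x∙yz≈y∙xz b k (sum bs))
    where open import Algebra.Properties.CommutativeSemigroup ℕₚ.+-commutativeSemigroup using (x∙yz≈y∙xz)

  support : List ℕ → List ℕ
  support = filter (1 ℕₚ.≤?_)

  Lowered-support-suc : ∀ {k a t t′} → Lowered (suc k) (suc a) t t′ → length (support t) ≡ length (support t′)
  Lowered-support-suc here                   = ≡.refl
  Lowered-support-suc (there {b = zero}  l) = Lowered-support-suc l
  Lowered-support-suc (there {b = suc b} l) = ≡.cong suc (Lowered-support-suc l)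

  Lowered-support-zero : ∀ {k t t′} → Lowered (suc k) 0 t t′ → support t ↭ suc k ∷ support t′
  Lowered-support-zero {k} (here {as = as}) = ↭-reflexive (≡.cong (λ m → suc m ∷ support as) (ℕₚ.+-identityʳ k))
  Lowered-support-zero (there {b = zero}  l) = Lowered-support-zero l
  Lowered-support-zero (there {b = suc b} l) = ↭-trans (prep (suc b) (Lowered-support-zero l)) (swap (suc b) _ ↭-refl)

  Homogeneous : ℕ → Λ → Set ℓ
  Homogeneous d f = ∀ t → sum t ≢ d → coeff f t ≈ 0#

  homogeneous-1Λ : Homogeneous 0 1Λ
  homogeneous-1Λ t t≢ = δ-≢ {[]} {type t} λ e → t≢ (≡.trans (≡.sym (sum-type t)) (≡.cong sum (≡.sym e)))

  homogeneous-p· : ∀ k {d f} → Homogeneous d f → Homogeneous (suc k ℕ.+ d) (p· k f)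
  homogeneous-p· k {d} {f} h t t≢ = trans (coeff-p· k f t) (powerShift-vanishes (suc k) (coeff f) t λ l →
    h _ λ e → t≢ (≡.trans (Lowered-sum l) (≡.cong (suc k ℕ.+_) e)))

  homogeneous-newton : ∀ w b {d f} → Homogeneous d f → Homogeneous (b ℕ.+ d) (newton w b f)
  homogeneous-newton w b {d} {f} h = strong (λ b → Homogeneous (b ℕ.+ d) (newton w b f)) h step b
    where
    step : ∀ b → (∀ j → j ≤ b → Homogeneous (j ℕ.+ d) (newton w j f)) → Homogeneous (suc b ℕ.+ d) (newton w (suc b) f)
    step b ih t t≢ = trans (coeff-newton-suc w b f t) (trans (*-congˡ (trans
      (diagonal-cong b λ i j i+j≡b → homogeneous-p· i {f = newton w j f} (ih j (≤-diagonal {i} i+j≡b)) t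
        λ e → t≢ (≡.trans e (≡.cong suc (≡.trans (≡.sym (ℕₚ.+-assoc i j d)) (≡.cong (ℕ._+ d) i+j≡b)))))
      (diagonal-0 b))) (zeroʳ _))

  homogeneous-pProduct : ∀ ks → Homogeneous (sum (map suc ks)) (pProduct ks)
  homogeneous-pProduct []       = homogeneous-1Λ
  homogeneous-pProduct (k ∷ ks) = homogeneous-p· k {f = pProduct ks} (homogeneous-pProduct ks)

  -- Each factor brings in at most one new variable.
  pProduct-long : ∀ ks t → length ks < length (support t) → coeff (pProduct ks) t ≈ 0#
  pProduct-long []       t lt = δ-length [] (type t) λ e →
    ℕₚ.<⇒≢ lt (≡.trans e (length-sort (support t)))
  pProduct-long (k ∷ ks) t lt = trans (coeff-p· k (pProduct ks) t) (powerShift-vanishes (suc k) _ t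
    λ {a} {t′} l → pProduct-long ks t′ (ℕₚ.≤-pred (ℕₚ.<-≤-trans lt (lowered a l))))
    where
    lowered : ∀ a {t t′} → Lowered (suc k) a t t′ → length (support t) ≤ suc (length (support t′))
    lowered zero    l = ℕₚ.≤-reflexive (↭-length (Lowered-support-zero l))
    lowered (suc a) l = ℕₚ.m≤n⇒m≤1+n (ℕₚ.≤-reflexive (Lowered-support-suc l))

  -- With as many variables as factors, every factor has a variable of its own, and the exponents
  -- are the parts.
  pProduct-other : ∀ ks t → length (support t) ≡ length ks → ¬ (support t ↭ map suc ks) → coeff (pProduct ks) t ≈ 0#
  pProduct-other [] t e ≁ with support t
  ... | []    = contradiction Perm.refl ≁
  ... | _ ∷ _ = contradiction e λ ()
  pProduct-other (k ∷ ks) t e ≁ = trans (coeff-p· k (pProduct ks) t) (powerShift-vanishes (suc k) _ t λ {a} → lowered a)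
    where
    lowered : ∀ a {t′} → Lowered (suc k) a t t′ → coeff (pProduct ks) t′ ≈ 0#
    lowered zero    {t′} l = pProduct-other ks t′
      (ℕₚ.suc-injective (≡.trans (≡.sym (↭-length (Lowered-support-zero l))) e))
      λ p → ≁ (↭-trans (Lowered-support-zero l) (prep (suc k) p))
    lowered (suc a) {t′} l = pProduct-long ks t′ (ℕₚ.≤-reflexive (≡.trans (≡.sym e) (Lowered-support-suc l)))

  module _ (orderedField : OrderedField) where

    open OrderedField orderedField

    powerShift-NonNeg : ∀ k f t → (∀ t → NonNeg (f t)) → NonNeg (powerShift k f t)
    powerShift-NonNeg k f []       n = inj₁ refl
    powerShift-NonNeg k f (x ∷ xs) n = NonNeg-+ (shift-NonNeg k x) (powerShift-NonNeg k _ xs (λ t → n (x ∷ t)))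
      where
      shift-NonNeg : ∀ k x → NonNeg (shiftᶠ k (λ y → f (y ∷ xs)) x)
      shift-NonNeg zero    x       = n (x ∷ xs)
      shift-NonNeg (suc k) zero    = inj₁ refl
      shift-NonNeg (suc k) (suc x) = shift-NonNeg k x

    pProduct-NonNeg : ∀ ks t → NonNeg (coeff (pProduct ks) t)
    pProduct-NonNeg []       t = indicator-NonNeg (≡-dec ℕₚ._≟_ [] (type t))
      where
      indicator-NonNeg : ∀ {P : Set} (d : Dec P) → NonNeg (indicator d)
      indicator-NonNeg (yes _) = inj₂ Pos-1
      indicator-NonNeg (no _)  = inj₁ refl
    pProduct-NonNeg (k ∷ ks) t = NonNeg-resp (sym (coeff-p· k (pProduct ks) t))
      (powerShift-NonNeg (suc k) (coeff (pProduct ks)) t (pProduct-NonNeg ks))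

    -- Giving each factor its own variable contributes positively, and no coefficient is negative,
    -- so nothing can cancel this contribution.
    pProduct-Pos : ∀ ks → Pos (coeff (pProduct ks) (map suc ks))
    pProduct-Pos []       = Pos-1
    pProduct-Pos (k ∷ ks) = Pos-resp (sym (coeff-p· k (pProduct ks) (suc k ∷ map suc ks)))
      (Pos-+NonNeg (shift-Pos k) (powerShift-NonNeg (suc k) (λ t → coeff (pProduct ks) (suc k ∷ t)) (map suc ks)
        (λ t → pProduct-NonNeg ks (suc k ∷ t))))
      where
      φ : ℕ → Carrier
      φ y = coeff (pProduct ks) (y ∷ map suc ks)
      shift-Pos : ∀ k → Pos (shiftᶠ k φ k)
      shift-Pos zero    = Pos-resp (sym (coeff-0∷ (pProduct ks) (map suc ks))) (pProduct-Pos ks)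
      shift-Pos (suc k) = shift-Pos k

    -- Gaussian elimination for a family that is triangular on the set S of partitions.
    module Elimination {s} (F : Partition → Λ) (S : Partition → Set s) (ρ : Partition → ℕ)
      (L : List Partition) (L-complete : ∀ {ν} → S ν → Any (λ κ → parts κ ≡ parts ν) L)
      (R : ℕ) (ρ<R : ∀ {ν} → S ν → ρ ν < R)
      (leading : ∀ κ → ¬ ¬ S κ → ¬ coeff (F κ) (parts κ) ≈ 0#)
      (lower : ∀ κ ν → ¬ ¬ S κ → parts ν ≢ parts κ → ¬ (S ν × ρ ν < ρ κ) → coeff (F κ) (parts ν) ≈ 0#) where

      -- The set `S` need not be decidable, and a nonzero coefficient only refutes non-membership;
      -- hence the double negation.
      Member : Set s
      Member = ∃ λ κ → ¬ ¬ S κ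

      -- The partitions still to be cleared: all those of level below `d`, and those of level `d`
      -- that occur in the rest of the list.
      Reached : ℕ → List Partition → Partition → Set s
      Reached d L′ ν = S ν × (ρ ν < d ⊎ ρ ν ≡ d × Any (λ κ → parts κ ≡ parts ν) L′)

      eliminate : ∀ d f → (∀ ν → ¬ (S ν × ρ ν < d) → coeff f (parts ν) ≈ 0#) → Span {I = Member} (F ∘ proj₁) f
      eliminate-level : ∀ d L′ f → (∀ ν → ¬ Reached d L′ ν → coeff f (parts ν) ≈ 0#) → Span {I = Member} (F ∘ proj₁) f

      eliminate zero    f h = resp (≈Λ-sym f 0Λ (vanishes f λ ν → h ν λ ())) null
      eliminate (suc d) f h = eliminate-level d L f λ ν ¬r → h ν λ (Sν , ρν≤d) → ¬r (Sν ,
        (case ℕₚ.m≤n⇒m<n∨m≡n (ℕₚ.≤-pred ρν≤d) of λ where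
          (inj₁ ρν<d) → inj₁ ρν<d
          (inj₂ ρν≡d) → inj₂ (ρν≡d , L-complete Sν)))

      eliminate-level d []       f h = eliminate d f λ ν ¬r → h ν λ where
        (Sν , inj₁ ρν<d) → ¬r (Sν , ρν<d)
      eliminate-level d (κ ∷ L′) f h = case coeff f (parts κ) ≈0? of λ where
          (yes c≈0) → eliminate-level d L′ f λ ν ¬r → case ≡-dec ℕₚ._≟_ (parts ν) (parts κ) of λ where
            (yes e) → trans (reflexive (≡.cong (coeff f) e)) c≈0
            (no ν≢κ)  → h ν (skip ν ν≢κ ¬r)
          (no c≉0) → subtract c≉0
        where
        skip : ∀ ν → parts ν ≢ parts κ → ¬ Reached d L′ ν → ¬ Reached d (κ ∷ L′) ν
        skip ν ν≢κ ¬r (Sν , inj₁ lt)              = ¬r (Sν , inj₁ lt)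
        skip ν ν≢κ ¬r (Sν , inj₂ (_ , here e))    = ν≢κ (≡.sym e)
        skip ν ν≢κ ¬r (Sν , inj₂ (eq , there in′)) = ¬r (Sν , inj₂ (eq , in′))
        subtract : ¬ coeff f (parts κ) ≈ 0# → Span {I = Member} (F ∘ proj₁) f
        subtract c≉0 = resp recombine (plus (eliminate-level d L′ f′ reduced) (scale y (base (κ , member))))
          where
          member : ¬ ¬ S κ
          member ¬S = c≉0 (h κ λ (Sκ , _) → ¬S Sκ)
          ρκ≤d : ρ κ ≤ d
          ρκ≤d = decidable-stable (ρ κ ℕₚ.≤? d) λ ≰ → c≉0 (h κ λ where
            (_ , inj₁ lt)      → ≰ (ℕₚ.<⇒≤ lt)
            (_ , inj₂ (eq , _)) → ≰ (ℕₚ.≤-reflexive eq))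
          l y : Carrier
          l = coeff (F κ) (parts κ)
          y = coeff f (parts κ) * recip l
          f′ : Λ
          f′ = f +Λ (- y) ·Λ F κ
          recombine : f′ +Λ y ·Λ F κ ≈Λ f
          recombine t = solve 3 (λ f y g → (f :+ :- y :* g) :+ y :* g := f) refl (coeff f t) y (coeff (F κ) t)
          reduced : ∀ ν → ¬ Reached d L′ ν → coeff f′ (parts ν) ≈ 0#
          reduced ν ¬r = case ≡-dec ℕₚ._≟_ (parts ν) (parts κ) of λ where
            (yes e) → trans (reflexive (≡.cong (coeff f′) e)) (trans
              (solve 3 (λ c r l → c :+ :- (c :* r) :* l := c :- c :* (r :* l)) refl (coeff f (parts κ)) (recip l) l)
              (trans (+-congˡ (-‿cong (trans (*-congˡ (recip-inverse (leading κ member))) (*-identityʳ _)))) (-‿inverseʳ _)))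
            (no ν≢κ) → trans (+-cong (h ν (skip ν ν≢κ ¬r)) (trans (*-congˡ (lower κ ν member ν≢κ
              λ (Sν , lt) → ¬r (Sν , inj₁ (ℕₚ.<-≤-trans lt ρκ≤d)))) (zeroʳ _))) (+-identityˡ 0#)

      spans : ∀ f → (∀ ν → ¬ S ν → coeff f (parts ν) ≈ 0#) → Span {I = Member} (F ∘ proj₁) f
      spans f h = eliminate R f λ ν ¬r → h ν λ Sν → ¬r (Sν , ρ<R Sν)

    Span-map : ∀ {i j} {I : Set i} {J : Set j} {A : I → Λ} {B : J → Λ} {f} →
               (∀ i → Span B (A i)) → Span A f → Span B f
    Span-map e (base i)    = e i
    Span-map e null        = null
    Span-map e (plus s s′) = plus (Span-map e s) (Span-map e s′)
    Span-map e (scale x s) = scale x (Span-map e s)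
    Span-map e (resp q s)  = resp q (Span-map e s)

    OfDegree : ℕ → Set
    OfDegree n = ∃ λ ks → sum (map suc ks) ≡ n

    -- Power sums are triangular for the number of parts: p_κ has no monomial with more parts than
    -- κ, and with equally many parts only m_κ, with a positive coefficient.
    homogeneous-span : ∀ n f → (∀ ν → size ν ≢ n → coeff f (parts ν) ≈ 0#) → Span {I = OfDegree n} (pProduct ∘ proj₁) f
    homogeneous-span n f h = Span-map (λ (κ , member) → resp
        (≈Λ-sym (powerSum κ) (pProduct (pred κ)) (powerSum-parts κ (pred κ) (pred-eq κ)))
        (base (pred κ , ≡.trans (≡.cong sum (≡.sym (pred-eq κ))) (decidable-stable (size κ ℕₚ.≟ n) member))))
      (spans f h)
      where
      pred : Partition → List ℕ
      pred κ = proj₁ (pred-parts κ)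
      pred-eq : ∀ κ → parts κ ≡ map suc (pred κ)
      pred-eq κ = proj₂ (pred-parts κ)
      coeff-powerSum : ∀ κ t → coeff (powerSum κ) t ≈ coeff (pProduct (pred κ)) t
      coeff-powerSum κ = powerSum-parts κ (pred κ) (pred-eq κ)
      length-pred : ∀ κ → length (pred κ) ≡ length (parts κ)
      length-pred κ = ≡.sym (≡.trans (≡.cong length (pred-eq κ)) (length-map suc (pred κ)))
      support-parts : ∀ ν → support (parts ν) ≡ parts ν
      support-parts ν = filter-all (1 ℕₚ.≤?_) (positive ν)
      leading : ∀ κ → ¬ ¬ size κ ≡ n → ¬ coeff (powerSum κ) (parts κ) ≈ 0#
      leading κ _ e = Pos⇒≉0 (pProduct-Pos (pred κ)) (trans (reflexive (≡.cong (coeff (pProduct (pred κ))) (≡.sym (pred-eq κ))))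
        (trans (sym (coeff-powerSum κ (parts κ))) e))
      lower : ∀ κ ν → ¬ ¬ size κ ≡ n → parts ν ≢ parts κ → ¬ (size ν ≡ n × length (parts ν) < length (parts κ)) →
              coeff (powerSum κ) (parts ν) ≈ 0#
      lower κ ν member ν≢κ ¬lower = trans (coeff-powerSum κ (parts ν)) (case size ν ℕₚ.≟ n of λ where
        (no size≢) → homogeneous-pProduct (pred κ) (parts ν) λ e → size≢ (≡.trans e
          (≡.trans (≡.cong sum (≡.sym (pred-eq κ))) (decidable-stable (size κ ℕₚ.≟ n) member)))
        (yes size≡) → case ℕₚ.<-cmp (length (parts ν)) (length (parts κ)) of λ where
          (tri< lt _ _) → contradiction (size≡ , lt) ¬lower
          (tri> _ _ gt) → pProduct-long (pred κ) (parts ν) (≡.subst₂ _<_ (≡.sym (length-pred κ))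
            (≡.cong length (≡.sym (support-parts ν))) gt)
          (tri≈ _ eq _) → pProduct-other (pred κ) (parts ν)
            (≡.trans (≡.cong length (support-parts ν)) (≡.trans eq (≡.sym (length-pred κ))))
            λ p → ν≢κ (≡.trans (≡.sym (type-parts ν)) (≡.trans (type-↭ (↭-trans (↭-reflexive (≡.sym (support-parts ν)))
              (↭-trans p (↭-reflexive (≡.sym (pred-eq κ)))))) (type-parts κ))))
      length< : ∀ {ν} → size ν ≡ n → length (parts ν) < suc n
      length< {ν} e = s≤s (ℕₚ.≤-trans (length≤sum (positive ν)) (ℕₚ.≤-reflexive e))
      open Elimination powerSum (λ ν → size ν ≡ n) (length ∘ parts) (allPartitions n)
        (λ {ν} → allPartitions-complete ν) (suc n) (λ {ν} → length< {ν}) leading lower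
        using (spans)

    combination : (List ℕ → Carrier) → List (List ℕ) → Λ
    combination c []       = 0Λ
    combination c (u ∷ us) = c u ·Λ pProduct u +Λ combination c us

    combination-+ : ∀ c d us → combination (λ u → c u + d u) us ≈Λ combination c us +Λ combination d us
    combination-+ c d []       t = trans (sym (+-identityʳ _)) (+-congˡ (sym (coeff-0Λ t)))
    combination-+ c d (u ∷ us) t = trans (+-congˡ (combination-+ c d us t))
      (solve 5 (λ c d p x y → (c :+ d) :* p :+ (x :+ y) := (c :* p :+ x) :+ (d :* p :+ y)) refl (c u) (d u) (coeff (pProduct u) t) _ _)

    combination-· : ∀ x c us → combination (λ u → x * c u) us ≈Λ x ·Λ combination c us
    combination-· x c []       t = trans (coeff-0Λ t) (sym (trans (*-congˡ (coeff-0Λ t)) (zeroʳ x)))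
    combination-· x c (u ∷ us) t = trans (+-congˡ (combination-· x c us t))
      (solve 4 (λ x c p y → x :* c :* p :+ x :* y := x :* (c :* p :+ y)) refl x (c u) (coeff (pProduct u) t) _)

    combination-0 : ∀ us {c} → (∀ u → u ∈ us → c u ≈ 0#) → combination c us ≈Λ 0Λ
    combination-0 []       e t = refl
    combination-0 (u ∷ us) e t = trans (+-cong (trans (*-congʳ (e u (here ≡.refl))) (zeroˡ _))
      (combination-0 us (λ v v∈ → e v (there v∈)) t)) (+-identityˡ _)

    Distinct : List (List ℕ) → Set
    Distinct = AllPairs (λ ks ls → ¬ (ks ↭ ls))

    combination-pProduct : ∀ ks us → Distinct us → Any (ks ↭_) us →
      combination (λ u → indicator (ks ↭? u)) us ≈Λ pProduct ks
    combination-pProduct ks (u ∷ us) (≁ ∷ _) (here p) t = trans (+-cong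
        (trans (*-congʳ (indicator-yes (ks ↭? u) p)) (trans (*-identityˡ _) (sym (pProduct-↭ p t))))
        (trans (combination-0 us (λ v v∈ → indicator-no (ks ↭? v) λ q → All.lookup ≁ v∈ (↭-trans (↭-sym p) q)) t) (coeff-0Λ t)))
      (+-identityʳ _)
    combination-pProduct ks (u ∷ us) (≁ ∷ ds) (there p∈) t = trans (+-cong
        (trans (*-congʳ (indicator-no (ks ↭? u) λ q → separate q p∈)) (zeroˡ _))
        (combination-pProduct ks us ds p∈ t))
      (+-identityˡ _)
      where
      separate : ks ↭ u → ¬ Any (ks ↭_) us
      separate q p∈ = case find p∈ of λ where
        (v , v∈ , p) → All.lookup ≁ v∈ (↭-trans (↭-sym q) p)

    -- Definiteness of the Jack product

    module _ (α : Carrier) (Pos-α : Pos α) (form : BilinearForm)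
      (values : ∀ λ′ ν → BilinearForm.⟨_,_⟩ form (powerSum λ′) (powerSum ν) ≈
                         δ (parts λ′) (parts ν) * (fromℕ (z λ′) * α ^ length (parts λ′))) where

      open Adjoints α
      open Form form
      open PowerForm form values

      weight>0 : ∀ ks → 0 < weight ks
      weight>0 []       = s≤s z≤n
      weight>0 (k ∷ ks) = ℕₚ.≤-trans (ℕₚ.*-mono-≤ {1} {suc k ℕ.* suc (multiplicity k ks)} (s≤s z≤n) (weight>0 ks))
        (ℕₚ.≤-reflexive (≡.sym (weight-∷ k ks)))

      Pos-norm : ∀ ks → Pos (norm ks)
      Pos-norm ks = Pos-* (positive-fromℕ (weight>0 ks)) (Pos-^ (length ks) Pos-α)
        where
        positive-fromℕ : ∀ {m} → 0 < m → Pos (fromℕ m)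
        positive-fromℕ {suc m} _ = Pos-fromℕ m

      ⟨pProduct,combination⟩ : ∀ ks c us → All (λ u → ¬ (ks ↭ u)) us → ⟨ pProduct ks , combination c us ⟩ ≈ 0#
      ⟨pProduct,combination⟩ ks c []       _        = ⟨,0⟩ _
      ⟨pProduct,combination⟩ ks c (u ∷ us) (≁ ∷ ≁s) = trans (+-linearʳ _ _ _) (trans
        (+-cong (trans (·-linearʳ _ _ _) (trans (*-congˡ (pairing-≁ ≁)) (zeroʳ _))) (⟨pProduct,combination⟩ ks c us ≁s))
        (+-identityˡ _))

      ⟨combination,pProduct⟩ : ∀ ks c us → All (λ u → ¬ (ks ↭ u)) us → ⟨ combination c us , pProduct ks ⟩ ≈ 0#
      ⟨combination,pProduct⟩ ks c []       _        = ⟨0,⟩ _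
      ⟨combination,pProduct⟩ ks c (u ∷ us) (≁ ∷ ≁s) = trans (+-linearˡ _ _ _) (trans
        (+-cong (trans (·-linearˡ _ _ _) (trans (*-congˡ (pairing-≁ (≁ ∘ ↭-sym))) (zeroʳ _))) (⟨combination,pProduct⟩ ks c us ≁s))
        (+-identityˡ _))

      ⟨combination⟩ : ∀ c u us → Distinct (u ∷ us) → ⟨ combination c (u ∷ us) , combination c (u ∷ us) ⟩ ≈
        c u * c u * norm u + ⟨ combination c us , combination c us ⟩
      ⟨combination⟩ c u us (≁ ∷ _) = begin
        ⟨ A +Λ B , A +Λ B ⟩
          ≈⟨ trans (+-linearˡ A B (A +Λ B)) (+-cong (+-linearʳ A A B) (+-linearʳ B A B)) ⟩
        (⟨ A , A ⟩ + ⟨ A , B ⟩) + (⟨ B , A ⟩ + ⟨ B , B ⟩)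
          ≈⟨ +-cong (trans (+-cong (trans (·-linearˡ (c u) (pProduct u) A) (*-congˡ (trans (·-linearʳ (c u) (pProduct u) (pProduct u)) (*-congˡ (pairing-↭ {u} {u} ↭-refl)))))
               (trans (·-linearˡ (c u) (pProduct u) B) (trans (*-congˡ (⟨pProduct,combination⟩ u c us ≁)) (zeroʳ _)))) (+-identityʳ _))
               (trans (+-congʳ (trans (·-linearʳ (c u) B (pProduct u)) (trans (*-congˡ (⟨combination,pProduct⟩ u c us ≁)) (zeroʳ _)))) (+-identityˡ _)) ⟩
        c u * (c u * norm u) + ⟨ B , B ⟩
          ≈⟨ +-congʳ (sym (*-assoc _ _ _)) ⟩
        c u * c u * norm u + ⟨ B , B ⟩ ∎
        where
        A B : Λ
        A = c u ·Λ pProduct u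
        B = combination c us

      square-norm : ∀ (c : List ℕ → Carrier) u → NonNeg (c u * c u * norm u)
      square-norm c u = case c u ≈0? of λ where
        (yes c≈0) → inj₁ (trans (*-congʳ (trans (*-congʳ c≈0) (zeroˡ _))) (zeroˡ _))
        (no c≉0)  → inj₂ (Pos-* (square c≉0) (Pos-norm u))

      ⟨combination⟩-NonNeg : ∀ c us → Distinct us → NonNeg ⟨ combination c us , combination c us ⟩
      ⟨combination⟩-NonNeg c []       _          = inj₁ (⟨0,⟩ _)
      ⟨combination⟩-NonNeg c (u ∷ us) d@(_ ∷ ds) = NonNeg-resp (sym (⟨combination⟩ c u us d))
        (NonNeg-+ (square-norm c u) (⟨combination⟩-NonNeg c us ds))

      -- In distinct products of power sums the form is diagonal with positive entries, so a
      -- vanishing sum of weighted squares has only zero terms.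
      combination-anisotropic : ∀ c us → Distinct us → ⟨ combination c us , combination c us ⟩ ≈ 0# → combination c us ≈Λ 0Λ
      combination-anisotropic c []       _          e t = refl
      combination-anisotropic c (u ∷ us) d@(_ ∷ ds) e = case c u ≈0? of λ where
          (yes c≈0) → λ t → trans (+-cong (trans (*-congʳ c≈0) (zeroˡ _))
            (combination-anisotropic c us ds (trans (sym (trans (⟨combination⟩ c u us d)
              (trans (+-congʳ (trans (*-congʳ (trans (*-congʳ c≈0) (zeroˡ _))) (zeroˡ _))) (+-identityˡ _)))) e) t)) (+-identityˡ _)
          (no c≉0) → contradiction (trans (sym (⟨combination⟩ c u us d)) e)
            (Pos⇒≉0 (Pos-+NonNeg (Pos-* (square c≉0) (Pos-norm u)) (⟨combination⟩-NonNeg c us ds)))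

      ↭-decSetoid : DecSetoid _ _
      ↭-decSetoid = record
        { Carrier = List ℕ ; _≈_ = _↭_
        ; isDecEquivalence = record { isEquivalence = ↭-isEquivalence ; _≟_ = _↭?_ } }

      -- One list from each permutation class, since products of power sums that differ only in
      -- order are equal and would spoil orthogonality.
      representatives : ℕ → List (List ℕ)
      representatives n = deduplicate _↭?_ (boundedLists n n)

      representatives-distinct : ∀ n → Distinct (representatives n)
      representatives-distinct n = deduplicate-! ↭-decSetoid (boundedLists n n)

      representatives-complete : ∀ n ks → sum (map suc ks) ≡ n → Any (ks ↭_) (representatives n)
      representatives-complete n ks e = ∈-deduplicate⁺ (DecSetoid.setoid ↭-decSetoid) _↭?_
          (λ p q → ↭-trans q (↭-sym p))
          (Any.map ↭-reflexive (boundedLists-complete n n ks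
            (≡.subst (length ks ≤_) e (lengths ks)) (All.map (λ k≤ → ℕₚ.≤-trans k≤ (ℕₚ.≤-reflexive e)) (entries ks))))
        where
        lengths : ∀ ks → length ks ≤ sum (map suc ks)
        lengths []       = z≤n
        lengths (k ∷ ks) = s≤s (ℕₚ.≤-trans (lengths ks) (ℕₚ.m≤n+m _ k))
        entries : ∀ ks → All (_≤ sum (map suc ks)) ks
        entries []       = []
        entries (k ∷ ks) = ℕₚ.≤-trans (ℕₚ.n≤1+n k) (ℕₚ.m≤m+n (suc k) _) ∷
          All.map (λ l≤ → ℕₚ.≤-trans l≤ (ℕₚ.m≤n+m _ (suc k))) (entries ks)

      span-combination : ∀ n {f} → Span {I = OfDegree n} (pProduct ∘ proj₁) f →
                         ∃ λ c → combination c (representatives n) ≈Λ f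
      span-combination n (base (ks , e)) = _ , combination-pProduct ks (representatives n)
        (representatives-distinct n) (representatives-complete n ks e)
      span-combination n null = (λ _ → 0#) , combination-0 (representatives n) (λ _ _ → refl)
      span-combination n (plus s s′) with span-combination n s | span-combination n s′
      ... | c , e | d , e′ = _ , λ t → trans (combination-+ c d (representatives n) t) (+-cong (e t) (e′ t))
      span-combination n (scale x s) with span-combination n s
      ... | c , e = _ , λ t → trans (combination-· x c (representatives n) t) (*-congˡ (e t))
      span-combination n (resp q s) with span-combination n s
      ... | c , e = c , λ t → trans (e t) (q t)

      -- Homogeneity brings `f` into the span of finitely many orthogonal products of power sums,
      -- where the form is diagonal.
      anisotropic : ∀ n f → (∀ ν → size ν ≢ n → coeff f (parts ν) ≈ 0#) → ⟨ f , f ⟩ ≈ 0# → f ≈Λ 0Λ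
      anisotropic n f h f⊥f = case span-combination n (homogeneous-span n f h) of λ where
        (c , e) → λ t → trans (sym (e t)) (combination-anisotropic c (representatives n) (representatives-distinct n)
          (trans (⟨⟩-cong (combination c (representatives n)) f _ f e e) f⊥f) t)

-- Jack families, hooks and the Hall product

module OverOrderedField {c ℓ} (K : CommutativeRing c ℓ) (orderedField : OverRing.OrderedField K) where

  open CommutativeRing K hiding (zero)
  open import Algebra.Properties.Semiring.Exp semiring using (_^_)
  open import Relation.Binary.Reasoning.Setoid setoid
  open SymmetricFunctions K
  open OverRing K
  open OrderedField orderedField
  open IntegerSolver using (solve; _:=_; _:+_; _:*_; _:-_; :-_; one; nil)

  Below : Partition → Partition → Set
  Below κ ν = ν ⊴ κ × parts ν ≢ parts κ

  -- Elimination along `rank`. It serves for Jack functions and for Schur functions alike, both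
  -- being triangular for dominance.
  span-below : ∀ (F : Partition → Λ) → (∀ μ ν → ¬ (ν ⊴ μ) → coeff (F μ) (parts ν) ≈ 0#) →
    ∀ κ → (∀ ν → ¬ ¬ Below κ ν → ¬ coeff (F ν) (parts ν) ≈ 0#) →
    ∀ f → (∀ ν → ¬ Below κ ν → coeff f (parts ν) ≈ 0#) → Span {I = ∃ λ ν → ¬ ¬ Below κ ν} (F ∘ proj₁) f
  span-below F triangular κ leading = spans
    where
    open Elimination orderedField F (Below κ) rank (allPartitions (size κ))
      (λ {ν} (ν⊴κ , _) → allPartitions-complete ν (proj₁ ν⊴κ))
      (rank κ) (λ {ν} (ν⊴κ , ν≢κ) → rank-strict ν κ ν⊴κ ν≢κ) leading
      (λ κ′ ν below ν≢κ′ ¬lower → triangular κ′ ν λ ν⊴κ′ → below λ (κ′⊴κ , κ′≢κ) → ¬lower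
        ((⊴-trans ν κ′ κ ν⊴κ′ κ′⊴κ , λ ν≡κ → κ′≢κ (⊴-antisym κ′ κ κ′⊴κ
            (≡.trans (≡.trans (≡.sym (proj₁ κ′⊴κ)) (≡.sym (proj₁ ν⊴κ′))) (proj₁ ν⊴κ′) , λ k →
              ℕₚ.≤-trans (ℕₚ.≤-reflexive (≡.cong (λ t → sum (take k t)) (≡.sym ν≡κ))) (proj₂ ν⊴κ′ k)))) ,
         rank-strict ν κ′ ν⊴κ′ ν≢κ′))
      using (spans)

  module JackFamily (α : Carrier) (Pos-α : Pos α) (form : BilinearForm)
    (values : ∀ λ′ ν → BilinearForm.⟨_,_⟩ form (powerSum λ′) (powerSum ν) ≈
                       δ (parts λ′) (parts ν) * (fromℕ (z λ′) * α ^ length (parts λ′)))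
    (J : Partition → Λ)
    (orthogonal : ∀ μ ν → parts μ ≢ parts ν → BilinearForm.⟨_,_⟩ form (J μ) (J ν) ≈ 0#)
    (triangular : ∀ μ ν → ¬ (ν ⊴ μ) → coeff (J μ) (parts ν) ≈ 0#)
    (normalized : ∀ μ → coeff (J μ) (replicate (size μ) 1) ≈ fromℕ (size μ !)) where

    open Form form
    open Adjoints α
    open PowerForm form values

    J-size : ∀ μ ν → size ν ≢ size μ → coeff (J μ) (parts ν) ≈ 0#
    J-size μ ν size≢ = triangular μ ν λ (e , _) → size≢ e

    -- The leading coefficients below κ are kept as a hypothesis because `leading` applies this
    -- inside its own induction.
    ⊥-below : ∀ κ → (∀ ν → ¬ ¬ Below κ ν → ¬ coeff (J ν) (parts ν) ≈ 0#) →
              ∀ f → (∀ ν → ¬ Below κ ν → coeff f (parts ν) ≈ 0#) → ⟨ J κ , f ⟩ ≈ 0#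
    ⊥-below κ leading f h = Span-⊥ʳ (J κ)
      (λ (ν , below) → orthogonal κ ν λ κ≡ν → below λ (_ , ν≢κ) → ν≢κ (≡.sym κ≡ν))
      (span-below J triangular κ leading f h)

    -- If the coefficient vanished, J_κ would lie strictly below κ, hence be orthogonal to itself
    -- and zero by definiteness, against its normalization at 1^n. The induction on `rank` supplies
    -- the Jack functions below κ.
    leading : ∀ κ → ¬ coeff (J κ) (parts κ) ≈ 0#
    leading κ = go (suc (rank κ)) κ ℕₚ.≤-refl
      where
      go : ∀ m κ → rank κ < m → ¬ coeff (J κ) (parts κ) ≈ 0#
      go (suc m) κ rκ<m C≈0 = Pos⇒≉0 (Pos-! (size κ)) (trans (sym (normalized κ))
        (trans (anisotropic orderedField α Pos-α form values (size κ) (J κ) (J-size κ)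
          (⊥-below κ (λ ν below → go m ν (decidable-stable (rank ν ℕₚ.<? m) λ ≮ → below λ (ν⊴κ , ν≢κ) →
              ≮ (ℕₚ.<-≤-trans (rank-strict ν κ ν⊴κ ν≢κ) (ℕₚ.≤-pred rκ<m))))
            (J κ) λ ν ¬below → case ≡-dec ℕₚ._≟_ (parts ν) (parts κ) of λ where
              (yes e) → trans (reflexive (≡.cong (coeff (J κ)) e)) C≈0
              (no ν≢κ) → triangular κ ν λ ν⊴κ → ¬below (ν⊴κ , ν≢κ))
          (replicate (size κ) 1)) (coeff-0Λ (replicate (size κ) 1))))

    module Hook (μ : Partition) (p s : ℕ) (μ-parts : parts μ ≡ suc p ∷ replicate s 1) where

      open Hooks α (recip α) (recip-inverse (Pos⇒≉0 Pos-α))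
        (λ b → recip (fromℕ (suc b))) (λ b → recip-inverse (Pos⇒≉0 (Pos-fromℕ b)))

      private
        n : ℕ
        n = suc p ℕ.+ s

        H D : Λ
        H = hookJack s n
        C h : Carrier
        C = coeff (J μ) (parts μ)
        h = coeff H (parts μ)
        -- Cross multiplication cancels the coefficients of m_μ without dividing by either of them.
        D = C ·Λ H +Λ (- h) ·Λ J μ

      homogeneous-EG : ∀ a b → Homogeneous (a ℕ.+ (b ℕ.+ 0)) (EG a b)
      homogeneous-EG a b = homogeneous-newton wᴱ a {f = G b 1Λ} (homogeneous-newton wᴳ b {f = 1Λ} homogeneous-1Λ)

      homogeneous-hookJack : ∀ s n → s ≤ n → Homogeneous n (hookJack s n)
      homogeneous-hookJack zero    n _   t t≢ = trans (*-congˡ (homogeneous-EG 0 n t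
        λ e → t≢ (≡.trans e (ℕₚ.+-identityʳ n)))) (zeroʳ _)
      homogeneous-hookJack (suc s) n s<n t t≢ = trans (+-cong (homogeneous-hookJack s n (ℕₚ.<⇒≤ s<n) t t≢)
        (trans (*-congˡ (homogeneous-EG (suc s) (n ∸ suc s) t λ e → t≢ (≡.trans e (≡.trans
          (≡.cong (suc s ℕ.+_) (ℕₚ.+-identityʳ (n ∸ suc s))) (ℕₚ.m+[n∸m]≡n s<n))))) (zeroʳ _))) (+-identityˡ 0#)

      s≤n : s ≤ n
      s≤n = ℕₚ.m≤n+m s (suc p)

      H-triangular : ∀ ν → ¬ (ν ⊴ μ) → coeff H (parts ν) ≈ 0#
      H-triangular ν ¬ν⊴μ = case size ν ℕₚ.≟ n of λ where
        (no size≢)  → homogeneous-hookJack s n s≤n (parts ν) size≢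
        (yes size≡) → hookJack-whole s n (parts ν) s≤n
          (ℕₚ.≮⇒≥ λ s<len → ¬ν⊴μ (⊴-hook μ p s μ-parts ν size≡ s<len))

      D-below : ∀ ν → ¬ Below μ ν → coeff D (parts ν) ≈ 0#
      D-below ν ¬below = case ≡-dec ℕₚ._≟_ (parts ν) (parts μ) of λ where
        (yes e)  → trans (reflexive (≡.cong (coeff D) e)) (solve 2 (λ c h → c :* h :+ :- h :* c := nil) refl C h)
        (no ν≢μ) → trans (+-cong (trans (*-congˡ (H-triangular ν λ ν⊴μ → ¬below (ν⊴μ , ν≢μ))) (zeroʳ _))
          (trans (*-congˡ (triangular μ ν λ ν⊴μ → ¬below (ν⊴μ , ν≢μ))) (zeroʳ _))) (+-identityˡ 0#)

      D-size : ∀ ν → size ν ≢ n → coeff D (parts ν) ≈ 0#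
      D-size ν size≢ = D-below ν λ ((e , _) , _) → size≢ (≡.trans e (hook-size μ p s μ-parts))

      D-span : PowerSpan D
      D-span = Span-map orderedField (λ (ks , _) → base ks) (homogeneous-span orderedField n D D-size)

      -- A coefficient of this slice belongs to a partition with a part of size at least `suc p`.
      -- Below μ only μ itself has such a part, and its coefficient in D is zero.
      slice-D : ∀ b → suc p ≤ b → slice b D ≈Λ 0Λ
      slice-D b@(suc _) p<b t = trans (coeff-type D (b ∷ t)) (trans (D-below (toPartition (b ∷ t))
        λ (⊴μ , ≢μ) → ≢μ (hook-maximal μ p s μ-parts (toPartition (b ∷ t)) ⊴μ
          (∈-resp-↭ (↭-sym (type-↭-filter (b ∷ t))) (here ≡.refl)) p<b)) (sym (coeff-0Λ t)))

      -- The product by g_b is brought outside so that `newton-adjoint` turns it into a slice of D.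
      EG⊥D : ∀ a b → suc p ≤ b → ⟨ EG a b , D ⟩ ≈ 0#
      EG⊥D a b p<b = begin
        ⟨ E a (G b 1Λ) , D ⟩   ≈⟨ ⟨⟩-congˡ D (E-G-comm a b 1Λ) ⟩
        ⟨ G b (E a 1Λ) , D ⟩
          ≈⟨ newton-adjoint wᴳ wᴳ-inverse (PowerSpan-newton wᴱ a (base [])) b D-span ⟩
        ⟨ E a 1Λ , slice b D ⟩ ≈⟨ ⟨⟩-congʳ (E a 1Λ) {slice b D} {0Λ} (slice-D b p<b) ⟩
        ⟨ E a 1Λ , 0Λ ⟩        ≈⟨ ⟨,0⟩ _ ⟩
        0# ∎

      hookTerm⊥D : ∀ a → a ≤ s → ⟨ hookTerm a (n ∸ a) , D ⟩ ≈ 0#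
      hookTerm⊥D a a≤s = trans (·-linearˡ _ (EG a (n ∸ a)) D) (trans (*-congˡ (EG⊥D a (n ∸ a)
        (ℕₚ.≤-trans (ℕₚ.≤-reflexive (≡.sym (ℕₚ.m+n∸n≡m (suc p) s))) (ℕₚ.∸-monoʳ-≤ n a≤s)))) (zeroʳ _))

      hookJack⊥D : ∀ a → a ≤ s → ⟨ hookJack a n , D ⟩ ≈ 0#
      hookJack⊥D zero    a≤s = hookTerm⊥D 0 a≤s
      hookJack⊥D (suc a) a<s = trans (+-linearˡ (hookJack a n) (hookTerm (suc a) (n ∸ suc a)) D) (trans
        (+-cong (hookJack⊥D a (ℕₚ.<⇒≤ a<s)) (hookTerm⊥D (suc a) a<s)) (+-identityˡ 0#))

      -- D is a combination of H and J_μ, both orthogonal to D.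
      D≈0 : D ≈Λ 0Λ
      D≈0 = anisotropic orderedField α Pos-α form values n D D-size (begin
        ⟨ D , D ⟩
          ≈⟨ +-linearˡ (C ·Λ H) ((- h) ·Λ J μ) D ⟩
        ⟨ C ·Λ H , D ⟩ + ⟨ (- h) ·Λ J μ , D ⟩
          ≈⟨ +-cong (trans (·-linearˡ C H D) (trans (*-congˡ (hookJack⊥D s ℕₚ.≤-refl)) (zeroʳ C)))
               (trans (·-linearˡ (- h) (J μ) D) (trans (*-congˡ (⊥-below μ (λ ν _ → leading ν) D D-below)) (zeroʳ _))) ⟩
        0# + 0#
          ≈⟨ +-identityˡ 0# ⟩
        0# ∎)

      proportional : C * coeff H (ones n) ≈ h * fromℕ (n !)
      proportional = begin
        C * coeff H (ones n)
          ≈⟨ solve 3 (λ x h j → x := (x :+ :- h :* j) :+ h :* j) refl (C * coeff H (ones n)) h (coeff (J μ) (ones n)) ⟩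
        coeff D (ones n) + h * coeff (J μ) (ones n)
          ≈⟨ +-cong (trans (D≈0 (ones n)) (coeff-0Λ (ones n)))
               (*-congˡ (≡.subst (λ m → coeff (J μ) (ones m) ≈ fromℕ (m !)) (hook-size μ p s μ-parts) (normalized μ))) ⟩
        0# + h * fromℕ (n !)
          ≈⟨ +-identityˡ _ ⟩
        h * fromℕ (n !) ∎

      -- The values of ω and γ are substituted in `proportional` after multiplication by their
      -- denominators; the common factor `n !` and the sign are cancelled at the end.
      hook-coefficient : coeff (J μ) (parts μ) ≈ hookValue α p s
      hook-coefficient = cancelˡ (λ e → sign≉0 s (cancel-zero e)) (begin
        fromℕ (n !) * (- 1#) ^ s * C
          ≈⟨ *-congʳ (*-congʳ (trans (fromℕ-* n ((p ℕ.+ s) !)) (*-congˡ (fromℕ-cong (≡.cong _! (ℕₚ.+-comm p s)))))) ⟩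
        fromℕ n * fromℕ ((s ℕ.+ p) !) * (- 1#) ^ s * C
          ≈⟨ solve 4 (λ k f m c → k :* f :* m :* c := c :* k :* (m :* f)) refl (fromℕ n) (fromℕ ((s ℕ.+ p) !)) ((- 1#) ^ s) C ⟩
        C * fromℕ n * ((- 1#) ^ s * fromℕ ((s ℕ.+ p) !))
          ≈⟨ *-congˡ (ω-value s p) ⟨
        C * fromℕ n * (α ^ p * (fromℕ (s !) * fromℕ (p !)) * ω s p)
          ≈⟨ solve 6 (λ c k a f g w → c :* k :* (a :* (f :* g) :* w) := a :* (f :* g) :* (c :* (k :* w))) refl
               C (fromℕ n) (α ^ p) (fromℕ (s !)) (fromℕ (p !)) (ω s p) ⟩
        α ^ p * (fromℕ (s !) * fromℕ (p !)) * (C * (fromℕ n * ω s p))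
          ≈⟨ *-congˡ (trans (*-congˡ (sym (coeff-hookJack-ones p s))) proportional) ⟩
        α ^ p * (fromℕ (s !) * fromℕ (p !)) * (h * fromℕ (n !))
          ≈⟨ *-congˡ (*-congʳ (trans (reflexive (≡.cong (coeff H) μ-parts)) (coeff-hookJack-hook p s))) ⟩
        α ^ p * (fromℕ (s !) * fromℕ (p !)) * ((- 1#) ^ s * (X * γ p) * fromℕ (n !))
          ≈⟨ solve 7 (λ a f g m x c k → a :* (f :* g) :* (m :* (x :* c) :* k) := k :* m :* (f :* x :* (a :* g :* c))) refl
               (α ^ p) (fromℕ (s !)) (fromℕ (p !)) ((- 1#) ^ s) X (γ p) (fromℕ (n !)) ⟩
        fromℕ (n !) * (- 1#) ^ s * (fromℕ (s !) * X * (α ^ p * fromℕ (p !) * γ p))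
          ≈⟨ *-congˡ (*-congˡ (γ-value p)) ⟩
        fromℕ (n !) * (- 1#) ^ s * (fromℕ (s !) * X * armProduct α p) ∎)
        where
        X : Carrier
        X = α * fromℕ p + fromℕ (suc s)
        cancel-zero : fromℕ (n !) * (- 1#) ^ s ≈ 0# → (- 1#) ^ s ≈ 0#
        cancel-zero e = cancelˡ (Pos⇒≉0 (Pos-! n)) (trans e (sym (zeroʳ _)))
        sign≉0 : ∀ s → ¬ (- 1#) ^ s ≈ 0#
        sign≉0 zero    e = Pos⇒≉0 Pos-1 e
        sign≉0 (suc s) e = sign≉0 s (trans (solve 1 (λ m → m := :- one :* (:- one :* m)) refl _) (trans (*-congˡ e) (zeroʳ _)))

  module HallProduct (form : BilinearForm)
    (values : ∀ λ′ μ → BilinearForm.⟨_,_⟩ form (schur λ′) (schur μ) ≈ δ (parts λ′) (parts μ)) where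

    open Form form

    schur-triangular : ∀ μ ν → ¬ (ν ⊴ μ) → coeff (schur μ) (parts ν) ≈ 0#
    schur-triangular μ ν ¬⊴ = fromℕ-cong (≡.trans (≡.cong (kostka (parts μ)) (type-parts ν)) (kostka-triangular μ ν ¬⊴))

    schur-leading : ∀ μ → coeff (schur μ) (parts μ) ≈ 1#
    schur-leading μ = trans (fromℕ-cong (≡.trans (≡.cong (kostka (parts μ)) (type-parts μ)) (kostka-diagonal μ)))
      (+-identityʳ 1#)

    -- Subtracting the leading term along s_μ leaves a function strictly below μ, which is spanned
    -- by Schur functions orthogonal to s_μ.
    ⟨,schur⟩ : ∀ μ f → (∀ ν → ¬ (ν ⊴ μ) → coeff f (parts ν) ≈ 0#) → ⟨ f , schur μ ⟩ ≈ coeff f (parts μ)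
    ⟨,schur⟩ μ f triangular = begin
      ⟨ f , schur μ ⟩
        ≈⟨ ⟨⟩-congˡ {f} {g +Λ x ·Λ schur μ} (schur μ)
             (λ t → solve 3 (λ f x s → f := (f :+ :- x :* s) :+ x :* s) refl (coeff f t) x (coeff (schur μ) t)) ⟩
      ⟨ g +Λ x ·Λ schur μ , schur μ ⟩
        ≈⟨ trans (+-linearˡ g (x ·Λ schur μ) (schur μ)) (+-congˡ (·-linearˡ x (schur μ) (schur μ))) ⟩
      ⟨ g , schur μ ⟩ + x * ⟨ schur μ , schur μ ⟩
        ≈⟨ +-cong (Span-⊥ˡ (schur μ) (λ (ν , below) → trans (values ν μ)
               (δ-≢ {parts ν} {parts μ} λ ν≡μ → below λ (_ , ν≢μ) → ν≢μ ν≡μ))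
             (span-below schur schur-triangular μ (λ ν _ e → Pos⇒≉0 Pos-1 (trans (sym (schur-leading ν)) e)) g g-below))
             (*-congˡ (trans (values μ μ) (indicator-yes (≡-dec ℕₚ._≟_ (parts μ) (parts μ)) ≡.refl))) ⟩
      0# + x * 1#
        ≈⟨ trans (+-identityˡ _) (*-identityʳ x) ⟩
      x ∎
      where
      x : Carrier
      x = coeff f (parts μ)
      g : Λ
      g = f +Λ (- x) ·Λ schur μ
      g-below : ∀ ν → ¬ Below μ ν → coeff g (parts ν) ≈ 0#
      g-below ν ¬below = case ≡-dec ℕₚ._≟_ (parts ν) (parts μ) of λ where
        (yes e)  → trans (reflexive (≡.cong (coeff g) e)) (trans (+-congˡ (*-congˡ (schur-leading μ)))
          (solve 1 (λ x → x :+ :- x :* one := nil) refl x))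
        (no ν≢μ) → trans (+-cong (triangular ν λ ν⊴μ → ¬below (ν⊴μ , ν≢μ))
          (trans (*-congˡ (schur-triangular μ ν λ ν⊴μ → ¬below (ν⊴μ , ν≢μ))) (zeroʳ _))) (+-identityˡ 0#)

-- Orders on fields of fractions

record OrderedDomain {c ℓ} (R : CommutativeRing c ℓ) : Set (Level.suc ℓ ⊔ c) where
  open CommutativeRing R
  field
    Pos      : Carrier → Set ℓ
    Pos-resp : ∀ {x y} → x ≈ y → Pos x → Pos y
    Pos-+    : ∀ {x y} → Pos x → Pos y → Pos (x + y)
    Pos-*    : ∀ {x y} → Pos x → Pos y → Pos (x * y)
    Pos-1    : Pos 1#
    Pos⇒≉0   : ∀ {x} → Pos x → ¬ x ≈ 0#
    sign     : ∀ x → ¬ x ≈ 0# → Pos x ⊎ Pos (- x)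

module FractionOrder {c ℓ} (R : CommutativeRing c ℓ) (isDomain : IsDecidableDomain R) (ordered : OrderedDomain R) where

  open CommutativeRing R hiding (zero)
  open IsDecidableDomain isDomain
  open OrderedDomain ordered
  open Fractions R isDomain
  open OverRing R using (module IntegerSolver)
  open IntegerSolver using (solve; _:=_; _:+_; _:*_; _:-_; :-_; one; nil)

  square : ∀ {x} → ¬ x ≈ 0# → Pos (x * x)
  square {x} x≉0 = case sign x x≉0 of λ where
    (inj₁ px)  → Pos-* px px
    (inj₂ p-x) → Pos-resp (solve 1 (λ x → :- x :* :- x := x :* x) refl x) (Pos-* p-x p-x)

  -- Invariance of the sign under equality of fractions rests on this: cross multiplication compares
  -- the products only up to squares of denominators.
  cancel-square : ∀ {x d} → ¬ d ≈ 0# → Pos (x * (d * d)) → Pos x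
  cancel-square {x} {d} d≉0 p = case x ≈0? of λ where
    (yes x≈0) → contradiction (trans (*-congʳ x≈0) (zeroˡ _)) (Pos⇒≉0 p)
    (no x≉0)  → case sign x x≉0 of λ where
      (inj₁ px)  → px
      (inj₂ p-x) → contradiction (solve 2 (λ x d → x :* d :+ :- x :* d := nil) refl x (d * d))
                     (Pos⇒≉0 (Pos-+ p (Pos-* p-x (square d≉0))))

  -- A fraction has the sign of the product of numerator and denominator, whatever the sign of the
  -- denominator.
  record Posᶠ (x : Fraction) : Set ℓ where
    constructor posᶠ
    field num*den : Pos (num x * den x)

  orderedField : OverRing.OrderedField fractionField
  orderedField = record
    { Pos      = Posᶠ
    ; Pos-resp = λ { {a / b [ b≉0 ]} {c / d [ d≉0 ]} (cross e) (posᶠ p) → posᶠ (cancel-square b≉0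
        (Pos-resp (trans (solve 4 (λ a b d b′ → a :* b :* (d :* d) := (a :* d) :* (b :* d)) refl a b d b)
          (trans (*-congʳ e) (solve 3 (λ c b d → (c :* b) :* (b :* d) := c :* d :* (b :* b)) refl c b d)))
          (Pos-* p (square d≉0)))) }
    ; Pos-+    = λ { {a / b [ b≉0 ]} {c / d [ d≉0 ]} (posᶠ p) (posᶠ q) → posᶠ (Pos-resp
        (solve 4 (λ a b c d → a :* b :* (d :* d) :+ c :* d :* (b :* b) := (a :* d :+ c :* b) :* (b :* d)) refl a b c d)
        (Pos-+ (Pos-* p (square d≉0)) (Pos-* q (square b≉0)))) }
    ; Pos-*    = λ { {a / b [ _ ]} {c / d [ _ ]} (posᶠ p) (posᶠ q) → posᶠ (Pos-resp
        (solve 4 (λ a b c d → a :* b :* (c :* d) := (a :* c) :* (b :* d)) refl a b c d) (Pos-* p q)) }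
    ; Pos-1    = posᶠ (Pos-* Pos-1 Pos-1)
    ; Pos⇒≉0   = λ { {a / b [ _ ]} (posᶠ p) (cross e) → Pos⇒≉0 p (trans (*-congʳ
        (trans (sym (*-identityʳ a)) (trans e (zeroˡ b)))) (zeroˡ b)) }
    ; square   = λ { {a / b [ b≉0 ]} x≉0 → posᶠ (Pos-* (square λ a≈0 → x≉0 (num≈0⇒≈0 a≈0)) (square b≉0)) }
    ; _≈0?     = λ { x@(a / b [ _ ]) → map′ (num≈0⇒≈0 {x}) (λ (cross e) → trans (sym (*-identityʳ a)) (trans e (zeroˡ b))) (a ≈0?) }
    ; recip    = _⁻¹
    ; recip-inverse = λ {x} → ⁻¹-inverseˡ x
    }

-- Hook values under ring homomorphisms

module RingHomomorphism {c ℓ c′ ℓ′} (R : CommutativeRing c ℓ) (K : CommutativeRing c′ ℓ′) where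

  private
    module R = CommutativeRing R
    module RF = SymmetricFunctions R
    module RO = OverRing R
  open CommutativeRing K hiding (zero)
  open SymmetricFunctions K using (fromℕ)
  open OverRing K using (armProduct; hookValue)

  module _ (φ : R.Carrier → Carrier) (φ-0 : φ R.0# ≈ 0#) (φ-1 : φ R.1# ≈ 1#)
    (φ-+ : ∀ x y → φ (x R.+ y) ≈ φ x + φ y) (φ-* : ∀ x y → φ (x R.* y) ≈ φ x * φ y) where

    φ-fromℕ : ∀ n → φ (RF.fromℕ n) ≈ fromℕ n
    φ-fromℕ zero    = φ-0
    φ-fromℕ (suc n) = trans (φ-+ _ _) (+-cong φ-1 (φ-fromℕ n))

    φ-armProduct : ∀ x p → φ (RO.armProduct x p) ≈ armProduct (φ x) p
    φ-armProduct x zero    = φ-1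
    φ-armProduct x (suc p) = trans (φ-* _ _) (*-cong (φ-armProduct x p)
      (trans (φ-+ _ _) (+-cong φ-1 (trans (φ-* _ _) (*-congˡ (φ-fromℕ p))))))

    -- It is applied both to the inclusion of polynomials into fractions and to the evaluation of
    -- polynomials at the inverse of α.
    φ-hookValue : ∀ x p s → φ (RO.hookValue x p s) ≈ hookValue (φ x) p s
    φ-hookValue x p s = trans (φ-* _ _) (*-cong (trans (φ-* _ _) (*-cong (φ-fromℕ (s !))
      (trans (φ-+ _ _) (+-cong (trans (φ-* _ _) (*-congˡ (φ-fromℕ p))) (φ-fromℕ (suc s)))))) (φ-armProduct x p))

-- Specialization to rational functions in α

open import Data.Rational.Base as ℚ using (ℚ; 0ℚ; 1ℚ)
import Data.Rational.Properties as ℚₚ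
open import Defs

-- The order of ℚ[α] for which α is a positive infinitesimal.
data LowestPositive : Poly → Set where
  here  : ∀ {a p} → 0ℚ ℚ.< a → LowestPositive (a ∷ p)
  there : ∀ {a p} → a ≡ 0ℚ → LowestPositive p → LowestPositive (a ∷ p)

module PolynomialOrder where

  open PolyLaws

  LowestPositive-resp : ∀ {p q} → p ≈ₚ q → LowestPositive p → LowestPositive q
  LowestPositive-resp {q = []}    e (here 0<a)     = contradiction (≡.sym (at e 0)) (ℚₚ.<⇒≢ 0<a)
  LowestPositive-resp {q = []}    e (there a≡0 lp) = contradiction (LowestPositive-resp {q = []} (coeffwise λ i → at e (suc i)) lp) λ ()
  LowestPositive-resp {q = b ∷ q} e (here 0<a)     = here (≡.subst (0ℚ ℚ.<_) (at e 0) 0<a)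
  LowestPositive-resp {q = b ∷ q} e (there a≡0 lp) = there (≡.trans (≡.sym (at e 0)) a≡0)
    (LowestPositive-resp (coeffwise λ i → at e (suc i)) lp)

  LowestPositive-+ : ∀ {p q} → LowestPositive p → LowestPositive q → LowestPositive (p +ₚ q)
  LowestPositive-+ (here {a} 0<a) (here {b} 0<b) = here (ℚₚ.+-mono-< 0<a 0<b)
  LowestPositive-+ (here {a} 0<a) (there ≡.refl lq) = here (≡.subst (0ℚ ℚ.<_) (≡.sym (ℚₚ.+-identityʳ a)) 0<a)
  LowestPositive-+ (there ≡.refl lp) (here {b} 0<b) = here (≡.subst (0ℚ ℚ.<_) (≡.sym (ℚₚ.+-identityˡ b)) 0<b)
  LowestPositive-+ (there ≡.refl lp) (there ≡.refl lq) = there ≡.refl (LowestPositive-+ lp lq)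

  LowestPositive-* : ∀ {p q} → LowestPositive p → LowestPositive q → LowestPositive (p *ₚ q)
  LowestPositive-* {_ ∷ p} {q} (there ≡.refl lp) lq =
    LowestPositive-resp (≈ₚ-sym (0∷-*ₚ p q)) (there ≡.refl (LowestPositive-* lp lq))
  LowestPositive-* {a ∷ p} {_ ∷ q} (here 0<a) (there ≡.refl lq) =
    LowestPositive-resp (≈ₚ-sym (≈ₚ-trans (*ₚ-∷ʳ (a ∷ p) 0ℚ q) (+ₚ-cong (·ₚ-zeroˡ (a ∷ p)) ≈ₚ-refl)))
      (there ≡.refl (LowestPositive-* {a ∷ p} {q} (here 0<a) lq))
  LowestPositive-* {a ∷ p} {b ∷ q} (here 0<a) (here 0<b) =
    here (≡.subst (0ℚ ℚ.<_) (≡.sym (ℚₚ.+-identityʳ _)) (ℚₚ.positive⁻¹ (a ℚ.* b)))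
    where
    instance
      ab-pos : ℚ.Positive (a ℚ.* b)
      ab-pos = ℚₚ.pos*pos⇒pos a {{ℚ.positive 0<a}} b {{ℚ.positive 0<b}}

  LowestPositive⇒≉0 : ∀ {p} → LowestPositive p → ¬ (p ≈ₚ [])
  LowestPositive⇒≉0 lp e = contradiction (LowestPositive-resp e lp) λ ()

  lowestSign : ∀ p → ¬ (p ≈ₚ []) → LowestPositive p ⊎ LowestPositive (-ₚ p)
  lowestSign []      p≉0 = contradiction ≈ₚ-refl p≉0
  lowestSign (a ∷ p) p≉0 = case ℚₚ.<-cmp 0ℚ a of λ where
    (tri< 0<a _ _)    → inj₁ (here 0<a)
    (tri> _ _ a<0)    → inj₂ (here (ℚₚ.neg-antimono-< a<0))
    (tri≈ _ ≡.refl _) → case lowestSign p (λ e → p≉0 (0∷≈[] e)) of λ where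
      (inj₁ lp) → inj₁ (there ≡.refl lp)
      (inj₂ lp) → inj₂ (there ≡.refl lp)

  ordered : OrderedDomain ℚ[α]
  ordered = record
    { Pos = LowestPositive ; Pos-resp = LowestPositive-resp ; Pos-+ = LowestPositive-+ ; Pos-* = LowestPositive-*
    ; Pos-1 = here (ℚₚ.positive⁻¹ 1ℚ) ; Pos⇒≉0 = LowestPositive⇒≉0 ; sign = lowestSign }

orderedField : OverRing.OrderedField ℚ⟨α⟩
orderedField = FractionOrder.orderedField ℚ[α] ℚ[α]-isDecidableDomain PolynomialOrder.ordered

open CommutativeRing ℚ⟨α⟩ using (refl; sym; trans; reflexive; *-congˡ; *-congʳ; *-cong; *-identityˡ; *-identityʳ; *-comm; +-congˡ; +-congʳ; +-cong; +-identityˡ; +-identityʳ; zeroʳ)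
open OverRing.OrderedField orderedField using (Pos; Pos-1; Pos-!; Pos⇒≉0)

α-Pos : Pos α
α-Pos = FractionOrder.posᶠ (PolynomialOrder.LowestPositive-* {0ℚ ∷ 1ℚ ∷ []} {1ℚ ∷ []}
  (there ≡.refl (here (ℚₚ.positive⁻¹ 1ℚ))) (here (ℚₚ.positive⁻¹ 1ℚ)))

-- The substitution `_[1/α]` acts on numerators and denominators, so the hook value is also needed
-- as a polynomial.
hookPoly : ℕ → ℕ → Poly
hookPoly = OverRing.hookValue ℚ[α] (0ℚ ∷ 1ℚ ∷ [])

fromR-hookPoly : ∀ p s → fromR (hookPoly p s) ≈ OverRing.hookValue ℚ⟨α⟩ α p s
fromR-hookPoly = RingHomomorphism.φ-hookValue ℚ[α] ℚ⟨α⟩ fromR refl refl fromR-+ fromR-* (0ℚ ∷ 1ℚ ∷ [])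

eval-1 : ∀ x → evalₚ (1ℚ ∷ []) x ≈ 1#
eval-1 x = trans (+-congˡ {1#} (zeroʳ x)) (+-identityʳ 1#)

eval-hookPoly : ∀ x p s → evalₚ (hookPoly p s) x ≈ OverRing.hookValue ℚ⟨α⟩ (evalₚ (0ℚ ∷ 1ℚ ∷ []) x) p s
eval-hookPoly x = RingHomomorphism.φ-hookValue ℚ[α] ℚ⟨α⟩ (λ p → evalₚ p x) refl (eval-1 x)
  (λ p q → EvalLaws.eval-+ p q x) (λ p q → EvalLaws.eval-* p q x) (0ℚ ∷ 1ℚ ∷ [])

private
  module Falling = OverRing.FallingFactorials ℚ⟨α⟩ fallingFactorial (λ _ → refl) (λ _ _ → refl)
  module Binomials = Falling.Binomials (λ k → fromℕ (k !) ⁻¹) (λ k → ⁻¹-inverseˡ (fromℕ (k !)) (Pos⇒≉0 (Pos-! k)))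

  X : Poly
  X = 0ℚ ∷ 1ℚ ∷ []

  -- Kept as an evaluation of `X`, the form in which `eval-hookPoly` produces it.
  1/α : Carrier
  1/α = evalₚ X (α ⁻¹)

  1/α≈ : 1/α ≈ α ⁻¹
  1/α≈ = trans (+-cong {fromℚ 0ℚ} {0#} EvalLaws.fromℚ-0
    (trans (*-congˡ {α ⁻¹} (eval-1 (α ⁻¹))) (*-identityʳ (α ⁻¹)))) (+-identityˡ (α ⁻¹))

  α*1/α≈1 : α * 1/α ≈ 1#
  α*1/α≈1 = trans (*-congˡ {α} 1/α≈) (trans (*-comm α (α ⁻¹)) (⁻¹-inverseˡ α (Pos⇒≉0 α-Pos)))

  ⁻¹-≈1 : ∀ x → x ≈ 1# → x ⁻¹ ≈ 1#
  ⁻¹-≈1 x x≈1 = trans (sym (*-identityʳ (x ⁻¹))) (trans (*-congˡ {x ⁻¹} (sym x≈1))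
    (⁻¹-inverseˡ x λ x≈0 → Pos⇒≉0 Pos-1 (trans (sym x≈1) x≈0)))

  -- Since `_[1/α]` respects equality, `r` may be replaced by the fraction `hookPoly p s` over 1,
  -- whose image is an evaluation.
  hookValue-[1/α] : ∀ r p s → r ≈ OverRing.hookValue ℚ⟨α⟩ α p s → r [1/α] ≈ OverRing.hookValue ℚ⟨α⟩ 1/α p s
  hookValue-[1/α] r p s e = trans ([1/α]-cong {r} {fromR (hookPoly p s)} (trans e (sym (fromR-hookPoly p s))))
    (trans (*-cong (eval-hookPoly (α ⁻¹) p s) (⁻¹-≈1 (evalₚ (1ℚ ∷ []) (α ⁻¹)) (eval-1 (α ⁻¹))))
      (*-identityʳ (OverRing.hookValue ℚ⟨α⟩ 1/α p s)))

  -- The factorizations `rooksC` and `rooksD` are the two summands of `hookValue-rising` at `x = α`.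
  boards : ∀ p ℓ →
    fromℕ (ℓ ℕ.* ℓ !) * OverRing.diagonal ℚ⟨α⟩ (λ j i → fromℕ (rookNumber j (ferrers (suc p ℕ.+ ℓ) (hookHeightsC (suc p ℕ.+ ℓ) ℓ))) * fallingFactorial α i) (suc p ℕ.+ ℓ) +
    fromℕ (ℓ !) * OverRing.diagonal ℚ⟨α⟩ (λ j i → fromℕ (rookNumber j (ferrers (suc p ℕ.+ ℓ) (hookHeightsD (suc p ℕ.+ ℓ) ℓ))) * fallingFactorial α i) (suc p ℕ.+ ℓ) ≈
    α ^ (suc p ℕ.+ ℓ) * OverRing.hookValue ℚ⟨α⟩ 1/α p ℓ
  boards p ℓ = trans
    (+-cong (*-congˡ {fromℕ (ℓ ℕ.* ℓ !)} (Falling.HookBoards.rooksC p ℓ α)) (*-congˡ {fromℕ (ℓ !)} (Falling.HookBoards.rooksD p ℓ α)))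
    (sym (OverRing.hookValue-rising ℚ⟨α⟩ α 1/α α*1/α≈1 p ℓ))

-- The pairing of a hook with its Schur function

module _ (hallProduct jackProduct : BilinearForm) (isHall : IsHallProduct hallProduct) (isJack : IsJackProduct jackProduct)
         (J : Partition → Λ) (isJackFamily : IsJackFamily jackProduct J) where

  open BilinearForm hallProduct using (⟨_,_⟩)
  open IsJackFamily isJackFamily

  tilde-triangular : ∀ μ ν → ¬ (ν ⊴ μ) → coeff (tilde J μ) (parts ν) ≈ 0#
  tilde-triangular μ ν ¬⊴ = trans (*-congˡ {α ^ size μ}
    (trans ([1/α]-cong {coeff (J μ) (parts ν)} {0#} (triangular μ ν ¬⊴)) 0[1/α])) (zeroʳ (α ^ size μ))

  -- Substitution and scaling preserve triangularity, so the pairing reads off the coefficient of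
  -- m_μ.
  ⟨tilde,schur⟩ : ∀ p ℓ μ → parts μ ≡ suc p ∷ replicate ℓ 1 →
    ⟨ tilde J μ , schur μ ⟩ ≈ α ^ (suc p ℕ.+ ℓ) * OverRing.hookValue ℚ⟨α⟩ 1/α p ℓ
  ⟨tilde,schur⟩ p ℓ μ μ-parts = trans
    (OverOrderedField.HallProduct.⟨,schur⟩ ℚ⟨α⟩ orderedField hallProduct isHall μ (tilde J μ) (tilde-triangular μ))
    (*-cong (reflexive (≡.cong (α ^_) (hook-size μ p ℓ μ-parts)))
      (hookValue-[1/α] (coeff (J μ) (parts μ)) p ℓ
        (OverOrderedField.JackFamily.Hook.hook-coefficient ℚ⟨α⟩ orderedField α α-Pos jackProduct isJack J
          orthogonal triangular normalized μ p ℓ μ-parts)))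

proposition3p10 : (hallProduct jackProduct : BilinearForm) →
    IsHallProduct hallProduct → IsJackProduct jackProduct →
    (J : Partition → Λ) → IsJackFamily jackProduct J →
    (n ℓ : ℕ) (ℓ<n : ℓ < n) →
    let open BilinearForm hallProduct using (⟨_,_⟩)
        μ = hook n ℓ ℓ<n
        B₁ = ferrers n (hookHeightsC n ℓ)
        B₂ = ferrers n (hookHeightsD n ℓ)
        hitSum = ∑[ k ≤ n ]
          (fromℕ (ℓ ℕ.* ℓ ! ℕ.* hitNumber (toℕ k) B₁ ℕ.+ ℓ ! ℕ.* hitNumber (toℕ k) B₂)
            * binomial (α + fromℕ (toℕ k)) n)
        rookSum = ∑[ k ≤ n ]
          (fromℕ (ℓ ℕ.* ℓ ! ℕ.* rookNumber (n ∸ toℕ k) B₁ ℕ.+ ℓ ! ℕ.* rookNumber (n ∸ toℕ k) B₂)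
            * (binomial α (toℕ k) * fromℕ (toℕ k !)))
    in ⟨ tilde J μ , schur μ ⟩ ≈ hitSum × hitSum ≈ rookSum
proposition3p10 hallProduct jackProduct isHall isJack J isJackFamily n ℓ ℓ<n =
  trans (byArm (n ∸ suc ℓ) n≡) (sym hit≈) , trans hit≈ (sym rook≈)
  where
  n≡ : n ≡ suc (n ∸ suc ℓ) ℕ.+ ℓ
  n≡ = ≡.sym (≡.trans (≡.sym (ℕₚ.+-suc (n ∸ suc ℓ) ℓ)) (ℕₚ.m∸n+n≡m ℓ<n))
  B₁ B₂ : Board n
  B₁ = ferrers n (hookHeightsC n ℓ)
  B₂ = ferrers n (hookHeightsD n ℓ)
  -- The combination of factorial rook polynomials at α to which both sums reduce, for arbitrary
  -- boards; the shape of the boards matters only for the pairing.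
  common : Carrier
  common = fromℕ (ℓ ℕ.* ℓ !) * OverRing.diagonal ℚ⟨α⟩ (λ j i → fromℕ (rookNumber j B₁) * fallingFactorial α i) n +
           fromℕ (ℓ !) * OverRing.diagonal ℚ⟨α⟩ (λ j i → fromℕ (rookNumber j B₂) * fallingFactorial α i) n
  hit≈ : ∑[ k ≤ n ] (fromℕ (ℓ ℕ.* ℓ ! ℕ.* hitNumber (toℕ k) B₁ ℕ.+ ℓ ! ℕ.* hitNumber (toℕ k) B₂)
           * binomial (α + fromℕ (toℕ k)) n) ≈ common
  hit≈ = Binomials.hitSum≈ (ℓ ℕ.* ℓ !) (ℓ !) B₁ B₂ α
  rook≈ : ∑[ k ≤ n ] (fromℕ (ℓ ℕ.* ℓ ! ℕ.* rookNumber (n ∸ toℕ k) B₁ ℕ.+ ℓ ! ℕ.* rookNumber (n ∸ toℕ k) B₂)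
            * (binomial α (toℕ k) * fromℕ (toℕ k !))) ≈ common
  rook≈ = Binomials.rookSum≈ (ℓ ℕ.* ℓ !) (ℓ !) B₁ B₂ α
  -- The arm length is generalized to a variable so that matching on the equation replaces `n`
  -- everywhere, including inside the hook and the boards.
  byArm : ∀ p → n ≡ suc p ℕ.+ ℓ → BilinearForm.⟨_,_⟩ hallProduct (tilde J (hook n ℓ ℓ<n)) (schur (hook n ℓ ℓ<n)) ≈ common
  byArm p ≡.refl = trans (⟨tilde,schur⟩ hallProduct jackProduct isHall isJack J isJackFamily p ℓ (hook n ℓ ℓ<n)
    (≡.cong (_∷ replicate ℓ 1) (ℕₚ.m+n∸n≡m (suc p) ℓ))) (sym (boards p ℓ))
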